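{- Let $r\geq 3$, $k\geq 1$ and $\ell_1,\dots,\ell_k\geq 5$ be integers, let $s\geq r$ be an integer, and let $t=\sum_{i=1}^k\lfloor\frac{\ell_i+1}{2}\rfloor-1$. For each $i\in[k]$ let $Q_i\in\{P_{\ell_i}^r,C_{\ell_i}^r\}$ (chosen independently). Let $n\to\infty$. (i) If $s\leq t+r-1$, then $$\mathrm{ex}_r(n,K_s^{(r)},Q_1\cup\cdots\cup Q_k)=(1+o(1))\,\mathcal{N}(K_s^{(r)},S_{n,t}^r)=\binom{t}{s-r+1}\frac{n^{r-1}}{(r-1)!}+o(n^{r-1}).$$ (ii) If $s\geq t+r$, then $\mathrm{ex}_r(n,K_s^{(r)},Q_1\cup\cdots\cup Q_k)=o(n^{r-1})$.
   Context: An $r$-graph is a hypergraph all of whose hyperedges have exactly $r$ vertices. $K_s^{(r)}$ is the complete $r$-graph on $s$ vertices. $P_\ell$ and $C_\ell$ are the path and cycle with $\ell$ edges. For a graph $F$, the $r$-expansion $F^r$ is obtained from $F$ by adding $r-2$ new vertices to each edge, all new vertices distinct from each other and from $V(F)$. $\cup$ denotes vertex-disjoint union. $S_{n,t}^r$ is the $n$-vertex $r$-graph whose hyperedges are all $r$-sets intersecting a fixed set of $t$ vertices. $\mathcal{N}(\mathcal{G}_1,\mathcal{G}_2)$ is the number of copies of $\mathcal{G}_1$ in $\mathcal{G}_2$. $\mathrm{ex}_r(n,\mathcal{H},\mathcal{F})$ is the maximum number of copies of $\mathcal{H}$ in an $n$-vertex $r$-graph containing no copy of $\mathcal{F}$.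 -}

module Defs where

open import Data.Bool using (Bool; true; false; _∧_; _∨_; not; if_then_else_)
open import Data.Nat using (ℕ; zero; suc; _+_; _*_; _∸_; _^_; _≤_; _<_; _≡ᵇ_; ⌊_/2⌋)
open import Data.Nat.Combinatorics using (_C_)
open import Data.Nat using (_!)
open import Data.Bool.ListAction using (all)
open import Data.Fin using (Fin)
open import Data.Fin.Subset using (Subset; inside; outside; ∣_∣; ⁅_⁆; _∪_; ⊥)
open import Data.Vec using (Vec; []; _∷_)
open import Data.List using (List; []; _∷_; map; _++_; filterᵇ; length; upTo)
open import Data.Nat.ListAction using (sum)
open import Data.List.Relation.Unary.All using (All)
open import Data.Product using (Σ; _×_; _,_; proj₁)
open import Relation.Binary.PropositionalEquality using (_≡_)
open import Relation.Nullary using (¬_)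

-- r-graphs on the vertex set Fin n.
-- An r-graph is given by a Boolean predicate on subsets of Fin n; its
-- hyperedges are exactly the r-element subsets on which it is true.

Graph : ℕ → Set
Graph n = Subset n → Bool

IsEdge : ∀ {n} → ℕ → Graph n → Subset n → Set
IsEdge r G e = (∣ e ∣ ≡ r) × (G e ≡ true)

allSubsets : (n : ℕ) → List (Subset n)
allSubsets zero = [] ∷ []
allSubsets (suc n) = map (inside ∷_) (allSubsets n) ++ map (outside ∷_) (allSubsets n)

_⊆ᵇ_ : ∀ {n} → Subset n → Subset n → Bool
[] ⊆ᵇ [] = true
(a ∷ p) ⊆ᵇ (b ∷ q) = (not a ∨ b) ∧ (p ⊆ᵇ q)

isCliqueᵇ : ∀ {n} → ℕ → ℕ → Graph n → Subset n → Bool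
isCliqueᵇ {n} r s G S =
  (∣ S ∣ ≡ᵇ s) ∧ all (λ T → not ((T ⊆ᵇ S) ∧ (∣ T ∣ ≡ᵇ r)) ∨ G T) (allSubsets n)

-- 𝒩(K_s^(r), G): number of copies of K_s^(r) in the r-graph G
-- (a copy of a complete r-graph is determined by its vertex set)
numK : ∀ {n} → (r s : ℕ) → Graph n → ℕ
numK {n} r s G = length (filterᵇ (isCliqueᵇ r s G) (allSubsets n))

-- Forbidden configurations: finite r-graphs whose vertices are 0,…,size-1
-- (natural numbers), each edge listed as a list of distinct vertices.

record Pattern : Set where
  constructor pat
  field
    size  : ℕ
    edges : List (List ℕ)
open Pattern public

-- the r-2 new vertices of the i-th edge of an expansion whose core has c vertices
newVerts : (r c i : ℕ) → List ℕ
newVerts r c i = map (λ j → c + i * (r ∸ 2) + j) (upTo (r ∸ 2))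

-- r-expansion P_ℓ^r of the path with ℓ edges (core vertices 0,…,ℓ)
pathExp : (r ℓ : ℕ) → Pattern
pathExp r ℓ = pat (suc ℓ + ℓ * (r ∸ 2))
  (map (λ i → i ∷ suc i ∷ newVerts r (suc ℓ) i) (upTo ℓ))

-- r-expansion C_ℓ^r of the cycle with ℓ edges (core vertices 0,…,ℓ-1)
cycleExp : (r ℓ : ℕ) → Pattern
cycleExp r ℓ = pat (ℓ + ℓ * (r ∸ 2))
  (map (λ i → i ∷ suc i ∷ newVerts r ℓ i) (upTo (ℓ ∸ 1))
   ++ ((ℓ ∸ 1) ∷ 0 ∷ newVerts r ℓ (ℓ ∸ 1)) ∷ [])

_⊎ᴾ_ : Pattern → Pattern → Pattern
pat a ea ⊎ᴾ pat b eb = pat (a + b) (ea ++ map (map (a +_)) eb)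

Component : Set
Component = ℕ × Bool

compPattern : ℕ → Component → Pattern
compPattern r (ℓ , true)  = pathExp r ℓ
compPattern r (ℓ , false) = cycleExp r ℓ

unionPattern : ℕ → List Component → Pattern
unionPattern r [] = pat 0 []
unionPattern r (q ∷ qs) = compPattern r q ⊎ᴾ unionPattern r qs

image : ∀ {n} → List (Fin n) → Subset n
image [] = ⊥
image (x ∷ xs) = ⁅ x ⁆ ∪ image xs

Contains : ∀ {n} → ℕ → Pattern → Graph n → Set
Contains {n} r F G =
  Σ (ℕ → Fin n) λ φ →
    (∀ u v → u < size F → v < size F → φ u ≡ φ v → u ≡ v) ×
    All (λ e → IsEdge r G (image (map φ e))) (edges F)

Free : ∀ {n} → ℕ → Pattern → Graph n → Set
Free r F G = ¬ Contains r F G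

meetsFirst : ∀ {n} → ℕ → Subset n → Bool
meetsFirst zero _ = false
meetsFirst (suc t) [] = false
meetsFirst (suc t) (b ∷ S) = b ∨ meetsFirst t S

starGraph : (n t : ℕ) → Graph n
starGraph n t = meetsFirst t

tOf : List Component → ℕ
tOf qs = sum (map (λ q → ⌊ suc (proj₁ q) /2⌋) qs) ∸ 1

{-# OPTIONS --safe #-}

-- Write d = r − 1 and c₀ = C(t, s − d). The star is free of the union because a vertex of an expanded
-- path or cycle lies in at most two edges, so t vertices cannot meet all edges.
--
-- For the upper bound, delete s-cliques through d-sets lying in at most c₀ cliques until every d-set
-- lies in none or in more than c₀. Each d-set dies at most once, so this costs at most c₀ C(n, d)
-- cliques, the main term. Afterwards every d-set that is covered at all has t + 1 extensions to an edge.
-- A second cleaning with a large constant in place of c₀ must exhaust the family, for otherwise the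
-- cycles embed greedily; hence the number of remaining cliques is linear in the number of covered
-- d-sets. If these were Ω(n^d) many, Erdős' theorem would give a large box A₁ × ⋯ × A_d of covered
-- d-tuples, which Ramsey's theorem makes canonical for the t + 1 extensions, viewed as functions of the
-- tuple: whether two values agree depends only on which coordinates the arguments share. If at most
-- one extension is nonconstant, the constants serve as the cover of size t (or t + 1) of the union. If
-- two are nonconstant, the edges take their extensions from them alternately. The delicate case is an
-- odd cycle for r = 3: if some extension x(a, b) of the pairs has no large level sets within rows and
-- columns, loose cycles of all lengths grow greedily and are closed up by two pairs with the same x;
-- otherwise, after passing to a dense set of pairs, each extension depends on one coordinate only.
module Submission where

open import Defs
open import Level using (Level)
open import Data.Bool using (Bool; true; false; _∧_; _∨_; not; T; if_then_else_)
import Data.Bool.Properties as Boolₚ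
open import Data.Nat using (ℕ; zero; suc; pred; _+_; _*_; _∸_; _^_; _≤_; _<_; _≥_; z≤n; s≤s; _⊔_; _≤?_; _<?_; _≤ᵇ_; _≡ᵇ_; _!; NonZero; >-nonZero; ⌊_/2⌋; _/_; _%_)
open import Data.Nat.Properties hiding (_≟_; ≡-decSetoid)
import Data.Nat as ℕ
import Data.Nat.DivMod as DivMod
open import Data.Nat.Combinatorics using (_C_; nCk+nC[k+1]≡[n+1]C[k+1]; nC1≡n; k>n⇒nCk≡0)
open import Data.Nat.Tactic.RingSolver using (solve-∀)
open import Data.Nat.ListAction using (sum)
import Data.Bool.ListAction as BoolL
open import Data.Fin using (Fin; toℕ; fromℕ<)
import Data.Fin as Fin
import Data.Fin.Properties as Finₚ
open import Data.Fin.Subset using (Subset; inside; outside; ∣_∣; ⁅_⁆; _∪_) renaming (_∈_ to _∈ˢ_; _⊆_ to _⊆ˢ_; _∉_ to _∉ˢ_)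
import Data.Fin.Subset.Properties as Subₚ
open import Data.Vec using (Vec; []; _∷_; here; there)
import Data.Vec as Vec
import Data.Vec.Properties as Vecₚ
open import Data.List using (List; []; _∷_; map; _++_; filterᵇ; length; upTo; concatMap; allFin; cartesianProduct)
import Data.List as List
import Data.List.Properties as Listₚ
open import Data.List.Relation.Unary.All as All using (All; []; _∷_)
import Data.List.Relation.Unary.All.Properties as Allₚ
open import Data.List.Relation.Unary.Any as Any using (Any; here; there)
open import Data.List.Relation.Unary.AllPairs as AllPairs using (AllPairs; []; _∷_)
open import Data.List.Relation.Unary.Unique.Propositional using (Unique)
import Data.List.Relation.Unary.Unique.Propositional.Properties as Uniqueₚ
open import Data.List.Membership.Propositional using (_∈_; _∉_; lose)
import Data.List.Membership.Propositional.Properties as ∈ₚ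
open import Data.Product using (Σ; ∃; _×_; _,_; proj₁; proj₂)
open import Data.Sum using (_⊎_; inj₁; inj₂; [_,_]′)
open import Data.Unit using (⊤; tt)
open import Data.Empty using (⊥-elim) renaming (⊥ to Empty)
open import Function using (_∘_; id; case_of_)
open import Relation.Nullary using (¬_; Dec; yes; no; contradiction)
open import Relation.Nullary.Decidable using (⌊_⌋; ¬?; _×-dec_)
open import Relation.Binary.PropositionalEquality using (_≡_; _≢_; refl; sym; trans; cong; cong₂; subst; subst₂; module ≡-Reasoning)
open import Data.List.Relation.Binary.Sublist.Propositional using ([]; _∷_; _∷ʳ_; ⊆-refl; ⊆-trans) renaming (_⊆_ to _⊑_)
import Data.List.Relation.Binary.Sublist.Propositional.Properties as ⊑ₚ

-- The number t + 1 is the sum of the cover numbers ⌊(ℓ + 1)/2⌋ of the components. It meets C(t, s -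
-- d) as follows: cliques through a fixed d-set are determined by their other s - d vertices, so
-- more than C(t, s - d) of them need more than t vertices outside the d-set, and each such vertex
-- is an extension. What makes these extensions hard to use is that they are arbitrary: those of
-- different d-sets may coincide with one another or with vertices already placed. In a canonical
-- box an equality at one pair of tuples implies it at every pair sharing at least the same
-- coordinates, so each collision is refuted by testing it on one convenient pair. Odd cycles resist
-- for r = 3 because the box then has only two sides. The core vertices of a cycle alternate between
-- the sides, and the last core of an odd cycle has neighbours on both. For r ≥ 4 a third side
-- receives it. For r = 3 it has to be a value of an extension, and the next edge must contain that
-- value as well, which is possible only if it is known on which coordinate the extension depends.
-- This is what the dichotomy on large level sets provides.

variable
  ℓᵃ ℓᵇ : Level
  A : Set ℓᵃ
  B : Set ℓᵇ

-- Counting over lists, and cleaning.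

𝟙 : Bool → ℕ
𝟙 true  = 1
𝟙 false = 0

∑ : List A → (A → ℕ) → ℕ
∑ []       f = 0
∑ (x ∷ xs) f = f x + ∑ xs f

# : List A → (A → Bool) → ℕ
# xs p = ∑ xs (λ x → 𝟙 (p x))

∧-true⁻ : ∀ p {q} → p ∧ q ≡ true → p ≡ true × q ≡ true
∧-true⁻ true e = refl , e

∧-true⁺ : ∀ {p q} → p ≡ true → q ≡ true → p ∧ q ≡ true
∧-true⁺ refl refl = refl

≡true⇒T : ∀ {p} → p ≡ true → T p
≡true⇒T refl = tt

T⇒≡true : ∀ {p} → T p → p ≡ true
T⇒≡true {true} _ = refl

⌊⌋-true⁻ : ∀ {P : Set ℓᵃ} (d : Dec P) → ⌊ d ⌋ ≡ true → P
⌊⌋-true⁻ (yes p) _ = p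

⌊⌋-true⁺ : ∀ {P : Set ℓᵃ} (d : Dec P) → P → ⌊ d ⌋ ≡ true
⌊⌋-true⁺ (yes _) _ = refl
⌊⌋-true⁺ (no ¬p) p = contradiction p ¬p

𝟙≤1 : ∀ p → 𝟙 p ≤ 1
𝟙≤1 true  = ≤-refl
𝟙≤1 false = z≤n

𝟙-true⁻ : ∀ {p} → 0 < 𝟙 p → p ≡ true
𝟙-true⁻ {true} _ = refl

𝟙-mono : ∀ {p q} → (p ≡ true → q ≡ true) → 𝟙 p ≤ 𝟙 q
𝟙-mono {false}     _ = z≤n
𝟙-mono {true} {q} h rewrite h refl = ≤-refl

𝟙-∧ : ∀ p q → 𝟙 (p ∧ q) ≡ 𝟙 p * 𝟙 q
𝟙-∧ true  q = sym (+-identityʳ _)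
𝟙-∧ false q = refl

𝟙-split : ∀ p q → 𝟙 p ≡ 𝟙 (p ∧ q) + 𝟙 (p ∧ not q)
𝟙-split true  true  = refl
𝟙-split true  false = refl
𝟙-split false _     = refl

∑-mono∈ : ∀ (xs : List A) {f g} → (∀ x → x ∈ xs → f x ≤ g x) → ∑ xs f ≤ ∑ xs g
∑-mono∈ []       h = z≤n
∑-mono∈ (x ∷ xs) h = +-mono-≤ (h x (here refl)) (∑-mono∈ xs (λ y y∈ → h y (there y∈)))

∑-mono : ∀ (xs : List A) {f g} → (∀ x → f x ≤ g x) → ∑ xs f ≤ ∑ xs g
∑-mono xs h = ∑-mono∈ xs (λ x _ → h x)

∑-cong : ∀ (xs : List A) {f g} → (∀ x → f x ≡ g x) → ∑ xs f ≡ ∑ xs g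
∑-cong []       h = refl
∑-cong (x ∷ xs) h = cong₂ _+_ (h x) (∑-cong xs h)

∑-+ : ∀ (xs : List A) f g → ∑ xs (λ x → f x + g x) ≡ ∑ xs f + ∑ xs g
∑-+ []       f g = refl
∑-+ (x ∷ xs) f g rewrite ∑-+ xs f g = lem (f x) (g x) (∑ xs f) (∑ xs g)
  where lem : ∀ a b c d → a + b + (c + d) ≡ a + c + (b + d)
        lem = solve-∀

∑-*ˡ : ∀ (xs : List A) c f → ∑ xs (λ x → c * f x) ≡ c * ∑ xs f
∑-*ˡ []       c f = sym (*-zeroʳ c)
∑-*ˡ (x ∷ xs) c f rewrite ∑-*ˡ xs c f = sym (*-distribˡ-+ c (f x) (∑ xs f))

∑-const : ∀ (xs : List A) c → ∑ xs (λ _ → c) ≡ length xs * c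
∑-const []       c = refl
∑-const (x ∷ xs) c = cong (c +_) (∑-const xs c)

∑-swap : ∀ (xs : List A) (ys : List B) (f : A → B → ℕ) →
  ∑ xs (λ x → ∑ ys (f x)) ≡ ∑ ys (λ y → ∑ xs (λ x → f x y))
∑-swap []       ys f = sym (trans (∑-const ys 0) (*-zeroʳ (length ys)))
∑-swap (x ∷ xs) ys f rewrite ∑-swap xs ys f =
  sym (∑-+ ys (f x) (λ y → ∑ xs (λ x → f x y)))

∑-++ : ∀ (xs ys : List A) f → ∑ (xs ++ ys) f ≡ ∑ xs f + ∑ ys f
∑-++ []       ys f = refl
∑-++ (x ∷ xs) ys f rewrite ∑-++ xs ys f = sym (+-assoc (f x) _ _)

∑-map : ∀ (h : A → B) xs f → ∑ (map h xs) f ≡ ∑ xs (f ∘ h)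
∑-map h []       f = refl
∑-map h (x ∷ xs) f = cong (f (h x) +_) (∑-map h xs f)

∑-∈ : ∀ {xs : List A} {x} f → x ∈ xs → f x ≤ ∑ xs f
∑-∈ f (here refl) = m≤m+n _ _
∑-∈ f (there x∈)  = ≤-trans (∑-∈ f x∈) (m≤n+m _ _)

∑-pos : ∀ (xs : List A) f → 0 < ∑ xs f → ∃ λ x → x ∈ xs × 0 < f x
∑-pos (x ∷ xs) f h with f x in eq
... | suc _ = x , here refl , subst (0 <_) (sym eq) (s≤s z≤n)
... | zero with ∑-pos xs f h
...   | y , y∈ , p = y , there y∈ , p

#-pos : ∀ (xs : List A) p → 0 < # xs p → ∃ λ x → x ∈ xs × p x ≡ true
#-pos xs p h with ∑-pos xs _ h
... | x , x∈ , q = x , x∈ , 𝟙-true⁻ q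

#-mono : ∀ (xs : List A) {p q} → (∀ x → p x ≡ true → q x ≡ true) → # xs p ≤ # xs q
#-mono xs h = ∑-mono xs (λ x → 𝟙-mono (h x))

#-≤length : ∀ (xs : List A) p → # xs p ≤ length xs
#-≤length xs p = ≤-trans (∑-mono xs (λ x → 𝟙≤1 (p x)))
  (≤-reflexive (trans (∑-const xs 1) (*-identityʳ _)))

#-filterᵇ : ∀ (p : A → Bool) xs → length (filterᵇ p xs) ≡ # xs p
#-filterᵇ p []       = refl
#-filterᵇ p (x ∷ xs) with p x
... | true  = cong suc (#-filterᵇ p xs)
... | false = #-filterᵇ p xs

#-split : ∀ (xs : List A) (p q : A → Bool) → # xs p ≡ # xs (λ x → p x ∧ q x) + # xs (λ x → p x ∧ not (q x))
#-split xs p q = trans (∑-cong xs (λ x → 𝟙-split (p x) (q x))) (∑-+ xs _ _)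

#-∨ : ∀ (xs : List A) (p q : A → Bool) → # xs (λ x → p x ∨ q x) ≤ # xs p + # xs q
#-∨ xs p q = ≤-trans (∑-mono xs (λ x → lem (p x) (q x))) (≤-reflexive (∑-+ xs _ _))
  where lem : ∀ p q → 𝟙 (p ∨ q) ≤ 𝟙 p + 𝟙 q
        lem true  q = s≤s z≤n
        lem false q = ≤-refl

find-or-all : ∀ {P : A → Set ℓᵇ} → (∀ x → Dec (P x)) → ∀ xs →
  (∃ λ x → x ∈ xs × P x) ⊎ (∀ x → x ∈ xs → ¬ P x)
find-or-all P? []       = inj₂ λ _ ()
find-or-all P? (x ∷ xs) with P? x | find-or-all P? xs
... | yes p | _ = inj₁ (x , here refl , p)
... | no _  | inj₁ (y , y∈ , q) = inj₁ (y , there y∈ , q)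
... | no ¬p | inj₂ h = inj₂ λ { _ (here refl) → ¬p ; y (there y∈) → h y y∈ }

-- If `B ≤ K * f x` failed for every entry, adding up `K * f x + 1 ≤ B` would contradict the
-- hypothesis with a surplus of `length xs`. Keeping the factor `K` on the right avoids division.
averaging : ∀ (xs : List A) f K B → 0 < length xs → length xs * B ≤ K * ∑ xs f →
  ∃ λ x → x ∈ xs × B ≤ K * f x
averaging xs f K B 0<l h with find-or-all (λ x → B ≤? K * f x) xs
... | inj₁ r = r
... | inj₂ none = ⊥-elim (<-irrefl refl (<-≤-trans
        (m<m+n (length xs * B) 0<l)
        (≤-trans (+-monoˡ-≤ (length xs) h)
          (≤-trans (≤-reflexive lhs)
            (≤-trans (∑-mono∈ xs (λ x x∈ → ≤-trans (≤-reflexive (+-comm _ 1)) (≰⇒> (none x x∈))))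
                     (≤-reflexive (∑-const xs B)))))))
  where
  lhs : K * ∑ xs f + length xs ≡ ∑ xs (λ x → K * f x + 1)
  lhs = sym (trans (∑-+ xs _ _) (cong₂ _+_ (∑-*ˡ xs K f) (trans (∑-const xs 1) (*-identityʳ _))))

∑-cartesian : ∀ (xs : List A) (ys : List B) f →
  ∑ (cartesianProduct xs ys) f ≡ ∑ xs (λ x → ∑ ys (λ y → f (x , y)))
∑-cartesian []       ys f = refl
∑-cartesian (x ∷ xs) ys f =
  trans (∑-++ (map (x ,_) ys) _ f) (cong₂ _+_ (∑-map (x ,_) ys f) (∑-cartesian xs ys f))

-- Items carrying a light handle are discarded until none is left; a handle dies at most once, so
-- each dead handle accounts for at most c discarded items.
module Cleaning {I H : Set} (Is : List I) (Hs : List H) (inc : H → I → Bool) (c : ℕ) where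

  deg : (I → Bool) → H → ℕ
  deg q h = # Is (λ i → q i ∧ inc h i)

  active : (I → Bool) → ℕ
  active q = # Hs (λ h → 1 ≤ᵇ deg q h)

  Full : (I → Bool) → Set
  Full q = ∀ h → h ∈ Hs → deg q h ≡ 0 ⊎ c < deg q h

  light? : ∀ q h → Dec (1 ≤ deg q h × deg q h ≤ c)
  light? q h = (1 ≤? deg q h) ×-dec (deg q h ≤? c)

  drop-handle : (I → Bool) → H → I → Bool
  drop-handle q h i = q i ∧ not (inc h i)

  deg-drop : ∀ q h h′ → deg (drop-handle q h) h′ ≤ deg q h′
  deg-drop q h h′ = #-mono Is λ i e → let e₁ , e₂ = ∧-true⁻ (q i ∧ not (inc h i)) e in ∧-true⁺ (proj₁ (∧-true⁻ (q i) e₁)) e₂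

  deg-drop-self : ∀ q h → deg (drop-handle q h) h ≡ 0
  deg-drop-self q h = trans (∑-cong Is (λ i → cong 𝟙 (lem (q i) (inc h i))))
    (trans (∑-const Is 0) (*-zeroʳ (length Is)))
    where lem : ∀ a b → (a ∧ not b) ∧ b ≡ false
          lem true  true  = refl
          lem true  false = refl
          lem false _     = refl

  active-drop : ∀ q h → h ∈ Hs → 1 ≤ deg q h → suc (active (drop-handle q h)) ≤ active q
  active-drop q h h∈ pos = go Hs h∈
    where
    pt : ∀ h′ → 𝟙 (1 ≤ᵇ deg (drop-handle q h) h′) ≤ 𝟙 (1 ≤ᵇ deg q h′)
    pt h′ = 𝟙-mono λ e → T⇒≡true (≤⇒≤ᵇ (≤-trans (≤ᵇ⇒≤ 1 _ (≡true⇒T e)) (deg-drop q h h′)))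
    pt-self : suc (𝟙 (1 ≤ᵇ deg (drop-handle q h) h)) ≤ 𝟙 (1 ≤ᵇ deg q h)
    pt-self rewrite deg-drop-self q h | T⇒≡true (≤⇒≤ᵇ pos) = ≤-refl
    go : ∀ hs → h ∈ hs → suc (# hs (λ h′ → 1 ≤ᵇ deg (drop-handle q h) h′)) ≤ # hs (λ h′ → 1 ≤ᵇ deg q h′)
    go (_ ∷ hs) (here refl) = +-mono-≤ pt-self (∑-mono hs pt)
    go (x ∷ hs) (there h∈′) = ≤-trans (≤-reflexive (sym (+-suc _ _))) (+-mono-≤ (pt x) (go hs h∈′))

  -- The difference of `# Is q` and `c * active q` never decreases: dropping a light handle costs at
  -- most `c` items and at least one active handle. The inequality states this without subtraction,
  -- and the number of active handles bounds the recursion.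
  clean : ∀ fuel q → active q ≤ fuel → Σ (I → Bool) λ q′ →
    (∀ i → q′ i ≡ true → q i ≡ true) ×
    # Is q + c * active q′ ≤ # Is q′ + c * active q × Full q′
  clean fuel q le with find-or-all (light? q) Hs
  ... | inj₂ none = q , (λ _ e → e) , ≤-refl , full
    where
    full : Full q
    full h h∈ with deg q h in eq | none h h∈
    ... | zero  | _ = inj₁ refl
    ... | suc k | n with suc k ≤? c
    ...   | yes le′ = ⊥-elim (n (s≤s z≤n , le′))
    ...   | no nle = inj₂ (≰⇒> nle)
  clean zero q le | inj₁ (h , h∈ , pos , _) = ⊥-elim (<⇒≱ (≤-trans (s≤s z≤n) (active-drop q h h∈ pos)) le)
  clean (suc fuel) q le | inj₁ (h , h∈ , pos , deg≤)
    with clean fuel (drop-handle q h) (≤-pred (≤-trans (active-drop q h h∈ pos) le))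
  ... | q′ , sub , ineq , full = q′ , (λ i e → proj₁ (∧-true⁻ (q i) (sub i e))) , bound , full
    where
    q₁ = drop-handle q h
    open ≤-Reasoning
    lem : ∀ a b x y → a + b + x * y ≡ (b + x * y) + a
    lem = solve-∀
    lem′ : ∀ x y c → x + c * y + c ≡ x + c * suc y
    lem′ = solve-∀
    bound : # Is q + c * active q′ ≤ # Is q′ + c * active q
    bound = begin
      # Is q + c * active q′                   ≡⟨ cong (_+ c * active q′) (#-split Is q (inc h)) ⟩
      deg q h + # Is q₁ + c * active q′        ≡⟨ lem (deg q h) (# Is q₁) c (active q′) ⟩
      (# Is q₁ + c * active q′) + deg q h      ≤⟨ +-mono-≤ ineq deg≤ ⟩
      # Is q′ + c * active q₁ + c              ≡⟨ lem′ (# Is q′) (active q₁) c ⟩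
      # Is q′ + c * suc (active q₁)            ≤⟨ +-monoʳ-≤ (# Is q′) (*-monoʳ-≤ c (active-drop q h h∈ pos)) ⟩
      # Is q′ + c * active q                   ∎

-- Expansions and their unions

data Vert : Set where
  core : ℕ → Vert
  new  : ℕ → ℕ → Vert

core-injective : ∀ {i j} → core i ≡ core j → i ≡ j
core-injective refl = refl

new-injective : ∀ {i j i′ j′} → new i j ≡ new i′ j′ → i ≡ i′ × j ≡ j′
new-injective refl = refl , refl

ncores : Component → ℕ
ncores (ℓ , true)  = suc ℓ
ncores (ℓ , false) = ℓ

next : Component → ℕ → ℕ
next (ℓ , true)  i = suc i
next (ℓ , false) i with suc i ℕ.≟ ℓ
... | yes _ = 0
... | no _  = suc i

next-last : ∀ ℓ i → suc i ≡ ℓ → next (ℓ , false) i ≡ 0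
next-last ℓ i e with suc i ℕ.≟ ℓ
... | yes _ = refl
... | no ¬e = contradiction e ¬e

next-inner : ∀ ℓ i → suc i < ℓ → next (ℓ , false) i ≡ suc i
next-inner ℓ i lt with suc i ℕ.≟ ℓ
... | yes e = contradiction e (<⇒≢ lt)
... | no _  = refl

next<ncores : ∀ q i → i < proj₁ q → next q i < ncores q
next<ncores (ℓ , true)  i lt = s≤s lt
next<ncores (ℓ , false) i lt with suc i ℕ.≟ ℓ
... | yes e = ≤-trans (s≤s z≤n) lt
... | no ¬e = ≤∧≢⇒< lt ¬e

data At : List Component → ℕ → Component → Set where
  at-zero : ∀ {q qs} → At (q ∷ qs) 0 q
  at-suc  : ∀ {q q′ qs κ} → At qs κ q → At (q′ ∷ qs) (suc κ) q

At⇒∈ : ∀ {qs κ q} → At qs κ q → q ∈ qs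
At⇒∈ at-zero    = here refl
At⇒∈ (at-suc a) = there (At⇒∈ a)

At⇒< : ∀ {qs κ q} → At qs κ q → κ < length qs
At⇒< at-zero    = s≤s z≤n
At⇒< (at-suc a) = s≤s (At⇒< a)

At-unique : ∀ {qs κ q q′} → At qs κ q → At qs κ q′ → q ≡ q′
At-unique at-zero    at-zero    = refl
At-unique (at-suc a) (at-suc b) = At-unique a b

module Assembly (r′ : ℕ) where

  r = suc (suc (suc r′))
  w = suc r′

  Valid : Component → Vert → Set
  Valid q (core i)  = i < ncores q
  Valid q (new i j) = i < proj₁ q × j < w

  -- The numbering used by the given patterns: core vertices first, then one block of `w = r − 2`
  -- new vertices per edge. Writing `r` as `3 + r′` makes `w` nonzero, so that quotient and
  -- remainder by `w` invert it.
  encode : ℕ → Vert → ℕ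
  encode c (core i)  = i
  encode c (new i j) = c + i * w + j

  decode : ℕ → ℕ → Vert
  decode c u with u <? c
  ... | yes _ = core u
  ... | no _  = new ((u ∸ c) / w) ((u ∸ c) % w)

  encode-decode : ∀ c u → encode c (decode c u) ≡ u
  encode-decode c u with u <? c
  ... | yes _ = refl
  ... | no ≮ = begin
    c + (u ∸ c) / w * w + (u ∸ c) % w   ≡⟨ +-assoc c _ _ ⟩
    c + ((u ∸ c) / w * w + (u ∸ c) % w) ≡⟨ cong (c +_) (trans (+-comm _ ((u ∸ c) % w)) (sym (DivMod.m≡m%n+[m/n]*n (u ∸ c) w))) ⟩
    c + (u ∸ c)                         ≡⟨ m+[n∸m]≡n (≮⇒≥ ≮) ⟩
    u                                   ∎
    where open ≡-Reasoning

  decode-valid : ∀ q u → u < ncores q + proj₁ q * w → Valid q (decode (ncores q) u)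
  decode-valid q u lt with u <? ncores q
  ... | yes l = l
  ... | no ≮ = DivMod.m<n*o⇒m/o<n (+-cancelˡ-< (ncores q) _ _
                 (subst (_< ncores q + proj₁ q * w) (sym (m+[n∸m]≡n (≮⇒≥ ≮))) lt))
             , DivMod.m%n<n (u ∸ ncores q) w

  decode-core : ∀ c i → i < c → decode c i ≡ core i
  decode-core c i lt with i <? c
  ... | yes _ = refl
  ... | no ≮ = contradiction lt ≮

  decode-new : ∀ c i j → j < w → decode c (c + i * w + j) ≡ new i j
  decode-new c i j lt with c + i * w + j <? c
  ... | yes l = contradiction (≤-trans (m≤m+n c (i * w)) (m≤m+n _ j)) (<⇒≱ l)
  ... | no _ = cong₂ new
          (trans (cong (_/ w) rw) (trans (DivMod.+-distrib-/ j (i * w) small)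
            (cong₂ _+_ (DivMod.m<n⇒m/n≡0 lt) (DivMod.m*n/n≡m i w))))
          (trans (cong (_% w) rw) (trans (DivMod.[m+kn]%n≡m%n j i w) (DivMod.m<n⇒m%n≡m lt)))
    where
    rw : c + i * w + j ∸ c ≡ j + i * w
    rw = trans (cong (_∸ c) (+-assoc c (i * w) j)) (trans (m+n∸m≡n c _) (+-comm (i * w) j))
    small : j % w + (i * w) % w < w
    small = subst (_< w) (sym (trans (cong₂ _+_ (DivMod.m<n⇒m%n≡m lt) (DivMod.m*n%n≡0 i w)) (+-identityʳ j))) lt

  size-comp : ∀ q → size (compPattern r q) ≡ ncores q + proj₁ q * w
  size-comp (ℓ , true)  = refl
  size-comp (ℓ , false) = refl

  edgeVerts : Component → ℕ → List Vert
  edgeVerts q i = core i ∷ core (next q i) ∷ map (new i) (upTo w)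

  edgeVerts-valid : ∀ q i → i < proj₁ q → i < ncores q → All (Valid q) (edgeVerts q i)
  edgeVerts-valid q i lt lt′ = lt′ ∷ next<ncores q i lt ∷
    Allₚ.map⁺ (All.tabulate (λ j∈ → lt , ∈ₚ.∈-upTo⁻ j∈))

  <ncores : ∀ q i → i < proj₁ q → i < ncores q
  <ncores (ℓ , true)  i lt = m<n⇒m<1+n lt
  <ncores (ℓ , false) i lt = lt

  encodeEdge : Component → ℕ → List ℕ
  encodeEdge q i = map (encode (ncores q)) (edgeVerts q i)

  newVerts≡ : ∀ c i → newVerts r c i ≡ map (encode c) (map (new i) (upTo w))
  newVerts≡ c i = Listₚ.map-∘ (upTo w)

  -- The given cycle pattern lists its closing edge separately. Past this point `next` treats it
  -- like the others, and paths and cycles are handled together.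
  edges-comp : ∀ q {P : List ℕ → Set} → 1 ≤ proj₁ q → (∀ i → i < proj₁ q → P (encodeEdge q i)) →
    All P (edges (compPattern r q))
  edges-comp (ℓ , true) {P} _ h = Allₚ.map⁺ (All.tabulate λ {i} i∈ →
    subst (λ vs → P (i ∷ suc i ∷ vs)) (sym (newVerts≡ (suc ℓ) i)) (h i (∈ₚ.∈-upTo⁻ i∈)))
  edges-comp (suc ℓ , false) {P} _ h = Allₚ.++⁺
    (Allₚ.map⁺ (All.tabulate λ {i} i∈ → subst P (inner i (∈ₚ.∈-upTo⁻ i∈)) (h i (m<n⇒m<1+n (∈ₚ.∈-upTo⁻ i∈)))))
    (subst P last (h ℓ ≤-refl) ∷ [])
    where
    inner : ∀ i → i < ℓ → encodeEdge (suc ℓ , false) i ≡ i ∷ suc i ∷ newVerts r (suc ℓ) i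
    inner i lt = cong₂ (λ x vs → i ∷ x ∷ vs) (next-inner (suc ℓ) i (s≤s lt)) (sym (newVerts≡ (suc ℓ) i))
    last : encodeEdge (suc ℓ , false) ℓ ≡ ℓ ∷ 0 ∷ newVerts r (suc ℓ) ℓ
    last = cong₂ (λ x vs → ℓ ∷ x ∷ vs) (next-last (suc ℓ) ℓ refl) (sym (newVerts≡ (suc ℓ) ℓ))

  decode-encode : ∀ q x → Valid q x → decode (ncores q) (encode (ncores q) x) ≡ x
  decode-encode q (core i)  v = decode-core (ncores q) i v
  decode-encode q (new i j) (_ , lt) = decode-new (ncores q) i j lt

  encode-bound : ∀ q x → Valid q x → encode (ncores q) x < size (compPattern r q)
  encode-bound q x v rewrite size-comp q with x | v
  ... | core i  | lt = ≤-trans lt (m≤m+n _ _)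
  ... | new i j | lt , lt′ = begin-strict
    ncores q + i * w + j     <⟨ +-monoʳ-< (ncores q + i * w) lt′ ⟩
    ncores q + i * w + w     ≡⟨ trans (+-assoc (ncores q) _ _) (cong (ncores q +_) (+-comm (i * w) w)) ⟩
    ncores q + suc i * w     ≤⟨ +-monoʳ-≤ (ncores q) (*-monoˡ-≤ w lt) ⟩
    ncores q + proj₁ q * w   ∎
    where open ≤-Reasoning

  WfEdge : ℕ → List ℕ → Set
  WfEdge m e = Unique e × length e ≡ r × All (_< m) e

  map-unique : ∀ {A B : Set} (f : A → B) {P : A → Set} {xs} → All P xs →
    (∀ {x y} → P x → P y → f x ≡ f y → x ≡ y) → Unique xs → Unique (map f xs)
  map-unique f []       inj []       = []
  map-unique f (p ∷ ps) inj (d ∷ u) =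
    Allₚ.map⁺ (All.zipWith (λ { (q , ne) e → ne (inj p q e) }) (ps , d)) ∷ map-unique f ps inj u

  next≢ : ∀ q i → 2 ≤ proj₁ q → i ≢ next q i
  next≢ (ℓ , true)  i _ e = 1+n≢n (sym e)
  next≢ (ℓ , false) i 2≤ e with suc i ℕ.≟ ℓ
  next≢ (.1 , false) .0 (s≤s ()) refl | yes refl
  ... | no _ = 1+n≢n (sym e)

  edgeVerts-unique : ∀ q i → 2 ≤ proj₁ q → Unique (edgeVerts q i)
  edgeVerts-unique q i 2≤ =
    ((λ e → next≢ q i 2≤ (core-injective e)) ∷ Allₚ.map⁺ (All.tabulate λ _ ())) ∷
    Allₚ.map⁺ (All.tabulate λ _ ()) ∷
    Uniqueₚ.map⁺ (λ e → proj₂ (new-injective e)) (Uniqueₚ.upTo⁺ w)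

  wf-comp : ∀ q → 2 ≤ proj₁ q → All (WfEdge (size (compPattern r q))) (edges (compPattern r q))
  wf-comp q 2≤ = edges-comp q (≤-trans (s≤s z≤n) 2≤) λ i lt →
    let vs = edgeVerts-valid q i lt (<ncores q i lt) in
    map-unique (encode (ncores q)) vs
      (λ {x} {y} vx vy e → trans (sym (decode-encode q x vx)) (trans (cong (decode (ncores q)) e) (decode-encode q y vy)))
      (edgeVerts-unique q i 2≤)
    , trans (Listₚ.length-map _ (edgeVerts q i))
        (cong (suc ∘ suc) (trans (Listₚ.length-map (new i) (upTo w)) (Listₚ.length-upTo w)))
    , Allₚ.map⁺ (All.map (λ {x} → encode-bound q x) vs)

  -- Freeness speaks of sets of size exactly `r`. The image of a listed edge has that size only
  -- because its entries are distinct and lie in the range where an embedding is injective.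
  wf-union : ∀ qs → All (λ q → 2 ≤ proj₁ q) qs →
    All (WfEdge (size (unionPattern r qs))) (edges (unionPattern r qs))
  wf-union []       []       = []
  wf-union (q ∷ qs) (p ∷ ps) = Allₚ.++⁺
    (All.map (λ { (u , l , b) → u , l , All.map (λ lt → ≤-trans lt (m≤m+n _ _)) b }) (wf-comp q p))
    (Allₚ.map⁺ (All.map (λ {e} → λ { (u , l , b) →
        Uniqueₚ.map⁺ (+-cancelˡ-≡ (size (compPattern r q)) _ _) u , trans (Listₚ.length-map _ e) l ,
        Allₚ.map⁺ (All.map (+-monoʳ-< (size (compPattern r q))) b) }) (wf-union qs ps)))

  module _ {V : Set} (Cov : List V → Set) where

    Embedding : Pattern → (ℕ → V) → Set
    Embedding F φ = (∀ u v → u < size F → v < size F → φ u ≡ φ v → u ≡ v) ×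
                    All (λ e → Cov (map φ e)) (edges F)

    record CompEmb (q : Component) (val : Vert → V) : Set where
      field
        inj   : ∀ x y → Valid q x → Valid q y → val x ≡ val y → x ≡ y
        cover : ∀ i → i < proj₁ q → Cov (map val (edgeVerts q i))

    valφ : Component → (Vert → V) → ℕ → V
    valφ q val u = val (decode (ncores q) u)

    valφ-edge : ∀ q val i → i < proj₁ q → map (valφ q val) (encodeEdge q i) ≡ map val (edgeVerts q i)
    valφ-edge q val i lt = trans (sym (Listₚ.map-∘ (edgeVerts q i)))
      (map-cong-∈ (edgeVerts q i) (edgeVerts-valid q i lt (<ncores q i lt)))
      where
      map-cong-∈ : ∀ xs → All (Valid q) xs →
        map (λ x → valφ q val (encode (ncores q) x)) xs ≡ map val xs
      map-cong-∈ []       []       = refl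
      map-cong-∈ (x ∷ xs) (v ∷ vs) = cong₂ _∷_ (cong val (decode-encode q x v)) (map-cong-∈ xs vs)

    comp-embedding : ∀ q val → 1 ≤ proj₁ q → CompEmb q val → Embedding (compPattern r q) (valφ q val)
    comp-embedding q val 1≤ ce =
      (λ u v lu lv e → trans (sym (encode-decode c u)) (trans
        (cong (encode c) (CompEmb.inj ce _ _ (dv u lu) (dv v lv) e)) (encode-decode c v))) ,
      edges-comp q 1≤ (λ i lt → subst Cov (sym (valφ-edge q val i lt)) (CompEmb.cover ce i lt))
      where
      c = ncores q
      dv : ∀ u → u < size (compPattern r q) → Valid q (decode c u)
      dv u lu = decode-valid q u (subst (u <_) (size-comp q) lu)

    joinφ : ℕ → (ℕ → V) → (ℕ → V) → ℕ → V
    joinφ a φ ψ u with u <? a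
    ... | yes _ = φ u
    ... | no _  = ψ (u ∸ a)

    joinφ-left : ∀ a φ ψ u → u < a → joinφ a φ ψ u ≡ φ u
    joinφ-left a φ ψ u lt with u <? a
    ... | yes _ = refl
    ... | no ≮ = contradiction lt ≮

    joinφ-right : ∀ a φ ψ u → joinφ a φ ψ (a + u) ≡ ψ u
    joinφ-right a φ ψ u with a + u <? a
    ... | yes lt = contradiction (m≤m+n a u) (<⇒≱ lt)
    ... | no _  = cong ψ (m+n∸m≡n a u)

    joinφ-case : ∀ a b φ ψ u → u < a + b →
      (u < a × joinφ a φ ψ u ≡ φ u) ⊎ (∃ λ u′ → u ≡ a + u′ × u′ < b × joinφ a φ ψ u ≡ ψ u′)
    joinφ-case a b φ ψ u lt with u <? a
    ... | yes l = inj₁ (l , refl)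
    ... | no ≮ = inj₂ (u ∸ a , e , +-cancelˡ-< a _ _ (subst (_< a + b) e lt) , refl)
      where e = sym (m+[n∸m]≡n (≮⇒≥ ≮))

    join-embedding : ∀ F₁ F₂ φ ψ → All (WfEdge (size F₁)) (edges F₁) →
      Embedding F₁ φ → Embedding F₂ ψ → (∀ u v → u < size F₁ → v < size F₂ → φ u ≢ ψ v) →
      Embedding (F₁ ⊎ᴾ F₂) (joinφ (size F₁) φ ψ)
    join-embedding F₁ F₂ φ ψ wf (i₁ , e₁) (i₂ , e₂) dis = inj ,
      Allₚ.++⁺ (All.zipWith (λ {e} → λ { ((_ , _ , b) , cv) → subst Cov (sym (left e b)) cv }) (wf , e₁))
               (Allₚ.map⁺ (All.map (λ {e} → subst Cov (sym (right e))) e₂))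
      where
      a = size F₁
      χ = joinφ a φ ψ
      left : ∀ e → All (_< a) e → map χ e ≡ map φ e
      left []      []       = refl
      left (u ∷ e) (p ∷ ps) = cong₂ _∷_ (joinφ-left a φ ψ u p) (left e ps)
      right : ∀ e → map χ (map (a +_) e) ≡ map ψ e
      right e = trans (sym (Listₚ.map-∘ e)) (Listₚ.map-cong (joinφ-right a φ ψ) e)
      inj : ∀ u v → u < a + size F₂ → v < a + size F₂ → χ u ≡ χ v → u ≡ v
      inj u v lu lv e with joinφ-case a (size F₂) φ ψ u lu | joinφ-case a (size F₂) φ ψ v lv
      ... | inj₁ (l , p) | inj₁ (m , q) = i₁ u v l m (trans (sym p) (trans e q))
      ... | inj₁ (l , p) | inj₂ (v′ , _ , m , q) = ⊥-elim (dis u v′ l m (trans (sym p) (trans e q)))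
      ... | inj₂ (u′ , _ , l , p) | inj₁ (m , q) = ⊥-elim (dis v u′ m l (trans (sym q) (trans (sym e) p)))
      ... | inj₂ (u′ , eu , l , p) | inj₂ (v′ , ev , m , q) =
        trans eu (trans (cong (a +_) (i₂ u′ v′ l m (trans (sym p) (trans e q)))) (sym ev))

    -- For constructions that name all vertices at once. The description of the range of `φ` is
    -- there for the induction: it shows that the first component misses the rest.
    family-embedding : ∀ qs (val : ℕ → Vert → V) → All (λ q → 2 ≤ proj₁ q) qs →
      (∀ κ κ′ q q′ x y → At qs κ q → At qs κ′ q′ → Valid q x → Valid q′ y →
        val κ x ≡ val κ′ y → κ ≡ κ′ × x ≡ y) →
      (∀ κ q i → At qs κ q → i < proj₁ q → Cov (map (val κ) (edgeVerts q i))) →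
      V → Σ (ℕ → V) λ φ → Embedding (unionPattern r qs) φ ×
        (∀ u → u < size (unionPattern r qs) → ∃ λ κ → ∃ λ q → ∃ λ x → At qs κ q × Valid q x × φ u ≡ val κ x)
    family-embedding [] val _ _ _ v = (λ _ → v) , ((λ _ _ ()) , []) , λ _ ()
    family-embedding (q ∷ qs) val (p ∷ ps) gi cv v
      with family-embedding qs (val ∘ suc) ps
             (λ κ κ′ q q′ x y a a′ vx vy e → let e₁ , e₂ = gi (suc κ) (suc κ′) q q′ x y (at-suc a) (at-suc a′) vx vy e
                                              in suc-injective e₁ , e₂)
             (λ κ q i a → cv (suc κ) q i (at-suc a)) v
    ... | ψ , emb , range = joinφ a φ ψ ,
          join-embedding F₁ F₂ φ ψ (wf-comp q p) head emb dis , range′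
      where
      F₁ = compPattern r q
      F₂ = unionPattern r qs
      a = size F₁
      φ = valφ q (val 0)
      dv : ∀ u → u < a → Valid q (decode (ncores q) u)
      dv u lu = decode-valid q u (subst (u <_) (size-comp q) lu)
      head = comp-embedding q (val 0) (≤-trans (s≤s z≤n) p) record
        { inj = λ x y vx vy e → proj₂ (gi 0 0 q q x y at-zero at-zero vx vy e)
        ; cover = λ i lt → cv 0 q i at-zero lt }
      dis : ∀ u u′ → u < a → u′ < size F₂ → φ u ≢ ψ u′
      dis u u′ lu lu′ e with range u′ lu′
      ... | κ , q′ , x , at , vx , e′ with gi 0 (suc κ) q q′ _ x at-zero (at-suc at) (dv u lu) vx (trans e e′)
      ...   | () , _
      range′ : ∀ u → u < a + size F₂ → ∃ λ κ → ∃ λ q′ → ∃ λ x →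
        At (q ∷ qs) κ q′ × Valid q′ x × joinφ a φ ψ u ≡ val κ x
      range′ u lu with joinφ-case a (size F₂) φ ψ u lu
      ... | inj₁ (l , e) = 0 , q , _ , at-zero , dv u l , e
      ... | inj₂ (u′ , _ , l , e) with range u′ l
      ...   | κ , q′ , x , at , vx , e′ = suc κ , q′ , x , at-suc at , vx , trans e e′

    CycleAvoiding : ℕ → List V → Set
    CycleAvoiding ℓ Z = Σ (Vert → V) λ val → CompEmb (ℓ , false) val ×
      (∀ x → Valid (ℓ , false) x → val x ∉ Z)

    -- A path with ℓ edges is a cycle with ℓ + 1 edges without its closing edge, so only cycles ever
    -- have to be constructed, at the price of one more length.
    comp-avoiding : ∀ q Z → (∀ ℓ → proj₁ q ≤ ℓ → ℓ ≤ suc (proj₁ q) → CycleAvoiding ℓ Z) →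
      Σ (Vert → V) λ val → CompEmb q val × (∀ x → Valid q x → val x ∉ Z)
    comp-avoiding (ℓ , false) Z h = h ℓ ≤-refl (n≤1+n ℓ)
    comp-avoiding (ℓ , true) Z h with h (suc ℓ) (n≤1+n ℓ) ≤-refl
    ... | val , ce , av = val , record
            { inj = λ x y vx vy → CompEmb.inj ce x y (valid x vx) (valid y vy)
            ; cover = λ i lt → subst (λ k → Cov (val (core i) ∷ val (core k) ∷ map val (map (new i) (upTo w))))
                (next-inner (suc ℓ) i (s≤s lt)) (CompEmb.cover ce i (m<n⇒m<1+n lt)) } ,
          λ x vx → av x (valid x vx)
      where
      valid : ∀ x → Valid (ℓ , true) x → Valid (suc ℓ , false) x
      valid (core i)  lt = lt
      valid (new i j) (lt , lt′) = m<n⇒m<1+n lt , lt′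

    -- For greedy constructions: each component avoids `Z` together with everything placed before
    -- it, and `B` bounds all these avoided lists in advance.
    sequential-embedding : ∀ qs B → All (λ q → 2 ≤ proj₁ q) qs → V →
      (∀ q Z → q ∈ qs → length Z ≤ B → ∀ ℓ → proj₁ q ≤ ℓ → ℓ ≤ suc (proj₁ q) → CycleAvoiding ℓ Z) →
      ∀ Z → length Z + size (unionPattern r qs) ≤ B →
      Σ (ℕ → V) λ φ → Embedding (unionPattern r qs) φ × (∀ u → u < size (unionPattern r qs) → φ u ∉ Z)
    sequential-embedding [] B _ v _ _ _ = (λ _ → v) , ((λ _ _ ()) , []) , λ _ ()
    sequential-embedding (q ∷ qs) B (p ∷ ps) v cyc Z le
      with comp-avoiding q Z (cyc q Z (here refl) (≤-trans (m≤m+n _ _) le))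
    ... | val , ce , av
      with sequential-embedding qs B ps v (λ q′ Z′ q∈ → cyc q′ Z′ (there q∈))
             (Z ++ map (valφ q val) (upTo (size (compPattern r q)))) (subst (_≤ B) len le)
      where
      a = size (compPattern r q)
      len : length Z + (a + size (unionPattern r qs)) ≡
            length (Z ++ map (valφ q val) (upTo a)) + size (unionPattern r qs)
      len = sym (trans (cong (_+ size (unionPattern r qs)) (trans (Listₚ.length-++ Z)
        (cong (length Z +_) (trans (Listₚ.length-map _ (upTo a)) (Listₚ.length-upTo a))))) (+-assoc (length Z) a _))
    ... | ψ , emb , av′ = joinφ a φ ψ ,
          join-embedding F₁ F₂ φ ψ (wf-comp q p) (comp-embedding q val (≤-trans (s≤s z≤n) p) ce) emb dis , avoid
      where
      F₁ = compPattern r q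
      F₂ = unionPattern r qs
      a = size F₁
      φ = valφ q val
      dis : ∀ u u′ → u < a → u′ < size F₂ → φ u ≢ ψ u′
      dis u u′ lu lu′ e = av′ u′ lu′ (∈ₚ.∈-++⁺ʳ Z (subst (_∈ map φ (upTo a)) e (∈ₚ.∈-map⁺ φ (∈ₚ.∈-upTo⁺ lu))))
      avoid : ∀ u → u < a + size F₂ → joinφ a φ ψ u ∉ Z
      avoid u lu u∈ with joinφ-case a (size F₂) φ ψ u lu
      ... | inj₁ (l , e) = av _ (decode-valid q u (subst (u <_) (size-comp q) l)) (subst (_∈ Z) e u∈)
      ... | inj₂ (u′ , _ , l , e) = av′ u′ l (∈ₚ.∈-++⁺ˡ (subst (_∈ Z) e u∈))

-- Positions in lists, and vertices outside a short list.

nth : List A → A → ℕ → A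
nth []       d _       = d
nth (x ∷ xs) d zero    = x
nth (x ∷ xs) d (suc i) = nth xs d i

nth-∈ : ∀ (xs : List A) d i → i < length xs → nth xs d i ∈ xs
nth-∈ (x ∷ xs) d zero    _        = here refl
nth-∈ (x ∷ xs) d (suc i) (s≤s lt) = there (nth-∈ xs d i lt)

nth-injective : ∀ (xs : List A) d → Unique xs → ∀ i j → i < length xs → j < length xs →
  nth xs d i ≡ nth xs d j → i ≡ j
nth-injective (x ∷ xs) d _       zero    zero    _ _ _ = refl
nth-injective (x ∷ xs) d (p ∷ _) zero    (suc j) _ (s≤s lt) e = contradiction e (All.lookup p (nth-∈ xs d j lt))
nth-injective (x ∷ xs) d (p ∷ _) (suc i) zero    (s≤s lt) _ e = contradiction (sym e) (All.lookup p (nth-∈ xs d i lt))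
nth-injective (x ∷ xs) d (_ ∷ u) (suc i) (suc j) (s≤s l) (s≤s l′) e = cong suc (nth-injective xs d u i j l l′ e)

All-map-upTo : ∀ {P : A → Set} (f : ℕ → A) m → (∀ i → i < m → P (f i)) → All P (map f (upTo m))
All-map-upTo f m h = Allₚ.map⁺ (All.tabulate λ {i} i∈ → h i (∈ₚ.∈-upTo⁻ i∈))

C-monoˡ-≤ : ∀ {m n} k → m ≤ n → m C k ≤ n C k
C-monoˡ-≤ {m} {n} k m≤n = subst (λ n → m C k ≤ n C k) (m+[n∸m]≡n m≤n) (go (n ∸ m))
  where
  step : ∀ n k → n C k ≤ suc n C k
  step n zero    = ≤-reflexive (trans (nC0 n) (sym (nC0 (suc n))))
    where nC0 : ∀ n → n C 0 ≡ 1
          nC0 n = refl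
  step n (suc k) = ≤-trans (m≤n+m (n C suc k) (n C k)) (≤-reflexive (nCk+nC[k+1]≡[n+1]C[k+1] n k))
  go : ∀ j → m C k ≤ (m + j) C k
  go zero    = ≤-reflexive (cong (_C k) (sym (+-identityʳ m)))
  go (suc j) = ≤-trans (go j) (≤-trans (step (m + j) k) (≤-reflexive (cong (_C k) (sym (+-suc m j)))))

#-unique : ∀ {A : Set} (_≟_ : (x y : A) → Dec (x ≡ y)) xs x → Unique xs → # xs (λ v → ⌊ v ≟ x ⌋) ≤ 1
#-unique _≟_ []       x _       = z≤n
#-unique _≟_ (y ∷ xs) x (p ∷ u) with y ≟ x
... | no _     = #-unique _≟_ xs x u
... | yes refl = s≤s (≤-reflexive (zero-rest xs p))
  where
  zero-rest : ∀ ys → All (y ≢_) ys → # ys (λ v → ⌊ v ≟ y ⌋) ≡ 0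
  zero-rest []       []       = refl
  zero-rest (z ∷ ys) (q ∷ qs) with z ≟ y
  ... | yes e = contradiction (sym e) q
  ... | no _  = zero-rest ys qs

module _ {n : ℕ} where

  _∈ᵇ_ : Fin n → List (Fin n) → Bool
  v ∈ᵇ W = ⌊ Any.any? (v Fin.≟_) W ⌋

  ∈ᵇ⁻ : ∀ v W → v ∈ᵇ W ≡ true → v ∈ W
  ∈ᵇ⁻ v W = ⌊⌋-true⁻ (Any.any? (v Fin.≟_) W)

  ∈ᵇ⁺ : ∀ {v W} → v ∈ W → v ∈ᵇ W ≡ true
  ∈ᵇ⁺ {v} {W} = ⌊⌋-true⁺ (Any.any? (v Fin.≟_) W)

  not-∈ᵇ⁻ : ∀ v W → not (v ∈ᵇ W) ≡ true → v ∉ W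
  not-∈ᵇ⁻ v W e v∈ rewrite ∈ᵇ⁺ v∈ with e
  ... | ()

  #-≟ : ∀ (xs : List (Fin n)) x → Unique xs → # xs (λ v → ⌊ v Fin.≟ x ⌋) ≤ 1
  #-≟ = #-unique Fin._≟_

  #-∈ᵇ : ∀ (xs W : List (Fin n)) → Unique xs → # xs (_∈ᵇ W) ≤ length W
  #-∈ᵇ xs []      u = ≤-reflexive (trans (∑-const xs 0) (*-zeroʳ (length xs)))
  #-∈ᵇ xs (x ∷ W) u = ≤-trans (∑-mono xs pt) (≤-trans (≤-reflexive (∑-+ xs _ _))
      (+-mono-≤ (#-≟ xs x u) (#-∈ᵇ xs W u)))
    where
    pt : ∀ v → 𝟙 (v ∈ᵇ (x ∷ W)) ≤ 𝟙 ⌊ v Fin.≟ x ⌋ + 𝟙 (v ∈ᵇ W)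
    pt v with v ∈ᵇ (x ∷ W) in e
    ... | false = z≤n
    ... | true with ∈ᵇ⁻ v (x ∷ W) e
    ...   | here e′ rewrite ⌊⌋-true⁺ (v Fin.≟ x) e′ = s≤s z≤n
    ...   | there v∈ rewrite ∈ᵇ⁺ v∈ = m≤n+m 1 _

  pick : ∀ (xs W : List (Fin n)) p → Unique xs → length W < # xs p →
    ∃ λ x → x ∈ xs × p x ≡ true × x ∉ W
  pick xs W p u lt with #-pos xs (λ x → p x ∧ not (x ∈ᵇ W)) pos
    where
    pos : 0 < # xs (λ x → p x ∧ not (x ∈ᵇ W))
    pos = +-cancelˡ-< (length W) _ _ (begin-strict
      length W + 0 ≡⟨ +-identityʳ _ ⟩
      length W <⟨ lt ⟩
      # xs p   ≡⟨ #-split xs p (_∈ᵇ W) ⟩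
      # xs (λ x → p x ∧ (x ∈ᵇ W)) + # xs (λ x → p x ∧ not (x ∈ᵇ W))
        ≤⟨ +-monoˡ-≤ _ (≤-trans (#-mono xs λ x e → proj₂ (∧-true⁻ (p x) e)) (#-∈ᵇ xs W u)) ⟩
      length W + # xs (λ x → p x ∧ not (x ∈ᵇ W)) ∎)
      where open ≤-Reasoning
  ... | x , x∈ , e = let e₁ , e₂ = ∧-true⁻ (p x) e in x , x∈ , e₁ , not-∈ᵇ⁻ x W e₂

  pick-length : ∀ (xs W : List (Fin n)) → Unique xs → length W < length xs → ∃ λ x → x ∈ xs × x ∉ W
  pick-length xs W u lt with pick xs W (λ _ → true) u
      (subst (length W <_) (sym (trans (∑-const xs 1) (*-identityʳ _))) lt)
  ... | x , x∈ , _ , x∉ = x , x∈ , x∉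

  #-avoid : ∀ (xs W : List (Fin n)) p → Unique xs →
    # xs p ≤ length W + # xs (λ x → p x ∧ not (x ∈ᵇ W))
  #-avoid xs W p u = ≤-trans (≤-reflexive (#-split xs p (_∈ᵇ W)))
    (+-monoˡ-≤ _ (≤-trans (#-mono xs λ x e → proj₂ (∧-true⁻ (p x) e)) (#-∈ᵇ xs W u)))

-- Subsets and their number.

∈-allSubsets : ∀ {n} (S : Subset n) → S ∈ allSubsets n
∈-allSubsets []            = here refl
∈-allSubsets (true ∷ S)    = ∈ₚ.∈-++⁺ˡ (∈ₚ.∈-map⁺ (inside ∷_) (∈-allSubsets S))
∈-allSubsets {suc n} (false ∷ S) = ∈ₚ.∈-++⁺ʳ (map (inside ∷_) (allSubsets n)) (∈ₚ.∈-map⁺ (outside ∷_) (∈-allSubsets S))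

∑-allSubsets : ∀ n (f : Subset (suc n) → ℕ) →
  ∑ (allSubsets (suc n)) f ≡ ∑ (allSubsets n) (f ∘ (inside ∷_)) + ∑ (allSubsets n) (f ∘ (outside ∷_))
∑-allSubsets n f = trans (∑-++ (map (inside ∷_) (allSubsets n)) _ f)
  (cong₂ _+_ (∑-map _ (allSubsets n) f) (∑-map _ (allSubsets n) f))

⊆ᵇ⁺ : ∀ {n} (p q : Subset n) → p ⊆ˢ q → p ⊆ᵇ q ≡ true
⊆ᵇ⁺ []          []      _ = refl
⊆ᵇ⁺ (false ∷ p) (y ∷ q) h = ⊆ᵇ⁺ p q (Subₚ.drop-∷-⊆ h)
⊆ᵇ⁺ (true ∷ p)  (y ∷ q) h with h here
... | here = ⊆ᵇ⁺ p q (Subₚ.drop-∷-⊆ h)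

⊆ᵇ⁻ : ∀ {n} (p q : Subset n) → p ⊆ᵇ q ≡ true → p ⊆ˢ q
⊆ᵇ⁻ (true ∷ p) (true ∷ q) e here       = here
⊆ᵇ⁻ (true ∷ p) (true ∷ q) e (there x∈) = there (⊆ᵇ⁻ p q e x∈)
⊆ᵇ⁻ (false ∷ p) (y ∷ q)   e (there x∈) = there (⊆ᵇ⁻ p q e x∈)

∈-image⁺ : ∀ {n} {v : Fin n} e → v ∈ e → v ∈ˢ image e
∈-image⁺ (x ∷ e) (here refl) = Subₚ.x∈p∪q⁺ (inj₁ (Subₚ.x∈⁅x⁆ x))
∈-image⁺ (x ∷ e) (there v∈)  = Subₚ.x∈p∪q⁺ (inj₂ (∈-image⁺ e v∈))

∈-image⁻ : ∀ {n} {v : Fin n} e → v ∈ˢ image e → v ∈ e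
∈-image⁻ []      v∈ = ⊥-elim (Subₚ.∉⊥ v∈)
∈-image⁻ (x ∷ e) v∈ with Subₚ.x∈p∪q⁻ ⁅ x ⁆ (image e) v∈
... | inj₁ m = here (Subₚ.x∈⁅y⁆⇒x≡y x m)
... | inj₂ m = there (∈-image⁻ e m)

card-insert : ∀ {n} (x : Fin n) p → x ∉ˢ p → ∣ ⁅ x ⁆ ∪ p ∣ ≡ suc ∣ p ∣
card-insert Fin.zero    (true ∷ p)  x∉ = contradiction here x∉
card-insert Fin.zero    (false ∷ p) x∉ = cong (suc ∘ ∣_∣) (Subₚ.∪-identityˡ p)
card-insert (Fin.suc x) (true ∷ p)  x∉ = cong suc (card-insert x p (x∉ ∘ there))
card-insert (Fin.suc x) (false ∷ p) x∉ = card-insert x p (x∉ ∘ there)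

card-image : ∀ {n} (e : List (Fin n)) → Unique e → ∣ image e ∣ ≡ length e
card-image {n} [] []      = Subₚ.∣⊥∣≡0 n
card-image (x ∷ e) (p ∷ u) = trans (card-insert x (image e) (λ m → All.lookup p (∈-image⁻ e m) refl))
  (cong suc (card-image e u))

card-lookup : ∀ {n} (p : Subset n) → ∣ p ∣ ≡ # (allFin n) (Vec.lookup p)
card-lookup []      = refl
card-lookup {suc n} (x ∷ p) = trans (lem x) (cong (𝟙 x +_)
    (trans (card-lookup p) (trans (sym (∑-map Fin.suc (allFin n) _)) (cong (λ l → # l (Vec.lookup (x ∷ p))) (Listₚ.map-tabulate id Fin.suc)))))
  where lem : ∀ x → ∣ x ∷ p ∣ ≡ 𝟙 x + ∣ p ∣
        lem true  = refl
        lem false = refl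

lookup⇒∈ : ∀ {n} (p : Subset n) v → Vec.lookup p v ≡ true → v ∈ˢ p
lookup⇒∈ p v e = Vecₚ.lookup⇒[]= v p e

∈⇒lookup : ∀ {n} {p : Subset n} {v} → v ∈ˢ p → Vec.lookup p v ≡ true
∈⇒lookup = Vecₚ.[]=⇒lookup

≡ᵇ-true⁻ : ∀ m n → (m ≡ᵇ n) ≡ true → m ≡ n
≡ᵇ-true⁻ m n e = ≡ᵇ⇒≡ m n (≡true⇒T e)

≡ᵇ-true⁺ : ∀ {m n} → m ≡ n → (m ≡ᵇ n) ≡ true
≡ᵇ-true⁺ {m} {n} e = T⇒≡true (≡⇒≡ᵇ m n e)

#-size : ∀ n k → # (allSubsets n) (λ S → ∣ S ∣ ≡ᵇ k) ≡ n C k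
#-size zero    zero    = refl
#-size zero    (suc k) = refl
#-size (suc n) zero    = trans (∑-allSubsets n _) (cong₂ _+_ (trans (∑-const (allSubsets n) 0) (*-zeroʳ (length (allSubsets n)))) (#-size n 0))
#-size (suc n) (suc k) = trans (∑-allSubsets n _) (trans (cong₂ _+_ (#-size n k) (#-size n (suc k))) (nCk+nC[k+1]≡[n+1]C[k+1] n k))

-- A member is determined by the elements it takes from `B` outside `A`. With `A` an (r - 1)-set and
-- `B` the union of the cliques through it, counting members turns a number of cliques into a number
-- of extensions.
between : ∀ {n} → Subset n → Subset n → ℕ → Subset n → Bool
between A B m S = (A ⊆ᵇ S) ∧ ((S ⊆ᵇ B) ∧ (∣ S ∣ ≡ᵇ m))

#-none : ∀ {A : Set} (xs : List A) p → (∀ x → p x ≡ true → Empty) → # xs p ≡ 0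
#-none []       p h = refl
#-none (x ∷ xs) p h with p x in e
... | false = #-none xs p h
... | true  = ⊥-elim (h x e)

#-between : ∀ {n} (A B : Subset n) k → A ⊆ᵇ B ≡ true →
  # (allSubsets n) (between A B (∣ A ∣ + k)) ≤ (∣ B ∣ ∸ ∣ A ∣) C k
#-between [] [] zero    e = ≤-refl
#-between [] [] (suc k) e = z≤n
#-between {suc n} (true ∷ A) (true ∷ B) k e = ≤-trans (≤-reflexive (∑-allSubsets n _))
  (≤-trans (≤-reflexive (cong (# (allSubsets n) (between A B (∣ A ∣ + k)) +_) (#-none (allSubsets n) _ λ _ ())))
    (≤-trans (≤-reflexive (+-identityʳ _)) (#-between A B k e)))
#-between {suc n} (false ∷ A) (false ∷ B) k e = ≤-trans (≤-reflexive (∑-allSubsets n _))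
  (≤-trans (≤-reflexive (cong (_+ # (allSubsets n) (between A B (∣ A ∣ + k)))
     (#-none (allSubsets n) _ λ S e′ → case proj₂ (∧-true⁻ (A ⊆ᵇ S) e′) of λ ()))) (#-between A B k e))
#-between {suc n} (false ∷ A) (true ∷ B) k e = ≤-trans (≤-reflexive (∑-allSubsets n _)) (go k)
  where
  A≤B : ∣ A ∣ ≤ ∣ B ∣
  A≤B = Subₚ.p⊆q⇒∣p∣≤∣q∣ (⊆ᵇ⁻ A B e)
  go : ∀ k → # (allSubsets n) (λ S → between (false ∷ A) (true ∷ B) (∣ A ∣ + k) (true ∷ S)) + # (allSubsets n) (between A B (∣ A ∣ + k))
       ≤ (suc ∣ B ∣ ∸ ∣ A ∣) C k
  go zero = ≤-trans (≤-reflexive (cong (_+ # (allSubsets n) (between A B (∣ A ∣ + 0)))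
              (#-none (allSubsets n) _ λ S e′ → let e₁ , e₂ = ∧-true⁻ (A ⊆ᵇ S) e′ in
                <⇒≱ (≤-reflexive (trans (≡ᵇ-true⁻ (suc ∣ S ∣) (∣ A ∣ + 0) (proj₂ (∧-true⁻ (S ⊆ᵇ B) e₂))) (+-identityʳ ∣ A ∣)))
                    (Subₚ.p⊆q⇒∣p∣≤∣q∣ (⊆ᵇ⁻ A S e₁)))))
              (#-between A B 0 e)
  go (suc k) rewrite +-∸-assoc 1 A≤B | +-suc ∣ A ∣ k = ≤-trans
    (+-mono-≤ (#-between A B k e)
              (subst (λ m → # (allSubsets n) (between A B m) ≤ (∣ B ∣ ∸ ∣ A ∣) C suc k) (+-suc ∣ A ∣ k) (#-between A B (suc k) e)))
    (≤-reflexive (nCk+nC[k+1]≡[n+1]C[k+1] (∣ B ∣ ∸ ∣ A ∣) k))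

all-true⁻ : ∀ {A : Set} (p : A → Bool) xs → BoolL.all p xs ≡ true → ∀ x → x ∈ xs → p x ≡ true
all-true⁻ p (y ∷ ys) e x (here refl) = proj₁ (∧-true⁻ (p y) e)
all-true⁻ p (y ∷ ys) e x (there x∈)  = all-true⁻ p ys (proj₂ (∧-true⁻ (p y) e)) x x∈

select : ∀ {n} (p : Fin n → Bool) → List (Fin n)
select {n} p = filterᵇ p (allFin n)

-- Families of cliques and their extensions.

module CliqueFamily {n : ℕ} (r′ s : ℕ) (r≤s : 3 + r′ ≤ s) (G : Graph n) where

  private
    d = 2 + r′
    k = s ∸ d
    V = Fin n

  s≡ : s ≡ d + k
  s≡ = sym (m+[n∸m]≡n (≤-trans (n≤1+n d) r≤s))

  handles : List (Subset n)
  handles = filterᵇ (λ f → ∣ f ∣ ≡ᵇ d) (allSubsets n)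

  length-handles : length handles ≡ n C d
  length-handles = trans (#-filterᵇ _ (allSubsets n)) (#-size n d)

  ∈-handles : ∀ f → ∣ f ∣ ≡ d → f ∈ handles
  ∈-handles f e = ∈ₚ.∈-filter⁺ _ (∈-allSubsets f) (≡true⇒T (≡ᵇ-true⁺ e))

  module Cl (c : ℕ) = Cleaning (allSubsets n) handles _⊆ᵇ_ c

  -- All embeddings work with coverage by a surviving clique instead of edges: it passes to
  -- sublists, applies to lists of any length, and for `r` distinct vertices it yields an edge.
  Cov : (Subset n → Bool) → List V → Set
  Cov q e = Σ (Subset n) λ S → q S ≡ true × All (_∈ˢ S) e

  Cov-mono : ∀ q {e f} → (∀ v → v ∈ e → v ∈ f) → Cov q f → Cov q e
  Cov-mono q h (S , qS , all) = S , qS , All.tabulate (λ {v} v∈ → All.lookup all (h v v∈))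

  Cliques : (Subset n → Bool) → Set
  Cliques q = ∀ S → q S ≡ true → isCliqueᵇ (3 + r′) s G S ≡ true

  module Family (q : Subset n → Bool) (cl : Cliques q) where

    card : ∀ S → q S ≡ true → ∣ S ∣ ≡ s
    card S qS = ≡ᵇ-true⁻ _ _ (proj₁ (∧-true⁻ (∣ S ∣ ≡ᵇ s) (cl S qS)))

    image⊆ : ∀ (e : List V) S → All (_∈ˢ S) e → image e ⊆ˢ S
    image⊆ e S all v∈ = All.lookup all (∈-image⁻ e v∈)

    cov⇒edge : ∀ e → Cov q e → Unique e → length e ≡ 3 + r′ → IsEdge (3 + r′) G (image e)
    cov⇒edge e (S , qS , all) u len = sz , lem (image e ⊆ᵇ S) (∣ image e ∣ ≡ᵇ 3 + r′) (G (image e))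
        (⊆ᵇ⁺ _ S (image⊆ e S all)) (≡ᵇ-true⁺ sz)
        (all-true⁻ _ (allSubsets n) (proj₂ (∧-true⁻ (∣ S ∣ ≡ᵇ s) (cl S qS))) (image e) (∈-allSubsets (image e)))
      where
      sz = trans (card-image e u) len
      lem : ∀ a b c → a ≡ true → b ≡ true → not (a ∧ b) ∨ c ≡ true → c ≡ true
      lem a b c refl refl h = h

    fill : ∀ m S → m ≤ ∣ S ∣ → ∀ f → All (_∈ˢ S) f → Unique f → length f ≤ m →
      Σ (List V) λ g → All (_∈ˢ S) g × Unique g × length g ≡ m × (∀ v → v ∈ f → v ∈ g)
    -- The list grows towards length `m`, and `≤‴` is the order whose derivations shrink as the
    -- smaller side grows.
    fill m S m≤ f all u le with ≤⇒≤‴ le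
    ... | lt = go f all u lt
      where
      go : ∀ f → All (_∈ˢ S) f → Unique f → length f ℕ.≤‴ m →
        Σ (List V) λ g → All (_∈ˢ S) g × Unique g × length g ≡ m × (∀ v → v ∈ f → v ∈ g)
      go f all u ℕ.≤‴-refl = f , all , u , refl , λ _ v∈ → v∈
      go f all u (ℕ.≤‴-step lt) with pick (allFin n) f (Vec.lookup S) (Uniqueₚ.allFin⁺ n)
          (subst (length f <_) (card-lookup S) (≤-trans (≤‴⇒≤ lt) m≤))
      ... | x , _ , x∈ , x∉ with go (x ∷ f) (lookup⇒∈ S x x∈ ∷ all)
                                  (All.tabulate (λ {y} y∈ e → x∉ (subst (_∈ f) (sym e) y∈)) ∷ u) lt
      ...   | g , a , b , c , sub = g , a , b , c , λ v v∈ → sub v (there v∈)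

    module _ (c t : ℕ) (t≤c : t C k ≤ c) (full : Cl.Full c q) where

      around : Subset n → V → Bool
      around f v = 1 ≤ᵇ # (allSubsets n) (λ S → (q S ∧ (f ⊆ᵇ S)) ∧ Vec.lookup S v)

      hull : Subset n → Subset n
      hull f = Vec.tabulate (around f)

      ⊆hull : ∀ f S → q S ≡ true → f ⊆ᵇ S ≡ true → S ⊆ˢ hull f
      ⊆hull f S qS f⊆ {v} v∈ = lookup⇒∈ (hull f) v (trans (Vecₚ.lookup∘tabulate (around f) v)
        (T⇒≡true (≤⇒≤ᵇ (≤-trans (≤-reflexive (cong 𝟙 (sym (∧-true⁺ (∧-true⁺ qS f⊆) (∈⇒lookup v∈)))))
          (∑-∈ _ (∈-allSubsets S))))))

      hull⁻ : ∀ f v → v ∈ˢ hull f → ∃ λ S → q S ≡ true × f ⊆ᵇ S ≡ true × v ∈ˢ S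
      hull⁻ f v v∈ with #-pos (allSubsets n) _ (≤ᵇ⇒≤ 1 _ (≡true⇒T (trans (sym (Vecₚ.lookup∘tabulate (around f) v)) (∈⇒lookup v∈))))
      ... | S , _ , e = let e₁ , e₂ = ∧-true⁻ (q S ∧ (f ⊆ᵇ S)) e ; e₃ , e₄ = ∧-true⁻ (q S) e₁ in
            S , e₃ , e₄ , lookup⇒∈ S v e₂

      -- The cliques through `f` all lie in `hull`, and each is determined by its `k` vertices
      -- outside `f`. If `hull` had at most `t` vertices beyond `f`, there would be at most
      -- `t C k ≤ c` such cliques, which fullness excludes.
      extensions : ∀ f → Cov q f → Unique f → length f ≡ d →
        Σ (List V) λ xs → Unique xs × t < length xs × All (λ x → x ∉ f × Cov q (x ∷ f)) xs
      extensions f (S , qS , all) u len = xs , Uniqueₚ.filter⁺ _ (Uniqueₚ.allFin⁺ n) , many , All.tabulate good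
        where
        I = image f
        I⊆S = ⊆ᵇ⁺ I S (image⊆ f S all)
        cardI : ∣ I ∣ ≡ d
        cardI = trans (card-image f u) len
        pos : Cl.deg c q I ≢ 0
        pos e = <⇒≢ (≤-trans (≤-reflexive (cong 𝟙 (sym (∧-true⁺ qS I⊆S))))
                      (∑-∈ (λ S → 𝟙 (q S ∧ (I ⊆ᵇ S))) (∈-allSubsets S))) (sym e)
        large : c < Cl.deg c q I
        large with full I (∈-handles I cardI)
        ... | inj₁ e = contradiction e pos
        ... | inj₂ l = l
        inB : ∀ S → q S ∧ (I ⊆ᵇ S) ≡ true → between I (hull I) (∣ I ∣ + k) S ≡ true
        inB S e = let e₁ , e₂ = ∧-true⁻ (q S) e in
          ∧-true⁺ e₂ (∧-true⁺ (⊆ᵇ⁺ S (hull I) (⊆hull I S e₁ e₂)) (≡ᵇ-true⁺ (trans (card S e₁) (trans s≡ (cong (_+ k) (sym cardI))))))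
        I⊆hull : I ⊆ᵇ hull I ≡ true
        I⊆hull = ⊆ᵇ⁺ I (hull I) (λ v∈ → ⊆hull I S qS I⊆S (⊆ᵇ⁻ I S I⊆S v∈))
        big : t < ∣ hull I ∣ ∸ ∣ I ∣
        big = ≰⇒> λ le → <⇒≱ large (≤-trans (#-mono (allSubsets n) inB) (≤-trans (#-between I (hull I) k I⊆hull)
          (≤-trans (C-monoˡ-≤ k le) t≤c)))
        p : V → Bool
        p v = Vec.lookup (hull I) v ∧ not (v ∈ᵇ f)
        xs = select p
        many : t < length xs
        many = ≤-trans big (≤-trans (∸-monoʳ-≤ ∣ hull I ∣ (≤-reflexive (sym (trans cardI (sym len)))))
          (≤-trans (m≤n+o⇒m∸n≤o ∣ hull I ∣ (length f) (≤-trans (≤-reflexive (card-lookup (hull I)))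
            (#-avoid (allFin n) f (Vec.lookup (hull I)) (Uniqueₚ.allFin⁺ n))))
            (≤-reflexive (sym (#-filterᵇ p (allFin n))))))
        good : ∀ {x} → x ∈ xs → x ∉ f × Cov q (x ∷ f)
        good {x} x∈ with ∈ₚ.∈-filter⁻ _ {xs = allFin n} x∈
        ... | _ , tx with ∧-true⁻ (Vec.lookup (hull I) x) (T⇒≡true tx)
        ...   | e₁ , e₂ with hull⁻ I x (lookup⇒∈ (hull I) x e₁)
        ...     | S′ , qS′ , I⊆ , x∈S′ = not-∈ᵇ⁻ x f e₂ ,
                  S′ , qS′ , x∈S′ ∷ All.tabulate (λ {v} v∈ → ⊆ᵇ⁻ I S′ I⊆ (∈-image⁺ f v∈))

      -- A short covered list is first filled up to `d` vertices inside its clique; an extension of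
      -- the larger list also extends the shorter one.
      extend : ∀ f W → Cov q f → Unique f → length f ≤ d → length W ≤ t → ∃ λ x → x ∉ W × Cov q (x ∷ f)
      extend f W (S , qS , all) u len lenW with fill d S (≤-trans (n≤1+n d) (≤-trans r≤s (≤-reflexive (sym (card S qS))))) f all u len
      ... | g , allg , ug , leng , sub with extensions g (S , qS , allg) ug leng
      ...   | xs , uxs , lt , good with pick-length xs W uxs (≤-trans (s≤s lenW) lt)
      ...     | x , x∈ , x∉ = x , x∉ , Cov-mono q (λ { v (here e) → here e ; v (there v∈) → there (sub v v∈) })
                                         (proj₂ (All.lookup good x∈))

-- Greedy embedding when extensions are abundant.

_[_↦_] : (ℕ → A) → ℕ → A → ℕ → A
(f [ m ↦ x ]) i with i ℕ.≟ m
... | yes _ = x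
... | no _  = f i

update-same : ∀ (f : ℕ → A) m x → (f [ m ↦ x ]) m ≡ x
update-same f m x with m ℕ.≟ m
... | yes _ = refl
... | no ¬e = contradiction refl ¬e

update-other : ∀ (f : ℕ → A) m x i → i ≢ m → (f [ m ↦ x ]) i ≡ f i
update-other f m x i ne with i ℕ.≟ m
... | yes e = contradiction e ne
... | no _  = refl

-- Everything embeds once extensions avoiding W exist for all short W: the core is the rim of a fan
-- with hub c 0 (closed up through the hub), and each of its edges is then filled up greedily.
module Greedy {V : Set} (r′ : ℕ) (Cov : List V → Set)
  (mono : ∀ {e f} → (∀ v → v ∈ e → v ∈ f) → Cov f → Cov e) (t : ℕ)
  (extend : ∀ f W → Cov f → Unique f → length f ≤ 2 + r′ → length W ≤ t → ∃ λ x → x ∉ W × Cov (x ∷ f)) where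

  open Assembly r′ using (w; Valid; CompEmb; CycleAvoiding; edgeVerts)

  record Fan (Z : List V) (m : ℕ) : Set where
    field
      c     : ℕ → V
      inj   : ∀ i j → i < 2 + m → j < 2 + m → c i ≡ c j → i ≡ j
      avoid : ∀ i → i < 2 + m → c i ∉ Z
      spoke : ∀ i → i < suc m → Cov (c 0 ∷ c (suc i) ∷ [])
      rim   : ∀ i → i < suc m → Cov (c i ∷ c (suc i) ∷ [])

  pair-unique : ∀ {x y : V} → x ≢ y → Unique (x ∷ y ∷ [])
  pair-unique ne = (ne ∷ []) ∷ [] ∷ []

  fan : ∀ Z m → Cov [] → length Z + (2 + m) ≤ t → Fan Z m
  fan Z zero cov le with extend [] Z cov [] z≤n (≤-trans (m≤m+n _ _) le)
  ... | x , x∉ , covx with extend (x ∷ []) (x ∷ Z) covx ([] ∷ []) (s≤s z≤n) (≤-trans (≤-reflexive (+-comm 1 (length Z))) (≤-trans (+-monoʳ-≤ (length Z) (s≤s z≤n)) le))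
  ...   | y , y∉ , covy = record
    { c = (λ _ → x) [ 1 ↦ y ]
    ; inj = λ { zero zero _ _ _ → refl ; zero (suc zero) _ _ e → contradiction (here (sym e)) y∉
              ; (suc zero) zero _ _ e → contradiction (here e) y∉ ; (suc zero) (suc zero) _ _ _ → refl
              ; (suc (suc _)) _ (s≤s (s≤s ())) ; _ (suc (suc _)) _ (s≤s (s≤s ())) }
    ; avoid = λ { zero _ → x∉ ; (suc zero) _ → λ y∈ → y∉ (there y∈) ; (suc (suc _)) (s≤s (s≤s ())) }
    ; spoke = λ { zero _ → xy ; (suc _) (s≤s ()) }
    ; rim = λ { zero _ → xy ; (suc _) (s≤s ()) } }
    where xy : Cov (x ∷ y ∷ [])
          xy = mono (λ { v (here e) → there (here e) ; v (there (here e)) → here e }) covy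
  fan Z (suc m) cov le with fan Z m cov (≤-trans (+-monoʳ-≤ (length Z) (n≤1+n (2 + m))) le)
  -- Extending the last spoke rather than the last rim vertex gives one covered triple that contains
  -- both the new spoke and the new rim pair.
  ... | F with extend (c 0 ∷ c (suc m) ∷ []) (Z ++ map c (upTo (2 + m))) (spoke m ≤-refl)
                 (pair-unique λ e → case inj 0 (suc m) (s≤s z≤n) ≤-refl e of λ ()) (s≤s (s≤s z≤n)) lenW
    where
    open Fan F
    lenW : length (Z ++ map c (upTo (2 + m))) ≤ t
    lenW = ≤-trans (≤-reflexive (trans (Listₚ.length-++ Z) (cong (length Z +_)
      (trans (Listₚ.length-map c (upTo (2 + m))) (Listₚ.length-upTo (2 + m))))))
      (≤-trans (+-monoʳ-≤ (length Z) (n≤1+n (2 + m))) le)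
  ... | x , x∉ , covx = record
    { c = c′
    ; inj = inj′
    ; avoid = avoid′
    ; spoke = spoke′
    ; rim = rim′ }
    where
    open Fan F
    c′ = c [ 2 + m ↦ x ]
    old : ∀ i → i < 2 + m → c′ i ≡ c i
    old i lt = update-other c (2 + m) x i (<⇒≢ lt)
    top : c′ (2 + m) ≡ x
    top = update-same c (2 + m) x
    fresh : ∀ i → i < 2 + m → x ≢ c i
    fresh i lt e = x∉ (∈ₚ.∈-++⁺ʳ Z (subst (_∈ map c (upTo (2 + m))) (sym e) (∈ₚ.∈-map⁺ c (∈ₚ.∈-upTo⁺ lt))))
    split : ∀ {m} i → i < suc m → i < m ⊎ i ≡ m
    split {m} i (s≤s le) = m≤n⇒m<n∨m≡n le
    inj′ : ∀ i j → i < 3 + m → j < 3 + m → c′ i ≡ c′ j → i ≡ j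
    inj′ i j li lj e with split i li | split j lj
    ... | inj₁ a | inj₁ b = inj i j a b (trans (sym (old i a)) (trans e (old j b)))
    ... | inj₁ a | inj₂ refl = contradiction (trans (sym top) (trans (sym e) (old i a))) (fresh i a)
    ... | inj₂ refl | inj₁ b = contradiction (trans (sym top) (trans e (old j b))) (fresh j b)
    ... | inj₂ refl | inj₂ refl = refl
    avoid′ : ∀ i → i < 3 + m → c′ i ∉ Z
    avoid′ i li with split i li
    ... | inj₁ a = subst (_∉ Z) (sym (old i a)) (avoid i a)
    ... | inj₂ refl = subst (_∉ Z) (sym top) (λ x∈ → x∉ (∈ₚ.∈-++⁺ˡ x∈))
    spoke′ : ∀ i → i < 2 + m → Cov (c′ 0 ∷ c′ (suc i) ∷ [])
    spoke′ i li with split i li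
    ... | inj₁ a rewrite old (suc i) (s≤s a) = spoke i a
    ... | inj₂ refl rewrite top = mono (λ { v (here e) → there (here e) ; v (there (here e)) → here e }) covx
    rim′ : ∀ i → i < 2 + m → Cov (c′ i ∷ c′ (suc i) ∷ [])
    rim′ i li with split i li
    ... | inj₁ a rewrite old i (m<n⇒m<1+n a) | old (suc i) (s≤s a) = rim i a
    ... | inj₂ refl rewrite old (suc m) ≤-refl | top =
          mono (λ { v (here e) → there (there (here e)) ; v (there (here e)) → here e }) covx

  expand : ∀ j u v W → j ≤ w → Cov (u ∷ v ∷ []) → u ≢ v → u ∈ W → v ∈ W → length W + j ≤ t →
    Σ (List V) λ g → length g ≡ j × Unique g × All (_∉ W) g × Cov (u ∷ v ∷ g)
  expand zero    u v W _ cov _ _ _ _ = [] , refl , [] , [] , cov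
  expand (suc j) u v W j≤ cov ne u∈ v∈ le
    with expand j u v W (≤-trans (n≤1+n j) j≤) cov ne u∈ v∈ (≤-trans (+-monoʳ-≤ (length W) (n≤1+n j)) le)
  ... | g , len , ug , av , covg
    with extend (u ∷ v ∷ g) (W ++ g) covg ((ne ∷ All.map (λ x∉ e → x∉ (subst (_∈ W) e u∈)) av) ∷
           All.map (λ x∉ e → x∉ (subst (_∈ W) e v∈)) av ∷ ug)
           (s≤s (s≤s (≤-trans (≤-reflexive len) (≤-pred j≤))))
           (≤-trans (≤-reflexive (trans (Listₚ.length-++ W) (cong (length W +_) len))) (≤-trans (+-monoʳ-≤ (length W) (n≤1+n j)) le))
  ...   | x , x∉ , covx = x ∷ g , cong suc len ,
          All.tabulate (λ {y} y∈ e → x∉ (∈ₚ.∈-++⁺ʳ W (subst (_∈ g) (sym e) y∈))) ∷ ug ,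
          (λ x∈ → x∉ (∈ₚ.∈-++⁺ˡ x∈)) ∷ av ,
          mono (λ { y (here e) → there (here e) ; y (there (here e)) → there (there (here e))
                  ; y (there (there (here e))) → here e ; y (there (there (there y∈))) → there (there (there y∈)) }) covx

  record Expanded (W : List V) (ℓ m : ℕ) (c : ℕ → V) : Set where
    field
      g     : ℕ → List V
      used  : List V
      len   : ∀ i → i < m → length (g i) ≡ w
      uniq  : ∀ i → i < m → Unique (g i)
      avoid : ∀ i → i < m → All (_∉ W) (g i)
      dis   : ∀ i j x → i < m → j < m → x ∈ g i → x ∈ g j → i ≡ j
      inUse : ∀ i x → i < m → x ∈ g i → x ∈ used
      bound : length used ≤ m * w
      cover : ∀ i → i < m → Cov (c i ∷ c (next (ℓ , false) i) ∷ g i)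

  expandAll : ∀ W ℓ c → (∀ i → i < ℓ → Cov (c i ∷ c (next (ℓ , false) i) ∷ [])) →
    (∀ i → i < ℓ → c i ≢ c (next (ℓ , false) i)) → (∀ i → i < ℓ → c i ∈ W) →
    length W + ℓ * w ≤ t → ∀ m → m ≤ ℓ → Expanded W ℓ m c
  expandAll W ℓ c pairs ne inW le zero m≤ = record { g = λ _ → [] ; used = [] ; len = λ _ () ; uniq = λ _ ()
    ; avoid = λ _ () ; dis = λ _ _ _ () ; inUse = λ _ _ () ; bound = z≤n ; cover = λ _ () }
  expandAll W ℓ c pairs ne inW le (suc m) m< with expandAll W ℓ c pairs ne inW le m (≤-trans (n≤1+n m) m<)
  ... | E with expand w (c m) (c (next (ℓ , false) m)) (W ++ used) ≤-refl (pairs m m<) (ne m m<)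
                 (∈ₚ.∈-++⁺ˡ (inW m m<)) (∈ₚ.∈-++⁺ˡ (inW _ (next<ncores (ℓ , false) m m<))) room
    where
    open Expanded E
    open ≤-Reasoning
    room : length (W ++ used) + w ≤ t
    room = begin
      length (W ++ used) + w          ≡⟨ cong (_+ w) (Listₚ.length-++ W) ⟩
      length W + length used + w      ≤⟨ +-monoˡ-≤ w (+-monoʳ-≤ (length W) bound) ⟩
      length W + m * w + w            ≡⟨ trans (+-assoc (length W) _ _) (cong (length W +_) (+-comm (m * w) w)) ⟩
      length W + suc m * w            ≤⟨ +-monoʳ-≤ (length W) (*-monoˡ-≤ w m<) ⟩
      length W + ℓ * w                ≤⟨ le ⟩
      t                               ∎
  ... | h , lenh , uh , avh , covh = record
    { g = g′ ; used = h ++ used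
    ; len = λ i li → [ (λ a → subst (λ l → length l ≡ w) (sym (old i a)) (len i a)) , (λ { refl → subst (λ l → length l ≡ w) (sym top) lenh }) ]′ (split i li)
    ; uniq = λ i li → [ (λ a → subst Unique (sym (old i a)) (uniq i a)) , (λ { refl → subst Unique (sym top) uh }) ]′ (split i li)
    ; avoid = λ i li → [ (λ a → subst (All (_∉ W)) (sym (old i a)) (avoid i a))
                       , (λ { refl → subst (All (_∉ W)) (sym top) (All.map (λ x∉ x∈ → x∉ (∈ₚ.∈-++⁺ˡ x∈)) avh) }) ]′ (split i li)
    ; dis = dis′
    ; inUse = λ i x li x∈ → [ (λ a → ∈ₚ.∈-++⁺ʳ h (inUse i x a (subst (x ∈_) (old i a) x∈)))
                            , (λ { refl → ∈ₚ.∈-++⁺ˡ (subst (x ∈_) top x∈) }) ]′ (split i li)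
    ; bound = ≤-trans (≤-reflexive (trans (Listₚ.length-++ h) (cong (_+ length used) lenh))) (+-monoʳ-≤ w bound)
    ; cover = λ i li → [ (λ a → subst (λ l → Cov (c i ∷ c (next (ℓ , false) i) ∷ l)) (sym (old i a)) (cover i a))
                       , (λ { refl → subst (λ l → Cov (c i ∷ c (next (ℓ , false) i) ∷ l)) (sym top) covh }) ]′ (split i li) }
    where
    open Expanded E
    g′ = g [ m ↦ h ]
    old : ∀ i → i < m → g′ i ≡ g i
    old i lt = update-other g m h i (<⇒≢ lt)
    top : g′ m ≡ h
    top = update-same g m h
    split : ∀ i → i < suc m → i < m ⊎ i ≡ m
    split i (s≤s le) = m≤n⇒m<n∨m≡n le
    clash : ∀ i x → i < m → x ∈ g i → x ∈ h → Empty
    clash i x a x∈ x∈h = All.lookup avh x∈h (∈ₚ.∈-++⁺ʳ W (inUse i x a x∈))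
    dis′ : ∀ i j x → i < suc m → j < suc m → x ∈ g′ i → x ∈ g′ j → i ≡ j
    dis′ i j x li lj x∈ x∈′ with split i li | split j lj
    ... | inj₁ a | inj₁ b = dis i j x a b (subst (x ∈_) (old i a) x∈) (subst (x ∈_) (old j b) x∈′)
    ... | inj₁ a | inj₂ refl = ⊥-elim (clash i x a (subst (x ∈_) (old i a) x∈) (subst (x ∈_) top x∈′))
    ... | inj₂ refl | inj₁ b = ⊥-elim (clash j x b (subst (x ∈_) (old j b) x∈′) (subst (x ∈_) top x∈))
    ... | inj₂ refl | inj₂ refl = refl

  rimPairs : ∀ {Z m} (F : Fan Z m) i → i < 2 + m → Cov (Fan.c F i ∷ Fan.c F (next (2 + m , false) i) ∷ [])
  rimPairs {m = m} F i lt with suc i ℕ.≟ 2 + m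
  ... | yes refl = mono (λ { v (here e) → there (here e) ; v (there (here e)) → here e }) (Fan.spoke F m ≤-refl)
  ... | no ne = Fan.rim F i (≤-pred (≤∧≢⇒< lt ne))

  rim-distinct : ∀ {Z m} (F : Fan Z m) i → i < 2 + m → Fan.c F i ≢ Fan.c F (next (2 + m , false) i)
  rim-distinct {m = m} F i lt e = Assembly.next≢ r′ (2 + m , false) i (s≤s (s≤s z≤n))
    (Fan.inj F i _ lt (next<ncores (2 + m , false) i lt) e)

  fan⇒cycle : ∀ {Z m} (F : Fan Z m) → Expanded (Z ++ map (Fan.c F) (upTo (2 + m))) (2 + m) (2 + m) (Fan.c F) →
    CycleAvoiding Cov (2 + m) Z
  fan⇒cycle {Z} {m} F E = val , record { inj = inj′ ; cover = cover′ } , avoid′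
    where
    ℓ = 2 + m
    open Fan F
    W = Z ++ map c (upTo ℓ)
    inW : ∀ i → i < ℓ → c i ∈ W
    inW i lt = ∈ₚ.∈-++⁺ʳ Z (∈ₚ.∈-map⁺ c (∈ₚ.∈-upTo⁺ lt))
    module E = Expanded E
    val : Vert → V
    val (core i)  = c i
    val (new i j) = nth (E.g i) (c 0) j
    in-g : ∀ i j → i < ℓ → j < w → val (new i j) ∈ E.g i
    in-g i j li lj = nth-∈ (E.g i) (c 0) j (subst (j <_) (sym (E.len i li)) lj)
    cn : ∀ i i′ j → i < ℓ → i′ < ℓ → j < w → c i ≢ val (new i′ j)
    cn i i′ j li li′ lj e = All.lookup (E.avoid i′ li′) (in-g i′ j li′ lj) (subst (_∈ W) e (inW i li))
    inj′ : ∀ x y → Valid (ℓ , false) x → Valid (ℓ , false) y → val x ≡ val y → x ≡ y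
    inj′ (core i) (core j) li lj e = cong core (inj i j li lj e)
    inj′ (core i) (new i′ j) li (li′ , lj) e = contradiction e (cn i i′ j li li′ lj)
    inj′ (new i′ j) (core i) (li′ , lj) li e = contradiction (sym e) (cn i i′ j li li′ lj)
    inj′ (new i j) (new i′ j′) (li , lj) (li′ , lj′) e
      with E.dis i i′ (val (new i j)) li li′ (in-g i j li lj) (subst (_∈ E.g i′) (sym e) (in-g i′ j′ li′ lj′))
    ... | refl = cong (new i) (nth-injective (E.g i) (c 0) (E.uniq i li) j j′
                   (subst (j <_) (sym (E.len i li)) lj) (subst (j′ <_) (sym (E.len i li)) lj′) e)
    cover′ : ∀ i → i < ℓ → Cov (map val (edgeVerts (ℓ , false) i))
    cover′ i li = mono (λ { v (here e) → here e ; v (there (here e)) → there (here e)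
                          ; v (there (there v∈)) → there (there (sub v v∈)) }) (E.cover i li)
      where
      sub : ∀ v → v ∈ map val (map (new i) (upTo w)) → v ∈ E.g i
      sub v v∈ = All.lookup {P = _∈ E.g i} (Allₚ.map⁺ (All-map-upTo (new i) w λ j lj → in-g i j li lj)) v∈
    avoid′ : ∀ x → Valid (ℓ , false) x → val x ∉ Z
    avoid′ (core i) li = avoid i li
    avoid′ (new i j) (li , lj) v∈ = All.lookup (E.avoid i li) (in-g i j li lj) (∈ₚ.∈-++⁺ˡ v∈)

  cycle : ∀ m Z → Cov [] → length Z + (2 + m) + (2 + m) * w ≤ t → CycleAvoiding Cov (2 + m) Z
  cycle m Z cov le with fan Z m cov (≤-trans (m≤m+n _ _) le)
  ... | F = fan⇒cycle F (expandAll _ (2 + m) (Fan.c F) (rimPairs F) (rim-distinct F)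
    (λ i lt → ∈ₚ.∈-++⁺ʳ Z (∈ₚ.∈-map⁺ (Fan.c F) (∈ₚ.∈-upTo⁺ lt)))
    (≤-trans (≤-reflexive (cong (_+ (2 + m) * w) (trans (Listₚ.length-++ Z) (cong (length Z +_)
        (trans (Listₚ.length-map (Fan.c F) (upTo (2 + m))) (Listₚ.length-upTo (2 + m))))))) le) (2 + m) ≤-refl)

-- Ramsey's theorem and canonical boxes

⊑-AllPairs : ∀ {A : Set} {R : A → A → Set} {xs ys : List A} → xs ⊑ ys → AllPairs R ys → AllPairs R xs
⊑-AllPairs []         _       = []
⊑-AllPairs (_ ∷ʳ τ)   (_ ∷ p) = ⊑-AllPairs τ p
⊑-AllPairs (refl ∷ τ) (h ∷ p) = ⊑ₚ.All-resp-⊆ τ h ∷ ⊑-AllPairs τ p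

⊑-∈ : ∀ {A : Set} {xs ys : List A} {x} → xs ⊑ ys → x ∈ xs → x ∈ ys
⊑-∈ = ⊑ₚ.Any-resp-⊆

length-take≡ : ∀ {A : Set} m (xs : List A) → m ≤ length xs → length (List.take m xs) ≡ m
length-take≡ m xs le = trans (Listₚ.length-take m xs) (m≤n⇒m⊓n≡m le)

majority : ∀ {A : Set} (p : A → Bool) xs M → M + M ≤ suc (length xs) →
  M ≤ length (filterᵇ p xs) ⊎ M ≤ length (filterᵇ (not ∘ p) xs)
majority p xs M le with M ≤? length (filterᵇ p xs)
... | yes q = inj₁ q
... | no ≰  = inj₂ (≤-pred (+-cancelˡ-≤ M _ _ (≤-trans (≤-reflexive (+-suc M M)) (≤-trans (s≤s le) (≤-trans (≤-reflexive (cong (suc ∘ suc) tot))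
        (≤-trans (≤-reflexive (sym (+-suc (suc (length (filterᵇ p xs))) _))) (+-monoˡ-≤ _ (≰⇒> ≰))))))))
  where
  tot : length xs ≡ length (filterᵇ p xs) + length (filterᵇ (not ∘ p) xs)
  tot = trans (sym (trans (∑-const xs 1) (*-identityʳ _)))
    (trans (#-split xs (λ _ → true) p) (sym (cong₂ _+_ (#-filterᵇ p xs) (#-filterᵇ (not ∘ p) xs))))

filterᵇ-All : ∀ {A : Set} (p : A → Bool) xs → All (λ x → p x ≡ true) (filterᵇ p xs)
filterᵇ-All p []       = []
filterᵇ-All p (x ∷ xs) with p x in e
... | true  = e ∷ filterᵇ-All p xs
... | false = filterᵇ-All p xs

not-true : ∀ {b} → not b ≡ true → b ≡ false
not-true {false} _ = refl

Homogeneous : ∀ {A : Set} → (A → A → Bool) → List A → Set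
Homogeneous P xs = Σ Bool λ c → AllPairs (λ x y → P x y ≡ c) xs

endSize : ℕ → ℕ
endSize zero    = 0
endSize (suc m) = suc (endSize m + endSize m)

-- Each chosen element keeps only the later ones that it sees in its majority colour, and remembers
-- that colour. The list halves at each step, hence `endSize m` is 2^m - 1.
end-homogeneous : ∀ {A : Set} (P : A → A → Bool) m xs → endSize m ≤ length xs →
  Σ (List (A × Bool)) λ es → map proj₁ es ⊑ xs × length es ≡ m ×
    AllPairs (λ x y → P (proj₁ x) (proj₁ y) ≡ proj₂ x) es
end-homogeneous P zero    xs le = [] , ⊑ₚ.[]⊆-universal xs , refl , []
end-homogeneous P (suc m) (x ∷ xs) (s≤s le) with majority (P x) xs (endSize m) (≤-trans le (n≤1+n _))
... | inj₁ big with end-homogeneous P m (filterᵇ (P x) xs) big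
...   | es , τ , len , ap = (x , true) ∷ es , refl ∷ ⊆-trans τ (⊑ₚ.filter-⊆ _ xs) , cong suc len ,
        Allₚ.map⁻ (⊑ₚ.All-resp-⊆ τ (filterᵇ-All (P x) xs)) ∷ ap
end-homogeneous P (suc m) (x ∷ xs) (s≤s le) | inj₂ big with end-homogeneous P m (filterᵇ (not ∘ P x) xs) big
...   | es , τ , len , ap = (x , false) ∷ es , refl ∷ ⊆-trans τ (⊑ₚ.filter-⊆ _ xs) , cong suc len ,
        All.map not-true (Allₚ.map⁻ (⊑ₚ.All-resp-⊆ τ (filterᵇ-All (not ∘ P x) xs))) ∷ ap

AllPairs-recolour : ∀ {A : Set} (P : A → A → Bool) c (es : List (A × Bool)) → All (λ e → proj₂ e ≡ c) es →
  AllPairs (λ x y → P (proj₁ x) (proj₁ y) ≡ proj₂ x) es → AllPairs (λ x y → P x y ≡ c) (map proj₁ es)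
AllPairs-recolour P c []             []         []       = []
AllPairs-recolour P c ((x , b) ∷ es) (refl ∷ h) (a ∷ ap) = Allₚ.map⁺ a ∷ AllPairs-recolour P b es h ap

ramsey : ∀ {A : Set} (P : A → A → Bool) m xs → endSize (m + m) ≤ length xs →
  Σ (List A) λ ys → ys ⊑ xs × length ys ≡ m × Homogeneous P ys
ramsey {A} P m xs le with end-homogeneous P (m + m) xs le
... | es , τ , len , ap =
  [ finish true _ (⊑ₚ.filter-⊆ _ es) (filterᵇ-All proj₂ es)
  , finish false _ (⊑ₚ.filter-⊆ _ es) (All.map not-true (filterᵇ-All (not ∘ proj₂) es)) ]′
  (majority proj₂ es m (≤-trans (≤-reflexive (sym len)) (n≤1+n _)))
  where
  finish : ∀ c fs → fs ⊑ es → All (λ e → proj₂ e ≡ c) fs → m ≤ length fs →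
    Σ (List A) λ ys → ys ⊑ xs × length ys ≡ m × Homogeneous P ys
  finish c fs σ h big = List.take m (map proj₁ fs) ,
    ⊆-trans (⊑ₚ.take-⊆ m _) (⊆-trans (⊑ₚ.map⁺ proj₁ σ) τ) ,
    length-take≡ m (map proj₁ fs) (≤-trans big (≤-reflexive (sym (Listₚ.length-map proj₁ fs)))) ,
    c , ⊑-AllPairs (⊑ₚ.take-⊆ m _) (AllPairs-recolour P c fs h (⊑-AllPairs σ ap))

ramseySize : ℕ → ℕ → ℕ
ramseySize zero    m = m
ramseySize (suc k) m = endSize (ramseySize k m + ramseySize k m)

ramseys : ∀ {A : Set} (Ps : List (A → A → Bool)) m xs → ramseySize (length Ps) m ≤ length xs →
  Σ (List A) λ ys → ys ⊑ xs × length ys ≡ m × (∀ P → P ∈ Ps → Homogeneous P ys)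
ramseys []       m xs le = List.take m xs , ⊑ₚ.take-⊆ m xs , length-take≡ m xs le , λ _ ()
ramseys (P ∷ Ps) m xs le with ramsey P (ramseySize (length Ps) m) xs le
... | ys , τ , len , c , ap with ramseys Ps m ys (≤-reflexive (sym len))
...   | zs , σ , len′ , hom = zs , ⊆-trans σ τ , len′ ,
        λ { _ (here refl) → c , ⊑-AllPairs σ ap ; P (there P∈) → hom P P∈ }

opaque
  ramseyBound : ℕ → ℕ → ℕ
  ramseyBound = ramseySize

  homogeneous-sublist : ∀ {A : Set} (Ps : List (A → A → Bool)) m xs → ramseyBound (length Ps) m ≤ length xs →
    Σ (List A) λ ys → ys ⊑ xs × length ys ≡ m × (∀ P → P ∈ Ps → Homogeneous P ys)
  homogeneous-sublist = ramseys

AllPairs-lookup : ∀ {A : Set} {R : A → A → Set} {xs : List A} {x y} → AllPairs R xs → x ∈ xs → y ∈ xs →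
  x ≡ y ⊎ R x y ⊎ R y x
AllPairs-lookup (_ ∷ _) (here refl) (here refl) = inj₁ refl
AllPairs-lookup (h ∷ _) (here refl) (there y∈)  = inj₂ (inj₁ (All.lookup h y∈))
AllPairs-lookup (h ∷ _) (there x∈)  (here refl) = inj₂ (inj₂ (All.lookup h x∈))
AllPairs-lookup (_ ∷ p) (there x∈)  (there y∈)  = AllPairs-lookup p x∈ y∈

AllPairs-snoc : ∀ {A : Set} {R : A → A → Set} (xs : List A) {z} → AllPairs R (xs ++ z ∷ []) →
  ∀ x → x ∈ xs → R x z
AllPairs-snoc (y ∷ xs) (h ∷ p) x (here refl) = All.lookup h (∈ₚ.∈-++⁺ʳ xs (here refl))
AllPairs-snoc (y ∷ xs) (h ∷ p) x (there x∈)  = AllPairs-snoc xs p x x∈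

split-ends : ∀ {A : Set} m (xs : List A) → length xs ≡ 2 + m →
  ∃ λ lo → ∃ λ mid → ∃ λ hi → xs ≡ lo ∷ (mid ++ hi ∷ []) × length mid ≡ m
split-ends m (x ∷ xs) len with List.initLast xs
split-ends m (x ∷ .[]) () | List.[]
... | mid List.∷ʳ′ hi = x , mid , hi , refl ,
      suc-injective (suc-injective (trans (cong suc (sym (trans (Listₚ.length-++ mid) (+-comm _ 1)))) len))

length-cartesian : ∀ {A B : Set} (xs : List A) (ys : List B) → length (cartesianProduct xs ys) ≡ length xs * length ys
length-cartesian []       ys = refl
length-cartesian (x ∷ xs) ys = trans (Listₚ.length-++ (map (x ,_) ys)) (cong₂ _+_ (Listₚ.length-map _ ys) (length-cartesian xs ys))

-- With the other sides cut down to `M`, each of `N` labels gives one function of the first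
-- coordinate per context, `k` in all. Every ordered pair of them contributes three relations, and
-- `2 + m` pays for two reference points. Fixing one of `m` first entries then turns `N` labels into
-- `N * m` labels of the remaining coordinates.
boxSize : ℕ → ℕ → ℕ → ℕ
boxSize zero    N m = 0
boxSize (suc d) N m = let M = boxSize d (N * m) m ; k = N * M ^ d in ramseySize (k * k * 3) (2 + m) ⊔ M

-- Opaque, since the type checker must never unfold these bounds.
opaque
  boxBound : ℕ → ℕ → ℕ → ℕ
  boxBound = boxSize

module Canonical {V : Set} (_≟ⱽ_ : (x y : V) → Dec (x ≡ y)) where

  -- For `i ≢ j` the last premise is void: one coincidence at different arguments makes both
  -- functions the same constant on `xs`. A coincidence at equal arguments only makes the two
  -- functions equal.
  Canonical₁ : ∀ {B : Set} → List (B → V) → List B → Set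
  Canonical₁ φs xs = ∀ φ φ′ i j i′ j′ → φ ∈ φs → φ′ ∈ φs → i ∈ xs → j ∈ xs → i′ ∈ xs → j′ ∈ xs →
    φ i ≡ φ′ j → (i ≡ j → i′ ≡ j′) → φ i′ ≡ φ′ j′

  module _ {B : Set} (φ φ′ : B → V) where
    forward backward diagonal : B → B → Bool
    forward  x y = ⌊ φ x ≟ⱽ φ′ y ⌋
    backward x y = ⌊ φ y ≟ⱽ φ′ x ⌋
    diagonal x y = ⌊ φ x ≟ⱽ φ′ x ⌋

    relations : List (B → B → Bool)
    relations = forward ∷ backward ∷ diagonal ∷ []

  allRelations : ∀ {B : Set} → List (B → V) → List (B → B → Bool)
  allRelations φs = concatMap (λ p → relations (proj₁ p) (proj₂ p)) (cartesianProduct φs φs)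

  ∈-allRelations : ∀ {B : Set} {φs : List (B → V)} {φ φ′ P} → φ ∈ φs → φ′ ∈ φs → P ∈ relations φ φ′ → P ∈ allRelations φs
  ∈-allRelations {φs = φs} φ∈ φ′∈ P∈ = ∈ₚ.∈-concatMap⁺ _ (lose (∈ₚ.∈-cartesianProduct⁺ φ∈ φ′∈) P∈)

  length-allRelations : ∀ {B : Set} (φs : List (B → V)) → length (allRelations φs) ≡ length φs * length φs * 3
  length-allRelations φs = trans (go (cartesianProduct φs φs)) (cong (_* 3) (length-cartesian φs φs))
    where
    go : ∀ ps → length (concatMap (λ p → relations (proj₁ p) (proj₂ p)) ps) ≡ length ps * 3
    go []       = refl
    go (p ∷ ps) = cong (3 +_) (go ps)

  -- The two ends of a homogeneous list serve as reference points and are then cut off.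
  canonical₁ : ∀ {B : Set} (φs : List (B → V)) m xs → Unique xs →
    ramseySize (length φs * length φs * 3) (2 + m) ≤ length xs →
    Σ (List B) λ ys → ys ⊑ xs × length ys ≡ m × Canonical₁ φs ys
  canonical₁ φs m xs uniq le
    with ramseys (allRelations φs) (2 + m) xs (subst (λ k → ramseySize k (2 + m) ≤ length xs) (sym (length-allRelations φs)) le)
  ... | zs , τ , len , hom with split-ends m zs len
  ... | lo , mid , hi , refl , lenm = mid , ⊆-trans (lo ∷ʳ ⊑ₚ.++⁺ʳ (hi ∷ []) ⊆-refl) τ , lenm , canon
    where
    canon : Canonical₁ φs mid
    canon φ φ′ i j i′ j′ φ∈ φ′∈ i∈ j∈ i′∈ j′∈ e same
      with hom _ (∈-allRelations φ∈ φ′∈ (here refl)) | hom _ (∈-allRelations φ∈ φ′∈ (there (here refl)))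
         | hom _ (∈-allRelations φ∈ φ′∈ (there (there (here refl))))
    ... | cf , apf | cb , apb | cd , apd with AllPairs.zip (apf , AllPairs.zip (apb , apd))
    ... | lo-all ∷ ap = cases (AllPairs-lookup (⊑-AllPairs (⊑ₚ.++⁺ʳ (hi ∷ []) ⊆-refl) ap) i∈ j∈)
      where
      lo-hi = All.lookup lo-all (∈ₚ.∈-++⁺ʳ mid (here refl))
      lo-mid = λ {x} (x∈ : x ∈ mid) → All.lookup lo-all (∈ₚ.∈-++⁺ˡ x∈)
      mid-hi = AllPairs-snoc mid ap
      cases : i ≡ j ⊎ _ ⊎ _ → φ i′ ≡ φ′ j′
      cases (inj₁ refl) = subst (λ k → φ i′ ≡ φ′ k) (same refl)
        (⌊⌋-true⁻ (φ i′ ≟ⱽ φ′ i′) (trans (proj₂ (proj₂ (mid-hi i′ i′∈)))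
          (trans (sym (proj₂ (proj₂ (mid-hi i i∈)))) (⌊⌋-true⁺ (φ i ≟ⱽ φ′ i) e))))
      -- Homogeneity gives `φ x ≡ φ′ y` for all `x` before `y`. The order is removed by the detour φ
      -- i′ = φ′ hi = φ lo = φ′ j′, each link of which is in this order.
      cases (inj₂ (inj₁ (fij , _))) =
        trans (fw (proj₁ (mid-hi i′ i′∈))) (trans (sym (fw (proj₁ lo-hi))) (fw (proj₁ (lo-mid j′∈))))
        where
        fw : ∀ {x y} → forward φ φ′ x y ≡ cf → φ x ≡ φ′ y
        fw {x} {y} h = ⌊⌋-true⁻ (φ x ≟ⱽ φ′ y) (trans h (trans (sym fij) (⌊⌋-true⁺ (φ i ≟ⱽ φ′ j) e)))
      cases (inj₂ (inj₂ (_ , bji , _))) =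
        trans (bw (proj₁ (proj₂ (lo-mid i′∈)))) (trans (sym (bw (proj₁ (proj₂ lo-hi)))) (bw (proj₁ (proj₂ (mid-hi j′ j′∈)))))
        where
        bw : ∀ {x y} → backward φ φ′ x y ≡ cb → φ y ≡ φ′ x
        bw {x} {y} h = ⌊⌋-true⁻ (φ y ≟ⱽ φ′ x) (trans h (trans (sym bji) (⌊⌋-true⁺ (φ i ≟ⱽ φ′ j) e)))

  InBox : ∀ {d} → Vec (List V) d → Vec V d → Set
  InBox []       []      = ⊤
  InBox (A ∷ As) (x ∷ u) = x ∈ A × InBox As u

  Agree : ∀ {d} → (u v u′ v′ : Vec V d) → Set
  Agree []      []      []        []        = ⊤
  Agree (x ∷ u) (y ∷ v) (x′ ∷ u′) (y′ ∷ v′) = (x ≡ y → x′ ≡ y′) × Agree u v u′ v′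

  -- Whether two labels agree depends only on which coordinates their arguments share.
  CanonicalBox : ∀ {d} → List (Vec V d → V) → Vec (List V) d → Set
  CanonicalBox Λ As = ∀ f g u v u′ v′ → f ∈ Λ → g ∈ Λ → InBox As u → InBox As v → InBox As u′ → InBox As v′ →
    f u ≡ g v → Agree u v u′ v′ → f u′ ≡ g v′

  contexts : ∀ {d} → Vec (List V) d → List (Vec V d)
  contexts []       = [] ∷ []
  contexts (A ∷ As) = map (λ p → proj₁ p ∷ proj₂ p) (cartesianProduct A (contexts As))

  ∈-contexts : ∀ {d} (As : Vec (List V) d) u → InBox As u → u ∈ contexts As
  ∈-contexts []       []      _        = here refl
  ∈-contexts (A ∷ As) (x ∷ u) (x∈ , b) = ∈ₚ.∈-map⁺ _ (∈ₚ.∈-cartesianProduct⁺ x∈ (∈-contexts As u b))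

  Lengths : ∀ {d} → ℕ → Vec (List V) d → Set
  Lengths m []       = ⊤
  Lengths m (A ∷ As) = Unique A × length A ≡ m × Lengths m As

  LongEnough : ∀ {d} → ℕ → Vec (List V) d → Set
  LongEnough m []       = ⊤
  LongEnough m (A ∷ As) = Unique A × m ≤ length A × LongEnough m As

  SubBox : ∀ {d} → Vec (List V) d → Vec (List V) d → Set
  SubBox []       []       = ⊤
  SubBox (A ∷ As) (B ∷ Bs) = A ⊑ B × SubBox As Bs

  SubBox-trans : ∀ {d} {As Bs Cs : Vec (List V) d} → SubBox As Bs → SubBox Bs Cs → SubBox As Cs
  SubBox-trans {As = []}     {[]}     {[]}     _       _       = tt
  SubBox-trans {As = _ ∷ _} {_ ∷ _} {_ ∷ _} (τ , s) (σ , t) = ⊆-trans τ σ , SubBox-trans s t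

  SubBox-In : ∀ {d} (As Bs : Vec (List V) d) → SubBox As Bs → ∀ u → InBox As u → InBox Bs u
  SubBox-In []       []       _       []      _        = tt
  SubBox-In (A ∷ As) (B ∷ Bs) (τ , s) (x ∷ u) (x∈ , b) = ⊑-∈ τ x∈ , SubBox-In As Bs s u b

  truncate : ∀ {d} m (As : Vec (List V) d) → LongEnough m As → Σ (Vec (List V) d) λ Bs → SubBox Bs As × Lengths m Bs
  truncate m []       _            = [] , tt , tt
  truncate m (A ∷ As) (u , l , ls) with truncate m As ls
  ... | Bs , s , len = List.take m A ∷ Bs , (⊑ₚ.take-⊆ m A , s) , (⊑-AllPairs (⊑ₚ.take-⊆ m A) u , length-take≡ m A l , len)

  length-contexts : ∀ {d} m (As : Vec (List V) d) → Lengths m As → length (contexts As) ≡ m ^ d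
  length-contexts m []       _             = refl
  length-contexts m (A ∷ As) (_ , l , ls) = trans (Listₚ.length-map _ (cartesianProduct A (contexts As)))
    (trans (length-cartesian A (contexts As)) (cong₂ _*_ l (length-contexts m As ls)))

  LongEnough-mono : ∀ {d m m′} (As : Vec (List V) d) → m ≤ m′ → LongEnough m′ As → LongEnough m As
  LongEnough-mono []       le _            = tt
  LongEnough-mono (A ∷ As) le (u , l , ls) = u , ≤-trans le l , LongEnough-mono As le ls

  canonicalBox : ∀ d N m (Λ : List (Vec V d → V)) → length Λ ≡ N → (As : Vec (List V) d) → LongEnough (boxSize d N m) As →
    Σ (Vec (List V) d) λ Bs → SubBox Bs As × Lengths m Bs × CanonicalBox Λ Bs
  canonicalBox zero    N m Λ lenΛ [] _ = [] , tt , tt , λ { f g [] [] [] [] _ _ _ _ _ _ e _ → e }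
  canonicalBox (suc d) N m Λ lenΛ (A ∷ As) (uA , lA , lAs)
    with truncate (boxSize d (N * m) m) As (LongEnough-mono As (m≤n⊔m (ramseySize (N * boxSize d (N * m) m ^ d * (N * boxSize d (N * m) m ^ d) * 3) (2 + m)) _) lAs)
  ... | Cs , subC , lenC
    with canonical₁ φs m A uA (≤-trans (≤-reflexive (cong (λ k → ramseySize (k * k * 3) (2 + m)) lenφ)) (≤-trans (m≤m⊔n _ _) lA))
    where
    φs = map (λ p x → proj₁ p (x ∷ proj₂ p)) (cartesianProduct Λ (contexts Cs))
    lenφ : length φs ≡ N * boxSize d (N * m) m ^ d
    lenφ = trans (Listₚ.length-map _ (cartesianProduct Λ (contexts Cs)))
      (trans (length-cartesian Λ (contexts Cs)) (cong₂ _*_ lenΛ (length-contexts _ Cs lenC)))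
  ... | B , τ , lenB , canB
    with canonicalBox d (N * m) m Λ′ lenΛ′ Cs (exact _ Cs lenC)
    where
    Λ′ = map (λ p u → proj₁ p (proj₂ p ∷ u)) (cartesianProduct Λ B)
    lenΛ′ : length Λ′ ≡ N * m
    lenΛ′ = trans (Listₚ.length-map _ (cartesianProduct Λ B)) (trans (length-cartesian Λ B) (cong₂ _*_ lenΛ lenB))
    exact : ∀ {d} M (Cs : Vec (List V) d) → Lengths M Cs → LongEnough M Cs
    exact M []       _            = tt
    exact M (_ ∷ Cs) (u , l , ls) = u , ≤-reflexive (sym l) , exact M Cs ls
  ... | Bs , subB , lenBs , canBs = B ∷ Bs , (τ , SubBox-trans subB subC) , (⊑-AllPairs τ uA , lenB , lenBs) , canon
    where
    canon : CanonicalBox Λ (B ∷ Bs)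
    canon f g (x ∷ u) (y ∷ v) (x′ ∷ u′) (y′ ∷ v′) f∈ g∈ (x∈ , bu) (y∈ , bv) (x′∈ , bu′) (y′∈ , bv′) e (a , as) =
      -- First the head entries are exchanged while the tails stay fixed as contexts, then the tails
      -- while the new heads stay fixed as part of the labels.
      canBs _ _ u v u′ v′
        (∈ₚ.∈-map⁺ (λ p u → proj₁ p (proj₂ p ∷ u)) (∈ₚ.∈-cartesianProduct⁺ f∈ x′∈))
        (∈ₚ.∈-map⁺ (λ p u → proj₁ p (proj₂ p ∷ u)) (∈ₚ.∈-cartesianProduct⁺ g∈ y′∈)) bu bv bu′ bv′
        (canB _ _ x y x′ y′
          (∈ₚ.∈-map⁺ (λ p x → proj₁ p (x ∷ proj₂ p)) (∈ₚ.∈-cartesianProduct⁺ f∈ (∈-contexts Cs u (SubBox-In Bs Cs subB u bu))))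
          (∈ₚ.∈-map⁺ (λ p x → proj₁ p (x ∷ proj₂ p)) (∈ₚ.∈-cartesianProduct⁺ g∈ (∈-contexts Cs v (SubBox-In Bs Cs subB v bv))))
          x∈ y∈ x′∈ y′∈ e a) as

  opaque
    unfolding boxBound

    canonical-box : ∀ d N m (Λ : List (Vec V d → V)) → length Λ ≡ N → (As : Vec (List V) d) → LongEnough (boxBound d N m) As →
      Σ (Vec (List V) d) λ Bs → SubBox Bs As × Lengths m Bs × CanonicalBox Λ Bs
    canonical-box = canonicalBox

-- Erdős' box theorem

erdosN : ℕ → ℕ → ℕ → ℕ
erdosN zero    K M = 1
erdosN (suc d) K M = suc (4 * K * M) ⊔ erdosN d ((4 * K) ^ M * (2 * K)) M

opaque
  denseBound : ℕ → ℕ → ℕ → ℕ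
  denseBound = erdosN

module Boxes (n : ℕ) where

  open Canonical {Fin n} Fin._≟_ public

  private V = Fin n

  tuples : ∀ d → List (Vec V d)
  tuples zero    = [] ∷ []
  tuples (suc d) = map (λ p → proj₁ p ∷ proj₂ p) (cartesianProduct (allFin n) (tuples d))

  ∑-tuples : ∀ d f → ∑ (tuples (suc d)) f ≡ ∑ (allFin n) (λ c → ∑ (tuples d) (λ u → f (c ∷ u)))
  ∑-tuples d f = trans (∑-map _ (cartesianProduct (allFin n) (tuples d)) f) (∑-cartesian (allFin n) (tuples d) _)

  length-allFin : length (allFin n) ≡ n
  length-allFin = Listₚ.length-tabulate id

  length-tuples : ∀ d → length (tuples d) ≡ n ^ d
  length-tuples zero    = refl
  length-tuples (suc d) = trans (Listₚ.length-map _ (cartesianProduct (allFin n) (tuples d)))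
    (trans (length-cartesian (allFin n) (tuples d)) (cong₂ _*_ length-allFin (length-tuples d)))

  ∈-tuples : ∀ {d} (u : Vec V d) → u ∈ tuples d
  ∈-tuples []      = here refl
  ∈-tuples (c ∷ u) = ∈ₚ.∈-map⁺ _ (∈ₚ.∈-cartesianProduct⁺ (∈ₚ.∈-allFin c) (∈-tuples u))

  module _ {Y : Set} (Ys : List Y) (R : V → Y → Bool) (K : ℕ) where

    degree : Y → ℕ
    degree y = # (allFin n) (λ c → R c y)

    rich : Y → Bool
    rich y = n ≤ᵇ 2 * K * degree y

    -- Those `y` that are not rich contribute less than n/(2K) each, so at most half of the
    -- guaranteed total; the other half comes from rich ones, which contribute at most `n` each.
    rich-dense : 0 < n → n * length Ys ≤ K * ∑ Ys degree → length Ys ≤ 2 * K * # Ys rich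
    rich-dense 0<n h = *-cancelˡ-≤ n {{>-nonZero 0<n}} (+-cancelʳ-≤ (n * length Ys) _ _ (begin
      n * length Ys + n * length Ys                     ≡⟨ lem₁ (n * length Ys) ⟩
      2 * (n * length Ys)                               ≤⟨ *-monoʳ-≤ 2 h ⟩
      2 * (K * ∑ Ys degree)                             ≡⟨ sym (*-assoc 2 K _) ⟩
      2 * K * ∑ Ys degree                               ≡⟨ sym (∑-*ˡ Ys (2 * K) degree) ⟩
      ∑ Ys (λ y → 2 * K * degree y)                     ≤⟨ ∑-mono Ys pt ⟩
      ∑ Ys (λ y → n * (2 * K) * 𝟙 (rich y) + n)         ≡⟨ ∑-+ Ys _ _ ⟩
      ∑ Ys (λ y → n * (2 * K) * 𝟙 (rich y)) + ∑ Ys (λ _ → n)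
        ≡⟨ cong₂ _+_ (trans (∑-*ˡ Ys (n * (2 * K)) _) (*-assoc n (2 * K) _)) (trans (∑-const Ys n) (*-comm _ n)) ⟩
      n * (2 * K * # Ys rich) + n * length Ys           ∎))
      where
      open ≤-Reasoning
      lem₁ : ∀ x → x + x ≡ 2 * x
      lem₁ = solve-∀
      pt : ∀ y → 2 * K * degree y ≤ n * (2 * K) * 𝟙 (rich y) + n
      pt y with rich y in e
      ... | true  = ≤-trans (*-monoʳ-≤ (2 * K) (≤-trans (#-≤length (allFin n) _) (≤-reflexive length-allFin)))
                      (≤-trans (≤-reflexive (trans (*-comm (2 * K) n) (sym (*-identityʳ _)))) (m≤m+n _ n))
      ... | false = ≤-trans (<⇒≤ (≰⇒> λ le → subst T e (≤⇒≤ᵇ le))) (m≤n+m n _)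

    Rich : (Y → Bool) → Set
    Rich q = ∀ y → q y ≡ true → n ≤ 2 * K * degree y

    common : List V → Y → Bool
    common cs y = BoolL.all (λ c → R c y) cs

    popular : ∀ q cs → 0 < n → Rich q → 4 * K * length cs ≤ n → 0 < # Ys q →
      ∃ λ c → c ∉ cs × # Ys q ≤ 4 * K * # Ys (λ y → q y ∧ R c y)
    popular q cs 0<n rq small pos with averaging (allFin n) f (4 * K) (# Ys q) (subst (0 <_) (sym length-allFin) 0<n) le
      where
      f : V → ℕ
      f c = # Ys (λ y → q y ∧ (R c y ∧ not (c ∈ᵇ cs)))
      pt : ∀ y → n * 𝟙 (q y) ≤ 4 * K * ∑ (allFin n) (λ c → 𝟙 (q y ∧ (R c y ∧ not (c ∈ᵇ cs))))
      pt y with q y in e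
      ... | false = ≤-trans (≤-reflexive (*-zeroʳ n)) z≤n
      ... | true  = +-cancelˡ-≤ n _ _ (begin
          n + n * 1                               ≡⟨ lem n ⟩
          2 * n                                   ≤⟨ *-monoʳ-≤ 2 (rq y e) ⟩
          2 * (2 * K * degree y)                  ≤⟨ *-monoʳ-≤ 2 (*-monoʳ-≤ (2 * K) (#-avoid (allFin n) cs (λ c → R c y) (Uniqueₚ.allFin⁺ n))) ⟩
          2 * (2 * K * (length cs + X))           ≡⟨ lem₂ K (length cs) X ⟩
          4 * K * length cs + 4 * K * X           ≤⟨ +-monoˡ-≤ _ small ⟩
          n + 4 * K * X                           ∎)
        where
        open ≤-Reasoning
        X = # (allFin n) (λ c → R c y ∧ not (c ∈ᵇ cs))
        lem : ∀ n → n + n * 1 ≡ 2 * n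
        lem = solve-∀
        lem₂ : ∀ K l x → 2 * (2 * K * (l + x)) ≡ 4 * K * l + 4 * K * x
        lem₂ = solve-∀
      le : length (allFin n) * # Ys q ≤ 4 * K * ∑ (allFin n) f
      le = begin
        length (allFin n) * # Ys q      ≡⟨ cong (_* # Ys q) length-allFin ⟩
        n * # Ys q                      ≡⟨ sym (∑-*ˡ Ys n _) ⟩
        ∑ Ys (λ y → n * 𝟙 (q y))        ≤⟨ ∑-mono Ys pt ⟩
        ∑ Ys (λ y → 4 * K * ∑ (allFin n) (λ c → 𝟙 (q y ∧ (R c y ∧ not (c ∈ᵇ cs)))))
          ≡⟨ trans (∑-*ˡ Ys (4 * K) _) (cong (4 * K *_) (sym (∑-swap (allFin n) Ys _))) ⟩
        4 * K * ∑ (allFin n) f          ∎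
        where open ≤-Reasoning
    ... | c , _ , big = c , c∉ , ≤-trans big (*-monoʳ-≤ (4 * K) (#-mono Ys λ y e →
            let e₁ , e₂ = ∧-true⁻ (q y) e in ∧-true⁺ e₁ (proj₁ (∧-true⁻ (R c y) e₂))))
      where
      fpos : 0 < # Ys (λ y → q y ∧ (R c y ∧ not (c ∈ᵇ cs)))
      fpos = n≢0⇒n>0 λ z → <⇒≱ pos (≤-trans big (≤-reflexive (trans (cong (4 * K *_) z) (*-zeroʳ (4 * K)))))
      c∉ : c ∉ cs
      c∉ with #-pos Ys _ fpos
      ... | y , _ , e = not-∈ᵇ⁻ c cs (proj₂ (∧-true⁻ (R c y) (proj₂ (∧-true⁻ (q y) e))))

    commonK : ℕ → ℕ
    commonK M = (4 * K) ^ M * (2 * K)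

    -- A rich `y` has at least n/(2K) neighbours, of which at least half are not among those already
    -- chosen. Averaging therefore finds a new vertex adjacent to a 1/(4K) part of the surviving
    -- `y`, and after `M` rounds a constant proportion survives.
    choose-common : ∀ M → 0 < n → 4 * K * M ≤ n → 0 < length Ys → n * length Ys ≤ K * ∑ Ys degree →
      Σ (List V) λ cs → Unique cs × length cs ≡ M × length Ys ≤ commonK M * # Ys (λ y → rich y ∧ common cs y)
    choose-common zero 0<n _ _ h = [] , [] , refl , ≤-trans (rich-dense 0<n h)
      (≤-reflexive (cong₂ _*_ (sym (*-identityˡ (2 * K))) (∑-cong Ys λ y → cong 𝟙 (sym (Boolₚ.∧-identityʳ (rich y))))))
    choose-common (suc M) 0<n small 0<Y h
      with choose-common M 0<n (≤-trans (*-monoʳ-≤ (4 * K) (n≤1+n M)) small) 0<Y h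
    ... | cs , u , len , dense with popular (λ y → rich y ∧ common cs y) cs 0<n
            (λ y e → ≤ᵇ⇒≤ n _ (≡true⇒T (proj₁ (∧-true⁻ (rich y) e))))
            (≤-trans (*-monoʳ-≤ (4 * K) (≤-trans (≤-reflexive len) (n≤1+n M))) small)
            (n≢0⇒n>0 λ z → <⇒≱ 0<Y (≤-trans dense (≤-reflexive (trans (cong (commonK M *_) z) (*-zeroʳ (commonK M))))))
    ...   | c , c∉ , big = c ∷ cs , All.tabulate (λ {y} y∈ e → c∉ (subst (_∈ cs) (sym e) y∈)) ∷ u , cong suc len ,
            (begin
              length Ys                                             ≤⟨ dense ⟩
              commonK M * # Ys (λ y → rich y ∧ common cs y)         ≤⟨ *-monoʳ-≤ (commonK M) big ⟩
              commonK M * (4 * K * # Ys (λ y → (rich y ∧ common cs y) ∧ R c y))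
                ≡⟨ lem ((4 * K) ^ M) (2 * K) (4 * K) _ ⟩
              commonK (suc M) * # Ys (λ y → (rich y ∧ common cs y) ∧ R c y)
                ≡⟨ cong (commonK (suc M) *_) (∑-cong Ys λ y → cong 𝟙 (lem′ (rich y) (common cs y) (R c y))) ⟩
              commonK (suc M) * # Ys (λ y → rich y ∧ common (c ∷ cs) y) ∎)
      where
      open ≤-Reasoning
      lem : ∀ p k q x → p * k * (q * x) ≡ q * p * k * x
      lem = solve-∀
      lem′ : ∀ a b c → (a ∧ b) ∧ c ≡ a ∧ (c ∧ b)
      lem′ a b c = trans (Boolₚ.∧-assoc a b c) (cong (a ∧_) (Boolₚ.∧-comm b c))

  erdos-box : ∀ d K M (F : Vec V d → Bool) → erdosN d K M ≤ n → n ^ d ≤ K * # (tuples d) F →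
    Σ (Vec (List V) d) λ As → Lengths M As × (∀ u → InBox As u → F u ≡ true)
  erdos-box zero K M F _ h = [] , tt , λ { [] _ → F[] }
    where
    F[] : F [] ≡ true
    F[] with F [] 
    ... | true  = refl
    ... | false = ⊥-elim (<⇒≱ h (≤-reflexive (*-zeroʳ K)))
  erdos-box (suc d) K M F n≥ h
    with choose-common (tuples d) (λ c u → F (c ∷ u)) K M 0<n (<⇒≤ big-n)
           (subst (0 <_) (sym (length-tuples d)) (m^n>0 n {{>-nonZero 0<n}} d))
           (≤-trans (≤-reflexive (cong (n *_) (length-tuples d))) (≤-trans h (≤-reflexive (cong (K *_)
             (trans (∑-tuples d _) (∑-swap (allFin n) (tuples d) _))))))
    where
    big-n : 4 * K * M < n
    big-n = m⊔n≤o⇒m≤o (suc (4 * K * M)) (erdosN d ((4 * K) ^ M * (2 * K)) M) n≥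
    0<n : 0 < n
    0<n = ≤-trans (s≤s z≤n) big-n
  ... | cs , uc , lenc , dense
    with erdos-box d ((4 * K) ^ M * (2 * K)) M (λ u → BoolL.all (λ c → F (c ∷ u)) cs) (m⊔n≤o⇒n≤o (suc (4 * K * M)) (erdosN d ((4 * K) ^ M * (2 * K)) M) n≥)
           (≤-trans (≤-reflexive (sym (length-tuples d))) (≤-trans dense (*-monoʳ-≤ ((4 * K) ^ M * (2 * K)) (#-mono (tuples d) λ u e → proj₂ (∧-true⁻ (rich (tuples d) (λ c u → F (c ∷ u)) K u) e)))))
  ...   | As , lens , inF = cs ∷ As , (uc , lenc , lens) , λ { (x ∷ u) (x∈ , b) → all-true⁻ (λ c → F (c ∷ u)) cs (inF u b) x x∈ }

  opaque
    unfolding denseBound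

    dense-box : ∀ d K M (F : Vec V d → Bool) → denseBound d K M ≤ n → n ^ d ≤ K * # (tuples d) F →
      Σ (Vec (List V) d) λ As → Lengths M As × (∀ u → InBox As u → F u ≡ true)
    dense-box = erdos-box

-- Embeddings into a canonical box

isEven : ℕ → Bool
isEven zero    = true
isEven (suc n) = not (isEven n)

bool-cases : ∀ b → b ≡ true ⊎ b ≡ false
bool-cases true  = inj₁ refl
bool-cases false = inj₂ refl

bit : Bool → ℕ
bit false = 0
bit true  = 1

bit-injective : ∀ {a b} → bit a ≡ bit b → a ≡ b
bit-injective {false} {false} _ = refl
bit-injective {true}  {true}  _ = refl

bit≤1 : ∀ b → bit b ≤ 1
bit≤1 false = z≤n
bit≤1 true  = ≤-refl

-- The coordinates alternate between bit b (at even positions) and 1 − bit b.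
side : Bool → ℕ → ℕ
side b i = bit (if isEven i then b else not b)

side-≢ : ∀ b i j → isEven i ≢ isEven j → side b i ≢ side b j
side-≢ b i j ne e with isEven i | isEven j | bit-injective e
... | true  | true  | _ = ne refl
... | false | false | _ = ne refl
side-≢ true  i j ne e | true | false | ()
side-≢ false i j ne e | true | false | ()
side-≢ true  i j ne e | false | true | ()
side-≢ false i j ne e | false | true | ()

side-≡ : ∀ b i j → isEven i ≡ isEven j → side b i ≡ side b j
side-≡ b i j e rewrite e = refl

side≤1 : ∀ b i → side b i ≤ 1
side≤1 b i = bit≤1 _

not-≢ : ∀ {b} → not b ≢ b
not-≢ {true}  ()
not-≢ {false} ()

mixed-radix-injective : ∀ w i j i′ j′ → j < suc w → j′ < suc w → i * suc w + j ≡ i′ * suc w + j′ → i ≡ i′ × j ≡ j′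
mixed-radix-injective w i j i′ j′ l l′ e =
  trans (sym (quot i j l)) (trans (cong (_/ suc w) e) (quot i′ j′ l′)) ,
  trans (sym (rem i j l)) (trans (cong (_% suc w) e) (rem i′ j′ l′))
  where
  rem : ∀ i j → j < suc w → (i * suc w + j) % suc w ≡ j
  rem i j l = trans (cong (_% suc w) (+-comm (i * suc w) j)) (trans (DivMod.[m+kn]%n≡m%n j i (suc w)) (DivMod.m<n⇒m%n≡m l))
  quot : ∀ i j → j < suc w → (i * suc w + j) / suc w ≡ i
  quot i j l = trans (cong (_/ suc w) (+-comm (i * suc w) j)) (trans (DivMod.+-distrib-/ j (i * suc w)
    (subst (_< suc w) (sym (trans (cong₂ _+_ (DivMod.m<n⇒m%n≡m l) (DivMod.m*n%n≡0 i (suc w))) (+-identityʳ j))) l))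
    (cong₂ _+_ (DivMod.m<n⇒m/n≡0 l) (DivMod.m*n/n≡m i (suc w))))

compAt : List Component → ℕ → Component
compAt []       _       = 0 , true
compAt (q ∷ _)  zero    = q
compAt (_ ∷ qs) (suc κ) = compAt qs κ

compAt-At : ∀ {qs κ q} → At qs κ q → compAt qs κ ≡ q
compAt-At at-zero    = refl
compAt-At (at-suc a) = compAt-At a

next-injective : ∀ q i j → i < proj₁ q → j < proj₁ q → next q i ≡ next q j → i ≡ j
next-injective (ℓ , true)  i j _ _ e = suc-injective e
next-injective (ℓ , false) i j _ _ e with suc i ℕ.≟ ℓ | suc j ℕ.≟ ℓ
... | yes p | yes p′ = suc-injective (trans p (sym p′))
next-injective (ℓ , false) i j _ _ () | yes _ | no _
next-injective (ℓ , false) i j _ _ () | no _ | yes _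
... | no _  | no _ = suc-injective e

oddLast : Component → ℕ → Bool
oddLast (ℓ , true)  i = false
oddLast (ℓ , false) i = not (isEven ℓ) ∧ ⌊ suc i ℕ.≟ ℓ ⌋

oddLast⁻ : ∀ q i → oddLast q i ≡ true → suc i ≡ proj₁ q × isEven i ≡ true × next q i ≡ 0
oddLast⁻ (ℓ , false) i e with ∧-true⁻ (not (isEven ℓ)) e
... | odd , last with ⌊⌋-true⁻ (suc i ℕ.≟ ℓ) last
...   | refl = refl , trans (sym (Boolₚ.not-involutive (isEven i))) odd , next-last (suc i) i refl

next-parity : ∀ q i → i < proj₁ q → (isEven (next q i) ≡ not (isEven i)) ⊎ (oddLast q i ≡ true)
next-parity (ℓ , true)  i _ = inj₁ refl
next-parity (ℓ , false) i lt with suc i ℕ.≟ ℓ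
... | no _ = inj₁ refl
... | yes refl with isEven i
...   | true  = inj₂ refl
...   | false = inj₁ refl

-- The functions of a tuple that are made canonical: its coordinates, its extensions col p, and, for
-- r = 3, the further extensions ext p b s of the pair formed by col p and one coordinate.
data Label : Set where
  proj col : ℕ → Label
  ext      : ℕ → Bool → ℕ → Label

module Embed (r′ t : ℕ) {V : Set} (Cov : List V → Set)
  (mono : ∀ {e f} → (∀ v → v ∈ e → v ∈ f) → Cov f → Cov e) where

  d = 2 + r′

  open Assembly r′ using (w; Valid; Embedding; edgeVerts; family-embedding)

  -- Index vectors are total functions bounded everywhere, although canonicity compares only the
  -- entries below `d`.
  Idx : ℕ → (ℕ → ℕ) → Set
  Idx m ι = ∀ h → ι h < m

  record BoxData (m : ℕ) : Set₁ where
    field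
      2≤m    : 2 ≤ m
      pt      : ℕ → ℕ → V
      eval   : Label → (ℕ → ℕ) → V
      Ok     : Label → Set
      pt-inj  : ∀ h h′ i i′ → h < d → h′ < d → i < m → i′ < m → pt h i ≡ pt h′ i′ → h ≡ h′ × i ≡ i′
      ok-proj : ∀ h → h < d → Ok (proj h)
      ok-col  : ∀ p → p ≤ t → Ok (col p)
      eval-proj : ∀ h ι → h < d → eval (proj h) ι ≡ pt h (ι h)
      canon  : ∀ f g ι κ ι′ κ′ → Ok f → Ok g → Idx m ι → Idx m κ → Idx m ι′ → Idx m κ′ →
        eval f ι ≡ eval g κ → (∀ h → h < d → ι h ≡ κ h → ι′ h ≡ κ′ h) → eval f ι′ ≡ eval g κ′
      col-distinct : ∀ p q ι → Idx m ι → p ≤ t → q ≤ t → p ≢ q → eval (col p) ι ≢ eval (col q) ι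
      col-fresh    : ∀ p h ι → Idx m ι → p ≤ t → h < d → eval (col p) ι ≢ pt h (ι h)
      col-cover    : ∀ p ι → Idx m ι → p ≤ t → Cov (eval (col p) ι ∷ map (λ h → pt h (ι h)) (upTo d))

  module Box {m} (D : BoxData m) (qs : List Component) (qs≥5 : All (λ q → 5 ≤ proj₁ q) qs)
    (L : ℕ) (L-bound : ∀ q → q ∈ qs → proj₁ q ≤ L) (m-bound : 2 + 2 * (length qs * suc L) ≤ m) where

    open BoxData D

    -- An equality at any two tuples carries over to a tuple paired with itself, since that pair
    -- shares every coordinate. One tuple at which two labels differ therefore separates all their
    -- values.
    separate : ∀ f g ι₀ → Ok f → Ok g → Idx m ι₀ → eval f ι₀ ≢ eval g ι₀ →
      ∀ ι κ → Idx m ι → Idx m κ → eval f ι ≢ eval g κ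
    separate f g ι₀ okf okg i₀ ne ι κ iι iκ e = ne (canon f g ι κ ι₀ ι₀ okf okg iι iκ i₀ i₀ e (λ _ _ _ → refl))

    col≢col : ∀ p q ι κ → Idx m ι → Idx m κ → p ≤ t → q ≤ t → p ≢ q → eval (col p) ι ≢ eval (col q) κ
    col≢col p q ι κ iι iκ p≤ q≤ ne = separate (col p) (col q) ι (ok-col p p≤) (ok-col q q≤) iι
      (col-distinct p q ι iι p≤ q≤ ne) ι κ iι iκ

    zeros ones : ℕ → ℕ
    zeros _ = 0
    ones  _ = 1

    keep : ℕ → ℕ → ℕ
    keep h i = if ⌊ i ℕ.≟ h ⌋ then 0 else 1

    idx-zeros : Idx m zeros
    idx-zeros _ = ≤-trans (s≤s z≤n) 2≤m

    idx-ones : Idx m ones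
    idx-ones _ = 2≤m

    idx-keep : ∀ h → Idx m (keep h)
    idx-keep h i with i ℕ.≟ h
    ... | yes _ = ≤-trans (s≤s z≤n) 2≤m
    ... | no _  = 2≤m

    keep-self : ∀ h → keep h h ≡ 0
    keep-self h with h ℕ.≟ h
    ... | yes _ = refl
    ... | no ne = contradiction refl ne

    Constant : Label → Set
    Constant f = eval f zeros ≡ eval f ones

    -- f is a function of the coordinate h alone.
    DependsOn : ℕ → Label → Set
    DependsOn h f = eval f zeros ≡ eval f (keep h)

    constant-const : ∀ f → Ok f → Constant f → ∀ ι κ → Idx m ι → Idx m κ → eval f ι ≡ eval f κ
    constant-const f ok c ι κ iι iκ = canon f f zeros ones ι κ ok ok idx-zeros idx-ones iι iκ c (λ _ _ ())

    -- `zeros` and `ones` agree nowhere, so an equality at any two tuples without a common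
    -- coordinate would carry over to them.
    nonconstant-disjoint : ∀ f → Ok f → ¬ Constant f → ∀ ι κ → Idx m ι → Idx m κ →
      (∀ h → h < d → ι h ≢ κ h) → eval f ι ≢ eval f κ
    nonconstant-disjoint f ok nc ι κ iι iκ dis e =
      nc (canon f f ι κ zeros ones ok ok iι iκ idx-zeros idx-ones e (λ h h< e′ → contradiction e′ (dis h h<)))

    -- `zeros` and `keep k` agree at `k`. Tuples that share no other coordinate agree nowhere else,
    -- so an equality at them would carry over to this pair.
    independent-share : ∀ f k → Ok f → ¬ DependsOn k f → ∀ ι κ → Idx m ι → Idx m κ →
      (∀ h → h < d → ι h ≡ κ h → h ≡ k) → eval f ι ≢ eval f κ
    independent-share f k ok nd ι κ iι iκ sh e =
      nd (canon f f ι κ zeros (keep k) ok ok iι iκ idx-zeros (idx-keep k) e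
           (λ h h< e′ → subst (λ k → 0 ≡ keep k h) (sh h h< e′) (sym (keep-self h))))

    depends-eq : ∀ f k → Ok f → DependsOn k f → ∀ ι κ → Idx m ι → Idx m κ → ι k ≡ κ k → eval f ι ≡ eval f κ
    depends-eq f k ok dp ι κ iι iκ e = canon f f zeros (keep k) ι κ ok ok idx-zeros (idx-keep k) iι iκ dp agree
      where
      agree : ∀ h → h < d → 0 ≡ keep k h → ι h ≡ κ h
      agree h _ z with h ℕ.≟ k
      ... | yes refl = e

    -- The passage from `zeros` to `ones` through `keep 0` preserves coordinate 0 in one step and
    -- coordinate 1 in the other. Consequently a nonconstant label is independent of one of the two,
    -- which is how sides are chosen later.
    depends-both : ∀ f → Ok f → DependsOn 0 f → DependsOn 1 f → Constant f
    depends-both f ok d₀ d₁ = trans (depends-eq f 0 ok d₀ zeros (keep 0) idx-zeros (idx-keep 0) refl)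
      (depends-eq f 1 ok d₁ (keep 0) ones (idx-keep 0) idx-ones refl)

    index : ℕ → ℕ → ℕ
    index κ i = κ * suc L + i

    index-bound : ∀ {κ q i} → At qs κ q → i ≤ L → index κ i < length qs * suc L
    index-bound {κ} {q} {i} at le = begin-strict
      κ * suc L + i       <⟨ +-monoʳ-< (κ * suc L) (s≤s le) ⟩
      κ * suc L + suc L   ≡⟨ +-comm (κ * suc L) (suc L) ⟩
      suc κ * suc L       ≤⟨ *-monoˡ-≤ (suc L) (At⇒< at) ⟩
      length qs * suc L   ∎
      where open ≤-Reasoning

    -- Even positions on a side are reserved for core vertices and odd ones for vertices private to
    -- an edge. The numbering runs through all components, so different components never meet.
    even-index odd-index : ℕ → ℕ → ℕ
    even-index κ i = 2 * index κ i
    odd-index  κ i = suc (2 * index κ i)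

    odd-index< : ∀ {κ q i} → At qs κ q → i ≤ L → odd-index κ i < m
    odd-index< {κ} {q} {i} at le = ≤-trans (s≤s (s≤s (*-monoʳ-≤ 2 (<⇒≤ (index-bound at le))))) m-bound

    even-index< : ∀ {κ q i} → At qs κ q → i ≤ L → even-index κ i < m
    even-index< at le = ≤-trans (n≤1+n _) (odd-index< at le)

    even-index-injective : ∀ κ κ′ i i′ → i ≤ L → i′ ≤ L → even-index κ i ≡ even-index κ′ i′ → κ ≡ κ′ × i ≡ i′
    even-index-injective κ κ′ i i′ l l′ e =
      mixed-radix-injective L κ i κ′ i′ (s≤s l) (s≤s l′) (*-cancelˡ-≡ _ _ 2 e)

    odd-index-injective : ∀ κ κ′ i i′ → i ≤ L → i′ ≤ L → odd-index κ i ≡ odd-index κ′ i′ → κ ≡ κ′ × i ≡ i′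
    odd-index-injective κ κ′ i i′ l l′ e = even-index-injective κ κ′ i i′ l l′ (suc-injective e)

    ℓ≤L : ∀ {κ q} → At qs κ q → proj₁ q ≤ L
    ℓ≤L at = L-bound _ (At⇒∈ at)

    5≤ℓ : ∀ {κ q} → At qs κ q → 5 ≤ proj₁ q
    5≤ℓ at = All.lookup qs≥5 (At⇒∈ at)

    core≤L : ∀ {κ q i} → At qs κ q → i < ncores q → i ≤ L
    core≤L {q = ℓ , true}  at (s≤s lt) = ≤-trans lt (ℓ≤L at)
    core≤L {q = ℓ , false} at lt       = ≤-trans (<⇒≤ lt) (ℓ≤L at)

    edge≤L : ∀ {κ q i} → At qs κ q → i < proj₁ q → i ≤ L
    edge≤L at lt = ≤-trans (<⇒≤ lt) (ℓ≤L at)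

    module Cells (hc : ℕ → ℕ → ℕ) where

      -- The tuple belonging to edge `i`: its two core vertices fix the coordinates assigned to them
      -- by `hc`, and every other coordinate is private to the edge.
      cell : ℕ → ℕ → ℕ → ℕ
      cell κ i h with h ℕ.≟ hc κ i | h ℕ.≟ hc κ (next (compAt qs κ) i)
      ... | yes _ | _     = even-index κ i
      ... | no _  | yes _ = even-index κ (next (compAt qs κ) i)
      ... | no _  | no _  = odd-index κ i

      cell-left : ∀ κ i → cell κ i (hc κ i) ≡ even-index κ i
      cell-left κ i with hc κ i ℕ.≟ hc κ i
      ... | yes _ = refl
      ... | no ne = contradiction refl ne

      cell-right : ∀ κ i → hc κ i ≢ hc κ (next (compAt qs κ) i) →
        cell κ i (hc κ (next (compAt qs κ) i)) ≡ even-index κ (next (compAt qs κ) i)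
      cell-right κ i ne with hc κ (next (compAt qs κ) i) ℕ.≟ hc κ i | hc κ (next (compAt qs κ) i) ℕ.≟ hc κ (next (compAt qs κ) i)
      ... | yes e | _     = contradiction (sym e) ne
      ... | no _  | yes _ = refl
      ... | no _  | no ne′ = contradiction refl ne′

      cell-fresh : ∀ κ i h → h ≢ hc κ i → h ≢ hc κ (next (compAt qs κ) i) → cell κ i h ≡ odd-index κ i
      cell-fresh κ i h ne ne′ with h ℕ.≟ hc κ i | h ℕ.≟ hc κ (next (compAt qs κ) i)
      ... | yes e | _     = contradiction e ne
      ... | no _  | yes e = contradiction e ne′
      ... | no _  | no _  = refl

      next≤L : ∀ {κ q i} → At qs κ q → i < proj₁ q → next (compAt qs κ) i ≤ L
      next≤L {κ} {q} {i} at lt rewrite compAt-At at = core≤L at (next<ncores q i lt)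

      idx-cell : ∀ {κ q i} → At qs κ q → i < proj₁ q → Idx m (cell κ i)
      idx-cell {κ} {q} {i} at lt h with h ℕ.≟ hc κ i | h ℕ.≟ hc κ (next (compAt qs κ) i)
      ... | yes _ | _     = even-index< at (edge≤L at lt)
      ... | no _  | yes _ = even-index< at (next≤L at lt)
      ... | no _  | no _  = odd-index< at (edge≤L at lt)

      Ends : ℕ → ℕ → ℕ → Set
      Ends κ i j = j ≡ i ⊎ j ≡ next (compAt qs κ) i

      cell-cases : ∀ κ i h → (∃ λ j → Ends κ i j × h ≡ hc κ j × cell κ i h ≡ even-index κ j) ⊎ (cell κ i h ≡ odd-index κ i)
      cell-cases κ i h with h ℕ.≟ hc κ i | h ℕ.≟ hc κ (next (compAt qs κ) i)
      ... | yes e | _     = inj₁ (i , inj₁ refl , e , refl)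
      ... | no _  | yes e = inj₁ (_ , inj₂ refl , e , refl)
      ... | no _  | no _  = inj₂ refl

      ends≤L : ∀ {κ q i j} → At qs κ q → i < proj₁ q → Ends κ i j → j ≤ L
      ends≤L at lt (inj₁ refl) = edge≤L at lt
      ends≤L at lt (inj₂ refl) = next≤L at lt

      -- An odd entry identifies its edge and an even entry its core vertex, so tuples of different
      -- edges can agree only at a common end.
      cell-share : ∀ {κ κ′ q q′ i i′} h → At qs κ q → At qs κ′ q′ → i < proj₁ q → i′ < proj₁ q′ →
        cell κ i h ≡ cell κ′ i′ h →
        (κ ≡ κ′ × i ≡ i′) ⊎ (κ ≡ κ′ × ∃ λ j → Ends κ i j × Ends κ′ i′ j × h ≡ hc κ j)
      cell-share {κ} {κ′} {i = i} {i′} h at at′ lt lt′ e with cell-cases κ i h | cell-cases κ′ i′ h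
      ... | inj₂ p | inj₂ p′ = inj₁ (odd-index-injective κ κ′ i i′ (edge≤L at lt) (edge≤L at′ lt′) (trans (sym p) (trans e p′)))
      ... | inj₂ p | inj₁ (j , _ , _ , p′) = ⊥-elim (even≢odd (index κ′ j) (index κ i) (trans (sym p′) (trans (sym e) p)))
      ... | inj₁ (j , _ , _ , p) | inj₂ p′ = ⊥-elim (even≢odd (index κ j) (index κ′ i′) (trans (sym p) (trans e p′)))
      ... | inj₁ (j , en , eh , p) | inj₁ (j′ , en′ , _ , p′)
        with even-index-injective κ κ′ j j′ (ends≤L at lt en) (ends≤L at′ lt′ en′) (trans (sym p) (trans e p′))
      ...   | refl , refl = inj₂ (refl , j , en , en′ , eh)

      InCell : ℕ → ℕ → ℕ → V → Set
      InCell p κ i v = v ≡ eval (col p) (cell κ i) ⊎ (∃ λ h → h < d × v ≡ pt h (cell κ i h))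

      cell-cover : ∀ {κ q i} p e → At qs κ q → i < proj₁ q → p ≤ t → All (InCell p κ i) e → Cov e
      cell-cover {κ} {i = i} p e at lt p≤ all = mono
        (λ v v∈ → [ here , (λ { (h , h< , refl) → there (∈ₚ.∈-map⁺ _ (∈ₚ.∈-upTo⁺ h<)) }) ]′ (All.lookup all v∈))
        (col-cover p (cell κ i) (idx-cell at lt) p≤)

    data Name : Set where
      st : ℕ → ℕ → Name
      cl : Label → (ℕ → ℕ) → Name

    value : Name → V
    value (st h i) = pt h i
    value (cl f ι) = eval f ι

    Clash : Name → Name → Set
    Clash (st h i) (st h′ i′) = h ≡ h′ × i ≡ i′
    Clash (st _ _) (cl _ _)   = Empty
    Clash (cl _ _) (st _ _)   = Empty
    Clash (cl f ι) (cl g κ)   = eval f ι ≡ eval g κ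

    NameOk : Name → Set
    NameOk (st h i) = h < d × i < m
    NameOk (cl f ι) = Ok f × Idx m ι × (∀ h → h < d → eval f ι ≢ pt h (ι h))

    -- A label that avoids the entries of one tuple avoids the whole side of the box: coordinates
    -- are labels themselves, so `separate` applies to the label and a projection. Only clashes
    -- within the same kind of name remain to be excluded.
    value-clash : ∀ x y → NameOk x → NameOk y → value x ≡ value y → Clash x y
    value-clash (st h i) (st h′ i′) (a , b) (a′ , b′) e = pt-inj h h′ i i′ a a′ b b′ e
    value-clash (st h i) (cl f ι) (a , b) (ok , iι , fr) e =
      separate f (proj h) ι ok (ok-proj h a) iι (λ e′ → fr h a (trans e′ (eval-proj h ι a)))
        ι (λ _ → i) iι (λ _ → b) (trans (sym e) (sym (eval-proj h (λ _ → i) a)))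
    value-clash (cl f ι) (st h i) (ok , iι , fr) (a , b) e =
      separate f (proj h) ι ok (ok-proj h a) iι (λ e′ → fr h a (trans e′ (eval-proj h ι a)))
        ι (λ _ → i) iι (λ _ → b) (trans e (sym (eval-proj h (λ _ → i) a)))
    value-clash (cl f ι) (cl g κ) _ _ e = e

    embed-names : (nm : ℕ → Vert → Name) →
      (∀ κ q x → At qs κ q → Valid q x → NameOk (nm κ x)) →
      (∀ κ κ′ q q′ x y → At qs κ q → At qs κ′ q′ → Valid q x → Valid q′ y → Clash (nm κ x) (nm κ′ y) → κ ≡ κ′ × x ≡ y) →
      (∀ κ q i → At qs κ q → i < proj₁ q → Cov (map (λ x → value (nm κ x)) (edgeVerts q i))) →
      Σ (ℕ → V) (Embedding Cov (unionPattern (3 + r′) qs))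
    embed-names nm ok inj cov with family-embedding Cov qs (λ κ x → value (nm κ x))
        (All.map (≤-trans (s≤s (s≤s z≤n))) qs≥5)
        (λ κ κ′ q q′ x y at at′ vx vy e → inj κ κ′ q q′ x y at at′ vx vy
          (value-clash (nm κ x) (nm κ′ y) (ok κ q x at vx) (ok κ′ q′ y at′ vy) e))
        cov (pt 0 0)
    ... | φ , emb , _ = φ , emb

-- Two nonconstant extensions: alternating colours.

module Rainbow (r′ t : ℕ) {V : Set} (Cov : List V → Set)
  (mono : ∀ {e f} → (∀ v → v ∈ e → v ∈ f) → Cov f → Cov e)
  {m} (D : Embed.BoxData r′ t Cov mono m) (qs : List Component) (qs≥5 : All (λ q → 5 ≤ proj₁ q) qs)
  (L : ℕ) (L-bound : ∀ q → q ∈ qs → proj₁ q ≤ L) (m-bound : 2 + 2 * (length qs * suc L) ≤ m)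
  (b : Bool) (e o : ℕ) (e≤ : e ≤ t) (o≤ : o ≤ t) (e≢o : e ≢ o) where

  open Embed r′ t Cov mono
  open BoxData D
  open Box D qs qs≥5 L L-bound m-bound
  open Assembly r′ using (w; Valid; Embedding; edgeVerts)

  -- The last core of an odd cycle stands between an odd core and core 0, which occupy the sides 1
  -- and 0 in some order, hence the value 2.
  hc : ℕ → ℕ → ℕ
  hc κ i = if oddLast (compAt qs κ) i then 2 else side b i

  open Cells hc

  lab : ℕ → ℕ
  lab i = if isEven i then e else o

  lab≤ : ∀ i → lab i ≤ t
  lab≤ i with isEven i
  ... | true  = e≤
  ... | false = o≤

  lab-≢ : ∀ i j → isEven i ≢ isEven j → lab i ≢ lab j
  lab-≢ i j odd x with isEven i | isEven j
  ... | true  | true  = odd refl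
  ... | true  | false = e≢o x
  ... | false | true  = e≢o (sym x)
  ... | false | false = odd refl

  oddLast-zero : ∀ {κ q} → At qs κ q → oddLast q 0 ≡ false
  oddLast-zero {q = q} at with oddLast q 0 in eq
  ... | false = refl
  ... | true  = ⊥-elim (<⇒≢ (≤-trans (s≤s (s≤s z≤n)) (5≤ℓ at)) (proj₁ (oddLast⁻ q 0 eq)))

  side≢2 : ∀ i → side b i ≢ 2
  side≢2 i eq = <⇒≱ (s≤s (side≤1 b i)) (≤-reflexive (sym eq))

  hc-≢ : ∀ {κ q i} → At qs κ q → i < proj₁ q → hc κ i ≢ hc κ (next (compAt qs κ) i)
  hc-≢ {κ} {q} {i} at lt rewrite compAt-At at with oddLast q i in eq | next-parity q i lt
  ... | true | _ rewrite proj₂ (proj₂ (oddLast⁻ q i eq)) | oddLast-zero at = λ x → side≢2 0 (sym x)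
  ... | false | inj₂ ()
  ... | false | inj₁ flip with oddLast q (next q i)
  ...   | true  = side≢2 i
  ...   | false = side-≢ b i (next q i) (λ x → not-≢ (trans (sym flip) (sym x)))

  -- Consecutive edges have opposite parity, except at the closing of an odd cycle: its first and
  -- last edge are both even and meet in core 0, which lies on `side b 0`.
  share : ∀ {κ κ′ q q′ i i′} h → At qs κ q → At qs κ′ q′ → i < proj₁ q → i′ < proj₁ q′ →
    ¬ (κ ≡ κ′ × i ≡ i′) → isEven i ≡ isEven i′ → cell κ i h ≡ cell κ′ i′ h →
    h ≡ side b 0 × (oddLast q i ≡ true ⊎ oddLast q′ i′ ≡ true)
  share {κ} {κ′} {q} {q′} {i} {i′} h at at′ lt lt′ ne par eq with cell-share h at at′ lt lt′ eq
  ... | inj₁ same = contradiction same ne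
  ... | inj₂ (refl , j , en , en′ , eh) with At-unique at at′
  ...   | refl = cases (subst (λ q → j ≡ i ⊎ j ≡ next q i) (compAt-At at) en) (subst (λ q → j ≡ i′ ⊎ j ≡ next q i′) (compAt-At at) en′)
    where
    zero-case : j ≡ 0 → h ≡ side b 0
    zero-case refl = trans eh (cong (λ x → if x then 2 else side b 0)
      (trans (cong (λ q → oddLast q 0) (compAt-At at)) (oddLast-zero at)))
    cases : j ≡ i ⊎ j ≡ next q i → j ≡ i′ ⊎ j ≡ next q i′ → h ≡ side b 0 × (oddLast q i ≡ true ⊎ oddLast q i′ ≡ true)
    cases (inj₁ refl) (inj₁ x) = contradiction (refl , x) ne
    cases (inj₂ x) (inj₂ y) = contradiction (refl , next-injective q i i′ lt lt′ (trans (sym x) y)) ne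
    cases (inj₁ refl) (inj₂ x) with next-parity q i′ lt′
    ... | inj₁ flip = ⊥-elim (not-≢ (trans (sym flip) (trans (cong isEven (sym x)) par)))
    ... | inj₂ last = zero-case (trans x (proj₂ (proj₂ (oddLast⁻ q i′ last)))) , inj₂ last
    cases (inj₂ x) (inj₁ refl) with next-parity q i lt
    ... | inj₁ flip = ⊥-elim (not-≢ (trans (sym flip) (trans (cong isEven (sym x)) (sym par))))
    ... | inj₂ last = zero-case (trans x (proj₂ (proj₂ (oddLast⁻ q i last)))) , inj₁ last

  colour : ℕ → ℕ → V
  colour κ i = eval (col (lab i)) (cell κ i)

  module _ (nce : ¬ Constant (col e)) (nco : ¬ Constant (col o)) where

    nonconst : ∀ i → ¬ Constant (col (lab i))
    nonconst i with isEven i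
    ... | true  = nce
    ... | false = nco

    -- Edges of opposite parity carry separated labels. Edges of equal parity have disjoint tuples
    -- and a nonconstant label, except across the closing of an odd cycle. That exception concerns
    -- even edges only, which is why independence is asked of `e` and not of `o`.
    colour-injective : ∀ {κ κ′ q q′ i i′} → At qs κ q → At qs κ′ q′ → i < proj₁ q → i′ < proj₁ q′ →
      ¬ DependsOn (side b 0) (col e) ⊎ (oddLast q i ≡ false × oddLast q′ i′ ≡ false) →
      colour κ i ≡ colour κ′ i′ → κ ≡ κ′ × i ≡ i′
    colour-injective {κ} {κ′} {q} {q′} {i} {i′} at at′ lt lt′ cond eq
      with (κ ℕ.≟ κ′) ×-dec (i ℕ.≟ i′)
    ... | yes same = same
    ... | no ne with isEven i Boolₚ.≟ isEven i′
    ...   | no odd = ⊥-elim (col≢col (lab i) (lab i′) (cell κ i) (cell κ′ i′) (idx-cell at lt) (idx-cell at′ lt′)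
                      (lab≤ i) (lab≤ i′) (lab-≢ i i′ odd) eq)
    ...   | yes par = ⊥-elim (final cond)
      where
      lab-≡ : lab i′ ≡ lab i
      lab-≡ = cong (λ x → if x then e else o) (sym par)
      eq′ : eval (col (lab i)) (cell κ i) ≡ eval (col (lab i)) (cell κ′ i′)
      eq′ = trans eq (cong (λ l → eval (col l) (cell κ′ i′)) lab-≡)
      ok = ok-col (lab i) (lab≤ i)
      final : ¬ DependsOn (side b 0) (col e) ⊎ (oddLast q i ≡ false × oddLast q′ i′ ≡ false) → Empty
      final (inj₂ (l , l′)) = nonconstant-disjoint (col (lab i)) ok (nonconst i) (cell κ i) (cell κ′ i′)
        (idx-cell at lt) (idx-cell at′ lt′) (λ h _ x → [ (λ y → case trans (sym l) y of λ ()) , (λ y → case trans (sym l′) y of λ ()) ]′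
          (proj₂ (share h at at′ lt lt′ ne par x))) eq′
      final (inj₁ nd) with bool-cases (isEven i)
      ... | inj₁ ev = independent-share (col e) (side b 0) (ok-col e e≤) nd (cell κ i) (cell κ′ i′)
                     (idx-cell at lt) (idx-cell at′ lt′) (λ h _ x → proj₁ (share h at at′ lt lt′ ne par x))
                     (subst (λ l → eval (col l) (cell κ i) ≡ eval (col l) (cell κ′ i′)) (cong (λ x → if x then e else o) ev) eq′)
      ... | inj₂ ev = nonconstant-disjoint (col (lab i)) ok (nonconst i) (cell κ i) (cell κ′ i′)
        (idx-cell at lt) (idx-cell at′ lt′) (λ h _ x → case proj₂ (share h at at′ lt lt′ ne par x) of λ
          { (inj₁ y) → case trans (sym ev) (proj₁ (proj₂ (oddLast⁻ q i y))) of λ ()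
          ; (inj₂ y) → case trans (sym ev) (trans par (proj₁ (proj₂ (oddLast⁻ q′ i′ y)))) of λ () }) eq′

    colour-ok : ∀ {κ q i} → At qs κ q → i < proj₁ q → NameOk (cl (col (lab i)) (cell κ i))
    colour-ok {κ} {q} {i} at lt = ok-col (lab i) (lab≤ i) , idx-cell at lt ,
      λ h h< → col-fresh (lab i) h (cell κ i) (idx-cell at lt) (lab≤ i) h<

    hc≤2 : ∀ κ i → hc κ i ≤ 2
    hc≤2 κ i with oddLast (compAt qs κ) i
    ... | true  = ≤-refl
    ... | false = ≤-trans (side≤1 b i) (s≤s z≤n)

    special : ℕ → ℕ → Bool
    special κ i = oddLast (compAt qs κ) i ∨ oddLast (compAt qs κ) (next (compAt qs κ) i)

    -- The coordinates not taken by the two cores of the edge. If one core sits in coordinate 2, the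
    -- other one is on `side b i` or, for the closing edge, on `side b 0` with `i` even; in both
    -- cases `side b (suc i)` is free.
    other : ℕ → ℕ → ℕ → ℕ
    other κ i zero    = if special κ i then side b (suc i) else 2
    other κ i (suc j) = 3 + j

    other-zero≤2 : ∀ κ i → other κ i zero ≤ 2
    other-zero≤2 κ i with special κ i
    ... | true  = ≤-trans (side≤1 b (suc i)) (s≤s z≤n)
    ... | false = ≤-refl

    other-injective : ∀ κ i j j′ → other κ i j ≡ other κ i j′ → j ≡ j′
    other-injective κ i zero    zero     _ = refl
    other-injective κ i zero    (suc j′) x = ⊥-elim (<⇒≱ (s≤s (s≤s (s≤s z≤n))) (subst (_≤ 2) x (other-zero≤2 κ i)))
    other-injective κ i (suc j) zero     x = ⊥-elim (<⇒≱ (s≤s (s≤s (s≤s z≤n))) (subst (_≤ 2) (sym x) (other-zero≤2 κ i)))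
    other-injective κ i (suc j) (suc j′) x = +-cancelˡ-≡ 2 _ _ x

    side-free : ∀ {κ q i} → At qs κ q → i < proj₁ q → special κ i ≡ true →
      side b (suc i) ≢ hc κ i × side b (suc i) ≢ hc κ (next (compAt qs κ) i)
    side-free {κ} {q} {i} at lt sp rewrite compAt-At at with oddLast q i in eq
    ... | true rewrite proj₂ (proj₂ (oddLast⁻ q i eq)) | oddLast-zero at =
          side≢2 (suc i) , side-≢ b (suc i) 0 (λ x → case trans (sym (cong not (proj₁ (proj₂ (oddLast⁻ q i eq))))) x of λ ())
    ... | false rewrite sp = side-≢ b (suc i) i not-≢ , side≢2 (suc i)

    other-fresh : ∀ {κ q i} j → At qs κ q → i < proj₁ q → cell κ i (other κ i j) ≡ odd-index κ i
    other-fresh {κ} {q} {i} (suc j) at lt = cell-fresh κ i (3 + j)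
      (λ x → <⇒≱ (s≤s (s≤s (s≤s z≤n))) (subst (_≤ 2) (sym x) (hc≤2 κ i)))
      (λ x → <⇒≱ (s≤s (s≤s (s≤s z≤n))) (subst (_≤ 2) (sym x) (hc≤2 κ _)))
    other-fresh {κ} {q} {i} zero at lt with special κ i in sp
    ... | true = cell-fresh κ i (side b (suc i)) (proj₁ (side-free at lt sp)) (proj₂ (side-free at lt sp))
    ... | false = cell-fresh κ i 2 (two i (proj₁ ns)) (two _ (proj₂ ns))
      where
      ns : oddLast (compAt qs κ) i ≡ false × oddLast (compAt qs κ) (next (compAt qs κ) i) ≡ false
      ns with oddLast (compAt qs κ) i
      ... | false = refl , sp
      two : ∀ j → oddLast (compAt qs κ) j ≡ false → 2 ≢ hc κ j
      two j x rewrite x = λ y → side≢2 j (sym y)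

    -- For r ≥ 4 an odd cycle is closed up at a core vertex in the third coordinate.
    module FourUniform (1≤r′ : 1 ≤ r′) (indep : ¬ DependsOn (side b 0) (col e)) where

      nm : ℕ → Vert → Name
      nm κ (core i)        = st (hc κ i) (even-index κ i)
      nm κ (new i zero)    = cl (col (lab i)) (cell κ i)
      nm κ (new i (suc j)) = st (other κ i j) (odd-index κ i)

      hc<d : ∀ κ i → hc κ i < d
      hc<d κ i = s≤s (≤-trans (hc≤2 κ i) (s≤s 1≤r′))

      other<d : ∀ κ i j → j < r′ → other κ i j < d
      other<d κ i zero    lt = s≤s (≤-trans (other-zero≤2 κ i) (s≤s lt))
      other<d κ i (suc j) lt = s≤s (s≤s lt)

      ok : ∀ κ q x → At qs κ q → Valid q x → NameOk (nm κ x)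
      ok κ q (core i) at v = hc<d κ i , even-index< at (core≤L at v)
      ok κ q (new i zero) at (v , _) = colour-ok at v
      ok κ q (new i (suc j)) at (v , s≤s lt) = other<d κ i j lt , odd-index< at (edge≤L at v)

      inj : ∀ κ κ′ q q′ x y → At qs κ q → At qs κ′ q′ → Valid q x → Valid q′ y → Clash (nm κ x) (nm κ′ y) → κ ≡ κ′ × x ≡ y
      inj κ κ′ q q′ (core i) (core j) at at′ v v′ (_ , x) with even-index-injective κ κ′ i j (core≤L at v) (core≤L at′ v′) x
      ... | refl , refl = refl , refl
      inj κ κ′ q q′ (core i) (new j (suc k)) at at′ v v′ (_ , x) = ⊥-elim (even≢odd (index κ i) (index κ′ j) x)
      inj κ κ′ q q′ (new j (suc k)) (core i) at at′ v v′ (_ , x) = ⊥-elim (even≢odd (index κ′ i) (index κ j) (sym x))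
      inj κ κ′ q q′ (new i zero) (new j zero) at at′ (v , _) (v′ , _) x with colour-injective at at′ v v′ (inj₁ indep) x
      ... | refl , refl = refl , refl
      inj κ κ′ q q′ (new i (suc j)) (new i′ (suc j′)) at at′ (v , _) (v′ , _) (y , x)
        with odd-index-injective κ κ′ i i′ (edge≤L at v) (edge≤L at′ v′) x
      ... | refl , refl = refl , cong (new i ∘ suc) (other-injective κ i j j′ y)

      cov : ∀ κ q i → At qs κ q → i < proj₁ q → Cov (map (λ x → value (nm κ x)) (edgeVerts q i))
      cov κ q i at lt = cell-cover (lab i) _ at lt (lab≤ i) (
        inj₂ (hc κ i , hc<d κ i , cong (pt (hc κ i)) (sym (cell-left κ i))) ∷
        inj₂ (hc κ (next q i) , hc<d κ (next q i) , right) ∷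
        Allₚ.map⁺ (Allₚ.map⁺ (All.tabulate λ {j} j∈ → news j (∈ₚ.∈-upTo⁻ j∈))))
        where
        right : pt (hc κ (next q i)) (even-index κ (next q i)) ≡ pt (hc κ (next q i)) (cell κ i (hc κ (next q i)))
        right = cong (pt (hc κ (next q i))) (sym (subst (λ q′ → cell κ i (hc κ (next q′ i)) ≡ even-index κ (next q′ i)) (compAt-At at)
          (cell-right κ i (hc-≢ at lt))))
        news : ∀ j → j < w → value (nm κ (new i j)) ≡ colour κ i ⊎ (∃ λ h → h < d × value (nm κ (new i j)) ≡ pt h (cell κ i h))
        news zero    _        = inj₁ refl
        news (suc j) (s≤s lj) = inj₂ (other κ i j , other<d κ i j lj , cong (pt (other κ i j)) (sym (other-fresh j at lt)))

      embedding : Σ (ℕ → V) (Embedding Cov (unionPattern (3 + r′) qs))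
      embedding = embed-names nm ok inj cov

-- For r = 3 an odd cycle is closed up at the core vertex γ = eval (col o), which depends only on the
-- coordinate side b 1: through {a, γ, b*} and {γ, u₀, z}, where z is a further extension of {γ, u₀}.
module ThreeUniform (t : ℕ) {V : Set} (Cov : List V → Set)
  (mono : ∀ {e f} → (∀ v → v ∈ e → v ∈ f) → Cov f → Cov e)
  {m} (D : Embed.BoxData 0 t Cov mono m) (qs : List Component) (qs≥5 : All (λ q → 5 ≤ proj₁ q) qs)
  (L : ℕ) (L-bound : ∀ q → q ∈ qs → proj₁ q ≤ L) (m-bound : 2 + 2 * (length qs * suc L) ≤ m)
  (b : Bool) (e o : ℕ) (e≤ : e ≤ t) (o≤ : o ≤ t) (e≢o : e ≢ o) where

  open Embed 0 t Cov mono
  open BoxData D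
  open Box D qs qs≥5 L L-bound m-bound
  open Assembly 0 using (w; Valid; Embedding; edgeVerts)
  open Rainbow 0 t Cov mono D qs qs≥5 L L-bound m-bound b e o e≤ o≤ e≢o
  open Cells hc

  record ExtData : Set where
    field
      ok-ext       : ∀ s → s < t → Ok (ext o b s)
      ext-distinct : ∀ s s′ ι → s < t → s′ < t → Idx m ι → s ≢ s′ → eval (ext o b s) ι ≢ eval (ext o b s′) ι
      ext-fresh    : ∀ s h ι → s < t → h < 2 → Idx m ι → eval (ext o b s) ι ≢ pt h (ι h)
      ext≢col      : ∀ s ι → s < t → Idx m ι → eval (ext o b s) ι ≢ eval (col o) ι
      ext-cover    : ∀ s ι → s < t → Idx m ι → Cov (eval (ext o b s) ι ∷ eval (col o) ι ∷ pt (side b 0) (ι (side b 0)) ∷ [])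

  module _ (nce : ¬ Constant (col e)) (nco : ¬ Constant (col o)) (X : ExtData) (dep : DependsOn (side b 1) (col o))
    -- `σ κ` selects the further extension used in component `κ`. Components may share a nonconstant
    -- one, because they evaluate it at disjoint tuples; otherwise they need different ones. `σ-e`
    -- keeps it apart from the colours of even edges.
    (σ : ℕ → ℕ) (σ< : ∀ κ → κ < length qs → σ κ < t)
    (σ-spread : ∀ κ κ′ → κ < length qs → κ′ < length qs → κ ≢ κ′ → σ κ ≢ σ κ′ ⊎ ¬ Constant (ext o b (σ κ)))
    (σ-e : ∀ κ → κ < length qs → eval (ext o b (σ κ)) zeros ≢ eval (col e) zeros) where

    open ExtData X

    data Slot : Set where
      corner fresh coloured extra : ℕ → Slot

    -- At the closing of an odd cycle the edge before the last gives up its colour, which becomes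
    -- the last core. The box vertex thereby left over in that edge becomes its expansion vertex,
    -- and the last edge receives the further extension.
    slot : Component → Vert → Slot
    slot q (core i)  = if oddLast q i then coloured (pred i) else corner i
    slot q (new i _) = if oddLast q i then extra i else if oddLast q (suc i) then fresh i else coloured i

    -- The entry on `side b 1`, on which γ depends, is kept from the edge before the last; the other
    -- entry becomes core 0. Thus γ is also the label of a tuple containing core 0, and the pair
    -- they form has further extensions.
    zcell : ℕ → ℕ → ℕ → ℕ
    zcell κ i h = if ⌊ h ℕ.≟ side b 0 ⌋ then even-index κ 0 else even-index κ (pred i)

    name : ℕ → Slot → Name
    name κ (corner i)   = st (hc κ i) (even-index κ i)
    name κ (fresh i)    = st (side b (suc i)) (odd-index κ i)
    name κ (coloured i) = cl (col (lab i)) (cell κ i)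
    name κ (extra i)    = cl (ext o b (σ κ)) (zcell κ i)

    SlotOk : Component → Slot → Set
    SlotOk q (corner i)   = i < ncores q × oddLast q i ≡ false
    SlotOk q (fresh i)    = i < proj₁ q
    SlotOk q (coloured i) = i < proj₁ q × oddLast q i ≡ false
    SlotOk q (extra i)    = i < proj₁ q × oddLast q i ≡ true

    oddLast-pred : ∀ q i → oddLast q i ≡ true → pred i < proj₁ q × (0 < i → oddLast q (pred i) ≡ false)
    oddLast-pred q i l = ≤-trans (s≤s pred[n]≤n) (≤-reflexive (proj₁ (oddLast⁻ q i l))) , go i l
      where
      go : ∀ i → oddLast q i ≡ true → 0 < i → oddLast q (pred i) ≡ false
      go (suc i) l _ with bool-cases (oddLast q i)
      ... | inj₂ f = f
      ... | inj₁ l′ = ⊥-elim (1+n≢n (trans (proj₁ (oddLast⁻ q (suc i) l)) (sym (proj₁ (oddLast⁻ q i l′)))))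

    oddLast-pos : ∀ {κ q} i → At qs κ q → oddLast q i ≡ true → 0 < i
    oddLast-pos zero    at l = ⊥-elim (case trans (sym l) (oddLast-zero at) of λ ())
    oddLast-pos (suc i) at l = s≤s z≤n

    slot-ok : ∀ {κ q} x → At qs κ q → Valid q x → SlotOk q (slot q x)
    slot-ok {κ} {q} (core i) at v with bool-cases (oddLast q i)
    ... | inj₁ l rewrite l = proj₁ (oddLast-pred q i l) , proj₂ (oddLast-pred q i l) (oddLast-pos i at l)
    ... | inj₂ l rewrite l = v , l
    slot-ok {κ} {q} (new i j) at (v , _) with bool-cases (oddLast q i)
    ... | inj₁ l rewrite l = v , l
    ... | inj₂ l rewrite l with oddLast q (suc i)
    ...   | true  = v
    ...   | false = v , l

    slot-injective : ∀ {κ q} x y → At qs κ q → Valid q x → Valid q y → slot q x ≡ slot q y → x ≡ y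
    slot-injective {κ} {q} x y at vx vy eq = go x y vx vy eq
      where
      last-unique : ∀ i j → oddLast q i ≡ true → oddLast q j ≡ true → i ≡ j
      last-unique i j l l′ = suc-injective (trans (proj₁ (oddLast⁻ q i l)) (sym (proj₁ (oddLast⁻ q j l′))))
      suc∘pred : ∀ i → 0 < i → suc (pred i) ≡ i
      suc∘pred (suc i) _ = refl
      cn : ∀ i i′ j′ → slot q (core i) ≢ slot q (new i′ j′)
      cn i i′ j′ eq with oddLast q i in l | oddLast q i′ | oddLast q (suc i′) in l″
      cn i i′ j′ refl | true | false | false = case trans (sym l″) (trans (cong (oddLast q) (suc∘pred i (oddLast-pos i at l))) l) of λ ()
      cn i i′ j′ () | true  | true  | _
      cn i i′ j′ () | true  | false | true
      cn i i′ j′ () | false | true  | _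
      cn i i′ j′ () | false | false | true
      cn i i′ j′ () | false | false | false
      go : ∀ x y → Valid q x → Valid q y → slot q x ≡ slot q y → x ≡ y
      go (core i) (core j) _ _ eq with oddLast q i in l | oddLast q j in l′
      ... | true  | true  = cong core (last-unique i j l l′)
      go (core i) (core j) _ _ refl | false | false = refl
      go (core i) (core j) _ _ () | true | false
      go (core i) (core j) _ _ () | false | true
      go (core i) (new i′ j′) _ _ eq = ⊥-elim (cn i i′ j′ eq)
      go (new i′ j′) (core i) _ _ eq = ⊥-elim (cn i i′ j′ (sym eq))
      go (new i zero) (new i′ zero) (_ , _) (_ , _) eq with oddLast q i | oddLast q (suc i) | oddLast q i′ | oddLast q (suc i′)
      go (new i zero) (new .i zero) _ _ refl | true  | _ | true  | _ = refl
      go (new i zero) (new .i zero) _ _ refl | false | true | false | true = refl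
      go (new i zero) (new .i zero) _ _ refl | false | false | false | false = refl
      go (new i zero) (new i′ zero) _ _ () | true | _ | false | true
      go (new i zero) (new i′ zero) _ _ () | true | _ | false | false
      go (new i zero) (new i′ zero) _ _ () | false | true | true | _
      go (new i zero) (new i′ zero) _ _ () | false | false | true | _
      go (new i zero) (new i′ zero) _ _ () | false | true | false | false
      go (new i zero) (new i′ zero) _ _ () | false | false | false | true
      go (new i (suc _)) _ (_ , s≤s ()) _ _
      go _ (new i (suc _)) _ (_ , s≤s ()) _

    hc-regular : ∀ {κ q i} → At qs κ q → oddLast q i ≡ false → hc κ i ≡ side b i
    hc-regular {i = i} at l = cong (λ x → if x then 2 else side b i) (trans (cong (λ q → oddLast q i) (compAt-At at)) l)

    idx-zcell : ∀ {κ q i} → At qs κ q → i < proj₁ q → Idx m (zcell κ i)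
    idx-zcell {i = i} at lt h with h ℕ.≟ side b 0
    ... | yes _ = even-index< at z≤n
    ... | no _  = even-index< at (≤-trans pred[n]≤n (edge≤L at lt))

    name-ok : ∀ {κ q} x → At qs κ q → SlotOk q x → NameOk (name κ x)
    name-ok (corner i) at (v , l) = ≤-trans (s≤s (≤-trans (≤-reflexive (hc-regular at l)) (side≤1 b i))) ≤-refl , even-index< at (core≤L at v)
    name-ok (fresh i) at v = s≤s (side≤1 b (suc i)) , odd-index< at (edge≤L at v)
    name-ok (coloured i) at (v , _) = colour-ok nce nco at v
    name-ok {κ} (extra i) at (v , _) = ok-ext (σ κ) (σ< κ (At⇒< at)) , idx-zcell at v ,
      λ h h< → ext-fresh (σ κ) h (zcell κ i) (σ< κ (At⇒< at)) h< (idx-zcell at v)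

    ext≢colour : ∀ {κ κ′ q q′ i i′} → At qs κ q → At qs κ′ q′ → i < proj₁ q → i′ < proj₁ q′ →
      eval (ext o b (σ κ)) (zcell κ i) ≢ colour κ′ i′
    ext≢colour {κ} {κ′} {i = i} {i′} at at′ lt lt′ = separate (ext o b (σ κ)) (col (lab i′)) zeros
      (ok-ext (σ κ) s<) (ok-col (lab i′) (lab≤ i′)) idx-zeros (ne (isEven i′)) _ _ (idx-zcell at lt) (idx-cell at′ lt′)
      where
      s< = σ< κ (At⇒< at)
      ne : ∀ b′ → eval (ext o b (σ κ)) zeros ≢ eval (col (if b′ then e else o)) zeros
      ne true  = σ-e κ (At⇒< at)
      ne false = ext≢col (σ κ) zeros s< idx-zeros

    zcell-disjoint : ∀ {κ κ′ q q′ i i′} → At qs κ q → At qs κ′ q′ → i < proj₁ q → i′ < proj₁ q′ → κ ≢ κ′ →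
      ∀ h → h < 2 → zcell κ i h ≢ zcell κ′ i′ h
    zcell-disjoint {κ} {κ′} {i = i} {i′} at at′ lt lt′ ne h _ eq with h ℕ.≟ side b 0
    ... | yes _ = ne (proj₁ (even-index-injective κ κ′ 0 0 z≤n z≤n eq))
    ... | no _  = ne (proj₁ (even-index-injective κ κ′ (pred i) (pred i′)
                    (≤-trans pred[n]≤n (edge≤L at lt)) (≤-trans pred[n]≤n (edge≤L at′ lt′)) eq))

    ext-injective : ∀ {κ κ′ q q′ i i′} → At qs κ q → At qs κ′ q′ → i < proj₁ q → i′ < proj₁ q′ →
      eval (ext o b (σ κ)) (zcell κ i) ≡ eval (ext o b (σ κ′)) (zcell κ′ i′) → κ ≡ κ′
    ext-injective {κ} {κ′} {i = i} {i′} at at′ lt lt′ eq with κ ℕ.≟ κ′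
    ... | yes same = same
    ... | no ne with σ κ ℕ.≟ σ κ′
    ...   | no s≢ = ⊥-elim (separate (ext o b (σ κ)) (ext o b (σ κ′)) zeros (ok-ext _ s<) (ok-ext _ s′<) idx-zeros
                      (ext-distinct (σ κ) (σ κ′) zeros s< s′< idx-zeros s≢) _ _ (idx-zcell at lt) (idx-zcell at′ lt′) eq)
      where s<  = σ< κ (At⇒< at)
            s′< = σ< κ′ (At⇒< at′)
    ...   | yes s≡ = ⊥-elim (case σ-spread κ κ′ (At⇒< at) (At⇒< at′) ne of λ
            { (inj₁ s≢) → s≢ s≡
            ; (inj₂ nc) → nonconstant-disjoint (ext o b (σ κ)) (ok-ext _ (σ< κ (At⇒< at))) nc (zcell κ i) (zcell κ′ i′)
                (idx-zcell at lt) (idx-zcell at′ lt′) (zcell-disjoint at at′ lt lt′ ne)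
                (trans eq (cong (λ s → eval (ext o b s) (zcell κ′ i′)) (sym s≡))) })

    name-injective : ∀ {κ κ′ q q′} x y → At qs κ q → At qs κ′ q′ → SlotOk q x → SlotOk q′ y →
      Clash (name κ x) (name κ′ y) → κ ≡ κ′ × x ≡ y
    name-injective {κ} {κ′} (corner i) (corner j) at at′ (v , _) (v′ , _) (_ , x)
      with even-index-injective κ κ′ i j (core≤L at v) (core≤L at′ v′) x
    ... | refl , refl = refl , refl
    name-injective {κ} {κ′} (corner i) (fresh j) at at′ _ _ (_ , x) = ⊥-elim (even≢odd (index κ i) (index κ′ j) x)
    name-injective {κ} {κ′} (fresh i) (corner j) at at′ _ _ (_ , x) = ⊥-elim (even≢odd (index κ′ j) (index κ i) (sym x))
    name-injective {κ} {κ′} (fresh i) (fresh j) at at′ v v′ (_ , x)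
      with odd-index-injective κ κ′ i j (edge≤L at v) (edge≤L at′ v′) x
    ... | refl , refl = refl , refl
    name-injective (coloured i) (coloured j) at at′ (v , l) (v′ , l′) x
      with colour-injective nce nco at at′ v v′ (inj₂ (l , l′)) x
    ... | refl , refl = refl , refl
    name-injective (coloured i) (extra j) at at′ (v , _) (v′ , _) x = ⊥-elim (ext≢colour at′ at v′ v (sym x))
    name-injective (extra j) (coloured i) at at′ (v′ , _) (v , _) x = ⊥-elim (ext≢colour at at′ v′ v x)
    name-injective {q = q} (extra i) (extra j) at at′ (v , l) (v′ , l′) x with ext-injective at at′ v v′ x
    ... | refl with At-unique at at′
    ...   | refl = refl , cong extra (suc-injective (trans (proj₁ (oddLast⁻ q i l)) (sym (proj₁ (oddLast⁻ q j l′)))))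

    left : ∀ {κ q i} → At qs κ q → oddLast q i ≡ false → ∃ λ h → h < d × value (name κ (slot q (core i))) ≡ pt h (cell κ i h)
    left {κ} {q} {i} at l = hc κ i , s≤s (≤-trans (≤-reflexive (hc-regular at l)) (side≤1 b i)) , trans (cong (λ x → value (name κ (if x then coloured (pred i) else corner i))) l) (cong (pt (hc κ i)) (sym (cell-left κ i)))

    nm : ℕ → Vert → Name
    nm κ x = name κ (slot (compAt qs κ) x)

    nm≡ : ∀ {κ q} x → At qs κ q → nm κ x ≡ name κ (slot q x)
    nm≡ {κ} x at = cong (λ q → name κ (slot q x)) (compAt-At at)

    ok : ∀ κ q x → At qs κ q → Valid q x → NameOk (nm κ x)
    ok κ q x at v = subst NameOk (sym (nm≡ x at)) (name-ok (slot q x) at (slot-ok x at v))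

    inj : ∀ κ κ′ q q′ x y → At qs κ q → At qs κ′ q′ → Valid q x → Valid q′ y → Clash (nm κ x) (nm κ′ y) → κ ≡ κ′ × x ≡ y
    inj κ κ′ q q′ x y at at′ vx vy c
      with name-injective (slot q x) (slot q′ y) at at′ (slot-ok x at vx) (slot-ok y at′ vy) (subst₂ Clash (nm≡ x at) (nm≡ y at′) c)
    ... | refl , eq with At-unique at at′
    ...   | refl = refl , slot-injective x y at vx vy eq

    oddLast-next : ∀ q i → i < proj₁ q → oddLast q i ≡ false → oddLast q (next q i) ≡ oddLast q (suc i)
    oddLast-next (ℓ , true)  i lt _ = refl
    oddLast-next (ℓ , false) i lt l with suc i ℕ.≟ ℓ
    ... | no _ = refl
    ... | yes refl with isEven i
    ...   | false = refl
    oddLast-next (ℓ , false) i lt () | yes refl | true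

    next-odd : ∀ q i → 2 ≤ proj₁ q → oddLast q (next q i) ≡ true → next q i ≡ suc i
    next-odd (ℓ , false) i 2≤ l with suc i ℕ.≟ ℓ
    ... | no _ = refl
    ... | yes refl with oddLast⁻ (suc i , false) 0 l
    ...   | refl , _ = case 2≤ of λ { (s≤s ()) }

    cov : ∀ κ q i → At qs κ q → i < proj₁ q →
      Cov (value (name κ (slot q (core i))) ∷ value (name κ (slot q (core (next q i)))) ∷ value (name κ (slot q (new i 0))) ∷ [])
    cov κ q i at lt with bool-cases (oddLast q i)
    ... | inj₁ l =
      mono (λ { v (here x) → there (here (trans x (trans (cong (λ x → value (name κ (if x then coloured (pred i) else corner i))) l) γ≡)))
              ; v (there (here x)) → there (there (here (trans x (trans (cong (λ j → value (name κ (slot q (core j)))) (proj₂ (proj₂ (oddLast⁻ q i l))))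
                  (trans (cong (λ x → value (name κ (if x then coloured 0 else corner 0))) (oddLast-zero at)) u₀≡)))))
              ; v (there (there (here x))) → here (trans x (cong (λ x → value (name κ (if x then extra i else if oddLast q (suc i) then fresh i else coloured i))) l)) })
        (ext-cover (σ κ) (zcell κ i) (σ< κ (At⇒< at)) (idx-zcell at lt))
      where
      even-i = proj₁ (proj₂ (oddLast⁻ q i l))
      odd-pred : ∀ i → 0 < i → isEven i ≡ true → isEven (pred i) ≡ false
      odd-pred (suc i) _ x with isEven i
      ... | false = refl
      odd = odd-pred i (oddLast-pos i at l) even-i
      pred< = proj₁ (oddLast-pred q i l)
      hcp : hc κ (pred i) ≡ side b 1
      hcp = trans (hc-regular at (proj₂ (oddLast-pred q i l) (oddLast-pos i at l))) (side-≡ b (pred i) 1 odd)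
      zc₁ : zcell κ i (side b 1) ≡ even-index κ (pred i)
      zc₁ with side b 1 ℕ.≟ side b 0
      ... | yes x = ⊥-elim (side-≢ b 1 0 (λ ()) x)
      ... | no _  = refl
      zc₀ : zcell κ i (side b 0) ≡ even-index κ 0
      zc₀ with side b 0 ℕ.≟ side b 0
      ... | yes _ = refl
      ... | no ne = contradiction refl ne
      γ≡ : eval (col (lab (pred i))) (cell κ (pred i)) ≡ eval (col o) (zcell κ i)
      γ≡ = trans (cong (λ x → eval (col (if x then e else o)) (cell κ (pred i))) odd)
        (depends-eq (col o) (side b 1) (ok-col o o≤) dep (cell κ (pred i)) (zcell κ i) (idx-cell at pred<) (idx-zcell at lt)
          (trans (subst (λ h → cell κ (pred i) h ≡ even-index κ (pred i)) hcp (cell-left κ (pred i))) (sym zc₁)))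
      u₀≡ : pt (hc κ 0) (even-index κ 0) ≡ pt (side b 0) (zcell κ i (side b 0))
      u₀≡ = cong₂ pt (hc-regular at (oddLast-zero at)) (sym zc₀)
    ... | inj₂ l with bool-cases (oddLast q (next q i))
    ...   | inj₁ l′ = cell-cover (lab i) _ at lt (lab≤ i) (
              inj₂ (left at l) ∷
              inj₁ (trans (cong (λ x → value (name κ (if x then coloured (pred (next q i)) else corner (next q i)))) l′)
                      (cong (λ j → colour κ j) (cong pred next≡))) ∷
              inj₂ (side b (suc i) , s≤s (side≤1 b (suc i)) ,
                trans (cong₂ (λ x y → value (name κ (if x then extra i else if y then fresh i else coloured i))) l (trans (sym (oddLast-next q i lt l)) l′))
                      (cong (pt (side b (suc i))) (sym (cell-fresh κ i (side b (suc i)) free₁ free₂)))) ∷ [])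
      where
      next≡ : next q i ≡ suc i
      next≡ = next-odd q i (≤-trans (s≤s (s≤s z≤n)) (5≤ℓ at)) l′
      free₁ : side b (suc i) ≢ hc κ i
      free₁ x = side-≢ b (suc i) i not-≢ (trans x (hc-regular at l))
      free₂ : side b (suc i) ≢ hc κ (next (compAt qs κ) i)
      free₂ rewrite compAt-At at | l′ = side≢2 (suc i)
    ...   | inj₂ l′ = cell-cover (lab i) _ at lt (lab≤ i) (
              inj₂ (left at l) ∷
              inj₂ (hc κ (next q i) , ≤-trans (s≤s (≤-trans (≤-reflexive (hc-regular at l′)) (side≤1 b (next q i)))) ≤-refl ,
                trans (cong (λ x → value (name κ (if x then coloured (pred (next q i)) else corner (next q i)))) l′)
                  (cong (pt (hc κ (next q i))) (sym (subst (λ q′ → cell κ i (hc κ (next q′ i)) ≡ even-index κ (next q′ i)) (compAt-At at)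
                    (cell-right κ i (hc-≢ at lt)))))) ∷
              inj₁ (cong₂ (λ x y → value (name κ (if x then extra i else if y then fresh i else coloured i))) l (trans (sym (oddLast-next q i lt l)) l′)) ∷ [])

    embedding : Σ (ℕ → V) (Embedding Cov (unionPattern 3 qs))
    embedding = embed-names nm ok inj λ κ q i at lt →
      subst Cov (cong (λ q′ → value (name κ (slot q′ (core i))) ∷ value (name κ (slot q′ (core (next q i)))) ∷ value (name κ (slot q′ (new i 0))) ∷ [])
        (sym (compAt-At at))) (cov κ q i at lt)

-- At most one nonconstant extension: covers by constants.

half-odd : ∀ i → isEven i ≡ false → i ≡ suc (2 * ⌊ i /2⌋)
half-odd (suc zero)    _ = refl
half-odd (suc (suc i)) e = cong (suc ∘ suc) (trans (half-odd i (trans (sym (Boolₚ.not-involutive (isEven i))) e)) (sym (+-suc ⌊ i /2⌋ _)))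

half-odd< : ∀ i ℓ → isEven i ≡ false → i ≤ ℓ → ⌊ i /2⌋ < ⌊ suc ℓ /2⌋
half-odd< i ℓ e le = ≤-trans (≤-reflexive (sym (suc-half i e))) (⌊n/2⌋-mono (s≤s le))
  where
  suc-half : ∀ i → isEven i ≡ false → ⌊ suc i /2⌋ ≡ suc ⌊ i /2⌋
  suc-half (suc zero)    _ = refl
  suc-half (suc (suc i)) e = cong suc (suc-half i (trans (sym (Boolₚ.not-involutive (isEven i))) e))

cover-number : Component → ℕ
cover-number q = ⌊ suc (proj₁ q) /2⌋

-- Start of the block of label numbers belonging to a component. The blocks have total length t + 1
-- and so use the labels 0 to t exactly once.
offset : List Component → ℕ → ℕ
offset []       _       = 0
offset (q ∷ qs) zero    = 0
offset (q ∷ qs) (suc κ) = cover-number q + offset qs κ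

offset-injective : ∀ {qs κ κ′ q q′} x x′ → At qs κ q → At qs κ′ q′ → x < cover-number q → x′ < cover-number q′ →
  offset qs κ + x ≡ offset qs κ′ + x′ → κ ≡ κ′ × x ≡ x′
offset-injective x x′ at-zero at-zero _ _ e = refl , e
offset-injective {q ∷ qs} {κ′ = suc κ} x x′ at-zero (at-suc _) lt _ e =
  ⊥-elim (<⇒≱ lt (≤-trans (m≤m+n _ (offset qs κ + x′)) (≤-reflexive (trans (sym (+-assoc (cover-number q) _ _)) (sym e)))))
offset-injective {q ∷ qs} {suc κ} x x′ (at-suc _) at-zero _ lt e =
  ⊥-elim (<⇒≱ lt (≤-trans (m≤m+n _ (offset qs κ + x)) (≤-reflexive (trans (sym (+-assoc (cover-number q) _ _)) e))))
offset-injective {q ∷ qs} {suc κ} {suc κ′} x x′ (at-suc a) (at-suc a′) lt lt′ e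
  with offset-injective x x′ a a′ lt lt′ (+-cancelˡ-≡ (cover-number q) _ _
         (trans (sym (+-assoc (cover-number q) _ _)) (trans e (+-assoc (cover-number q) _ _))))
... | refl , refl = refl , refl

offset-bound : ∀ {qs κ q} x → At qs κ q → x < cover-number q → offset qs κ + x < sum (map cover-number qs)
offset-bound x at-zero lt = ≤-trans lt (m≤m+n _ _)
offset-bound {q ∷ qs} {suc κ} x (at-suc a) lt = ≤-trans (s≤s (≤-reflexive (+-assoc (cover-number q) _ _)))
  (≤-trans (≤-reflexive (sym (+-suc (cover-number q) _))) (+-monoʳ-≤ (cover-number q) (offset-bound x a lt)))

-- Core vertices at odd positions cover all edges but the last one of an odd cycle. They are mapped to
-- constant labels; if one constant label is missing, the vertex 1 of the first component becomes a
-- vertex of the box and its two edges get their colours from the nonconstant label lb 0.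
module Crosscut (r′ t : ℕ) {V : Set} (Cov : List V → Set)
  (mono : ∀ {e f} → (∀ v → v ∈ e → v ∈ f) → Cov f → Cov e)
  {m} (D : Embed.BoxData r′ t Cov mono m) (qs : List Component) (qs≥5 : All (λ q → 5 ≤ proj₁ q) qs)
  (L : ℕ) (L-bound : ∀ q → q ∈ qs → proj₁ q ≤ L) (m-bound : 2 + 2 * (length qs * suc L) ≤ m)
  (total : sum (map cover-number qs) ≡ suc t)
  (lb : ℕ → ℕ) (lb≤ : ∀ p → p ≤ t → lb p ≤ t) (lb-inj : ∀ p p′ → p ≤ t → p′ ≤ t → lb p ≡ lb p′ → p ≡ p′)
  (b sp : Bool) where

  open Embed r′ t Cov mono
  open BoxData D
  open Box D qs qs≥5 L L-bound m-bound
  open Assembly r′ using (w; Valid; Embedding; edgeVerts)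

  row column : ℕ
  row    = bit (not b)
  column = bit b

  row≢column : row ≢ column
  row≢column e = not-≢ (bit-injective e)

  module _ (const : ∀ p → p ≤ t → (p ≡ 0 → sp ≡ false) → Constant (col (lb p)))
    (indep : sp ≡ true → ¬ DependsOn row (col (lb 0))) where

    specialCore specialEdge : ℕ → ℕ → Bool
    specialCore κ i = sp ∧ (⌊ κ ℕ.≟ 0 ⌋ ∧ ⌊ i ℕ.≟ 1 ⌋)
    specialEdge κ i = sp ∧ (⌊ κ ℕ.≟ 0 ⌋ ∧ ⌊ i ≤? 1 ⌋)

    specialCore⁻ : ∀ κ i → specialCore κ i ≡ true → sp ≡ true × κ ≡ 0 × i ≡ 1
    specialCore⁻ κ i e = let e₁ , e₂ = ∧-true⁻ sp e ; e₃ , e₄ = ∧-true⁻ ⌊ κ ℕ.≟ 0 ⌋ e₂ in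
      e₁ , ⌊⌋-true⁻ (κ ℕ.≟ 0) e₃ , ⌊⌋-true⁻ (i ℕ.≟ 1) e₄

    specialEdge⁻ : ∀ κ i → specialEdge κ i ≡ true → sp ≡ true × κ ≡ 0 × i ≤ 1
    specialEdge⁻ κ i e = let e₁ , e₂ = ∧-true⁻ sp e ; e₃ , e₄ = ∧-true⁻ ⌊ κ ℕ.≟ 0 ⌋ e₂ in
      e₁ , ⌊⌋-true⁻ (κ ℕ.≟ 0) e₃ , ⌊⌋-true⁻ (i ≤? 1) e₄

    specialEdge⁺ : ∀ κ i → sp ≡ true → κ ≡ 0 → i ≤ 1 → specialEdge κ i ≡ true
    specialEdge⁺ κ i e₁ e₂ e₃ = ∧-true⁺ e₁ (∧-true⁺ (⌊⌋-true⁺ (κ ℕ.≟ 0) e₂) (⌊⌋-true⁺ (i ≤? 1) e₃))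

    inBox : ℕ → ℕ → Bool
    inBox κ i = isEven i ∨ specialCore κ i

    -- The value `d` is out of range on purpose: a centre is the value of a constant label and
    -- occupies no coordinate. The last core of an odd cycle is even, like core 0 to which it is
    -- joined, so it moves to `row`.
    hc : ℕ → ℕ → ℕ
    hc κ i = if isEven i then (if oddLast (compAt qs κ) i then row else column)
             else (if specialCore κ i then row else d)

    open Cells hc

    free : ℕ → ℕ → ℕ
    free κ i = if isEven i then row else (if oddLast (compAt qs κ) (next (compAt qs κ) i) then column else row)

    centre-index : ℕ → ℕ → ℕ
    centre-index κ i = offset qs κ + ⌊ i /2⌋

    data Slot : Set where
      corner centre coloured : ℕ → Slot
      fresh : ℕ → ℕ → Slot

    slot : ℕ → Component → Vert → Slot
    slot κ q (core i)        = if inBox κ i then corner i else centre i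
    -- The closing edge of an odd cycle has two even ends. It is covered by one more centre,
    -- numbered like a core ℓ, which serves as its expansion vertex.
    slot κ q (new i zero)    = if oddLast q i then centre (suc i) else if specialEdge κ i then coloured i else fresh i 0
    slot κ q (new i (suc j)) = fresh i (suc j)

    coordinate : ℕ → ℕ → ℕ → ℕ
    coordinate κ i zero    = free κ i
    coordinate κ i (suc j) = 2 + j

    name : ℕ → Slot → Name
    name κ (corner i)   = st (hc κ i) (even-index κ i)
    name κ (centre i)   = cl (col (lb (centre-index κ i))) zeros
    name κ (coloured i) = cl (col (lb 0)) (cell κ i)
    name κ (fresh i j)  = st (coordinate κ i j) (odd-index κ i)

    SlotOk : ℕ → Component → Slot → Set
    SlotOk κ q (corner i)   = i < ncores q × inBox κ i ≡ true
    SlotOk κ q (centre i)   = i ≤ proj₁ q × isEven i ≡ false × specialCore κ i ≡ false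
    SlotOk κ q (coloured i) = i < proj₁ q × specialEdge κ i ≡ true
    SlotOk κ q (fresh i j)  = i < proj₁ q × j < w

    ncores≤ : ∀ q i → i < ncores q → i ≤ proj₁ q
    ncores≤ (ℓ , true)  i lt = ≤-pred lt
    ncores≤ (ℓ , false) i lt = <⇒≤ lt

    ∨-false⁻ : ∀ a {c} → a ∨ c ≡ false → a ≡ false × c ≡ false
    ∨-false⁻ false e = refl , e

    slot-ok : ∀ {κ q} x → At qs κ q → Valid q x → SlotOk κ q (slot κ q x)
    slot-ok {κ} {q} (core i) at v with bool-cases (inBox κ i)
    ... | inj₁ l rewrite l = v , l
    ... | inj₂ l rewrite l = ncores≤ q i v , ∨-false⁻ (isEven i) l
    slot-ok {κ} {q} (new i zero) at (v , j<) with bool-cases (oddLast q i)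
    ... | inj₁ l rewrite l = v , cong not (proj₁ (proj₂ (oddLast⁻ q i l))) , not-special
      where
      not-special : specialCore κ (suc i) ≡ false
      not-special with bool-cases (specialCore κ (suc i))
      ... | inj₂ f = f
      ... | inj₁ s with specialCore⁻ κ (suc i) s
      ...   | _ , _ , refl = ⊥-elim (<⇒≢ (≤-trans (s≤s (s≤s z≤n)) (5≤ℓ at)) (proj₁ (oddLast⁻ q i l)))
    ... | inj₂ l rewrite l with bool-cases (specialEdge κ i)
    ...   | inj₁ s rewrite s = v , s
    ...   | inj₂ s rewrite s = v , j<
    slot-ok (new i (suc j)) at v = v

    slot-injective : ∀ {κ q} x y → At qs κ q → Valid q x → Valid q y → slot κ q x ≡ slot κ q y → x ≡ y
    slot-injective {κ} {q} x y at vx vy eq = go x y vx vy eq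
      where
      cn : ∀ i i′ j′ → i < ncores q → slot κ q (core i) ≢ slot κ q (new i′ j′)
      cn i i′ zero v eq with inBox κ i | oddLast q i′ in l | specialEdge κ i′
      cn i i′ zero v refl | false | true | _ = ends q (proj₁ (oddLast⁻ q i′ l)) v l
        where
        ends : ∀ q → suc i′ ≡ proj₁ q → suc i′ < ncores q → oddLast q i′ ≡ true → Empty
        ends (ℓ , false) refl lt _ = <-irrefl refl lt
      cn i i′ zero v () | true  | true  | _
      cn i i′ zero v () | true  | false | true
      cn i i′ zero v () | true  | false | false
      cn i i′ zero v () | false | false | true
      cn i i′ zero v () | false | false | false
      cn i i′ (suc j′) v eq with inBox κ i
      cn i i′ (suc j′) v () | true
      cn i i′ (suc j′) v () | false
      zs : ∀ i i′ j → slot κ q (new i zero) ≢ slot κ q (new i′ (suc j))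
      zs i i′ j eq with oddLast q i | specialEdge κ i
      zs i i′ j () | true  | _
      zs i i′ j () | false | true
      zs i i′ j () | false | false
      go : ∀ x y → Valid q x → Valid q y → slot κ q x ≡ slot κ q y → x ≡ y
      go (core i) (core j) _ _ eq with inBox κ i | inBox κ j
      go (core i) (core j) _ _ refl | true  | true  = refl
      go (core i) (core j) _ _ refl | false | false = refl
      go (core i) (core j) _ _ () | true  | false
      go (core i) (core j) _ _ () | false | true
      go (core i) (new i′ j′) v _ eq = ⊥-elim (cn i i′ j′ v eq)
      go (new i′ j′) (core i) _ v eq = ⊥-elim (cn i i′ j′ v (sym eq))
      go (new i zero) (new i′ (suc j)) _ _ eq = ⊥-elim (zs i i′ j eq)
      go (new i′ (suc j)) (new i zero) _ _ eq = ⊥-elim (zs i i′ j (sym eq))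
      go (new i (suc j)) (new i′ (suc j′)) _ _ refl = refl
      go (new i zero) (new i′ zero) _ _ eq with oddLast q i | specialEdge κ i | oddLast q i′ | specialEdge κ i′
      go (new i zero) (new i′ zero) _ _ refl | true  | _ | true  | _ = refl
      go (new i zero) (new i′ zero) _ _ refl | false | true | false | true = refl
      go (new i zero) (new i′ zero) _ _ refl | false | false | false | false = refl
      go (new i zero) (new i′ zero) _ _ () | true | _ | false | true
      go (new i zero) (new i′ zero) _ _ () | true | _ | false | false
      go (new i zero) (new i′ zero) _ _ () | false | true | true | _
      go (new i zero) (new i′ zero) _ _ () | false | false | true | _
      go (new i zero) (new i′ zero) _ _ () | false | true | false | false
      go (new i zero) (new i′ zero) _ _ () | false | false | false | true

    free≤1 : ∀ κ i → free κ i ≤ 1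
    free≤1 κ i with isEven i | oddLast (compAt qs κ) (next (compAt qs κ) i)
    ... | true  | _     = bit≤1 (not b)
    ... | false | true  = bit≤1 b
    ... | false | false = bit≤1 (not b)

    coordinate<d : ∀ κ i j → j < w → coordinate κ i j < d
    coordinate<d κ i zero    _        = s≤s (≤-trans (free≤1 κ i) (s≤s z≤n))
    coordinate<d κ i (suc j) (s≤s lt) = s≤s (s≤s lt)

    coordinate-injective : ∀ κ i j j′ → coordinate κ i j ≡ coordinate κ i j′ → j ≡ j′
    coordinate-injective κ i zero    zero     _ = refl
    coordinate-injective κ i zero    (suc j′) e = ⊥-elim (<⇒≱ (s≤s (s≤s z≤n)) (subst (_≤ 1) e (free≤1 κ i)))
    coordinate-injective κ i (suc j) zero     e = ⊥-elim (<⇒≱ (s≤s (s≤s z≤n)) (subst (_≤ 1) (sym e) (free≤1 κ i)))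
    coordinate-injective κ i (suc j) (suc j′) e = cong suc (+-cancelˡ-≡ 2 _ _ e)

    hc-box : ∀ κ i → inBox κ i ≡ true → hc κ i ≤ 1
    hc-box κ i e with isEven i | oddLast (compAt qs κ) i | specialCore κ i
    ... | true  | true  | _     = bit≤1 (not b)
    ... | true  | false | _     = bit≤1 b
    ... | false | _     | true  = bit≤1 (not b)
    hc-box κ i () | false | _ | false

    hc-centre : ∀ κ i → inBox κ i ≡ false → hc κ i ≡ d
    hc-centre κ i e with isEven i | specialCore κ i
    hc-centre κ i () | true  | _
    hc-centre κ i () | false | true
    ... | false | false = refl

    centre≤t : ∀ {κ q} i → At qs κ q → SlotOk κ q (centre i) → centre-index κ i ≤ t
    centre≤t {κ} {q} i at (le , odd , _) = ≤-pred (subst (centre-index κ i <_) total (offset-bound ⌊ i /2⌋ at (half-odd< i (proj₁ q) odd le)))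

    centre-injective : ∀ {κ κ′ q q′} i j → At qs κ q → At qs κ′ q′ → i ≤ proj₁ q → isEven i ≡ false → j ≤ proj₁ q′ → isEven j ≡ false →
      centre-index κ i ≡ centre-index κ′ j → κ ≡ κ′ × i ≡ j
    centre-injective {q = q} {q′} i j at at′ le odd le′ odd′ e
      with offset-injective ⌊ i /2⌋ ⌊ j /2⌋ at at′ (half-odd< i (proj₁ q) odd le) (half-odd< j (proj₁ q′) odd′ le′) e
    ... | eκ , eh = eκ , trans (half-odd i odd) (trans (cong (suc ∘ (2 *_)) eh) (sym (half-odd j odd′)))

    zero-special : ∀ {κ q} i → At qs κ q → SlotOk κ q (centre i) → centre-index κ i ≡ 0 → sp ≡ false
    zero-special {κ} {q} i at (le , odd , ns) e with zero-at at
      where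
      zero-at : ∀ {qs κ q} → At qs κ q → ∃ λ q₀ → At qs 0 q₀
      zero-at at-zero    = _ , at-zero
      zero-at (at-suc _) = _ , at-zero
    ... | q₀ , at₀ with centre-injective i 1 at at₀ le odd (≤-trans (s≤s z≤n) (5≤ℓ at₀)) refl (trans e (sym (zero-offset qs at₀)))
      where
      zero-offset : ∀ qs {q₀} → At qs 0 q₀ → offset qs 0 + 0 ≡ 0
      zero-offset (_ ∷ _) at-zero = refl
    ...   | refl , refl = trans (sym (Boolₚ.∧-identityʳ sp)) ns

    centre-const : ∀ {κ q} i → At qs κ q → SlotOk κ q (centre i) → ∀ ι → Idx m ι →
      eval (col (lb (centre-index κ i))) zeros ≡ eval (col (lb (centre-index κ i))) ι
    centre-const {κ} i at ok ι iι = constant-const (col (lb (centre-index κ i)))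
      (ok-col _ (lb≤ _ (centre≤t i at ok))) (const _ (centre≤t i at ok) (zero-special i at ok)) zeros ι idx-zeros iι

    name-ok : ∀ {κ q} x → At qs κ q → SlotOk κ q x → NameOk (name κ x)
    name-ok {κ} (corner i) at (v , l) = s≤s (≤-trans (hc-box κ i l) (s≤s z≤n)) , even-index< at (core≤L at v)
    name-ok {κ} (centre i) at ok = ok-col _ p≤ , idx-zeros , λ h h< → col-fresh _ h zeros idx-zeros p≤ h<
      where p≤ = lb≤ _ (centre≤t i at ok)
    name-ok {κ} (coloured i) at (v , _) = ok-col _ (lb≤ 0 z≤n) , idx-cell at v , λ h h< → col-fresh _ h (cell κ i) (idx-cell at v) (lb≤ 0 z≤n) h<
    name-ok {κ} (fresh i j) at (v , l) = coordinate<d κ i j l , odd-index< at (edge≤L at v)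

    next-small : ∀ {κ q} i → At qs κ q → suc i < proj₁ q → next (compAt qs κ) i ≡ suc i
    next-small {κ} {q} i at lt = trans (cong (λ q → next q i) (compAt-At at)) (go q lt)
      where
      go : ∀ q → suc i < proj₁ q → next q i ≡ suc i
      go (ℓ , true)  _  = refl
      go (ℓ , false) lt = next-inner ℓ i lt

    special-share : ∀ h {q} → At qs 0 q → sp ≡ true → cell 0 0 h ≡ cell 0 1 h → h ≡ row
    special-share h {q} at s e with cell-share h at at (≤-trans (s≤s z≤n) (5≤ℓ at)) (≤-trans (s≤s (s≤s z≤n)) (5≤ℓ at)) e
    ... | inj₁ (_ , ())
    ... | inj₂ (_ , j , en , en′ , eh) = trans eh (trans (cong (hc 0) (common en en′)) (cong (λ x → if x ∧ true then row else d) s))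
      where
      common : Ends 0 0 j → Ends 0 1 j → j ≡ 1
      common _ (inj₁ x) = x
      common (inj₂ x) _ = trans x (next-small 0 at (≤-trans (s≤s (s≤s z≤n)) (5≤ℓ at)))
      common (inj₁ refl) (inj₂ x) = case trans x (next-small 1 at (≤-trans (s≤s (s≤s (s≤s z≤n))) (5≤ℓ at))) of λ ()

    -- Edges 0 and 1 meet only in core 1, which lies in `row`; a label that is not a function of
    -- that coordinate alone distinguishes their tuples.
    coloured-injective : ∀ {q} i j → At qs 0 q → sp ≡ true → i ≤ 1 → j ≤ 1 →
      eval (col (lb 0)) (cell 0 i) ≡ eval (col (lb 0)) (cell 0 j) → i ≡ j
    coloured-injective zero zero _ _ _ _ _ = refl
    coloured-injective (suc zero) (suc zero) _ _ _ _ _ = refl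
    coloured-injective (suc (suc _)) _ _ _ (s≤s ())
    coloured-injective zero (suc (suc _)) _ _ _ (s≤s ())
    coloured-injective (suc zero) (suc (suc _)) _ _ _ (s≤s ())
    coloured-injective {q} zero (suc zero) at s _ _ e = ⊥-elim (independent-share (col (lb 0)) row (ok-col _ (lb≤ 0 z≤n)) (indep s)
      (cell 0 0) (cell 0 1) (idx-cell at (≤-trans (s≤s z≤n) (5≤ℓ at))) (idx-cell at (≤-trans (s≤s (s≤s z≤n)) (5≤ℓ at)))
      (λ h _ x → special-share h at s x) e)
    coloured-injective (suc zero) zero at s a c e = sym (coloured-injective zero (suc zero) at s c a (sym e))

    centre≢coloured : ∀ {κ κ′ q q′} i j → At qs κ q → At qs κ′ q′ → SlotOk κ q (centre i) → SlotOk κ′ q′ (coloured j) →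
      eval (col (lb (centre-index κ i))) zeros ≢ eval (col (lb 0)) (cell κ′ j)
    centre≢coloured {κ} {κ′} i j at at′ ok (v , s) = col≢col _ _ zeros (cell κ′ j) idx-zeros (idx-cell at′ v)
      (lb≤ _ (centre≤t i at ok)) (lb≤ 0 z≤n)
      (λ e → case trans (sym (zero-special i at ok (lb-inj _ _ (centre≤t i at ok) z≤n e))) (proj₁ (specialEdge⁻ κ′ j s)) of λ ())

    name-injective : ∀ {κ κ′ q q′} x y → At qs κ q → At qs κ′ q′ → SlotOk κ q x → SlotOk κ′ q′ y →
      Clash (name κ x) (name κ′ y) → κ ≡ κ′ × x ≡ y
    name-injective {κ} {κ′} (corner i) (corner j) at at′ (v , _) (v′ , _) (_ , x)
      with even-index-injective κ κ′ i j (core≤L at v) (core≤L at′ v′) x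
    ... | refl , refl = refl , refl
    name-injective {κ} {κ′} (corner i) (fresh j _) at at′ _ _ (_ , x) = ⊥-elim (even≢odd (index κ i) (index κ′ j) x)
    name-injective {κ} {κ′} (fresh i _) (corner j) at at′ _ _ (_ , x) = ⊥-elim (even≢odd (index κ′ j) (index κ i) (sym x))
    name-injective {κ} {κ′} (fresh i j) (fresh i′ j′) at at′ (v , _) (v′ , _) (y , x)
      with odd-index-injective κ κ′ i i′ (edge≤L at v) (edge≤L at′ v′) x
    ... | refl , refl = refl , cong (fresh i) (coordinate-injective κ i j j′ y)
    name-injective {κ} {κ′} (centre i) (centre j) at at′ ok@(le , odd , _) ok′@(le′ , odd′ , _) x
      with centre-index κ i ℕ.≟ centre-index κ′ j
    ... | no ne = ⊥-elim (col≢col _ _ zeros zeros idx-zeros idx-zeros (lb≤ _ (centre≤t i at ok)) (lb≤ _ (centre≤t j at′ ok′))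
            (λ e → ne (lb-inj _ _ (centre≤t i at ok) (centre≤t j at′ ok′) e)) x)
    ... | yes e with centre-injective i j at at′ le odd le′ odd′ e
    ...   | refl , refl = refl , refl
    name-injective (centre i) (coloured j) at at′ ok ok′ x = ⊥-elim (centre≢coloured i j at at′ ok ok′ x)
    name-injective (coloured j) (centre i) at at′ ok ok′ x = ⊥-elim (centre≢coloured i j at′ at ok′ ok (sym x))
    name-injective {κ} {κ′} (coloured i) (coloured j) at at′ (_ , s) (_ , s′) x
      with specialEdge⁻ κ i s | specialEdge⁻ κ′ j s′
    ... | e , refl , i≤ | _ , refl , j≤ = refl , cong coloured (coloured-injective i j at e i≤ j≤ x)

    ∨-true⁺ˡ : ∀ {a} c → a ≡ true → a ∨ c ≡ true
    ∨-true⁺ˡ _ refl = refl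

    d≢small : ∀ {h} → h ≤ 1 → h ≢ d
    d≢small le refl = <⇒≱ (s≤s (s≤s z≤n)) le

    fresh-in : ∀ {κ q i} j → At qs κ q → (∀ h → h ≡ hc κ i ⊎ h ≡ hc κ (next q i) → h ≡ row ⊎ h ≡ column ⊎ h ≡ d) →
      free κ i ≢ hc κ i → free κ i ≢ hc κ (next q i) → j < w → cell κ i (coordinate κ i j) ≡ odd-index κ i
    fresh-in {κ} {q} {i} j at sides f₁ f₂ lt rewrite sym (compAt-At at) = go j lt
      where
      big : ∀ h → h ≡ row ⊎ h ≡ column ⊎ h ≡ d → ∀ j → j < r′ → 2 + j ≢ h
      big h (inj₁ refl) j _ e = <⇒≱ (s≤s (s≤s z≤n)) (subst (_≤ 1) (sym e) (bit≤1 (not b)))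
      big h (inj₂ (inj₁ refl)) j _ e = <⇒≱ (s≤s (s≤s z≤n)) (subst (_≤ 1) (sym e) (bit≤1 b))
      big h (inj₂ (inj₂ refl)) j lt e = <⇒≢ lt (+-cancelˡ-≡ 2 _ _ e)
      go : ∀ j → j < w → cell κ i (coordinate κ i j) ≡ odd-index κ i
      go zero    _        = cell-fresh κ i (free κ i) f₁ f₂
      go (suc j) (s≤s lt) = cell-fresh κ i (2 + j) (big _ (sides _ (inj₁ refl)) j lt) (big _ (sides _ (inj₂ refl)) j lt)

    hc-range : ∀ κ i → hc κ i ≡ row ⊎ hc κ i ≡ column ⊎ hc κ i ≡ d
    hc-range κ i with isEven i | oddLast (compAt qs κ) i | specialCore κ i
    ... | true  | true  | _     = inj₁ refl
    ... | true  | false | _     = inj₂ (inj₁ refl)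
    ... | false | _     | true  = inj₁ refl
    ... | false | _     | false = inj₂ (inj₂ refl)

    sides : ∀ κ i j h → h ≡ hc κ i ⊎ h ≡ hc κ j → h ≡ row ⊎ h ≡ column ⊎ h ≡ d
    sides κ i j h (inj₁ refl) = hc-range κ i
    sides κ i j h (inj₂ refl) = hc-range κ j

    cov-edge : ∀ {κ q i} p → At qs κ q → i < proj₁ q → p ≤ t → hc κ i ≢ hc κ (next q i) →
      InCell p κ i (value (name κ (slot κ q (core i)))) → InCell p κ i (value (name κ (slot κ q (core (next q i))))) →
      InCell p κ i (value (name κ (slot κ q (new i zero)))) →
      (∀ j → suc j < w → cell κ i (2 + j) ≡ odd-index κ i) →
      Cov (map (λ x → value (name κ (slot κ q x))) (edgeVerts q i))
    cov-edge {κ} {q} {i} p at lt p≤ ne left right first rest = cell-cover p _ at lt p≤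
      (left ∷ right ∷ Allₚ.map⁺ (Allₚ.map⁺ (All.tabulate λ {j} j∈ → news j (∈ₚ.∈-upTo⁻ j∈))))
      where
      news : ∀ j → j < w → InCell p κ i (value (name κ (slot κ q (new i j))))
      news zero    _  = first
      news (suc j) lt@(s≤s l) = inj₂ (2 + j , s≤s (s≤s l) , cong (pt (2 + j)) (sym (rest j lt)))

    corner-left : ∀ {κ q i} p → inBox κ i ≡ true → InCell p κ i (value (name κ (slot κ q (core i))))
    corner-left {κ} {q} {i} p l = inj₂ (hc κ i , s≤s (≤-trans (hc-box κ i l) (s≤s z≤n)) ,
      trans (cong (λ x → value (name κ (if x then corner i else centre i))) l) (cong (pt (hc κ i)) (sym (cell-left κ i))))

    corner-right : ∀ {κ q i} p → At qs κ q → inBox κ (next q i) ≡ true → hc κ i ≢ hc κ (next q i) →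
      InCell p κ i (value (name κ (slot κ q (core (next q i)))))
    corner-right {κ} {q} {i} p at l ne = inj₂ (hc κ (next q i) , s≤s (≤-trans (hc-box κ _ l) (s≤s z≤n)) ,
      trans (cong (λ x → value (name κ (if x then corner (next q i) else centre (next q i)))) l)
        (cong (pt (hc κ (next q i))) (sym (subst (λ q → hc κ i ≢ hc κ (next q i) → cell κ i (hc κ (next q i)) ≡ even-index κ (next q i)) (compAt-At at)
          (cell-right κ i) ne))))

    centre-in : ∀ {κ q i} j → At qs κ q → i < proj₁ q → inBox κ j ≡ false → SlotOk κ q (centre j) →
      InCell (lb (centre-index κ j)) κ i (value (name κ (slot κ q (core j))))
    centre-in {κ} {q} {i} j at lt l ok = inj₁ (trans (cong (λ x → value (name κ (if x then corner j else centre j))) l)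
      (centre-const j at ok (cell κ i) (idx-cell at lt)))

    slot-new-fresh : ∀ κ q i → oddLast q i ≡ false → specialEdge κ i ≡ false → slot κ q (new i zero) ≡ fresh i 0
    slot-new-fresh κ q i l s rewrite l | s = refl

    fresh-zero : ∀ {κ q i} p → At qs κ q → oddLast q i ≡ false → specialEdge κ i ≡ false →
      cell κ i (free κ i) ≡ odd-index κ i → InCell p κ i (value (name κ (slot κ q (new i zero))))
    fresh-zero {κ} {q} {i} p at l s e = inj₂ (free κ i , s≤s (≤-trans (free≤1 κ i) (s≤s z≤n)) ,
      trans (cong (value ∘ name κ) (slot-new-fresh κ q i l s)) (cong (pt (free κ i)) (sym e)))

    hc-even : ∀ {κ q} i → At qs κ q → isEven i ≡ true → hc κ i ≡ (if oddLast q i then row else column)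
    hc-even {κ} {q} i at e = trans (cong (λ x → if x then (if oddLast (compAt qs κ) i then row else column) else (if specialCore κ i then row else d)) e)
      (cong (λ q → if oddLast q i then row else column) (compAt-At at))

    free-even : ∀ κ i → isEven i ≡ true → free κ i ≡ row
    free-even κ i e rewrite e = refl

    free-odd : ∀ {κ q} i → At qs κ q → isEven i ≡ false → free κ i ≡ (if oddLast q (next q i) then column else row)
    free-odd {κ} i at e = trans (cong (λ x → if x then row else (if oddLast (compAt qs κ) (next (compAt qs κ) i) then column else row)) e)
      (cong (λ q → if oddLast q (next q i) then column else row) (compAt-At at))

    inBox-even : ∀ κ i → isEven i ≡ true → inBox κ i ≡ true
    inBox-even κ i e = ∨-true⁺ˡ (specialCore κ i) e

    next-one : ∀ q i → next q i ≡ 1 → i ≡ 0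
    next-one (ℓ , true)  i e = suc-injective e
    next-one (ℓ , false) i e with suc i ℕ.≟ ℓ
    next-one (ℓ , false) i () | yes _
    ... | no _ = suc-injective e

    regular-even : ∀ {κ q i} → At qs κ q → i < proj₁ q → oddLast q i ≡ false → specialEdge κ i ≡ false → isEven i ≡ true →
      Cov (map (λ x → value (name κ (slot κ q x))) (edgeVerts q i))
    regular-even {κ} {q} {i} at lt l s ev with next-parity q i lt
    ... | inj₂ l′ = case trans (sym l) l′ of λ ()
    ... | inj₁ flip = cov-edge (lb (centre-index κ (next q i))) at lt (lb≤ _ (centre≤t (next q i) at ok)) ne
            (corner-left {κ} {q} {i} _ (inBox-even κ i ev)) (centre-in (next q i) at lt out ok)
            (fresh-zero _ at l s (fi 0 (s≤s z≤n))) (λ j → fi (suc j))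
      where
      ns : specialCore κ (next q i) ≡ false
      ns with bool-cases (specialCore κ (next q i))
      ... | inj₂ f = f
      ... | inj₁ c with specialCore⁻ κ (next q i) c
      ...   | e₁ , e₂ , e₃ = case trans (sym (specialEdge⁺ κ i e₁ e₂ (≤-trans (≤-reflexive (next-one q i e₃)) z≤n))) s of λ ()
      odd : isEven (next q i) ≡ false
      odd = trans flip (cong not ev)
      ok : SlotOk κ q (centre (next q i))
      ok = ncores≤ q _ (next<ncores q i lt) , odd , ns
      out : inBox κ (next q i) ≡ false
      out = trans (cong (_∨ specialCore κ (next q i)) odd) ns
      hi : hc κ i ≡ column
      hi = trans (hc-even i at ev) (cong (λ x → if x then row else column) l)
      ne : hc κ i ≢ hc κ (next q i)
      ne e = d≢small (bit≤1 b) (trans (sym hi) (trans e (hc-centre κ _ out)))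
      fi = λ j → fresh-in {κ} {q} {i} j at (sides κ i (next q i))
        (λ e → row≢column (trans (sym (free-even κ i ev)) (trans e hi)))
        (λ e → d≢small (bit≤1 (not b)) (trans (sym (free-even κ i ev)) (trans e (hc-centre κ _ out))))

    regular-odd : ∀ {κ q i} → At qs κ q → i < proj₁ q → oddLast q i ≡ false → specialEdge κ i ≡ false → isEven i ≡ false →
      Cov (map (λ x → value (name κ (slot κ q x))) (edgeVerts q i))
    regular-odd {κ} {q} {i} at lt l s od with next-parity q i lt
    ... | inj₂ l′ = case trans (sym l) l′ of λ ()
    ... | inj₁ flip = cov-edge (lb (centre-index κ i)) at lt (lb≤ _ (centre≤t i at ok)) ne
            (centre-in i at lt out ok) (corner-right _ at (inBox-even κ (next q i) even) ne)
            (fresh-zero _ at l s (fi 0 (s≤s z≤n))) (λ j → fi (suc j))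
      where
      ns : specialCore κ i ≡ false
      ns with bool-cases (specialCore κ i)
      ... | inj₂ f = f
      ... | inj₁ c with specialCore⁻ κ i c
      ...   | e₁ , e₂ , e₃ = case trans (sym (specialEdge⁺ κ i e₁ e₂ (≤-reflexive e₃))) s of λ ()
      even : isEven (next q i) ≡ true
      even = trans flip (cong not od)
      ok : SlotOk κ q (centre i)
      ok = <⇒≤ lt , od , ns
      out : inBox κ i ≡ false
      out = trans (cong (_∨ specialCore κ i) od) ns
      ne : hc κ i ≢ hc κ (next q i)
      ne e = d≢small (hc-box κ (next q i) (inBox-even κ (next q i) even)) (trans (sym e) (hc-centre κ i out))
      free≢ : free κ i ≢ hc κ (next q i)
      free≢ e with trans (sym (free-odd i at od)) (trans e (hc-even (next q i) at even))
      ... | e′ with oddLast q (next q i)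
      ...   | true  = row≢column (sym e′)
      ...   | false = row≢column e′
      fi = λ j → fresh-in {κ} {q} {i} j at (sides κ i (next q i))
        (λ e → d≢small (free≤1 κ i) (trans e (hc-centre κ i out))) free≢

    special-cov : ∀ {κ q i} → At qs κ q → i < proj₁ q → oddLast q i ≡ false → specialEdge κ i ≡ true →
      Cov (map (λ x → value (name κ (slot κ q x))) (edgeVerts q i))
    special-cov {κ} {q} {i} at lt l s = cov-edge (lb 0) at lt (lb≤ 0 z≤n) (proj₂ (proj₂ (ends i i≤))) (corner-left {κ} {q} {i} _ (proj₁ (ends i i≤)))
        (corner-right _ at (proj₁ (proj₂ (ends i i≤))) (proj₂ (proj₂ (ends i i≤))))
        (inj₁ (cong (value ∘ name κ) slot≡)) rest
      where
      sp≡ = proj₁ (specialEdge⁻ κ i s)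
      κ≡ = proj₁ (proj₂ (specialEdge⁻ κ i s))
      i≤ = proj₂ (proj₂ (specialEdge⁻ κ i s))
      slot≡ : slot κ q (new i zero) ≡ coloured i
      slot≡ rewrite l | s = refl
      core₁ : specialCore κ 1 ≡ true
      core₁ = ∧-true⁺ sp≡ (∧-true⁺ (⌊⌋-true⁺ (κ ℕ.≟ 0) κ≡) refl)
      hc₁ : hc κ 1 ≡ row
      hc₁ = cong (λ x → if x then row else d) core₁
      next≡ : ∀ i → suc i < proj₁ q → next q i ≡ suc i
      next≡ i lt = trans (cong (λ q → next q i) (sym (compAt-At at))) (next-small i at lt)
      hc₀ : ∀ i → isEven i ≡ true → i ≤ 2 → hc κ i ≡ column
      hc₀ i ev le = trans (hc-even i at ev) (cong (λ x → if x then row else column) no-last)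
        where
        no-last : oddLast q i ≡ false
        no-last with bool-cases (oddLast q i)
        ... | inj₂ f = f
        ... | inj₁ x = ⊥-elim (<⇒≱ (s≤s (s≤s le)) (≤-trans (≤-trans (n≤1+n 4) (5≤ℓ at)) (≤-reflexive (sym (proj₁ (oddLast⁻ q i x))))))
      ends : ∀ i → i ≤ 1 → inBox κ i ≡ true × inBox κ (next q i) ≡ true × hc κ i ≢ hc κ (next q i)
      ends zero _ rewrite next≡ 0 (≤-trans (s≤s (s≤s z≤n)) (5≤ℓ at)) =
        refl , core₁ , λ e → row≢column (sym (trans (sym (hc₀ 0 refl z≤n)) (trans e hc₁)))
      ends (suc zero) _ rewrite next≡ 1 (≤-trans (s≤s (s≤s (s≤s z≤n))) (5≤ℓ at)) =
        core₁ , refl , λ e → row≢column (trans (sym hc₁) (trans e (hc₀ 2 refl ≤-refl)))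
      ends (suc (suc _)) (s≤s ())
      rest : ∀ j → suc j < w → cell κ i (2 + j) ≡ odd-index κ i
      rest j lt = cell-fresh κ i (2 + j) (large i (proj₁ (ends i i≤))) (subst (λ q → 2 + j ≢ hc κ (next q i)) (sym (compAt-At at)) (large _ (proj₁ (proj₂ (ends i i≤)))))
        where
        large : ∀ k → inBox κ k ≡ true → 2 + j ≢ hc κ k
        large k l e = <⇒≱ (s≤s (s≤s z≤n)) (subst (_≤ 1) (sym e) (hc-box κ k l))

    last-cov : ∀ {κ q i} → At qs κ q → i < proj₁ q → oddLast q i ≡ true →
      Cov (map (λ x → value (name κ (slot κ q x))) (edgeVerts q i))
    last-cov {κ} {q} {i} at lt l = cov-edge (lb (centre-index κ (suc i))) at lt (lb≤ _ (centre≤t (suc i) at ok)) ne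
        (corner-left {κ} {q} {i} _ (inBox-even κ i ev)) (corner-right _ at in₀ ne)
        (inj₁ (trans (cong (value ∘ name κ) slot≡) (centre-const (suc i) at ok (cell κ i) (idx-cell at lt)))) rest
      where
      ev = proj₁ (proj₂ (oddLast⁻ q i l))
      next≡ = proj₂ (proj₂ (oddLast⁻ q i l))
      slot≡ : slot κ q (new i zero) ≡ centre (suc i)
      slot≡ = cong (λ x → if x then centre (suc i) else (if specialEdge κ i then coloured i else fresh i 0)) l
      ok : SlotOk κ q (centre (suc i))
      ok = subst (SlotOk κ q) slot≡ (slot-ok (new i zero) at (lt , s≤s z≤n))
      in₀ : inBox κ (next q i) ≡ true
      in₀ = trans (cong (inBox κ) next≡) refl
      no-last : oddLast q 0 ≡ false
      no-last with bool-cases (oddLast q 0)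
      ... | inj₂ f = f
      ... | inj₁ x = ⊥-elim (<⇒≢ (≤-trans (s≤s (s≤s z≤n)) (5≤ℓ at)) (proj₁ (oddLast⁻ q 0 x)))
      ne : hc κ i ≢ hc κ (next q i)
      ne e = row≢column (trans (sym (trans (hc-even i at ev) (cong (λ x → if x then row else column) l)))
        (trans e (trans (cong (hc κ) next≡) (trans (hc-even 0 at refl) (cong (λ x → if x then row else column) no-last)))))
      rest : ∀ j → suc j < w → cell κ i (2 + j) ≡ odd-index κ i
      rest j lt = cell-fresh κ i (2 + j) (large i (inBox-even κ i ev)) (subst (λ q → 2 + j ≢ hc κ (next q i)) (sym (compAt-At at)) (large _ in₀))
        where
        large : ∀ k → inBox κ k ≡ true → 2 + j ≢ hc κ k
        large k l e = <⇒≱ (s≤s (s≤s z≤n)) (subst (_≤ 1) (sym e) (hc-box κ k l))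

    cov : ∀ κ q i → At qs κ q → i < proj₁ q → Cov (map (λ x → value (name κ (slot κ q x))) (edgeVerts q i))
    cov κ q i at lt with bool-cases (oddLast q i)
    ... | inj₁ l = last-cov at lt l
    ... | inj₂ l with bool-cases (specialEdge κ i)
    ...   | inj₁ s = special-cov at lt l s
    ...   | inj₂ s with bool-cases (isEven i)
    ...     | inj₁ ev = regular-even at lt l s ev
    ...     | inj₂ od = regular-odd at lt l s od

    nm : ℕ → Vert → Name
    nm κ x = name κ (slot κ (compAt qs κ) x)

    nm≡ : ∀ {κ q} x → At qs κ q → nm κ x ≡ name κ (slot κ q x)
    nm≡ {κ} x at = cong (λ q → name κ (slot κ q x)) (compAt-At at)

    embedding : Σ (ℕ → V) (Embedding Cov (unionPattern (3 + r′) qs))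
    embedding = embed-names nm
      (λ κ q x at v → subst NameOk (sym (nm≡ x at)) (name-ok (slot κ q x) at (slot-ok x at v)))
      inj
      (λ κ q i at lt → subst Cov (Listₚ.map-cong (λ x → cong value (sym (nm≡ x at))) (edgeVerts q i)) (cov κ q i at lt))
      where
      inj : ∀ κ κ′ q q′ x y → At qs κ q → At qs κ′ q′ → Valid q x → Valid q′ y → Clash (nm κ x) (nm κ′ y) → κ ≡ κ′ × x ≡ y
      inj κ κ′ q q′ x y at at′ vx vy c
        with name-injective (slot κ q x) (slot κ′ q′ y) at at′ (slot-ok x at vx) (slot-ok y at′ vy) (subst₂ Clash (nm≡ x at) (nm≡ y at′) c)
      ... | refl , eq with At-unique at at′
      ...   | refl = refl , slot-injective x y at vx vy eq

-- Distinguishing by the number of nonconstant extensions.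

swap : ℕ → ℕ → ℕ
swap c p with p ℕ.≟ 0 | p ℕ.≟ c
... | yes _ | _     = c
... | no _  | yes _ = 0
... | no _  | no _  = p

swap-zero : ∀ c → swap c 0 ≡ c
swap-zero c = refl

swap≤ : ∀ t c p → c ≤ t → p ≤ t → swap c p ≤ t
swap≤ t c p c≤ p≤ with p ℕ.≟ 0 | p ℕ.≟ c
... | yes _ | _     = c≤
... | no _  | yes _ = z≤n
... | no _  | no _  = p≤

swap-involutive : ∀ c p → swap c (swap c p) ≡ p
swap-involutive c p with p ℕ.≟ 0 | p ℕ.≟ c
swap-involutive c p | yes refl | _ with c ℕ.≟ 0 | c ℕ.≟ c
... | yes refl | _     = refl
... | no _     | yes _ = refl
... | no _     | no ne = contradiction refl ne
swap-involutive c p | no _ | yes refl = refl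
swap-involutive c p | no ne | no ne′ with p ℕ.≟ 0 | p ℕ.≟ c
... | yes e | _     = contradiction e ne
... | no _  | yes e = contradiction e ne′
... | no _  | no _  = refl

swap-fixed : ∀ c p → p ≢ 0 → swap c p ≢ c
swap-fixed c p ne e = ne (trans (sym (swap-involutive c p)) (trans (cong (swap c) e) back))
  where
  back : swap c c ≡ 0
  back = trans (cong (swap c) (sym (swap-zero c))) (swap-involutive c 0)

skip : ℕ → ℕ → ℕ
skip c i with i <? c
... | yes _ = i
... | no _  = suc i

skip≢ : ∀ c i → skip c i ≢ c
skip≢ c i e with i <? c
... | yes lt = <⇒≢ lt e
... | no ≮  = ≮ (≤-reflexive e)

skip≤ : ∀ c i → skip c i ≤ suc i
skip≤ c i with i <? c
... | yes _ = n≤1+n i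
... | no _  = ≤-refl

skip-injective : ∀ c i j → skip c i ≡ skip c j → i ≡ j
skip-injective c i j e with i <? c | j <? c
... | yes _  | yes _  = e
... | yes lt | no ≮   = ⊥-elim (≮ (≤-trans (≤-reflexive (sym e)) (<⇒≤ lt)))
... | no ≮   | yes lt = ⊥-elim (≮ (≤-trans (≤-reflexive e) (<⇒≤ lt)))
... | no _   | no _   = suc-injective e

-- Five edges already force cover number ⌊6/2⌋ = 3.
3*length≤cover : ∀ qs → All (λ q → 5 ≤ proj₁ q) qs → 3 * length qs ≤ sum (map cover-number qs)
3*length≤cover []       []       = z≤n
3*length≤cover (q ∷ qs) (p ∷ ps) = ≤-trans (≤-reflexive (*-suc 3 (length qs)))
  (+-mono-≤ (⌊n/2⌋-mono (s≤s p)) (3*length≤cover qs ps))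

module Dispatch (r′ t : ℕ) {V : Set} (_≟ⱽ_ : (x y : V) → Dec (x ≡ y)) (Cov : List V → Set)
  (mono : ∀ {e f} → (∀ v → v ∈ e → v ∈ f) → Cov f → Cov e)
  {m} (D : Embed.BoxData r′ t Cov mono m) (qs : List Component) (qs≥5 : All (λ q → 5 ≤ proj₁ q) qs)
  (L : ℕ) (L-bound : ∀ q → q ∈ qs → proj₁ q ≤ L) (m-bound : 2 + 2 * (length qs * suc L) ≤ m)
  (total : sum (map cover-number qs) ≡ suc t) where

  open Embed r′ t Cov mono
  open BoxData D
  open Box D qs qs≥5 L L-bound m-bound
  open Assembly r′ using (Embedding)

  Goal : Set
  Goal = Σ (ℕ → V) (Embedding Cov (unionPattern (3 + r′) qs))

  constant? : ∀ f → Dec (Constant f)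
  constant? f = eval f zeros ≟ⱽ eval f ones

  depends? : ∀ h f → Dec (DependsOn h f)
  depends? h f = eval f zeros ≟ⱽ eval f (keep h)

  all-constant : (∀ p → p ≤ t → Constant (col p)) → Goal
  all-constant c = Crosscut.embedding r′ t Cov mono D qs qs≥5 L L-bound m-bound total id (λ _ p≤ → p≤) (λ _ _ _ _ e → e) false false
    (λ p p≤ _ → c p p≤) (λ ())

  -- The transposition `swap p` makes the nonconstant label number 0, the one missing centre that
  -- can be replaced. Since the label is nonconstant, it is independent of one of the first two
  -- coordinates, and that one is taken as `row`.
  one-nonconstant : ∀ p → p ≤ t → ¬ Constant (col p) → (∀ p′ → p′ ≤ t → p′ ≢ p → Constant (col p′)) → Goal
  one-nonconstant p p≤ nc c = pick-side (depends? 0 (col p))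
    where
    run : ∀ b → ¬ DependsOn (bit (not b)) (col p) → Goal
    run b nd = Crosscut.embedding r′ t Cov mono D qs qs≥5 L L-bound m-bound total (swap p) (λ p′ → swap≤ t p p′ p≤)
      (λ x y _ _ e → trans (sym (swap-involutive p x)) (trans (cong (swap p) e) (swap-involutive p y))) b true
      (λ p′ p′≤ z → c (swap p p′) (swap≤ t p p′ p≤ p′≤) (swap-fixed p p′ (λ e → case z e of λ ())))
      (λ _ → nd)
    pick-side : Dec (DependsOn 0 (col p)) → Goal
    pick-side (no nd) = run true nd
    pick-side (yes d₀) = run false λ d₁ → nc (depends-both (col p) (ok-col p p≤) d₀ d₁)

  dispatch : (∀ p p′ → p ≤ t → p′ ≤ t → p ≢ p′ → ¬ Constant (col p) → ¬ Constant (col p′) → Goal) → Goal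
  dispatch two with find-or-all (λ p → ¬? (constant? (col p))) (upTo (suc t))
  ... | inj₂ none = all-constant λ p p≤ → dec-stable (constant? (col p)) (none p (∈ₚ.∈-upTo⁺ (s≤s p≤)))
    where
    dec-stable : ∀ {P : Set} → Dec P → ¬ ¬ P → P
    dec-stable (yes p) _ = p
    dec-stable (no ¬p) h = contradiction ¬p h
  ... | inj₁ (p , p∈ , nc) with find-or-all (λ p′ → ¬? (p′ ℕ.≟ p) ×-dec ¬? (constant? (col p′))) (upTo (suc t))
  ...   | inj₁ (p′ , p′∈ , ne , nc′) = two p p′ (≤-pred (∈ₚ.∈-upTo⁻ p∈)) (≤-pred (∈ₚ.∈-upTo⁻ p′∈)) (ne ∘ sym) nc nc′
  ...   | inj₂ none = one-nonconstant p (≤-pred (∈ₚ.∈-upTo⁻ p∈)) nc λ p′ p′≤ ne → decide p′ ne (none p′ (∈ₚ.∈-upTo⁺ (s≤s p′≤)))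
    where
    decide : ∀ p′ → p′ ≢ p → ¬ (p′ ≢ p × ¬ Constant (col p′)) → Constant (col p′)
    decide p′ ne h with constant? (col p′)
    ... | yes c = c
    ... | no nc = contradiction (ne , nc) h

  independent-side : ∀ p → p ≤ t → ¬ Constant (col p) → ∃ λ b → ¬ DependsOn (side b 0) (col p)
  independent-side p p≤ nc with depends? 0 (col p)
  ... | no nd = false , nd
  ... | yes d₀ = true , λ d₁ → nc (depends-both (col p) (ok-col p p≤) d₀ d₁)

  four-uniform : 1 ≤ r′ → Goal
  four-uniform 1≤r′ = dispatch λ e o e≤ o≤ ne nce nco → let b , nd = independent-side e e≤ nce in
    Rainbow.FourUniform.embedding r′ t Cov mono D qs qs≥5 L L-bound m-bound b e o e≤ o≤ ne nce nco 1≤r′ nd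

module Dispatch₃ (t : ℕ) {V : Set} (_≟ⱽ_ : (x y : V) → Dec (x ≡ y)) (Cov : List V → Set)
  (mono : ∀ {e f} → (∀ v → v ∈ e → v ∈ f) → Cov f → Cov e)
  {m} (D : Embed.BoxData 0 t Cov mono m) (qs : List Component) (qs≥5 : All (λ q → 5 ≤ proj₁ q) qs)
  (L : ℕ) (L-bound : ∀ q → q ∈ qs → proj₁ q ≤ L) (m-bound : 2 + 2 * (length qs * suc L) ≤ m)
  (total : sum (map cover-number qs) ≡ suc t) (0<k : 0 < length qs) where

  open Embed 0 t Cov mono
  open BoxData D
  open Box D qs qs≥5 L L-bound m-bound
  open Dispatch 0 t _≟ⱽ_ Cov mono D qs qs≥5 L L-bound m-bound total

  -- As k ≥ 1, k + 2 ≤ 3k ≤ t + 1. So the t further extensions of a pair suffice for k components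
  -- even after one of them is excluded.
  k<t : length qs < t
  k<t = ≤-pred (≤-trans (s≤s (s≤s (≤-trans (m≤m+n (length qs) 0) ≤-refl))) (≤-trans
    (≤-trans (+-mono-≤ 0<k (+-mono-≤ 0<k (≤-reflexive (+-identityʳ (length qs))))) (≤-reflexive (lem (length qs))))
    (≤-trans (3*length≤cover qs qs≥5) (≤-reflexive total))))
    where
    lem : ∀ k → k + (k + k) ≡ 3 * k
    lem = solve-∀

  three-uniform : (∀ p → p ≤ t → DependsOn 0 (col p) ⊎ DependsOn 1 (col p)) →
    (∀ b e o → (e≤ : e ≤ t) (o≤ : o ≤ t) (e≢o : e ≢ o) → ThreeUniform.ExtData t Cov mono D qs qs≥5 L L-bound m-bound b e o e≤ o≤ e≢o) → Goal
  three-uniform dep X = dispatch λ e o e≤ o≤ ne nce nco → run e o e≤ o≤ ne nce nco (dep o o≤)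
    where
    module _ (e o : ℕ) (e≤ : e ≤ t) (o≤ : o ≤ t) (ne : e ≢ o) (nce : ¬ Constant (col e)) (nco : ¬ Constant (col o)) where
      side-run : ∀ b → DependsOn (side b 1) (col o) → Goal
      -- A nonconstant further extension different from `col e` serves all components. Failing that,
      -- the components take different ones; at most one of these can agree with `col e` at `zeros`,
      -- and `skip` leaves it out.
      side-run b dp with find-or-all (λ s → ¬? (eval (ext o b s) zeros ≟ⱽ eval (col e) zeros) ×-dec ¬? (constant? (ext o b s))) (upTo t)
      ... | inj₁ (s , s∈ , s≢e , nc) = ThreeUniform.embedding t Cov mono D qs qs≥5 L L-bound m-bound b e o e≤ o≤ ne nce nco (X b e o e≤ o≤ ne) dp
              (λ _ → s) (λ _ _ → ∈ₚ.∈-upTo⁻ s∈) (λ _ _ _ _ _ → inj₂ nc) (λ _ _ → s≢e)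
      ... | inj₂ none with find-or-all (λ s → eval (ext o b s) zeros ≟ⱽ eval (col e) zeros) (upTo t)
      ...   | inj₁ (s₀ , s₀∈ , e₀) = ThreeUniform.embedding t Cov mono D qs qs≥5 L L-bound m-bound b e o e≤ o≤ ne nce nco (X b e o e≤ o≤ ne) dp
              (skip s₀) (λ κ lt → ≤-trans (s≤s (skip≤ s₀ κ)) (≤-trans (s≤s lt) k<t))
              (λ κ κ′ _ _ κ≢ → inj₁ (λ x → κ≢ (skip-injective s₀ κ κ′ x)))
              (λ κ lt x → ThreeUniform.ExtData.ext-distinct (X b e o e≤ o≤ ne) (skip s₀ κ) s₀ zeros
                (≤-trans (s≤s (skip≤ s₀ κ)) (≤-trans (s≤s lt) k<t)) (∈ₚ.∈-upTo⁻ s₀∈) idx-zeros (skip≢ s₀ κ) (trans x (sym e₀)))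
      ...   | inj₂ never = ThreeUniform.embedding t Cov mono D qs qs≥5 L L-bound m-bound b e o e≤ o≤ ne nce nco (X b e o e≤ o≤ ne) dp
              id (λ κ lt → ≤-trans lt (<⇒≤ k<t)) (λ κ κ′ _ _ κ≢ → inj₁ κ≢)
              (λ κ lt → never κ (∈ₚ.∈-upTo⁺ (≤-trans lt (<⇒≤ k<t))))
      run : DependsOn 0 (col o) ⊎ DependsOn 1 (col o) → Goal
      run (inj₁ d₀) = side-run true d₀
      run (inj₂ d₁) = side-run false d₁

-- From a dense set of covered tuples to a canonical box.

∈-map-upTo : ∀ {A : Set} (f : ℕ → A) m i → i < m → f i ∈ map f (upTo m)
∈-map-upTo f m i lt = ∈ₚ.∈-map⁺ f (∈ₚ.∈-upTo⁺ lt)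

module Extensions {n : ℕ} (v₀ : Fin n) (d t : ℕ) (Cov : List (Fin n) → Set)
  (mono : ∀ {e f} → (∀ v → v ∈ e → v ∈ f) → Cov f → Cov e)
  (extensions : ∀ f → Cov f → Unique f → length f ≡ d →
    Σ (List (Fin n)) λ xs → Unique xs × t < length xs × All (λ x → x ∉ f × Cov (x ∷ f)) xs)
  (F : Vec (Fin n) d → Bool)
  (F-cov : ∀ u → F u ≡ true → Cov (Vec.toList u)) (F-unique : ∀ u → F u ≡ true → Unique (Vec.toList u)) where

  private V = Fin n

  choices : ∀ u → F u ≡ true ⊎ F u ≡ false → List V
  choices u (inj₁ e) = proj₁ (extensions (Vec.toList u) (F-cov u e) (F-unique u e) (Vecₚ.length-toList u))
  choices u (inj₂ _) = []

  colour : ℕ → Vec V d → V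
  colour p u = nth (choices u (bool-cases (F u))) v₀ p

  choices-ok : ∀ u → F u ≡ true → ∀ c → Unique (choices u c) × t < length (choices u c) ×
    All (λ x → x ∉ Vec.toList u × Cov (x ∷ Vec.toList u)) (choices u c)
  choices-ok u _ (inj₁ e) = proj₂ (extensions (Vec.toList u) (F-cov u e) (F-unique u e) (Vecₚ.length-toList u))
  choices-ok u e (inj₂ f) = case trans (sym e) f of λ ()

  colour-distinct : ∀ u p p′ → F u ≡ true → p ≤ t → p′ ≤ t → colour p u ≡ colour p′ u → p ≡ p′
  colour-distinct u p p′ Fu p≤ p′≤ = let un , len , _ = choices-ok u Fu (bool-cases (F u)) in
    nth-injective _ v₀ un p p′ (≤-trans (s≤s p≤) len) (≤-trans (s≤s p′≤) len)

  colour-cover : ∀ u p → F u ≡ true → p ≤ t → colour p u ∉ Vec.toList u × Cov (colour p u ∷ Vec.toList u)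
  colour-cover u p Fu p≤ = let _ , len , all = choices-ok u Fu (bool-cases (F u)) in
    All.lookup all (nth-∈ _ v₀ p (≤-trans (s≤s p≤) len))

module FromBox {n : ℕ} (v₀ : Fin n) (r′ t : ℕ) (Cov : List (Fin n) → Set)
  (mono : ∀ {e f} → (∀ v → v ∈ e → v ∈ f) → Cov f → Cov e) where

  open Boxes n
  open Embed r′ t Cov mono using (BoxData; Idx)

  private
    V = Fin n
    d = 2 + r′

  cellvec : ∀ {d} → Vec (List V) d → (ℕ → ℕ) → Vec V d
  cellvec []       ι = []
  cellvec (A ∷ As) ι = nth A v₀ (ι 0) ∷ cellvec As (ι ∘ suc)

  point : ∀ {d} → Vec (List V) d → ℕ → ℕ → V
  point []       _       _ = v₀
  point (A ∷ As) zero    i = nth A v₀ i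
  point (A ∷ As) (suc h) i = point As h i

  nth-cellvec : ∀ {d} (As : Vec (List V) d) ι h → h < d → nth (Vec.toList (cellvec As ι)) v₀ h ≡ point As h (ι h)
  nth-cellvec (A ∷ As) ι zero    _        = refl
  nth-cellvec (A ∷ As) ι (suc h) (s≤s lt) = nth-cellvec As (ι ∘ suc) h lt

  cellvec-in : ∀ {d} m (As : Vec (List V) d) ι → Lengths m As → (∀ h → ι h < m) → InBox As (cellvec As ι)
  cellvec-in m []       ι _            _  = tt
  cellvec-in m (A ∷ As) ι (u , l , ls) iι = nth-∈ A v₀ (ι 0) (subst (ι 0 <_) (sym l) (iι 0)) , cellvec-in m As (ι ∘ suc) ls (iι ∘ suc)

  cellvec-agree : ∀ {d} m (As : Vec (List V) d) ι κ ι′ κ′ → Lengths m As → (∀ h → ι h < m) → (∀ h → κ h < m) →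
    (∀ h → h < d → ι h ≡ κ h → ι′ h ≡ κ′ h) → Agree (cellvec As ι) (cellvec As κ) (cellvec As ι′) (cellvec As κ′)
  cellvec-agree m []       ι κ ι′ κ′ _ _ _ _ = tt
  cellvec-agree m (A ∷ As) ι κ ι′ κ′ (u , l , ls) iι iκ ag =
    (λ e → cong (nth A v₀) (ag 0 (s≤s z≤n) (nth-injective A v₀ u (ι 0) (κ 0) (subst (ι 0 <_) (sym l) (iι 0)) (subst (κ 0 <_) (sym l) (iκ 0)) e))) ,
    cellvec-agree m As (ι ∘ suc) (κ ∘ suc) (ι′ ∘ suc) (κ′ ∘ suc) ls (iι ∘ suc) (iκ ∘ suc) (λ h lt → ag (suc h) (s≤s lt))

  point-same : ∀ {d} m (As : Vec (List V) d) h i i′ → Lengths m As → h < d → i < m → i′ < m → point As h i ≡ point As h i′ → i ≡ i′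
  point-same m (A ∷ As) zero    i i′ (u , l , _) _ lt lt′ e = nth-injective A v₀ u i i′ (subst (i <_) (sym l) lt) (subst (i′ <_) (sym l) lt′) e
  point-same m (A ∷ As) (suc h) i i′ (_ , _ , ls) (s≤s h<) lt lt′ e = point-same m As h i i′ ls h< lt lt′ e

  module _ (labels : List Label) (labelFun : Label → Vec V d → V)
    (fun-proj : ∀ h u → labelFun (proj h) u ≡ nth (Vec.toList u) v₀ h)
    (in-proj : ∀ h → h < d → proj h ∈ labels) (in-col : ∀ p → p ≤ t → col p ∈ labels)
    (F : Vec V d → Bool) (F-unique : ∀ u → F u ≡ true → Unique (Vec.toList u))
    (distinct : ∀ u p p′ → F u ≡ true → p ≤ t → p′ ≤ t → labelFun (col p) u ≡ labelFun (col p′) u → p ≡ p′)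
    (cover : ∀ u p → F u ≡ true → p ≤ t → labelFun (col p) u ∉ Vec.toList u × Cov (labelFun (col p) u ∷ Vec.toList u))
    (m : ℕ) (2≤m : 2 ≤ m) (As : Vec (List V) d) (lens : Lengths m As) (inF : ∀ u → InBox As u → F u ≡ true)
    (can : CanonicalBox (map labelFun labels) As) where

    cellF : ∀ ι → Idx m ι → F (cellvec As ι) ≡ true
    cellF ι iι = inF _ (cellvec-in m As ι lens iι)

    length-cell : ∀ ι → length (Vec.toList (cellvec As ι)) ≡ d
    length-cell ι = Vecₚ.length-toList (cellvec As ι)

    point-in : ∀ ι h → h < d → point As h (ι h) ∈ Vec.toList (cellvec As ι)
    point-in ι h h< = subst (_∈ Vec.toList (cellvec As ι)) (nth-cellvec As ι h h<)
      (nth-∈ _ v₀ h (subst (h <_) (sym (length-cell ι)) h<))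

    two-indices : ℕ → ℕ → ℕ → ℕ → ℕ
    two-indices h i i′ h′ = if ⌊ h′ ℕ.≟ h ⌋ then i else i′

    -- Points on different sides are entries of a common tuple of the box, made by `two-indices`,
    -- and tuples in `F` have distinct entries. This also shows that the sides are disjoint.
    point-injective : ∀ h h′ i i′ → h < d → h′ < d → i < m → i′ < m → point As h i ≡ point As h′ i′ → h ≡ h′ × i ≡ i′
    point-injective h h′ i i′ h< h′< i< i′< e with h′ ℕ.≟ h
    ... | yes refl = refl , point-same m As h i i′ lens h< i< i′< e
    ... | no ne = ⊥-elim (ne (sym (nth-injective (Vec.toList (cellvec As ι)) v₀ (F-unique _ (cellF ι iι)) h h′
            (subst (h <_) (sym (length-cell ι)) h<) (subst (h′ <_) (sym (length-cell ι)) h′<)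
            (trans (nth-cellvec As ι h h<) (trans (cong (point As h) at-h) (trans e (trans (cong (point As h′) (sym at-h′)) (sym (nth-cellvec As ι h′ h′<)))))))))
      where
      ι = two-indices h i i′
      iι : Idx m ι
      iι x with x ℕ.≟ h
      ... | yes _ = i<
      ... | no _  = i′<
      at-h : ι h ≡ i
      at-h with h ℕ.≟ h
      ... | yes _ = refl
      ... | no x = contradiction refl x
      at-h′ : ι h′ ≡ i′
      at-h′ with h′ ℕ.≟ h
      ... | yes x = contradiction x ne
      ... | no _ = refl

    boxData : BoxData m
    boxData = record
      { 2≤m = 2≤m ; pt = point As ; eval = λ f ι → labelFun f (cellvec As ι) ; Ok = _∈ labels
      ; pt-inj = point-injective
      ; ok-proj = in-proj ; ok-col = in-col
      ; eval-proj = λ h ι h< → trans (fun-proj h _) (nth-cellvec As ι h h<)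
      ; canon = λ f g ι κ ι′ κ′ okf okg iι iκ iι′ iκ′ e ag → can (labelFun f) (labelFun g) _ _ _ _
          (∈ₚ.∈-map⁺ labelFun okf) (∈ₚ.∈-map⁺ labelFun okg)
          (cellvec-in m As ι lens iι) (cellvec-in m As κ lens iκ) (cellvec-in m As ι′ lens iι′) (cellvec-in m As κ′ lens iκ′)
          e (cellvec-agree m As ι κ ι′ κ′ lens iι iκ ag)
      ; col-distinct = λ p p′ ι iι p≤ p′≤ ne e → ne (distinct _ p p′ (cellF ι iι) p≤ p′≤ e)
      ; col-fresh = λ p h ι iι p≤ h< e → proj₁ (cover _ p (cellF ι iι) p≤) (subst (_∈ Vec.toList (cellvec As ι)) (sym e) (point-in ι h h<))
      ; col-cover = λ p ι iι p≤ → mono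
          (λ { v (here e) → here e ; v (there v∈) → there (All.lookup {P = _∈ Vec.toList (cellvec As ι)} (All-map-upTo _ d (λ h h< → point-in ι h h<)) v∈) })
          (proj₂ (cover _ p (cellF ι iι) p≤)) }

maxLength : List Component → ℕ
maxLength []       = 0
maxLength (q ∷ qs) = proj₁ q ⊔ maxLength qs

maxLength-bound : ∀ qs q → q ∈ qs → proj₁ q ≤ maxLength qs
maxLength-bound (q ∷ qs) _ (here refl) = m≤m⊔n _ _
maxLength-bound (q ∷ qs) q′ (there q∈) = ≤-trans (maxLength-bound qs q′ q∈) (m≤n⊔m (proj₁ q) _)

gridSize : List Component → ℕ
gridSize qs = 2 + 2 * (length qs * suc (maxLength qs))

baseLabels : ℕ → ℕ → List Label
baseLabels d t = map proj (upTo d) ++ map col (upTo (suc t))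

length-baseLabels : ∀ d t → length (baseLabels d t) ≡ d + suc t
length-baseLabels d t = trans (Listₚ.length-++ (map proj (upTo d))) (cong₂ _+_
  (trans (Listₚ.length-map proj (upTo d)) (Listₚ.length-upTo d)) (trans (Listₚ.length-map col (upTo (suc t))) (Listₚ.length-upTo (suc t))))

∈-base-proj : ∀ d t h → h < d → proj h ∈ baseLabels d t
∈-base-proj d t h h< = ∈ₚ.∈-++⁺ˡ (∈-map-upTo proj d h h<)

∈-base-col : ∀ d t p → p ≤ t → col p ∈ baseLabels d t
∈-base-col d t p p≤ = ∈ₚ.∈-++⁺ʳ (map proj (upTo d)) (∈-map-upTo col (suc t) p (s≤s p≤))

LongEnough-exact : ∀ {V : Set} (_≟ⱽ_ : (x y : V) → Dec (x ≡ y)) {d} M (As : Vec (List V) d) →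
  Canonical.Lengths _≟ⱽ_ M As → Canonical.LongEnough _≟ⱽ_ M As
LongEnough-exact _≟ⱽ_ M []       _            = tt
LongEnough-exact _≟ⱽ_ M (_ ∷ As) (u , l , ls) = u , ≤-reflexive (sym l) , LongEnough-exact _≟ⱽ_ M As ls

module DenseFour {n : ℕ} (v₀ : Fin n) (r″ t : ℕ) (Cov : List (Fin n) → Set)
  (mono : ∀ {e f} → (∀ v → v ∈ e → v ∈ f) → Cov f → Cov e)
  (extensions : ∀ f → Cov f → Unique f → length f ≡ 3 + r″ →
    Σ (List (Fin n)) λ xs → Unique xs × t < length xs × All (λ x → x ∉ f × Cov (x ∷ f)) xs)
  (F : Vec (Fin n) (3 + r″) → Bool)
  (F-cov : ∀ u → F u ≡ true → Cov (Vec.toList u)) (F-unique : ∀ u → F u ≡ true → Unique (Vec.toList u))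
  (qs : List Component) (qs≥5 : All (λ q → 5 ≤ proj₁ q) qs) (total : sum (map cover-number qs) ≡ suc t) where

  open Boxes n
  open Extensions v₀ (3 + r″) t Cov mono extensions F F-cov F-unique

  private
    V = Fin n
    d = 3 + r″

  labelFun : Label → Vec V d → V
  labelFun (proj h)    u = nth (Vec.toList u) v₀ h
  labelFun (col p)     u = colour p u
  labelFun (ext _ _ _) u = v₀

  dense-embedding : ∀ K → denseBound d K (boxBound d (d + suc t) (gridSize qs)) ≤ n → n ^ d ≤ K * # (tuples d) F →
    Σ (ℕ → V) (Assembly.Embedding (suc r″) Cov (unionPattern (4 + r″) qs))
  dense-embedding K n≥ dense with dense-box d K (boxBound d (d + suc t) (gridSize qs)) F n≥ dense
  ... | As , lens , inF with canonical-box d (d + suc t) (gridSize qs) (map labelFun (baseLabels d t))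
            (trans (Listₚ.length-map labelFun (baseLabels d t)) (length-baseLabels d t)) As (LongEnough-exact Fin._≟_ _ As lens)
  ...   | Bs , sub , lensB , can = Dispatch.four-uniform (suc r″) t Fin._≟_ Cov mono
            (FromBox.boxData v₀ (suc r″) t Cov mono (baseLabels d t) labelFun (λ _ _ → refl)
              (∈-base-proj d t) (∈-base-col d t)
              F F-unique colour-distinct colour-cover (gridSize qs) (s≤s (s≤s z≤n)) Bs lensB (λ u b → inF u (SubBox-In Bs As sub u b)) can)
            qs qs≥5 (maxLength qs) (maxLength-bound qs) ≤-refl total (s≤s z≤n)

-- Loose cycles in 3-graphs

module Chains {V : Set} (v₀ : V) (Cov : List V → Set)
  (mono : ∀ {e f} → (∀ v → v ∈ e → v ∈ f) → Cov f → Cov e) where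

  open Assembly 0 using (Valid; CompEmb; CycleAvoiding)

  -- The vertices of a loose path, listed backwards with the expansion vertices in between.
  data Chain (s : V) : ℕ → List V → Set where
    start : Chain s 0 (s ∷ [])
    step  : ∀ {m v′ R} v γ → Chain s m (v′ ∷ R) → Cov (v ∷ v′ ∷ γ ∷ []) → Chain s (suc m) (v ∷ γ ∷ v′ ∷ R)

  chain-length : ∀ {s m R} → Chain s m R → length R ≡ suc (m + m)
  chain-length start = refl
  chain-length (step {m} v γ c _) = trans (cong (suc ∘ suc) (chain-length c)) (cong suc (cong suc (sym (+-suc m m))))

  chain-last : ∀ {s m R} → Chain s m R → ∀ T → nth (R ++ T) v₀ (m + m) ≡ s
  chain-last start T = refl
  chain-last (step {m} {v′} {R} v γ c _) T = trans (cong (λ i → nth (v ∷ γ ∷ v′ ∷ R ++ T) v₀ (suc i)) (+-suc m m)) (chain-last c T)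

  chain-edge : ∀ {s m R} → Chain s m R → ∀ T i → i < m →
    Cov (nth (R ++ T) v₀ (i + i) ∷ nth (R ++ T) v₀ (suc i + suc i) ∷ nth (R ++ T) v₀ (suc (i + i)) ∷ [])
  chain-edge (step v γ c cv) T zero    _        = cv
  chain-edge (step v γ c cv) T (suc i) (s≤s lt) rewrite +-suc i i | +-suc i (suc i) = chain-edge c T i lt

  double< : ∀ {i m} → i < m → suc (i + i) < m + m
  double< {i} {m} lt = ≤-trans (≤-reflexive (cong suc (sym (+-suc i i)))) (+-mono-≤ lt lt)

  double-injective : ∀ i j → i + i ≡ j + j → i ≡ j
  double-injective zero    zero    _ = refl
  double-injective (suc i) (suc j) e = cong suc (double-injective i j
    (suc-injective (suc-injective (trans (cong suc (sym (+-suc i i))) (trans e (cong suc (+-suc j j)))))))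

  double≢ : ∀ i j → i + i ≢ suc (j + j)
  double≢ i j e = even≢odd i j (trans (cong (i +_) (+-identityʳ i)) (trans e (cong (λ x → suc (j + x)) (sym (+-identityʳ j)))))

  -- With expansion vertices listed between the cores, core `i` is at position 2i and the new vertex
  -- of edge `i` at 2i + 1. Injectivity of the whole cycle is then uniqueness of a single list, to
  -- which `γ` is appended for the closing edge.
  chain⇒cycle : ∀ {s m v R} γ Z → 1 ≤ m → Chain s m (v ∷ R) → Unique (v ∷ R) → γ ∉ v ∷ R → Cov (s ∷ v ∷ γ ∷ []) →
    All (_∉ Z) (v ∷ R) → γ ∉ Z → CycleAvoiding Cov (suc m) Z
  chain⇒cycle {s} {m} {v} {R} γ Z 1≤m c u γ∉ cv avoid γ∉Z = val , record { inj = inj ; cover = cover } , avoid′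
    where
    Us = (v ∷ R) ++ (γ ∷ [])
    uT : Unique Us
    uT = Uniqueₚ.++⁺ u ([] ∷ []) λ { (x∈ , here refl) → γ∉ x∈ }
    lenT : length Us ≡ suc m + suc m
    lenT = trans (Listₚ.length-++ (v ∷ R)) (trans (cong (_+ 1) (chain-length c)) (trans (+-comm _ 1) (cong suc (sym (+-suc m m)))))
    val : Vert → V
    val (core i)  = nth Us v₀ (i + i)
    val (new i _) = nth Us v₀ (suc (i + i))
    bound : ∀ {i} → i < suc m → suc (i + i) < length Us
    bound lt = ≤-trans (double< lt) (≤-reflexive (sym lenT))
    inj : ∀ x y → Valid (suc m , false) x → Valid (suc m , false) y → val x ≡ val y → x ≡ y
    inj (core i) (core j) li lj e = cong core (double-injective i j (nth-injective Us v₀ uT _ _ (<-trans (n<1+n _) (bound li)) (<-trans (n<1+n _) (bound lj)) e))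
    inj (core i) (new j _) li (lj , _) e = ⊥-elim (double≢ i j (nth-injective Us v₀ uT _ _ (<-trans (n<1+n _) (bound li)) (bound lj) e))
    inj (new j _) (core i) (lj , _) li e = ⊥-elim (double≢ i j (nth-injective Us v₀ uT _ _ (<-trans (n<1+n _) (bound li)) (bound lj) (sym e)))
    inj (new i zero) (new j zero) (li , _) (lj , _) e =
      cong (λ i → new i 0) (double-injective i j (suc-injective (nth-injective Us v₀ uT _ _ (bound li) (bound lj) e)))
    inj (new i (suc _)) _ (_ , s≤s ()) _ _
    inj (new i zero) (new _ (suc _)) _ (_ , s≤s ()) _
    last-γ : nth Us v₀ (suc (m + m)) ≡ γ
    last-γ = go (v ∷ R) (chain-length c)
      where
      go : ∀ xs {k} → length xs ≡ k → nth (xs ++ γ ∷ []) v₀ k ≡ γ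
      go []       refl = refl
      go (x ∷ xs) refl = go xs refl
    cover : ∀ i → i < suc m → Cov (val (core i) ∷ val (core (next (suc m , false) i)) ∷ val (new i 0) ∷ [])
    cover i (s≤s le) with suc i ℕ.≟ suc m
    ... | yes refl = subst₂ (λ x y → Cov (x ∷ v ∷ y ∷ [])) (sym (chain-last c (γ ∷ []))) (sym last-γ) cv
    ... | no ne = chain-edge c (γ ∷ []) i (≤∧≢⇒< le (ne ∘ cong suc))
    avoidT : All (_∉ Z) Us
    avoidT = Allₚ.++⁺ avoid (γ∉Z ∷ [])
    avoid′ : ∀ x → Valid (suc m , false) x → val x ∉ Z
    avoid′ (core i) li = All.lookup avoidT (nth-∈ Us v₀ _ (<-trans (n<1+n _) (bound li)))
    avoid′ (new i _) (li , _) = All.lookup avoidT (nth-∈ Us v₀ _ (bound li))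

-- Colourings without large level sets.

𝟙-three : ∀ a b c → 𝟙 a ≤ 𝟙 b + 𝟙 (a ∧ c) + 𝟙 (a ∧ (not b ∧ not c))
𝟙-three false _     _     = z≤n
𝟙-three true  true  _     = s≤s z≤n
𝟙-three true  false true  = s≤s z≤n
𝟙-three true  false false = s≤s z≤n

-- There are at least n/l candidates. The `w` forbidden vertices and the at most wn/k vertices of
-- forbidden colour amount to at most n/(4l) each, so not every candidate is bad.
few-bad : ∀ k l w n P b → 0 < k → 0 < n → 4 * l * w ≤ k → 4 * l * w ≤ n → n ≤ l * P → k * b ≤ w * n → P ≤ w + b → Empty
few-bad k l w n P b 0<k 0<n k≥ n≥ many fib split = <⇒≱ (*-mono-< 0<k 0<n) (+-cancelˡ-≤ (3 * (k * n)) (k * n) 0 (begin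
      3 * (k * n) + k * n                ≡⟨ lem₁ k n ⟩
      4 * k * n                          ≤⟨ *-monoʳ-≤ (4 * k) (≤-trans many (*-monoʳ-≤ l split)) ⟩
      4 * k * (l * (w + b))              ≡⟨ lem₂ k l w b ⟩
      k * (4 * l * w) + 4 * l * (k * b)  ≤⟨ +-mono-≤ (*-monoʳ-≤ k n≥) (*-monoʳ-≤ (4 * l) fib) ⟩
      k * n + 4 * l * (w * n)            ≡⟨ cong (k * n +_) (sym (*-assoc (4 * l) w n)) ⟩
      k * n + 4 * l * w * n              ≤⟨ +-monoʳ-≤ (k * n) (*-monoˡ-≤ n k≥) ⟩
      k * n + k * n                      ≤⟨ +-monoʳ-≤ (k * n) (m≤m+n (k * n) _) ⟩
      3 * (k * n)                        ≡⟨ sym (+-identityʳ _) ⟩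
      3 * (k * n) + 0                    ∎))
  where
  open ≤-Reasoning
  lem₁ : ∀ k n → 3 * (k * n) + k * n ≡ 4 * k * n
  lem₁ = solve-∀
  lem₂ : ∀ k l w b → 4 * k * (l * (w + b)) ≡ k * (4 * l * w) + 4 * l * (k * b)
  lem₂ = solve-∀

module NonStarry {n : ℕ} (K₂ : ℕ) (0<K₂ : 0 < K₂) (0<n : 0 < n) where

  private V = Fin n

  Vs : List V
  Vs = allFin n

  uVs : Unique Vs
  uVs = Uniqueₚ.allFin⁺ n

  lenVs : length Vs ≡ n
  lenVs = Listₚ.length-tabulate id

  -- g takes no value too often on p; an extension failing this on many pairs contains large stars.
  Spread : (V → Bool) → (V → V) → Set
  Spread p g = ∀ y → K₂ * # Vs (λ v → p v ∧ ⌊ g v Fin.≟ y ⌋) ≤ n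

  spread-mono : ∀ {p p′ g} → (∀ v → p′ v ≡ true → p v ≡ true) → Spread p g → Spread p′ g
  spread-mono {p} {p′} h s y = ≤-trans (*-monoʳ-≤ K₂ (#-mono Vs λ v e → let e₁ , e₂ = ∧-true⁻ (p′ v) e in ∧-true⁺ (h v e₁) e₂)) (s y)

  fibres : ∀ p g W → Spread p g → K₂ * # Vs (λ v → p v ∧ (g v ∈ᵇ W)) ≤ length W * n
  fibres p g []      s = ≤-reflexive (trans (cong (K₂ *_) (trans (∑-cong Vs (λ v → cong 𝟙 (Boolₚ.∧-zeroʳ (p v)))) (trans (∑-const Vs 0) (*-zeroʳ (length Vs))))) (*-zeroʳ K₂))
  fibres p g (y ∷ W) s = begin
    K₂ * # Vs (λ v → p v ∧ (g v ∈ᵇ (y ∷ W)))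
      ≤⟨ *-monoʳ-≤ K₂ (≤-trans (#-mono Vs pt) (#-∨ Vs (λ v → p v ∧ ⌊ g v Fin.≟ y ⌋) (λ v → p v ∧ (g v ∈ᵇ W)))) ⟩
    K₂ * (# Vs (λ v → p v ∧ ⌊ g v Fin.≟ y ⌋) + # Vs (λ v → p v ∧ (g v ∈ᵇ W)))
      ≡⟨ *-distribˡ-+ K₂ _ _ ⟩
    K₂ * # Vs (λ v → p v ∧ ⌊ g v Fin.≟ y ⌋) + K₂ * # Vs (λ v → p v ∧ (g v ∈ᵇ W))
      ≤⟨ +-mono-≤ (s y) (fibres p g W s) ⟩
    n + length W * n ∎
    where
    open ≤-Reasoning
    pt : ∀ v → p v ∧ (g v ∈ᵇ (y ∷ W)) ≡ true → (p v ∧ ⌊ g v Fin.≟ y ⌋) ∨ (p v ∧ (g v ∈ᵇ W)) ≡ true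
    pt v e with ∧-true⁻ (p v) e
    ... | e₁ , e₂ with ∈ᵇ⁻ (g v) (y ∷ W) e₂
    ...   | here x rewrite e₁ | ⌊⌋-true⁺ (g v Fin.≟ y) x = refl
    ...   | there x rewrite e₁ | ∈ᵇ⁺ x = Boolₚ.∨-zeroʳ _

  module _ (p : V → Bool) (g : V → V) (W : List V) where

    clean : V → Bool
    clean v = p v ∧ (not (v ∈ᵇ W) ∧ not (g v ∈ᵇ W))

    caught : V → Bool
    caught v = p v ∧ (g v ∈ᵇ W)

    clean-split : # Vs p ≤ length W + # Vs caught + # Vs clean
    clean-split = begin
      # Vs p
        ≤⟨ ∑-mono Vs (λ v → 𝟙-three (p v) (v ∈ᵇ W) (g v ∈ᵇ W)) ⟩
      ∑ Vs (λ v → 𝟙 (v ∈ᵇ W) + 𝟙 (caught v) + 𝟙 (clean v))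
        ≡⟨ ∑-+ Vs (λ v → 𝟙 (v ∈ᵇ W) + 𝟙 (caught v)) (λ v → 𝟙 (clean v)) ⟩
      ∑ Vs (λ v → 𝟙 (v ∈ᵇ W) + 𝟙 (caught v)) + # Vs clean
        ≡⟨ cong (_+ # Vs clean) (∑-+ Vs (λ v → 𝟙 (v ∈ᵇ W)) (λ v → 𝟙 (caught v))) ⟩
      # Vs (_∈ᵇ W) + # Vs caught + # Vs clean
        ≤⟨ +-monoˡ-≤ (# Vs clean) (+-monoˡ-≤ (# Vs caught) (#-∈ᵇ Vs W uVs)) ⟩
      length W + # Vs caught + # Vs clean ∎
      where open ≤-Reasoning

    clean⁻ : ∀ v → clean v ≡ true → p v ≡ true × v ∉ W × g v ∉ W
    clean⁻ v e = let e₁ , e₂ = ∧-true⁻ (p v) e ; e₃ , e₄ = ∧-true⁻ (not (v ∈ᵇ W)) e₂ in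
      e₁ , not-∈ᵇ⁻ v W e₃ , not-∈ᵇ⁻ (g v) W e₄

    clean-pos : ∀ K₃ w → length W ≤ w → 4 * K₃ * w ≤ K₂ → 4 * K₃ * w ≤ n → n ≤ K₃ * # Vs p → Spread p g → # Vs clean ≢ 0
    clean-pos K₃ w lenW K₂≥ n≥ many s z = few-bad K₂ K₃ w n (# Vs p) (# Vs caught) 0<K₂ 0<n K₂≥ n≥ many
      (≤-trans (fibres p g W s) (*-monoˡ-≤ n lenW))
      (≤-trans clean-split (≤-trans (≤-reflexive (trans (cong (length W + # Vs caught +_) z) (+-identityʳ (length W + # Vs caught)))) (+-monoˡ-≤ (# Vs caught) lenW)))

    pick-good : ∀ K₃ w → length W ≤ w → 4 * K₃ * w ≤ K₂ → 4 * K₃ * w ≤ n → n ≤ K₃ * # Vs p → Spread p g →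
      ∃ λ v → p v ≡ true × v ∉ W × g v ∉ W
    pick-good K₃ w lenW K₂≥ n≥ many s =
      let v , _ , e = #-pos Vs clean (n≢0⇒n>0 (clean-pos K₃ w lenW K₂≥ n≥ many s)) in v , clean⁻ v e

-- Six kinds of bad pairs, each at most w n²/k + w n. The two conditions on 24 l w bound their total
-- by n²/(2l), half of the guaranteed number of items.
many-good : ∀ k l w n I G → 0 < k → n * n ≤ l * I → k * I ≤ k * G + 6 * (w * n * n + k * (w * n)) →
  24 * l * w ≤ k → 24 * l * w ≤ n → n * n ≤ 2 * l * G
many-good k l w n I G 0<k dense split k≥ n≥ = *-cancelˡ-≤ (2 * k) {{>-nonZero (*-mono-< {0} {2} (s≤s z≤n) 0<k)}} (+-cancelʳ-≤ (2 * (k * (n * n))) _ _ (begin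
  2 * k * (n * n) + 2 * (k * (n * n))                     ≡⟨ lem₁ k (n * n) ⟩
  4 * k * (n * n)                                         ≤⟨ *-monoʳ-≤ (4 * k) dense ⟩
  4 * k * (l * I)                                         ≡⟨ lem₂ k l I ⟩
  4 * l * (k * I)                                         ≤⟨ *-monoʳ-≤ (4 * l) split ⟩
  4 * l * (k * G + 6 * (w * n * n + k * (w * n)))         ≡⟨ lem₃ k l w n G ⟩
  2 * k * (2 * l * G) + (24 * l * w * (n * n) + k * (24 * l * w * n))
    ≤⟨ +-monoʳ-≤ (2 * k * (2 * l * G)) (+-mono-≤ (*-monoˡ-≤ (n * n) k≥) (*-monoʳ-≤ k (*-monoˡ-≤ n n≥))) ⟩
  2 * k * (2 * l * G) + (k * (n * n) + k * (n * n))       ≡⟨ cong (2 * k * (2 * l * G) +_) (lem₄ (k * (n * n))) ⟩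
  2 * k * (2 * l * G) + 2 * (k * (n * n))                 ∎))
  where
  open ≤-Reasoning
  lem₁ : ∀ k x → 2 * k * x + 2 * (k * x) ≡ 4 * k * x
  lem₁ = solve-∀
  lem₂ : ∀ k l x → 4 * k * (l * x) ≡ 4 * l * (k * x)
  lem₂ = solve-∀
  lem₃ : ∀ k l w n G → 4 * l * (k * G + 6 * (w * n * n + k * (w * n))) ≡ 2 * k * (2 * l * G) + (24 * l * w * (n * n) + k * (24 * l * w * n))
  lem₃ = solve-∀
  lem₄ : ∀ x → x + x ≡ 2 * x
  lem₄ = solve-∀

cube-dense : ∀ n K R S → n ≤ 2 * K * R → n * n * R ≤ 4 * K * K * S → n * (n * n) ≤ 8 * K * K * K * S
cube-dense n K R S h₁ h₂ = begin
  n * (n * n)               ≤⟨ *-monoˡ-≤ (n * n) h₁ ⟩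
  2 * K * R * (n * n)       ≡⟨ lem₁ K R (n * n) ⟩
  2 * K * (n * n * R)       ≤⟨ *-monoʳ-≤ (2 * K) h₂ ⟩
  2 * K * (4 * K * K * S)   ≡⟨ lem₂ K S ⟩
  8 * K * K * K * S         ∎
  where
  open ≤-Reasoning
  lem₁ : ∀ K R x → 2 * K * R * x ≡ 2 * K * (x * R)
  lem₁ = solve-∀
  lem₂ : ∀ K S → 2 * K * (4 * K * K * S) ≡ 8 * K * K * K * S
  lem₂ = solve-∀

square-rich : ∀ n K D → n ≤ 2 * K * D → n * n ≤ 4 * K * K * (D * D)
square-rich n K D h = ≤-trans (*-mono-≤ h h) (≤-reflexive (lem K D))
  where
  lem : ∀ K D → 2 * K * D * (2 * K * D) ≡ 4 * K * K * (D * D)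
  lem = solve-∀

cleaning-nonempty : ∀ n K c X Y → 0 < n → n * n ≤ K * X → 4 * K * c ≤ n → X ≤ c * (n + n) + Y → Y ≢ 0
cleaning-nonempty n K c X Y 0<n dense small le refl = <⇒≱ (*-mono-< 0<n 0<n) (+-cancelˡ-≤ (n * n) (n * n) 0 (begin
  n * n + n * n               ≡⟨ lem₁ (n * n) ⟩
  2 * (n * n)                 ≤⟨ *-monoʳ-≤ 2 (≤-trans dense (*-monoʳ-≤ K (≤-trans le (≤-reflexive (+-identityʳ _))))) ⟩
  2 * (K * (c * (n + n)))     ≡⟨ lem₂ K c n ⟩
  4 * K * c * n               ≤⟨ *-monoˡ-≤ n small ⟩
  n * n                       ≡⟨ sym (+-identityʳ _) ⟩
  n * n + 0                   ∎))
  where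
  open ≤-Reasoning
  lem₁ : ∀ x → x + x ≡ 2 * x
  lem₁ = solve-∀
  lem₂ : ∀ K c n → 2 * (K * (c * (n + n))) ≡ 4 * K * c * n
  lem₂ = solve-∀

matching-room : ∀ k l M n G b → 0 < k → 0 < n → n ≤ l * G → k * b ≤ M * n → 2 * l * M ≤ k → b < G
matching-room k l M n G b 0<k 0<n dense small k≥ = ≰⇒> λ G≤b → <⇒≱ (*-mono-< 0<k 0<n) (+-cancelˡ-≤ (k * n) (k * n) 0 (begin
  k * n + k * n         ≡⟨ lem₁ k n ⟩
  2 * k * n             ≤⟨ *-monoʳ-≤ (2 * k) (≤-trans dense (*-monoʳ-≤ l G≤b)) ⟩
  2 * k * (l * b)       ≡⟨ lem₂ k l b ⟩
  2 * l * (k * b)       ≤⟨ *-monoʳ-≤ (2 * l) small ⟩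
  2 * l * (M * n)       ≡⟨ sym (*-assoc (2 * l) M n) ⟩
  2 * l * M * n         ≤⟨ *-monoˡ-≤ n k≥ ⟩
  k * n                 ≡⟨ sym (+-identityʳ _) ⟩
  k * n + 0             ∎))
  where
  open ≤-Reasoning
  lem₁ : ∀ k n → k * n + k * n ≡ 2 * k * n
  lem₁ = solve-∀
  lem₂ : ∀ k l b → 2 * k * (l * b) ≡ 2 * l * (k * b)
  lem₂ = solve-∀

m<[1+m/n]*n : ∀ m n .{{_ : NonZero n}} → m < suc (m / n) * n
m<[1+m/n]*n m n = ≤-trans (s≤s (≤-reflexive (DivMod.m≡m%n+[m/n]*n m n))) (+-monoˡ-≤ (m / n * n) (DivMod.m%n<n m n))

-- Hubs and subgraphs of linear minimum degree.

module RichSubgraph {n : ℕ} (0<n : 0 < n) where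

  open Boxes n using (length-allFin; rich; rich-dense)

  private
    V = Fin n
    Vs = allFin n

  pairs : List (V × V)
  pairs = cartesianProduct Vs Vs

  #pairs : (V → V → Bool) → ℕ
  #pairs E = ∑ Vs (λ a → # Vs (E a))

  #pairs-list : ∀ (E : V × V → Bool) → # pairs E ≡ #pairs (λ a b → E (a , b))
  #pairs-list E = ∑-cartesian Vs Vs (λ p → 𝟙 (E p))

  -- Summed over `s`, the pairs counted on the right number ∑ D(a)². At least n/(2K) rows have D(a)
  -- ≥ n/(2K), so the sum is at least n³/(8K³) and some `s` gets its share. Every row vertex of the
  -- remaining graph is joined to `s`, so a path started at `s` can be closed from any of them.
  hub : ∀ K F → n * n ≤ K * #pairs F → ∃ λ s → n * n ≤ 8 * K * K * K * #pairs (λ a b → F a b ∧ F a s)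
  hub K F dense = let s , _ , e = averaging Vs (λ s → #pairs (λ a b → F a b ∧ F a s)) (8 * K * K * K) (n * n)
                                    (subst (0 <_) (sym length-allFin) 0<n) le in s , e
    where
    D : V → ℕ
    D a = # Vs (F a)
    R : V → Bool
    R = rich Vs (λ c a → F a c) K
    pt : ∀ a → n * n * 𝟙 (R a) ≤ 4 * K * K * (D a * D a)
    pt a with bool-cases (R a)
    ... | inj₁ e = ≤-trans (≤-reflexive (trans (cong (λ x → n * n * 𝟙 x) e) (*-identityʳ _))) (square-rich n K (D a) (≤ᵇ⇒≤ n _ (≡true⇒T e)))
    ... | inj₂ e = ≤-trans (≤-reflexive (trans (cong (λ x → n * n * 𝟙 x) e) (*-zeroʳ (n * n)))) z≤n
    squares : ∑ Vs (λ s → #pairs (λ a b → F a b ∧ F a s)) ≡ ∑ Vs (λ a → D a * D a)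
    squares = trans (∑-swap Vs Vs (λ s a → # Vs (λ b → F a b ∧ F a s))) (∑-cong Vs λ a →
      trans (∑-cong Vs λ s → trans (∑-cong Vs λ b → trans (𝟙-∧ (F a b) (F a s)) (*-comm (𝟙 (F a b)) (𝟙 (F a s)))) (∑-*ˡ Vs (𝟙 (F a s)) (λ b → 𝟙 (F a b))))
        (trans (∑-cong Vs λ s → *-comm (𝟙 (F a s)) (D a)) (∑-*ˡ Vs (D a) (λ s → 𝟙 (F a s)))))
    le : length Vs * (n * n) ≤ 8 * K * K * K * ∑ Vs (λ s → #pairs (λ a b → F a b ∧ F a s))
    le = ≤-trans (≤-reflexive (cong (_* (n * n)) length-allFin)) (≤-trans
      (cube-dense n K (# Vs R) (∑ Vs (λ a → D a * D a))
        (≤-trans (≤-reflexive (sym length-allFin)) (rich-dense Vs (λ c a → F a c) K 0<n (≤-trans (≤-reflexive (cong (n *_) length-allFin)) dense)))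
        (≤-trans (≤-reflexive (sym (∑-*ˡ Vs (n * n) (λ a → 𝟙 (R a))))) (≤-trans (∑-mono Vs pt) (≤-reflexive (∑-*ˡ Vs (4 * K * K) (λ a → D a * D a))))))
      (≤-reflexive (cong (8 * K * K * K *_) (sym squares))))

  inc : V ⊎ V → V × V → Bool
  inc (inj₁ a) (a′ , _) = ⌊ a′ Fin.≟ a ⌋
  inc (inj₂ b) (_ , b′) = ⌊ b′ Fin.≟ b ⌋

  lines : List (V ⊎ V)
  lines = map inj₁ Vs ++ map inj₂ Vs

  length-lines : length lines ≡ n + n
  length-lines = trans (Listₚ.length-++ (map inj₁ Vs)) (cong₂ _+_ (trans (Listₚ.length-map inj₁ Vs) length-allFin) (trans (Listₚ.length-map inj₂ Vs) length-allFin))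

  pick-one : ∀ (f : V → ℕ) v → ∑ Vs (λ v′ → 𝟙 ⌊ v′ Fin.≟ v ⌋ * f v) ≤ f v
  pick-one f v = ≤-trans (≤-reflexive (trans (∑-cong Vs λ v′ → *-comm (𝟙 ⌊ v′ Fin.≟ v ⌋) (f v)) (∑-*ˡ Vs (f v) (λ v′ → 𝟙 ⌊ v′ Fin.≟ v ⌋))))
    (≤-trans (*-monoʳ-≤ (f v) (#-≟ Vs v (Uniqueₚ.allFin⁺ n))) (≤-reflexive (*-identityʳ (f v))))

  at-≟ : ∀ (g : V → Bool) v v′ → 𝟙 (g v′ ∧ ⌊ v′ Fin.≟ v ⌋) ≤ 𝟙 ⌊ v′ Fin.≟ v ⌋ * 𝟙 (g v)
  at-≟ g v v′ = ≤-trans (≤-reflexive (trans (𝟙-∧ (g v′) _) (*-comm (𝟙 (g v′)) _))) (at (v′ Fin.≟ v))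
    where
    at : (dc : Dec (v′ ≡ v)) → 𝟙 ⌊ dc ⌋ * 𝟙 (g v′) ≤ 𝟙 ⌊ dc ⌋ * 𝟙 (g v)
    at (yes refl) = ≤-refl
    at (no _)     = z≤n

  -- A dense bipartite graph has a nonempty subgraph all of whose nonzero degrees are linear.
  min-degree : ∀ K F → 0 < K → n * n ≤ K * #pairs F → Σ (V → V → Bool) λ E →
    (∀ a b → E a b ≡ true → F a b ≡ true) × (∃ λ a → ∃ λ b → E a b ≡ true) ×
    (∀ a b → E a b ≡ true → n ≤ 4 * K * # Vs (E a)) × (∀ a b → E a b ≡ true → n ≤ 4 * K * # Vs (λ a′ → E a′ b))
  min-degree K F 0<K dense = E , (λ a b → proj₁ (proj₂ cleaned) (a , b)) , nonempty , rows , columns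
    where
    instance 4K≢0 : NonZero (4 * K)
    4K≢0 = >-nonZero (*-mono-< {0} {4} (s≤s z≤n) 0<K)
    -- At this threshold the 2n rows and columns lose at most n²/(2K) pairs altogether, so a
    -- nonempty graph remains.
    c = n / (4 * K)
    module C = Cleaning pairs lines inc c
    q : V × V → Bool
    q p = F (proj₁ p) (proj₂ p)
    cleaned = C.clean (C.active q) q ≤-refl
    q′ = proj₁ cleaned
    E : V → V → Bool
    E a b = q′ (a , b)
    bound : # pairs q + c * C.active q′ ≤ # pairs q′ + c * C.active q
    bound = proj₁ (proj₂ (proj₂ cleaned))
    full = proj₂ (proj₂ (proj₂ cleaned))
    c-small : 4 * K * c ≤ n
    c-small = ≤-trans (≤-reflexive (*-comm (4 * K) c)) (DivMod.m/n*n≤m n (4 * K))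
    pos : # pairs q′ ≢ 0
    pos = cleaning-nonempty n K c (# pairs q) (# pairs q′) 0<n (≤-trans dense (≤-reflexive (cong (K *_) (sym (#pairs-list q))))) c-small
      (≤-trans (m≤m+n _ _) (≤-trans bound (≤-trans (≤-reflexive (+-comm (# pairs q′) _))
        (+-monoˡ-≤ (# pairs q′) (*-monoʳ-≤ c (≤-trans (#-≤length lines _) (≤-reflexive length-lines)))))))
    nonempty : ∃ λ a → ∃ λ b → E a b ≡ true
    nonempty = let (a , b) , _ , e = #-pos pairs q′ (n≢0⇒n>0 pos) in a , b , e
    scale : ∀ x → c < x → n ≤ 4 * K * x
    scale x lt = ≤-trans (<⇒≤ (m<[1+m/n]*n n (4 * K))) (≤-trans (≤-reflexive (*-comm (suc c) (4 * K))) (*-monoʳ-≤ (4 * K) lt))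
    heavy : ∀ h a b → h ∈ lines → E a b ≡ true → inc h (a , b) ≡ true → c < C.deg q′ h
    heavy h a b h∈ e i = [ (λ z → ⊥-elim (<⇒≢ (≤-trans (≤-reflexive (cong 𝟙 (sym (∧-true⁺ e i))))
        (∑-∈ (λ p → 𝟙 (q′ p ∧ inc h p)) (∈ₚ.∈-cartesianProduct⁺ (∈ₚ.∈-allFin a) (∈ₚ.∈-allFin b)))) (sym z))) , (λ lt → lt) ]′ (full h h∈)
    row-deg : ∀ a → C.deg q′ (inj₁ a) ≤ # Vs (E a)
    row-deg a = ≤-trans (≤-reflexive (trans (#pairs-list _) (∑-swap Vs Vs _)))
      (∑-mono Vs λ b → ≤-trans (∑-mono Vs λ a′ → at-≟ (λ a → E a b) a a′) (pick-one (λ a → 𝟙 (E a b)) a))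
    column-deg : ∀ b → C.deg q′ (inj₂ b) ≤ # Vs (λ a → E a b)
    column-deg b = ≤-trans (≤-reflexive (#pairs-list _))
      (∑-mono Vs λ a → ≤-trans (∑-mono Vs λ b′ → at-≟ (E a) b b′) (pick-one (λ b → 𝟙 (E a b)) b))
    rows : ∀ a b → E a b ≡ true → n ≤ 4 * K * # Vs (E a)
    rows a b e = scale _ (≤-trans (heavy (inj₁ a) a b (∈ₚ.∈-++⁺ˡ (∈ₚ.∈-map⁺ inj₁ (∈ₚ.∈-allFin a))) e (⌊⌋-true⁺ (a Fin.≟ a) refl)) (row-deg a))
    columns : ∀ a b → E a b ≡ true → n ≤ 4 * K * # Vs (λ a′ → E a′ b)
    columns a b e = scale _ (≤-trans (heavy (inj₂ b) a b (∈ₚ.∈-++⁺ʳ (map inj₁ Vs) (∈ₚ.∈-map⁺ inj₂ (∈ₚ.∈-allFin b))) e (⌊⌋-true⁺ (b Fin.≟ b) refl)) (column-deg b))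

-- Growing and closing loose cycles.

Unique-cons : ∀ {V : Set} {v : V} {W} → v ∉ W → Unique W → Unique (v ∷ W)
Unique-cons v∉ u = All.tabulate (λ {y} y∈ e → v∉ (subst (_∈ _) (sym e) y∈)) ∷ u

∉-cons : ∀ {V : Set} {v u : V} {W} → v ≢ u → v ∉ W → v ∉ u ∷ W
∉-cons ne v∉ (here e)   = ne e
∉-cons ne v∉ (there v∈) = v∉ v∈

∉-head : ∀ {V : Set} {v u : V} {W} → v ∉ u ∷ W → v ≢ u
∉-head v∉ e = v∉ (here e)

∉-tail : ∀ {V : Set} {v u : V} {W} → v ∉ u ∷ W → v ∉ W
∉-tail v∉ v∈ = v∉ (there v∈)

module LooseCycles {n : ℕ} (v₀ : Fin n) (Cov : List (Fin n) → Set)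
  (mono : ∀ {e f} → (∀ v → v ∈ e → v ∈ f) → Cov f → Cov e)
  (K₂ : ℕ) (0<K₂ : 0 < K₂) (0<n : 0 < n) (Z : List (Fin n))
  (F : Fin n → Fin n → Bool) (x : Fin n → Fin n → Fin n)
  (F-cov : ∀ a b → F a b ≡ true → Cov (x a b ∷ a ∷ b ∷ []))
  (F-distinct : ∀ a b → F a b ≡ true → a ≢ b × x a b ≢ a × x a b ≢ b)
  (F-avoid : ∀ a b → F a b ≡ true → a ∉ Z × b ∉ Z × x a b ∉ Z)
  (rows : ∀ a → NonStarry.Spread K₂ 0<K₂ 0<n (F a) (x a))
  (columns : ∀ b → NonStarry.Spread K₂ 0<K₂ 0<n (λ a → F a b) (λ a → x a b))
  (s : Fin n) (E : Fin n → Fin n → Bool)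
  (E⊂F : ∀ a b → E a b ≡ true → F a b ≡ true) (E-hub : ∀ a b → E a b ≡ true → F a s ≡ true)
  (K₃ : ℕ) (E-row : ∀ a b → E a b ≡ true → n ≤ K₃ * # (allFin n) (E a))
  (E-column : ∀ a b → E a b ≡ true → n ≤ K₃ * # (allFin n) (λ a′ → E a′ b))
  (a₀ b₀ : Fin n) (E₀ : E a₀ b₀ ≡ true)
  (w : ℕ) (K₂≥ : 4 * K₃ * w ≤ K₂) (n≥ : 4 * K₃ * w ≤ n)
  (K₂≥′ : 24 * (K₃ * K₃) * w ≤ K₂) (n≥′ : 24 * (K₃ * K₃) * w ≤ n) where

  open NonStarry K₂ 0<K₂ 0<n
  open RichSubgraph 0<n using (#pairs; pairs; #pairs-list)
  open Chains v₀ Cov mono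
  open Assembly 0 using (CycleAvoiding)

  private V = Fin n

  cov₁ : ∀ a b → F a b ≡ true → Cov (a ∷ b ∷ x a b ∷ [])
  cov₁ a b e = mono (λ { v (here p) → there (here p) ; v (there (here p)) → there (there (here p)) ; v (there (there (here p))) → here p }) (F-cov a b e)

  cov₂ : ∀ a b → F a b ≡ true → Cov (b ∷ a ∷ x a b ∷ [])
  cov₂ a b e = mono (λ { v (here p) → there (here p) ; v (there (here p)) → here p ; v (there (there (here p))) → there (there (here p)) }) (cov₁ a b e)

  cov₃ : ∀ a b → F a b ≡ true → Cov (x a b ∷ b ∷ a ∷ [])
  cov₃ a b e = mono (λ { v (here p) → here p ; v (there (here p)) → there (there (here p)) ; v (there (there (here p))) → there (here p) }) (F-cov a b e)

  cov₄ : ∀ a b → F a b ≡ true → Cov (a ∷ x a b ∷ b ∷ [])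
  cov₄ a b e = mono (λ { v (here p) → there (here p) ; v (there (here p)) → here p ; v (there (there (here p))) → there (there (here p)) }) (F-cov a b e)

  -- After a first edge at `s` the path grows by two edges at a time, to a column vertex and back to
  -- a row vertex, with the colours of the pairs as expansion vertices. It always ends in a row
  -- vertex that still has partners in `E`.
  record Path (p : ℕ) : Set where
    field
      a     : V
      R     : List V
      chain : Chain s (suc (p + p)) (a ∷ R)
      uniq  : Unique (a ∷ R)
      avoid : All (_∉ Z) (a ∷ R)
      b     : V
      alive : E a b ≡ true

    size≡ : length (a ∷ R) ≡ 3 + 4 * p
    size≡ = trans (chain-length chain) (lem p)
      where lem : ∀ p → suc (suc (p + p) + suc (p + p)) ≡ 3 + 4 * p
            lem = solve-∀

  extend-unique : ∀ {v γ : V} {W : List V} → v ∉ W → γ ∉ W → v ≢ γ → Unique W → Unique (v ∷ γ ∷ W)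
  extend-unique v∉ γ∉ ne u = Unique-cons (∉-cons ne v∉) (Unique-cons γ∉ u)

  initial : 1 ≤ w → Path 0
  initial 1≤w =
    let a , e , a∉ , γ∉ = pick-good (λ a → E a b₀) (λ a → x a s) (s ∷ []) K₃ w 1≤w K₂≥ n≥ (E-column a₀ b₀ E₀)
                            (spread-mono (λ a e → E-hub a b₀ e) (columns s))
        as = E-hub a b₀ e
        a∉Z , s∉Z , γ∉Z = F-avoid a s as
    in record { a = a ; R = x a s ∷ s ∷ [] ; chain = step a (x a s) start (cov₁ a s as)
              ; uniq = extend-unique a∉ γ∉ (λ eq → proj₁ (proj₂ (F-distinct a s as)) (sym eq)) ([] ∷ [])
              ; avoid = a∉Z ∷ γ∉Z ∷ s∉Z ∷ [] ; b = b₀ ; alive = e }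

  advance : ∀ {p} → 5 + 4 * p ≤ w → Path p → Path (suc p)
  advance {p} room P =
    let open Path P
        b′ , e , b∉ , γ∉ = pick-good (E a) (x a) (a ∷ R) K₃ w (≤-trans (≤-reflexive size≡) (≤-trans (n≤1+n _) (≤-trans (n≤1+n _) room))) K₂≥ n≥ (E-row a b alive)
                             (spread-mono (E⊂F a) (rows a))
        f = E⊂F a b′ e
        W = b′ ∷ x a b′ ∷ a ∷ R
        a′ , e′ , a′∉ , γ′∉ = pick-good (λ a → E a b′) (λ a → x a b′) W K₃ w
                             (≤-trans (≤-reflexive (cong (suc ∘ suc) size≡)) room) K₂≥ n≥ (E-column a b′ e)
                             (spread-mono (λ a e → E⊂F a b′ e) (columns b′))
        f′ = E⊂F a′ b′ e′
        _ , b∉Z , γ∉Z = F-avoid a b′ f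
        a′∉Z , _ , γ′∉Z = F-avoid a′ b′ f′
    in record { a = a′ ; R = x a′ b′ ∷ W
              ; chain = subst (λ k → Chain s (suc k) (a′ ∷ x a′ b′ ∷ W)) (cong suc (sym (+-suc p p)))
                          (step a′ (x a′ b′) (step b′ (x a b′) chain (cov₂ a b′ f)) (cov₁ a′ b′ f′))
              ; uniq = extend-unique a′∉ γ′∉ (λ eq → proj₁ (proj₂ (F-distinct a′ b′ f′)) (sym eq))
                         (extend-unique b∉ γ∉ (λ eq → proj₂ (proj₂ (F-distinct a b′ f)) (sym eq)) uniq)
              ; avoid = a′∉Z ∷ γ′∉Z ∷ b∉Z ∷ γ∉Z ∷ avoid ; b = b′ ; alive = e′ }

  path : ∀ p → 5 + 4 * p ≤ w → Path p
  path zero    room = initial (≤-trans (s≤s z≤n) room)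
  path (suc p) room = advance room′ (path p room′)
    where
    room′ : 5 + 4 * p ≤ w
    room′ = ≤-trans (+-monoʳ-≤ 5 (*-monoʳ-≤ 4 (n≤1+n p))) room

  #pairs-mono : ∀ {P Q : V → V → Bool} → (∀ a b → P a b ≡ true → Q a b ≡ true) → #pairs P ≤ #pairs Q
  #pairs-mono h = ∑-mono Vs (λ a → #-mono Vs (h a))

  #pairs-∨ : ∀ (i e f : V → V → Bool) → #pairs (λ a b → i a b ∧ (e a b ∨ f a b)) ≤ #pairs (λ a b → i a b ∧ e a b) + #pairs (λ a b → i a b ∧ f a b)
  #pairs-∨ i e f = ≤-trans (∑-mono Vs λ a → ≤-trans (#-mono Vs λ b h → trans (sym (Boolₚ.∧-distribˡ-∨ (i a b) (e a b) (f a b))) h)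
    (#-∨ Vs (λ b → i a b ∧ e a b) (λ b → i a b ∧ f a b))) (≤-reflexive (∑-+ Vs _ _))

  slack : ℕ
  slack = w * n * n + K₂ * (w * n)

  by-rows : ∀ (P : V → V → Bool) → (∀ a → K₂ * # Vs (P a) ≤ w * n + K₂ * w) → K₂ * #pairs P ≤ slack
  by-rows P h = begin
    K₂ * #pairs P                          ≡⟨ sym (∑-*ˡ Vs K₂ (λ a → # Vs (P a))) ⟩
    ∑ Vs (λ a → K₂ * # Vs (P a))           ≤⟨ ∑-mono Vs h ⟩
    ∑ Vs (λ _ → w * n + K₂ * w)            ≡⟨ trans (∑-const Vs (w * n + K₂ * w)) (cong (_* (w * n + K₂ * w)) lenVs) ⟩
    n * (w * n + K₂ * w)                   ≡⟨ lem n w K₂ ⟩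
    slack                                  ∎
    where
    open ≤-Reasoning
    lem : ∀ n w k → n * (w * n + k * w) ≡ w * n * n + k * (w * n)
    lem = solve-∀

  by-columns : ∀ (P : V → V → Bool) → (∀ b → K₂ * # Vs (λ a → P a b) ≤ w * n + K₂ * w) → K₂ * #pairs P ≤ slack
  by-columns P h = ≤-trans (≤-reflexive (cong (K₂ *_) (∑-swap Vs Vs (λ a b → 𝟙 (P a b))))) (by-rows (λ b a → P a b) h)

  listed : ∀ (P : V → Bool) W → (∀ v → P v ≡ true → v ∈ᵇ W ≡ true) → length W ≤ w → K₂ * # Vs P ≤ w * n + K₂ * w
  listed P W h len = ≤-trans (*-monoʳ-≤ K₂ (≤-trans (#-mono Vs h) (≤-trans (#-∈ᵇ Vs W uVs) len))) (m≤n+m _ (w * n))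

  coloured : ∀ (P : V → Bool) p g W → (∀ v → P v ≡ true → p v ∧ (g v ∈ᵇ W) ≡ true) → Spread p g → length W ≤ w → K₂ * # Vs P ≤ w * n + K₂ * w
  coloured P p g W h sp len = ≤-trans (*-monoʳ-≤ K₂ (#-mono Vs h)) (≤-trans (fibres p g W sp) (≤-trans (*-monoˡ-≤ n len) (m≤m+n _ _)))

  module Close {p : ℕ} (P : Path p) (room : 4 + 4 * p ≤ w) where

    open Path P using (R; chain; uniq; avoid; alive; size≡) renaming (a to a*; b to b*)

    W : List V
    W = a* ∷ R

    lenW : suc (length W) ≤ w
    lenW = ≤-trans (s≤s (≤-reflexive size≡)) room

    y z : V → V
    y a = x a s
    z b = x a* b

    -- The pair (a, b) is to continue the path by `b` and `a` and return to `s`, with expansion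
    -- vertices `z b`, `x a b` and `y a`. The six events are the remaining coincidences of these
    -- vertices with one another and with the path. Each one, along a row or a column, hits a short
    -- list or asks a spread colouring for few values, and is therefore rare.
    item e₁ e₂ e₃ e₄ e₅ e₆ good : V → V → Bool
    item a b = E a b ∧ E a* b
    e₁ a b = b ∈ᵇ (y a ∷ W)
    e₂ a b = x a b ∈ᵇ (y a ∷ W)
    e₃ a b = z b ∈ᵇ W
    e₄ a b = a ∈ᵇ (z b ∷ W)
    e₅ a b = y a ∈ᵇ (z b ∷ W)
    e₆ a b = x a b ∈ᵇ (z b ∷ [])
    good a b = item a b ∧ not (e₁ a b ∨ (e₂ a b ∨ (e₃ a b ∨ (e₄ a b ∨ (e₅ a b ∨ e₆ a b)))))

    item⁻ : ∀ a b → item a b ≡ true → F a b ≡ true × F a s ≡ true × F a* b ≡ true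
    item⁻ a b e = let i , j = ∧-true⁻ (E a b) e in E⊂F a b i , E-hub a b i , E⊂F a* b j

    many-items : n * n ≤ K₃ * K₃ * #pairs item
    many-items = begin
      n * n                                        ≤⟨ *-monoʳ-≤ n (E-row a* b* alive) ⟩
      n * (K₃ * # Vs (E a*))                       ≡⟨ lem n K₃ (# Vs (E a*)) ⟩
      K₃ * (n * # Vs (E a*))                       ≡⟨ cong (K₃ *_) (sym (∑-*ˡ Vs n (λ b → 𝟙 (E a* b)))) ⟩
      K₃ * ∑ Vs (λ b → n * 𝟙 (E a* b))             ≤⟨ *-monoʳ-≤ K₃ (∑-mono Vs pt) ⟩
      K₃ * ∑ Vs (λ b → K₃ * # Vs (λ a → item a b)) ≡⟨ cong (K₃ *_) (∑-*ˡ Vs K₃ (λ b → # Vs (λ a → item a b))) ⟩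
      K₃ * (K₃ * ∑ Vs (λ b → # Vs (λ a → item a b))) ≡⟨ cong (λ q → K₃ * (K₃ * q)) (sym (∑-swap Vs Vs (λ a b → 𝟙 (item a b)))) ⟩
      K₃ * (K₃ * #pairs item)                      ≡⟨ sym (*-assoc K₃ K₃ _) ⟩
      K₃ * K₃ * #pairs item                        ∎
      where
      open ≤-Reasoning
      lem : ∀ n k q → n * (k * q) ≡ k * (n * q)
      lem = solve-∀
      pt : ∀ b → n * 𝟙 (E a* b) ≤ K₃ * # Vs (λ a → item a b)
      pt b with bool-cases (E a* b)
      ... | inj₂ e = ≤-trans (≤-reflexive (trans (cong (λ q → n * 𝟙 q) e) (*-zeroʳ n))) z≤n
      ... | inj₁ e = ≤-trans (≤-reflexive (trans (cong (λ q → n * 𝟙 q) e) (*-identityʳ n)))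
              (≤-trans (E-column a* b e) (*-monoʳ-≤ K₃ (#-mono Vs λ a e′ → ∧-true⁺ e′ e)))

    b₁ : K₂ * #pairs (λ a b → item a b ∧ e₁ a b) ≤ slack
    b₁ = by-rows _ λ a → listed _ (y a ∷ W) (λ b e → proj₂ (∧-true⁻ (item a b) e)) lenW

    b₂ : K₂ * #pairs (λ a b → item a b ∧ e₂ a b) ≤ slack
    b₂ = by-rows _ λ a → coloured _ (F a) (x a) (y a ∷ W)
      (λ b e → let i , j = ∧-true⁻ (item a b) e in ∧-true⁺ (proj₁ (item⁻ a b i)) j) (rows a) lenW

    b₃ : K₂ * #pairs (λ a b → item a b ∧ e₃ a b) ≤ slack
    b₃ = by-rows _ λ a → coloured _ (F a*) (x a*) W
      (λ b e → let i , j = ∧-true⁻ (item a b) e in ∧-true⁺ (proj₂ (proj₂ (item⁻ a b i))) j) (rows a*) (≤-trans (n≤1+n _) lenW)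

    b₄ : K₂ * #pairs (λ a b → item a b ∧ e₄ a b) ≤ slack
    b₄ = by-columns _ λ b → listed _ (z b ∷ W) (λ a e → proj₂ (∧-true⁻ (item a b) e)) lenW

    b₅ : K₂ * #pairs (λ a b → item a b ∧ e₅ a b) ≤ slack
    b₅ = by-columns _ λ b → coloured _ (λ a → F a s) (λ a → x a s) (z b ∷ W)
      (λ a e → let i , j = ∧-true⁻ (item a b) e in ∧-true⁺ (proj₁ (proj₂ (item⁻ a b i))) j) (columns s) lenW

    b₆ : K₂ * #pairs (λ a b → item a b ∧ e₆ a b) ≤ slack
    b₆ = by-columns _ λ b → coloured _ (λ a → F a b) (λ a → x a b) (z b ∷ [])
      (λ a e → let i , j = ∧-true⁻ (item a b) e in ∧-true⁺ (proj₁ (item⁻ a b i)) j) (columns b) (≤-trans (s≤s z≤n) lenW)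

    many-good-items : n * n ≤ 2 * (K₃ * K₃) * #pairs good
    many-good-items = many-good K₂ (K₃ * K₃) w n (#pairs item) (#pairs good) 0<K₂ many-items split K₂≥′ n≥′
      where
      open ≤-Reasoning
      N₁ = #pairs (λ a b → item a b ∧ e₁ a b)
      N₂ = #pairs (λ a b → item a b ∧ e₂ a b)
      N₃ = #pairs (λ a b → item a b ∧ e₃ a b)
      N₄ = #pairs (λ a b → item a b ∧ e₄ a b)
      N₅ = #pairs (λ a b → item a b ∧ e₅ a b)
      N₆ = #pairs (λ a b → item a b ∧ e₆ a b)
      all-bad : V → V → Bool
      all-bad a b = e₁ a b ∨ (e₂ a b ∨ (e₃ a b ∨ (e₄ a b ∨ (e₅ a b ∨ e₆ a b))))
      union : #pairs (λ a b → item a b ∧ all-bad a b) ≤ N₁ + (N₂ + (N₃ + (N₄ + (N₅ + N₆))))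
      union = ≤-trans (#pairs-∨ item e₁ (λ a b → e₂ a b ∨ (e₃ a b ∨ (e₄ a b ∨ (e₅ a b ∨ e₆ a b))))) (+-monoʳ-≤ N₁
        (≤-trans (#pairs-∨ item e₂ (λ a b → e₃ a b ∨ (e₄ a b ∨ (e₅ a b ∨ e₆ a b)))) (+-monoʳ-≤ N₂
        (≤-trans (#pairs-∨ item e₃ (λ a b → e₄ a b ∨ (e₅ a b ∨ e₆ a b))) (+-monoʳ-≤ N₃
        (≤-trans (#pairs-∨ item e₄ (λ a b → e₅ a b ∨ e₆ a b)) (+-monoʳ-≤ N₄ (#pairs-∨ item e₅ e₆))))))))
      lem : ∀ k a b c d e f g → k * (a + (b + (c + (d + (e + (f + g)))))) ≡ k * a + (k * b + (k * c + (k * d + (k * e + (k * f + k * g)))))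
      lem = solve-∀
      six : ∀ q → q + (q + (q + (q + (q + q)))) ≡ 6 * q
      six = solve-∀
      split : K₂ * #pairs item ≤ K₂ * #pairs good + 6 * slack
      split = begin
        K₂ * #pairs item
          ≡⟨ cong (K₂ *_) (trans (∑-cong Vs λ a → #-split Vs (item a) (all-bad a)) (trans (∑-+ Vs _ _) (+-comm _ (#pairs good)))) ⟩
        K₂ * (#pairs good + #pairs (λ a b → item a b ∧ all-bad a b))
          ≤⟨ *-monoʳ-≤ K₂ (+-monoʳ-≤ (#pairs good) union) ⟩
        K₂ * (#pairs good + (N₁ + (N₂ + (N₃ + (N₄ + (N₅ + N₆))))))
          ≡⟨ lem K₂ (#pairs good) N₁ N₂ N₃ N₄ N₅ N₆ ⟩
        K₂ * #pairs good + (K₂ * N₁ + (K₂ * N₂ + (K₂ * N₃ + (K₂ * N₄ + (K₂ * N₅ + K₂ * N₆)))))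
          ≤⟨ +-monoʳ-≤ (K₂ * #pairs good) (+-mono-≤ b₁ (+-mono-≤ b₂ (+-mono-≤ b₃ (+-mono-≤ b₄ (+-mono-≤ b₅ b₆))))) ⟩
        K₂ * #pairs good + (slack + (slack + (slack + (slack + (slack + slack)))))
          ≡⟨ cong (K₂ * #pairs good +_) (six slack) ⟩
        K₂ * #pairs good + 6 * slack ∎

    record Good (a b : V) : Set where
      field
        ab : F a b ≡ true
        as : F a s ≡ true
        a*b : F a* b ≡ true
        b∉ : b ∉ y a ∷ W
        x∉ : x a b ∉ y a ∷ W
        z∉ : z b ∉ W
        a∉ : a ∉ z b ∷ W
        y∉ : y a ∉ z b ∷ W
        x≢z : x a b ≢ z b

    not-∨⁻ : ∀ p {q} → not (p ∨ q) ≡ true → not p ≡ true × not q ≡ true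
    not-∨⁻ false e = refl , e

    good⁻ : ∀ a b → good a b ≡ true → Good a b
    good⁻ a b e =
      let i , n₀ = ∧-true⁻ (item a b) e
          f₁ , n₁ = not-∨⁻ (e₁ a b) n₀
          f₂ , n₂ = not-∨⁻ (e₂ a b) n₁
          f₃ , n₃ = not-∨⁻ (e₃ a b) n₂
          f₄ , n₄ = not-∨⁻ (e₄ a b) n₃
          f₅ , f₆ = not-∨⁻ (e₅ a b) n₄
          ab , as , a*b = item⁻ a b i
      in record { ab = ab ; as = as ; a*b = a*b ; b∉ = not-∈ᵇ⁻ b (y a ∷ W) f₁ ; x∉ = not-∈ᵇ⁻ (x a b) (y a ∷ W) f₂
                ; z∉ = not-∈ᵇ⁻ (z b) W f₃ ; a∉ = not-∈ᵇ⁻ a (z b ∷ W) f₄ ; y∉ = not-∈ᵇ⁻ (y a) (z b ∷ W) f₅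
                ; x≢z = ∉-head (not-∈ᵇ⁻ (x a b) (z b ∷ []) f₆) }

    -- The edges from `a*` to `b`, from `b` to `a` and from `a` to `s` complete the 2p + 1 edges of
    -- the path.
    even-cycle : CycleAvoiding Cov (4 + (p + p)) Z
    even-cycle =
      let (a , b) , _ , e = #-pos pairs (λ q → good (proj₁ q) (proj₂ q)) (n≢0⇒n>0 pos)
          open Good (good⁻ a b e)
          a≢b , x≢a , x≢b = F-distinct a b ab
          _ , y≢a , _ = F-distinct a s as
          _ , _ , z≢b = F-distinct a* b a*b
          a∉Z , b∉Z , x∉Z = F-avoid a b ab
      in chain⇒cycle (y a) Z (s≤s z≤n)
           (step a (x a b) (step b (z b) chain (cov₂ a* b a*b)) (cov₁ a b ab))
           (extend-unique (∉-cons a≢b a∉) (∉-cons x≢b (∉-cons x≢z (∉-tail x∉))) (λ eq → x≢a (sym eq))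
             (extend-unique (∉-tail b∉) z∉ (λ eq → z≢b (sym eq)) uniq))
           (∉-cons y≢a (∉-cons (λ eq → ∉-head x∉ (sym eq)) (∉-cons (λ eq → ∉-head b∉ (sym eq)) y∉)))
           (cov₂ a s as)
           (a∉Z ∷ x∉Z ∷ b∉Z ∷ proj₂ (proj₂ (F-avoid a* b a*b)) ∷ avoid) (proj₂ (proj₂ (F-avoid a s as)))
      where
      pos : # pairs (λ q → good (proj₁ q) (proj₂ q)) ≢ 0
      pos e = <⇒≱ (*-mono-< 0<n 0<n) (≤-trans many-good-items (≤-reflexive (trans (cong (2 * (K₃ * K₃) *_)
        (trans (sym (#pairs-list (λ q → good (proj₁ q) (proj₂ q)))) e)) (*-zeroʳ (2 * (K₃ * K₃))))))

    module _ (room′ : 2 * (2 * (K₃ * K₃)) * (8 * ramseyBound 3 3) ≤ K₂) where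

      M = ramseyBound 3 3

      -- The good pairs number of order n² and have only `n` possible colours. A row or column holds
      -- at most n/K₂ pairs of one colour, so linearly many pairs of the same colour contain a
      -- matching of any prescribed constant size.
      popular-colour : ∃ λ x₀ → n ≤ 2 * (K₃ * K₃) * #pairs (λ a b → good a b ∧ ⌊ x a b Fin.≟ x₀ ⌋)
      popular-colour =
        let x₀ , _ , e = averaging Vs (λ x₀ → #pairs (λ a b → good a b ∧ ⌊ x a b Fin.≟ x₀ ⌋)) (2 * (K₃ * K₃)) n
                           (subst (0 <_) (sym lenVs) 0<n)
                           (≤-trans (≤-reflexive (cong (_* n) lenVs)) (≤-trans many-good-items (*-monoʳ-≤ (2 * (K₃ * K₃)) by-colour)))
        in x₀ , e
        where
        pt : ∀ a b → 𝟙 (good a b) ≤ ∑ Vs (λ x₀ → 𝟙 (good a b ∧ ⌊ x a b Fin.≟ x₀ ⌋))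
        pt a b = ≤-trans (≤-reflexive (cong 𝟙 (sym (trans (cong (good a b ∧_) (⌊⌋-true⁺ (x a b Fin.≟ x a b) refl)) (Boolₚ.∧-identityʳ (good a b))))))
          (∑-∈ (λ x₀ → 𝟙 (good a b ∧ ⌊ x a b Fin.≟ x₀ ⌋)) (∈ₚ.∈-allFin (x a b)))
        by-colour : #pairs good ≤ ∑ Vs (λ x₀ → #pairs (λ a b → good a b ∧ ⌊ x a b Fin.≟ x₀ ⌋))
        by-colour = ≤-trans (∑-mono Vs λ a → ≤-trans (∑-mono Vs (pt a)) (≤-reflexive (∑-swap Vs Vs (λ b x₀ → 𝟙 (good a b ∧ ⌊ x a b Fin.≟ x₀ ⌋)))))
          (≤-reflexive (∑-swap Vs Vs (λ a x₀ → # Vs (λ b → good a b ∧ ⌊ x a b Fin.≟ x₀ ⌋))))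

      module Class (x₀ : V) (dense-class : n ≤ 2 * (K₃ * K₃) * #pairs (λ a b → good a b ∧ ⌊ x a b Fin.≟ x₀ ⌋)) where

        class : V → V → Bool
        class a b = good a b ∧ ⌊ x a b Fin.≟ x₀ ⌋

        class⁻ : ∀ a b → class a b ≡ true → Good a b × x a b ≡ x₀
        class⁻ a b e = let i , j = ∧-true⁻ (good a b) e in good⁻ a b i , ⌊⌋-true⁻ (x a b Fin.≟ x₀) j

        near : V × V → List V
        near (a , b) = a ∷ b ∷ y a ∷ z b ∷ []

        Away : V × V → V × V → Set
        Away (a′ , b′) q = a′ ∉ near q × b′ ∉ near q

        class-row : ∀ a → K₂ * # Vs (class a) ≤ n
        class-row a = ≤-trans (*-monoʳ-≤ K₂ (#-mono Vs λ b e → let i , j = ∧-true⁻ (good a b) e in ∧-true⁺ (Good.ab (good⁻ a b i)) j)) (rows a x₀)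

        class-column : ∀ b → K₂ * # Vs (λ a → class a b) ≤ n
        class-column b = ≤-trans (*-monoʳ-≤ K₂ (#-mono Vs λ a e → let i , j = ∧-true⁻ (good a b) e in ∧-true⁺ (Good.ab (good⁻ a b i)) j)) (columns b x₀)

        blocked-rows : ∀ (Q : V → V → Bool) S → (∀ v → K₂ * # Vs (Q v) ≤ n) → K₂ * #pairs (λ v u → (v ∈ᵇ S) ∧ Q v u) ≤ length S * n
        blocked-rows Q S h = begin
          K₂ * #pairs (λ v u → (v ∈ᵇ S) ∧ Q v u)              ≡⟨ sym (∑-*ˡ Vs K₂ (λ v → # Vs (λ u → (v ∈ᵇ S) ∧ Q v u))) ⟩
          ∑ Vs (λ v → K₂ * # Vs (λ u → (v ∈ᵇ S) ∧ Q v u))     ≤⟨ ∑-mono Vs pt ⟩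
          ∑ Vs (λ v → n * 𝟙 (v ∈ᵇ S))                         ≡⟨ ∑-*ˡ Vs n (λ v → 𝟙 (v ∈ᵇ S)) ⟩
          n * # Vs (_∈ᵇ S)                                    ≤⟨ *-monoʳ-≤ n (#-∈ᵇ Vs S uVs) ⟩
          n * length S                                        ≡⟨ *-comm n (length S) ⟩
          length S * n                                        ∎
          where
          open ≤-Reasoning
          at : ∀ c v → K₂ * # Vs (λ u → c ∧ Q v u) ≤ n * 𝟙 c
          at true  v = ≤-trans (h v) (≤-reflexive (sym (*-identityʳ n)))
          at false v = ≤-reflexive (trans (cong (K₂ *_) (trans (∑-const Vs 0) (*-zeroʳ (length Vs)))) (trans (*-zeroʳ K₂) (sym (*-zeroʳ n))))
          pt : ∀ v → K₂ * # Vs (λ u → (v ∈ᵇ S) ∧ Q v u) ≤ n * 𝟙 (v ∈ᵇ S)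
          pt v = at (v ∈ᵇ S) v

        away-from : ∀ S → length S ≤ 4 * M → ∃ λ a → ∃ λ b → class a b ≡ true × a ∉ S × b ∉ S
        away-from S len =
          let (a , b) , _ , e = #-pos pairs (λ q → free (proj₁ q) (proj₂ q)) (n≢0⇒n>0 pos)
              i , j = ∧-true⁻ (class a b) e
              k , l = not-∨⁻ (a ∈ᵇ S) j
          in a , b , i , not-∈ᵇ⁻ a S k , not-∈ᵇ⁻ b S l
          where
          free : V → V → Bool
          free a b = class a b ∧ not ((a ∈ᵇ S) ∨ (b ∈ᵇ S))
          blocked = #pairs (λ a b → class a b ∧ ((a ∈ᵇ S) ∨ (b ∈ᵇ S)))
          few : K₂ * blocked ≤ 8 * M * n
          few = begin
            K₂ * blocked
              ≤⟨ *-monoʳ-≤ K₂ (#pairs-∨ class (λ a b → a ∈ᵇ S) (λ a b → b ∈ᵇ S)) ⟩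
            K₂ * (#pairs (λ a b → class a b ∧ (a ∈ᵇ S)) + #pairs (λ a b → class a b ∧ (b ∈ᵇ S)))
              ≡⟨ *-distribˡ-+ K₂ _ _ ⟩
            K₂ * #pairs (λ a b → class a b ∧ (a ∈ᵇ S)) + K₂ * #pairs (λ a b → class a b ∧ (b ∈ᵇ S))
              ≤⟨ +-mono-≤
                   (≤-trans (*-monoʳ-≤ K₂ (#pairs-mono λ a b e → let i , j = ∧-true⁻ (class a b) e in ∧-true⁺ j i)) (blocked-rows class S class-row))
                   (≤-trans (*-monoʳ-≤ K₂ (≤-trans (#pairs-mono λ a b e → let i , j = ∧-true⁻ (class a b) e in ∧-true⁺ j i)
                      (≤-reflexive (∑-swap Vs Vs (λ a b → 𝟙 ((b ∈ᵇ S) ∧ class a b)))))) (blocked-rows (λ b a → class a b) S class-column)) ⟩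
            length S * n + length S * n
              ≤⟨ +-mono-≤ (*-monoˡ-≤ n len) (*-monoˡ-≤ n len) ⟩
            4 * M * n + 4 * M * n
              ≡⟨ lem M n ⟩
            8 * M * n ∎
            where
            open ≤-Reasoning
            lem : ∀ m n → 4 * m * n + 4 * m * n ≡ 8 * m * n
            lem = solve-∀
          pos : # pairs (λ q → free (proj₁ q) (proj₂ q)) ≢ 0
          pos e = <-irrefl refl (≤-trans (matching-room K₂ (2 * (K₃ * K₃)) (8 * M) n (#pairs class) blocked 0<K₂ 0<n dense-class few room′)
            (≤-reflexive (trans (∑-cong Vs λ a → #-split Vs (class a) (λ b → (a ∈ᵇ S) ∨ (b ∈ᵇ S)))
              (trans (∑-+ Vs _ _) (trans (cong (blocked +_) (trans (sym (#pairs-list (λ q → free (proj₁ q) (proj₂ q)))) e)) (+-identityʳ blocked))))))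

        Matching : ℕ → Set
        Matching m = Σ (List (V × V)) λ qs → length qs ≡ m × All (λ q → class (proj₁ q) (proj₂ q) ≡ true) qs × AllPairs Away qs

        length-near : ∀ qs → length (concatMap near qs) ≡ 4 * length qs
        length-near []       = refl
        length-near (q ∷ qs) = trans (cong (4 +_) (length-near qs)) (sym (*-suc 4 (length qs)))

        near-away : ∀ {v} qs → v ∉ concatMap near qs → All (λ q → v ∉ near q) qs
        near-away []       _  = []
        near-away (q ∷ qs) v∉ = (λ v∈ → v∉ (∈ₚ.∈-++⁺ˡ v∈)) ∷ near-away qs (λ v∈ → v∉ (∈ₚ.∈-++⁺ʳ (near q) v∈))

        matching : ∀ m → m ≤ M → Matching m
        matching zero    _  = [] , refl , [] , []
        matching (suc m) le =
          let qs , len , all , ap = matching m (≤-trans (n≤1+n m) le)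
              a , b , e , a∉ , b∉ = away-from (concatMap near qs) (≤-trans (≤-reflexive (trans (length-near qs) (cong (4 *_) len))) (*-monoʳ-≤ 4 (≤-trans (n≤1+n m) le)))
          in (a , b) ∷ qs , cong suc len , e ∷ all , All.zip (near-away qs a∉ , near-away qs b∉) ∷ ap

        z≟a z≟b y≟z : V × V → V × V → Bool
        z≟a (_ , b′) (a , _) = ⌊ z b′ Fin.≟ a ⌋
        z≟b (_ , b′) (_ , b) = ⌊ z b′ Fin.≟ b ⌋
        y≟z (_ , b′) (a , _) = ⌊ y a Fin.≟ z b′ ⌋

        Compatible : V × V → V × V → Set
        Compatible (a′ , b′) (a , b) = class a′ b′ ≡ true × class a b ≡ true × Away (a′ , b′) (a , b) × z b′ ≢ a × z b′ ≢ b × y a ≢ z b′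

        homogeneous-false : ∀ (P : V × V → V × V → Bool) {u₃ u₂ u₁} → Homogeneous P (u₃ ∷ u₂ ∷ u₁ ∷ []) →
          (P u₃ u₂ ≡ true → P u₃ u₁ ≡ true → P u₂ u₁ ≡ true → Empty) → P u₃ u₂ ≡ false
        homogeneous-false P (false , (e ∷ _) ∷ _) _ = e
        homogeneous-false P (true , (e₁ ∷ e₂ ∷ []) ∷ (e₃ ∷ []) ∷ _) h = ⊥-elim (h e₁ e₂ e₃)

        ≟-false : ∀ {u v : V} → ⌊ u Fin.≟ v ⌋ ≡ false → u ≢ v
        ≟-false {u} {v} e eq = case trans (sym (⌊⌋-true⁺ (u Fin.≟ v) eq)) e of λ ()

        -- None of the relations can hold throughout the triple. In the first two, `z b₃` would
        -- equal both a₂ and a₁, or both b₂ and b₁, which `Away` excludes. In the third, y a₂ = z b₃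
        -- = y a₁ = z b₂, although (a₂, b₂) is good. By homogeneity they fail for the first two
        -- pairs.
        triple : ∀ qs → length qs ≡ 3 → All (λ q → class (proj₁ q) (proj₂ q) ≡ true) qs → AllPairs Away qs →
          (∀ P → P ∈ z≟a ∷ z≟b ∷ y≟z ∷ [] → Homogeneous P qs) → ∃ λ u → ∃ λ v → Compatible u v
        triple (u₃@(a₃ , b₃) ∷ u₂@(a₂ , b₂) ∷ u₁@(a₁ , b₁) ∷ []) _ (c₃ ∷ c₂ ∷ c₁ ∷ []) ((w₃₂ ∷ _) ∷ (w₂₁ ∷ []) ∷ _) hom =
          u₃ , u₂ , c₃ , c₂ , w₃₂ ,
          ≟-false (homogeneous-false z≟a (hom _ (here refl)) λ e e′ _ →
            ∉-head (proj₁ w₂₁) (trans (sym (⌊⌋-true⁻ (z b₃ Fin.≟ a₂) e)) (⌊⌋-true⁻ (z b₃ Fin.≟ a₁) e′))) ,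
          ≟-false (homogeneous-false z≟b (hom _ (there (here refl))) λ e e′ _ →
            ∉-head (∉-tail (proj₂ w₂₁)) (trans (sym (⌊⌋-true⁻ (z b₃ Fin.≟ b₂) e)) (⌊⌋-true⁻ (z b₃ Fin.≟ b₁) e′))) ,
          ≟-false (homogeneous-false y≟z (hom _ (there (there (here refl)))) λ e e′ e″ →
            ∉-head (Good.y∉ (proj₁ (class⁻ a₂ b₂ c₂))) (trans (⌊⌋-true⁻ (y a₂ Fin.≟ z b₃) e)
              (trans (sym (⌊⌋-true⁻ (y a₁ Fin.≟ z b₃) e′)) (⌊⌋-true⁻ (y a₁ Fin.≟ z b₂) e″))))

        compatible : ∃ λ u → ∃ λ v → Compatible u v
        compatible =
          let qs , len , all , ap = matching M ≤-refl
              ts , τ , len₃ , hom = homogeneous-sublist (z≟a ∷ z≟b ∷ y≟z ∷ []) 3 qs (≤-reflexive (sym len))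
          in triple ts len₃ (⊑ₚ.All-resp-⊆ τ all) (⊑-AllPairs τ ap) hom

        -- The parity changes because the common colour itself becomes a core vertex: the path
        -- continues from `a*` through b′, `x a b` and `a` to `s`, and a′ and `b` are now expansion
        -- vertices. That makes four more edges instead of three.
        close-odd : ∀ {a′ b′ a b} → Good a′ b′ → Good a b → x a′ b′ ≡ x a b → Away (a′ , b′) (a , b) →
          z b′ ≢ a → z b′ ≢ b → y a ≢ z b′ → CycleAvoiding Cov (5 + (p + p)) Z
        close-odd {a′} {b′} {a} {b} G′ G XX (a′∉ , b′∉) z≢a z≢b y≢z′ =
          let module G′ = Good G′
              module G = Good G
              a≢b , x≢a , x≢b = F-distinct a b G.ab
              _ , y≢a , _ = F-distinct a s G.as
              a′≢b′ , x≢a′ , x≢b′ = F-distinct a′ b′ G′.ab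
              _ , _ , z≢b′ = F-distinct a* b′ G′.a*b
              a∉Z , b∉Z , x∉Z = F-avoid a b G.ab
              a′∉Z , b′∉Z , _ = F-avoid a′ b′ G′.ab
          in chain⇒cycle (y a) Z (s≤s z≤n)
               (step a b (step (x a b) a′ (step b′ (z b′) chain (cov₂ a* b′ G′.a*b))
                  (subst (λ v → Cov (v ∷ b′ ∷ a′ ∷ [])) XX (cov₃ a′ b′ G′.ab))) (cov₄ a b G.ab))
               (extend-unique
                 (∉-cons (λ eq → x≢a (sym eq)) (∉-cons (λ eq → ∉-head a′∉ (sym eq)) (∉-cons (λ eq → ∉-head b′∉ (sym eq)) (∉-cons (λ eq → z≢a (sym eq)) (∉-tail G.a∉)))))
                 (∉-cons (λ eq → x≢b (sym eq)) (∉-cons (λ eq → ∉-head (∉-tail a′∉) (sym eq)) (∉-cons (λ eq → ∉-head (∉-tail b′∉) (sym eq)) (∉-cons (λ eq → z≢b (sym eq)) (∉-tail G.b∉)))))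
                 a≢b
                 (extend-unique
                   (subst (_∉ b′ ∷ z b′ ∷ W) XX (∉-cons x≢b′ (∉-cons G′.x≢z (∉-tail G′.x∉))))
                   (∉-cons a′≢b′ G′.a∉)
                   (λ eq → x≢a′ (trans XX eq))
                   (extend-unique (∉-tail G′.b∉) G′.z∉ (λ eq → z≢b′ (sym eq)) uniq)))
               (∉-cons y≢a (∉-cons (λ eq → ∉-head G.b∉ (sym eq)) (∉-cons (λ eq → ∉-head G.x∉ (sym eq))
                 (∉-cons (λ eq → ∉-head (∉-tail (∉-tail a′∉)) (sym eq)) (∉-cons (λ eq → ∉-head (∉-tail (∉-tail b′∉)) (sym eq)) (∉-cons y≢z′ (∉-tail G.y∉)))))))
               (cov₂ a s G.as)
               (a∉Z ∷ b∉Z ∷ x∉Z ∷ a′∉Z ∷ b′∉Z ∷ proj₂ (proj₂ (F-avoid a* b′ G′.a*b)) ∷ avoid) (proj₂ (proj₂ (F-avoid a s G.as)))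

        odd-cycle′ : CycleAvoiding Cov (5 + (p + p)) Z
        odd-cycle′ = let u , v , cp = compatible in finish u v cp
          where
          finish : ∀ u v → Compatible u v → CycleAvoiding Cov (5 + (p + p)) Z
          finish (a′ , b′) (a , b) (c′ , c , aw , z≢a , z≢b , y≢z) =
            close-odd (proj₁ (class⁻ a′ b′ c′)) (proj₁ (class⁻ a b c)) (trans (proj₂ (class⁻ a′ b′ c′)) (sym (proj₂ (class⁻ a b c)))) aw z≢a z≢b y≢z

      odd-cycle : CycleAvoiding Cov (5 + (p + p)) Z
      odd-cycle = Class.odd-cycle′ (proj₁ popular-colour) (proj₂ popular-colour)

-- At most 2zn pairs have an end in the avoided set and at most z n²/k have their colour in it.
-- Either loss is at most n²/(4K), so half of the pairs remain.
thinning-dense : ∀ k K z n P G → 0 < k → n * n ≤ K * P → k * P ≤ k * G + (2 * k * (z * n) + z * n * n) →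
  4 * K * z ≤ k → 8 * K * z ≤ n → n * n ≤ 2 * K * G
thinning-dense k K z n P G 0<k dense split k≥ n≥ = *-cancelˡ-≤ (2 * k) {{>-nonZero (*-mono-< {0} {2} (s≤s z≤n) 0<k)}}
  (+-cancelʳ-≤ (2 * (k * (n * n))) _ _ (begin
  2 * k * (n * n) + 2 * (k * (n * n))                          ≡⟨ lem₁ k (n * n) ⟩
  4 * k * (n * n)                                              ≤⟨ *-monoʳ-≤ (4 * k) dense ⟩
  4 * k * (K * P)                                              ≡⟨ lem₂ k K P ⟩
  4 * K * (k * P)                                              ≤⟨ *-monoʳ-≤ (4 * K) split ⟩
  4 * K * (k * G + (2 * k * (z * n) + z * n * n))              ≡⟨ lem₃ k K z n G ⟩
  2 * k * (2 * K * G) + (k * (8 * K * z * n) + 4 * K * z * (n * n))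
    ≤⟨ +-monoʳ-≤ (2 * k * (2 * K * G)) (+-mono-≤ (*-monoʳ-≤ k (*-monoˡ-≤ n n≥)) (*-monoˡ-≤ (n * n) k≥)) ⟩
  2 * k * (2 * K * G) + (k * (n * n) + k * (n * n))            ≡⟨ cong (2 * k * (2 * K * G) +_) (lem₄ (k * (n * n))) ⟩
  2 * k * (2 * K * G) + 2 * (k * (n * n))                      ∎))
  where
  open ≤-Reasoning
  lem₁ : ∀ k x → 2 * k * x + 2 * (k * x) ≡ 4 * k * x
  lem₁ = solve-∀
  lem₂ : ∀ k l x → 4 * k * (l * x) ≡ 4 * l * (k * x)
  lem₂ = solve-∀
  lem₃ : ∀ k K z n G → 4 * K * (k * G + (2 * k * (z * n) + z * n * n)) ≡ 2 * k * (2 * K * G) + (k * (8 * K * z * n) + 4 * K * z * (n * n))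
  lem₃ = solve-∀
  lem₄ : ∀ x → x + x ≡ 2 * x
  lem₄ = solve-∀

cycle-length : ∀ ℓ → 4 ≤ ℓ → ∃ λ p → (ℓ ≡ 4 + (p + p) ⊎ ℓ ≡ 5 + (p + p))
cycle-length ℓ 4≤ = let p , e = go (ℓ ∸ 4) in p , [ (λ e → inj₁ (back e)) , (λ e → inj₂ (back e)) ]′ e
  where
  back : ∀ {x} → ℓ ∸ 4 ≡ x → ℓ ≡ 4 + x
  back e = trans (sym (m+[n∸m]≡n 4≤)) (cong (4 +_) e)
  go : ∀ m → ∃ λ p → (m ≡ p + p ⊎ m ≡ suc (p + p))
  go zero          = 0 , inj₁ refl
  go (suc zero)    = 0 , inj₂ refl
  go (suc (suc m)) = let p , e = go m in suc p ,
    [ (λ e → inj₁ (cong suc (trans (cong suc e) (sym (+-suc p p))))) , (λ e → inj₂ (cong (suc ∘ suc) (trans e (sym (+-suc p p))))) ]′ e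

𝟙-thin : ∀ f a b c → 𝟙 f ≤ 𝟙 (f ∧ (not a ∧ (not b ∧ not c))) + (𝟙 a + (𝟙 b + 𝟙 (f ∧ c)))
𝟙-thin false _     _     _     = z≤n
𝟙-thin true  true  _     _     = s≤s z≤n
𝟙-thin true  false true  _     = s≤s z≤n
𝟙-thin true  false false true  = s≤s z≤n
𝟙-thin true  false false false = s≤s z≤n

-- Thinning replaces `K` by 2K, the hub turns this into 8(2K)³, and the minimum degree costs a
-- further factor 4. A path with parameter p has 3 + 4p vertices and `advance` adds two more to its
-- forbidden list, hence 5 + 4L.
hubConst degConst widthConst : ℕ → ℕ
hubConst K = 8 * (2 * K) * (2 * K) * (2 * K)
degConst K = 4 * hubConst K
widthConst L = 5 + 4 * L

spreadConst : ℕ → ℕ → ℕ → ℕ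
spreadConst K z L = suc (4 * K * z + (4 * degConst K * widthConst L + (24 * (degConst K * degConst K) * widthConst L
  + 2 * (2 * (degConst K * degConst K)) * (8 * ramseyBound 3 3))))

sizeConst : ℕ → ℕ → ℕ → ℕ
sizeConst K z L = suc (8 * K * z + (4 * degConst K * widthConst L + 24 * (degConst K * degConst K) * widthConst L))

module NonStarryCycles {n : ℕ} (v₀ : Fin n) (Cov : List (Fin n) → Set)
  (mono : ∀ {e f} → (∀ v → v ∈ e → v ∈ f) → Cov f → Cov e)
  (K₂ : ℕ) (0<K₂ : 0 < K₂) (0<n : 0 < n)
  (F : Fin n → Fin n → Bool) (x : Fin n → Fin n → Fin n)
  (F-cov : ∀ a b → F a b ≡ true → Cov (x a b ∷ a ∷ b ∷ []))
  (F-distinct : ∀ a b → F a b ≡ true → a ≢ b × x a b ≢ a × x a b ≢ b)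
  (rows : ∀ a → NonStarry.Spread K₂ 0<K₂ 0<n (F a) (x a))
  (columns : ∀ b → NonStarry.Spread K₂ 0<K₂ 0<n (λ a → F a b) (λ a → x a b))
  (K : ℕ) (0<K : 0 < K) (dense : n * n ≤ K * RichSubgraph.#pairs 0<n F) where

  open NonStarry K₂ 0<K₂ 0<n
  open RichSubgraph 0<n
  open Assembly 0 using (CycleAvoiding)

  private V = Fin n

  module _ (Z : List V) where

    thin : V → V → Bool
    thin a b = F a b ∧ (not (a ∈ᵇ Z) ∧ (not (b ∈ᵇ Z) ∧ not (x a b ∈ᵇ Z)))

    thin⊂F : ∀ a b → thin a b ≡ true → F a b ≡ true
    thin⊂F a b e = proj₁ (∧-true⁻ (F a b) e)

    thin-avoid : ∀ a b → thin a b ≡ true → a ∉ Z × b ∉ Z × x a b ∉ Z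
    thin-avoid a b e =
      let _ , e₁ = ∧-true⁻ (F a b) e ; f , e₂ = ∧-true⁻ (not (a ∈ᵇ Z)) e₁ ; g , h = ∧-true⁻ (not (b ∈ᵇ Z)) e₂
      in not-∈ᵇ⁻ a Z f , not-∈ᵇ⁻ b Z g , not-∈ᵇ⁻ (x a b) Z h

    hit : V → V → Bool
    hit a b = F a b ∧ (x a b ∈ᵇ Z)

    thin-split : K₂ * #pairs F ≤ K₂ * #pairs thin + (2 * K₂ * (length Z * n) + length Z * n * n)
    thin-split = begin
      K₂ * #pairs F
        ≤⟨ *-monoʳ-≤ K₂ pointwise ⟩
      K₂ * (#pairs thin + (A₁ + (A₂ + #pairs hit)))
        ≡⟨ lem₁ K₂ (#pairs thin) A₁ A₂ (#pairs hit) ⟩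
      K₂ * #pairs thin + ((K₂ * A₁ + K₂ * A₂) + K₂ * #pairs hit)
        ≤⟨ +-monoʳ-≤ (K₂ * #pairs thin) (+-mono-≤ (+-mono-≤ (*-monoʳ-≤ K₂ le₁) (*-monoʳ-≤ K₂ le₂)) le₃) ⟩
      K₂ * #pairs thin + ((K₂ * (length Z * n) + K₂ * (length Z * n)) + length Z * n * n)
        ≡⟨ cong (λ q → K₂ * #pairs thin + (q + length Z * n * n)) (lem₂ K₂ (length Z * n)) ⟩
      K₂ * #pairs thin + (2 * K₂ * (length Z * n) + length Z * n * n) ∎
      where
      open ≤-Reasoning
      A₁ = ∑ Vs (λ a → # Vs (λ b → a ∈ᵇ Z))
      A₂ = ∑ Vs (λ a → # Vs (λ b → b ∈ᵇ Z))
      lem₁ : ∀ k t a b c → k * (t + (a + (b + c))) ≡ k * t + ((k * a + k * b) + k * c)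
      lem₁ = solve-∀
      lem₂ : ∀ k q → k * q + k * q ≡ 2 * k * q
      lem₂ = solve-∀
      pointwise : #pairs F ≤ #pairs thin + (A₁ + (A₂ + #pairs hit))
      pointwise = ≤-trans (∑-mono Vs λ a → ≤-trans (∑-mono Vs λ b → 𝟙-thin (F a b) (a ∈ᵇ Z) (b ∈ᵇ Z) (x a b ∈ᵇ Z))
          (≤-reflexive (trans (∑-+ Vs _ _) (cong (# Vs (thin a) +_) (trans (∑-+ Vs _ _) (cong (# Vs (λ b → a ∈ᵇ Z) +_) (∑-+ Vs _ _)))))))
        (≤-reflexive (trans (∑-+ Vs _ _) (cong (#pairs thin +_) (trans (∑-+ Vs _ _) (cong (A₁ +_) (∑-+ Vs _ _))))))
      le₂ : A₂ ≤ length Z * n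
      le₂ = ≤-trans (∑-mono Vs λ a → #-∈ᵇ Vs Z uVs) (≤-reflexive (trans (∑-const Vs (length Z)) (trans (cong (_* length Z) lenVs) (*-comm n (length Z)))))
      le₁ : A₁ ≤ length Z * n
      le₁ = ≤-trans (≤-reflexive (∑-swap Vs Vs (λ a b → 𝟙 (a ∈ᵇ Z)))) le₂
      le₃ : K₂ * #pairs hit ≤ length Z * n * n
      le₃ = ≤-trans (≤-reflexive (sym (∑-*ˡ Vs K₂ (λ a → # Vs (hit a))))) (≤-trans (∑-mono Vs λ a → fibres (F a) (x a) Z (rows a))
        (≤-reflexive (trans (∑-const Vs (length Z * n)) (trans (cong (_* (length Z * n)) lenVs) (*-comm n (length Z * n))))))

    thin-rows : ∀ a → Spread (thin a) (x a)
    thin-rows a = spread-mono (thin⊂F a) (rows a)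

    thin-columns : ∀ b → Spread (λ a → thin a b) (λ a → x a b)
    thin-columns b = spread-mono (λ a → thin⊂F a b) (columns b)

    module _ (z L : ℕ) (Z≤ : length Z ≤ z) (K₂≥ : spreadConst K z L ≤ K₂) (n≥ : sizeConst K z L ≤ n) where

      thin-dense : n * n ≤ 2 * K * #pairs thin
      thin-dense = thinning-dense K₂ K (length Z) n (#pairs F) (#pairs thin) 0<K₂ dense thin-split
        (≤-trans (*-monoʳ-≤ (4 * K) Z≤) (≤-trans (m≤m+n _ _) (≤-trans (n≤1+n _) K₂≥)))
        (≤-trans (*-monoʳ-≤ (8 * K) Z≤) (≤-trans (m≤m+n _ _) (≤-trans (n≤1+n _) n≥)))

      from-hub : ∀ s → n * n ≤ hubConst K * #pairs (λ a b → thin a b ∧ thin a s) →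
        (E : V → V → Bool) → (∀ a b → E a b ≡ true → thin a b ∧ thin a s ≡ true) → (∃ λ a → ∃ λ b → E a b ≡ true) →
        (∀ a b → E a b ≡ true → n ≤ degConst K * # Vs (E a)) → (∀ a b → E a b ≡ true → n ≤ degConst K * # Vs (λ a′ → E a′ b)) →
        ∀ ℓ → 4 ≤ ℓ → ℓ ≤ L → CycleAvoiding Cov ℓ Z
      from-hub s _ E E⊂ (a₀ , b₀ , E₀) E-row E-column ℓ 4≤ ℓ≤ = close (cycle-length ℓ 4≤) ℓ≤
        where
        K₂-rest : 4 * degConst K * widthConst L + (24 * (degConst K * degConst K) * widthConst L + 2 * (2 * (degConst K * degConst K)) * (8 * ramseyBound 3 3)) ≤ K₂
        K₂-rest = ≤-trans (m≤n+m _ (4 * K * z)) (≤-trans (n≤1+n _) K₂≥)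
        n-rest : 4 * degConst K * widthConst L + 24 * (degConst K * degConst K) * widthConst L ≤ n
        n-rest = ≤-trans (m≤n+m _ (8 * K * z)) (≤-trans (n≤1+n _) n≥)
        module LC = LooseCycles v₀ Cov mono K₂ 0<K₂ 0<n Z thin x (λ a b e → F-cov a b (thin⊂F a b e)) (λ a b e → F-distinct a b (thin⊂F a b e)) thin-avoid
          thin-rows thin-columns s E (λ a b e → proj₁ (∧-true⁻ (thin a b) (E⊂ a b e))) (λ a b e → proj₂ (∧-true⁻ (thin a b) (E⊂ a b e)))
          (degConst K) E-row E-column a₀ b₀ E₀ (widthConst L)
          (≤-trans (m≤m+n _ _) K₂-rest) (≤-trans (m≤m+n _ _) n-rest)
          (≤-trans (m≤m+n _ _) (≤-trans (m≤n+m _ (4 * degConst K * widthConst L)) K₂-rest)) (≤-trans (m≤n+m _ (4 * degConst K * widthConst L)) n-rest)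
        fits : ∀ p c → c + (p + p) ≤ L → 5 + 4 * p ≤ widthConst L
        fits p c le = +-monoʳ-≤ 5 (*-monoʳ-≤ 4 (≤-trans (m≤m+n p p) (≤-trans (m≤n+m (p + p) c) le)))
        close : ∀ {ℓ} → (∃ λ p → (ℓ ≡ 4 + (p + p) ⊎ ℓ ≡ 5 + (p + p))) → ℓ ≤ L → CycleAvoiding Cov ℓ Z
        close (p , inj₁ refl) le = LC.Close.even-cycle (LC.path p (fits p 4 le)) (≤-trans (n≤1+n _) (fits p 4 le))
        close (p , inj₂ refl) le = LC.Close.odd-cycle (LC.path p (fits p 5 le)) (≤-trans (n≤1+n _) (fits p 5 le))
          (≤-trans (m≤n+m _ (24 * (degConst K * degConst K) * widthConst L)) (≤-trans (m≤n+m _ (4 * degConst K * widthConst L)) K₂-rest))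

      cycles : ∀ ℓ → 4 ≤ ℓ → ℓ ≤ L → CycleAvoiding Cov ℓ Z
      cycles = use (hub (2 * K) thin thin-dense)
        where
        0<hub : 0 < hubConst K
        0<hub = *-mono-< {0} {8 * (2 * K) * (2 * K)} (*-mono-< {0} {8 * (2 * K)} (*-mono-< {0} {8} (s≤s z≤n) 0<2K) 0<2K) 0<2K
          where 0<2K : 0 < 2 * K
                0<2K = *-mono-< {0} {2} (s≤s z≤n) 0<K
        use : (∃ λ s → n * n ≤ 8 * (2 * K) * (2 * K) * (2 * K) * #pairs (λ a b → thin a b ∧ thin a s)) → ∀ ℓ → 4 ≤ ℓ → ℓ ≤ L → CycleAvoiding Cov ℓ Z
        use (s , h) = use′ (min-degree (hubConst K) (λ a b → thin a b ∧ thin a s) 0<hub h)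
          where
          use′ : _ → ∀ ℓ → 4 ≤ ℓ → ℓ ≤ L → CycleAvoiding Cov ℓ Z
          use′ (E , sub , ne , r , c) = from-hub s h E sub ne r c

nonstarry-embedding : ∀ {n} (v₀ : Fin n) Cov (mono : ∀ {e f} → (∀ v → v ∈ e → v ∈ f) → Cov f → Cov e)
  qs → All (λ q → 5 ≤ proj₁ q) qs → ∀ K → 0 < K → ∀ K₂ (0<K₂ : 0 < K₂) (0<n : 0 < n) →
  spreadConst K (size (unionPattern 3 qs)) (suc (maxLength qs)) ≤ K₂ → sizeConst K (size (unionPattern 3 qs)) (suc (maxLength qs)) ≤ n →
  (F : Fin n → Fin n → Bool) (x : Fin n → Fin n → Fin n) →
  (∀ a b → F a b ≡ true → Cov (x a b ∷ a ∷ b ∷ [])) → (∀ a b → F a b ≡ true → a ≢ b × x a b ≢ a × x a b ≢ b) →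
  (∀ a → NonStarry.Spread K₂ 0<K₂ 0<n (F a) (x a)) → (∀ b → NonStarry.Spread K₂ 0<K₂ 0<n (λ a → F a b) (λ a → x a b)) →
  n * n ≤ K * RichSubgraph.#pairs 0<n F → Σ (ℕ → Fin n) (Assembly.Embedding 0 Cov (unionPattern 3 qs))
nonstarry-embedding v₀ Cov mono qs qs≥5 K 0<K K₂ 0<K₂ 0<n K₂≥ n≥ F x F-cov F-distinct rows columns dense =
  let φ , emb , _ = Assembly.sequential-embedding 0 Cov qs (size (unionPattern 3 qs)) (All.map (≤-trans (s≤s (s≤s z≤n))) qs≥5) v₀
        (λ q Z q∈ Z≤ ℓ ℓ≥ ℓ≤ → NonStarryCycles.cycles v₀ Cov mono K₂ 0<K₂ 0<n F x F-cov F-distinct rows columns K 0<K dense Z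
          (size (unionPattern 3 qs)) (suc (maxLength qs)) Z≤ K₂≥ n≥ ℓ (≤-trans (≤-trans (n≤1+n 4) (All.lookup qs≥5 q∈)) ℓ≥) (≤-trans ℓ≤ (s≤s (maxLength-bound qs q q∈))))
        [] ≤-refl
  in φ , emb

-- Making each extension depend on one coordinate.

pair-arith : ∀ K n P N R S → n * n ≤ K * P → P ≤ N + (R + S) → ¬ (n * n ≤ 2 * K * N) →
  n * n ≤ 4 * K * R ⊎ n * n ≤ 4 * K * S
pair-arith K n P N R S dense split few with n * n ≤? 4 * K * R
... | yes h = inj₁ h
... | no nr = inj₂ (+-cancelˡ-≤ (3 * (n * n)) _ _ (begin
  3 * (n * n) + n * n                           ≡⟨ lem₁ (n * n) ⟩
  4 * (n * n)                                   ≤⟨ *-monoʳ-≤ 4 (≤-trans dense (*-monoʳ-≤ K split)) ⟩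
  4 * (K * (N + (R + S)))                       ≡⟨ lem₂ K N R S ⟩
  2 * (2 * K * N) + 4 * K * R + 4 * K * S       ≤⟨ +-monoˡ-≤ (4 * K * S) (+-mono-≤ (*-monoʳ-≤ 2 (<⇒≤ (≰⇒> few))) (<⇒≤ (≰⇒> nr))) ⟩
  2 * (n * n) + n * n + 4 * K * S               ≡⟨ cong (_+ 4 * K * S) (lem₃ (n * n)) ⟩
  3 * (n * n) + 4 * K * S                       ∎))
  where
  open ≤-Reasoning
  lem₁ : ∀ x → 3 * x + x ≡ 4 * x
  lem₁ = solve-∀
  lem₂ : ∀ K N R S → 4 * (K * (N + (R + S))) ≡ 2 * (2 * K * N) + 4 * K * R + 4 * K * S
  lem₂ = solve-∀
  lem₃ : ∀ x → 2 * x + x ≡ 3 * x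
  lem₃ = solve-∀

𝟙-two : ∀ f a b → 𝟙 f ≤ 𝟙 (f ∧ (a ∧ b)) + (𝟙 (f ∧ not a) + 𝟙 (f ∧ not b))
𝟙-two false _     _     = z≤n
𝟙-two true  true  true  = s≤s z≤n
𝟙-two true  true  false = s≤s z≤n
𝟙-two true  false _     = s≤s z≤n

module Starry {n : ℕ} (0<n : 0 < n) (K₂ : ℕ) where

  open RichSubgraph 0<n using (#pairs)
  open Boxes n using (length-allFin)

  private
    V = Fin n
    Vs = allFin n

  module _ (F : V → V → Bool) (x : V → V → V) where

    multiplicity : V → V → ℕ
    multiplicity a b = # Vs (λ b′ → F a b′ ∧ ⌊ x a b′ Fin.≟ x a b ⌋)

    light : V → V → Bool
    light a b = K₂ * multiplicity a b ≤ᵇ n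

    starry : V → V → Bool
    starry a b = F a b ∧ not (light a b)

    Star : V → Set
    Star a = (∃ λ b → b ∈ Vs × starry a b ≡ true) ⊎ (∀ b → b ∈ Vs → starry a b ≢ true)

    star? : ∀ a → Star a
    star? a = find-or-all (λ b → starry a b Boolₚ.≟ true) Vs

    -- A row with a starry pair keeps one large level set and nothing else. This retains more than
    -- n/K₂ of at most `n` pairs, so the density drops by the factor `K₂` only, and on what remains
    -- the colour is a function of the row.
    keep-star : ∀ a → Star a → V → Bool
    keep-star a (inj₁ (b , _)) b′ = F a b′ ∧ ⌊ x a b′ Fin.≟ x a b ⌋
    keep-star a (inj₂ _)       b′ = false

    restrict : V → V → Bool
    restrict a = keep-star a (star? a)

    restrict⊂F : ∀ a b → restrict a b ≡ true → F a b ≡ true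
    restrict⊂F a b = go (star? a)
      where
      go : ∀ st → keep-star a st b ≡ true → F a b ≡ true
      go (inj₁ _) e = proj₁ (∧-true⁻ (F a b) e)

    restrict-row : ∀ a b b′ → restrict a b ≡ true → restrict a b′ ≡ true → x a b ≡ x a b′
    restrict-row a b b′ = go (star? a)
      where
      go : ∀ st → keep-star a st b ≡ true → keep-star a st b′ ≡ true → x a b ≡ x a b′
      go (inj₁ (c , _)) e e′ = trans (⌊⌋-true⁻ (x a b Fin.≟ x a c) (proj₂ (∧-true⁻ (F a b) e)))
        (sym (⌊⌋-true⁻ (x a b′ Fin.≟ x a c) (proj₂ (∧-true⁻ (F a b′) e′))))

    isStar : ∀ a → Star a → Bool
    isStar a (inj₁ _) = true
    isStar a (inj₂ _) = false

    hasStar : V → Bool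
    hasStar a = isStar a (star? a)

    starry-row : ∀ a → # Vs (starry a) ≤ n * 𝟙 (hasStar a)
    starry-row a = go (star? a)
      where
      go : ∀ st → # Vs (starry a) ≤ n * 𝟙 (isStar a st)
      go (inj₁ _) = ≤-trans (#-≤length Vs _) (≤-reflexive (trans length-allFin (sym (*-identityʳ n))))
      go (inj₂ h) = ≤-trans (≤-trans (∑-mono∈ Vs λ b b∈ → zero-at b (h b b∈)) (≤-reflexive (trans (∑-const Vs 0) (*-zeroʳ (length Vs))))) z≤n
        where
        zero-at : ∀ b → starry a b ≢ true → 𝟙 (starry a b) ≤ 0
        zero-at b ne with starry a b
        ... | true  = ⊥-elim (ne refl)
        ... | false = z≤n

    restrict-dense-row : ∀ a → n * 𝟙 (hasStar a) ≤ K₂ * # Vs (restrict a)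
    restrict-dense-row a = go (star? a)
      where
      go : ∀ st → n * 𝟙 (isStar a st) ≤ K₂ * # Vs (keep-star a st)
      go (inj₂ _) = ≤-trans (≤-reflexive (*-zeroʳ n)) z≤n
      go (inj₁ (b , _ , e)) = ≤-trans (≤-reflexive (*-identityʳ n)) (<⇒≤ (≰⇒> λ le → case trans (sym (T⇒≡true (≤⇒≤ᵇ le))) (not-true (proj₂ (∧-true⁻ (F a b) e))) of λ ()))

    restrict-dense : ∀ K → n * n ≤ 4 * K * #pairs starry → n * n ≤ 4 * K * K₂ * #pairs restrict
    restrict-dense K h = ≤-trans h (≤-trans (*-monoʳ-≤ (4 * K) (≤-trans (∑-mono Vs λ a → ≤-trans (starry-row a) (restrict-dense-row a))
      (≤-reflexive (∑-*ˡ Vs K₂ (λ a → # Vs (restrict a)))))) (≤-reflexive (sym (*-assoc (4 * K) K₂ _))))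

    light-spread : ∀ (0<K₂ : 0 < K₂) (P : V → V → Bool) → (∀ a b → P a b ≡ true → F a b ≡ true × light a b ≡ true) →
      ∀ a → NonStarry.Spread K₂ 0<K₂ 0<n (P a) (x a)
    light-spread 0<K₂ P h a y = decide (find-or-all (λ b → (P a b ∧ ⌊ x a b Fin.≟ y ⌋) Boolₚ.≟ true) Vs)
      where
      decide : (∃ λ b → b ∈ Vs × P a b ∧ ⌊ x a b Fin.≟ y ⌋ ≡ true) ⊎ (∀ b → b ∈ Vs → P a b ∧ ⌊ x a b Fin.≟ y ⌋ ≢ true) →
        K₂ * # Vs (λ b → P a b ∧ ⌊ x a b Fin.≟ y ⌋) ≤ n
      decide (inj₁ (b , _ , e)) =
        let i , j = ∧-true⁻ (P a b) e
            y≡ = ⌊⌋-true⁻ (x a b Fin.≟ y) j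
        in ≤-trans (*-monoʳ-≤ K₂ (#-mono Vs λ b′ e′ → let i′ , j′ = ∧-true⁻ (P a b′) e′ in
             ∧-true⁺ (proj₁ (h a b′ i′)) (⌊⌋-true⁺ (x a b′ Fin.≟ x a b) (trans (⌊⌋-true⁻ (x a b′ Fin.≟ y) j′) (sym y≡)))))
             (≤ᵇ⇒≤ _ n (≡true⇒T (proj₂ (h a b i))))
      decide (inj₂ none) = ≤-trans (≤-reflexive (trans (cong (K₂ *_) (n≤0⇒n≡0 (≤-trans (∑-mono∈ Vs λ b b∈ → zero-at b (none b b∈))
          (≤-reflexive (trans (∑-const Vs 0) (*-zeroʳ (length Vs))))))) (*-zeroʳ K₂))) z≤n
        where
        zero-at : ∀ b → P a b ∧ ⌊ x a b Fin.≟ y ⌋ ≢ true → 𝟙 (P a b ∧ ⌊ x a b Fin.≟ y ⌋) ≤ 0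
        zero-at b ne with P a b ∧ ⌊ x a b Fin.≟ y ⌋
        ... | true  = ⊥-elim (ne refl)
        ... | false = z≤n

extLabels : ℕ → List Label
extLabels t = concatMap (λ p → concatMap (λ b → map (ext p b) (upTo t)) (true ∷ false ∷ [])) (upTo (suc t))

labels₃ : ℕ → List Label
labels₃ t = baseLabels 2 t ++ extLabels t

base⊂labels₃ : ∀ t {f} → f ∈ baseLabels 2 t → f ∈ labels₃ t
base⊂labels₃ t = ∈ₚ.∈-++⁺ˡ

∈-extLabels : ∀ t p b s → p ≤ t → s < t → ext p b s ∈ labels₃ t
∈-extLabels t p b s p≤ s< = ∈ₚ.∈-++⁺ʳ (baseLabels 2 t) (∈ₚ.∈-concatMap⁺ _ (lose (∈ₚ.∈-upTo⁺ (s≤s p≤))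
  (∈ₚ.∈-concatMap⁺ (λ b → map (ext p b) (upTo t)) (lose (∈-bool b) (∈ₚ.∈-map⁺ (ext p b) (∈ₚ.∈-upTo⁺ s<))))))
  where
  ∈-bool : ∀ b → b ∈ true ∷ false ∷ []
  ∈-bool true  = here refl
  ∈-bool false = there (here refl)

starConst : ℕ → ℕ → ℕ → ℕ
starConst z L K = 4 * K * spreadConst (2 * K) z L

-- The density constant after `j` extensions have been treated. Each stage needs its own spread
-- constant, computed from the density that the previous one left.
refined : ℕ → ℕ → ℕ → ℕ → ℕ
refined z L K zero    = K
refined z L K (suc j) = starConst z L (refined z L K j)

refinedSize : ℕ → ℕ → ℕ → ℕ → ℕ
refinedSize z L K zero    = 1
refinedSize z L K (suc j) = sizeConst (2 * refined z L K j) z L ⊔ refinedSize z L K j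

module DenseThree {n : ℕ} (v₀ : Fin n) (t : ℕ) (Cov : List (Fin n) → Set)
  (mono : ∀ {e f} → (∀ v → v ∈ e → v ∈ f) → Cov f → Cov e)
  (extensions : ∀ f → Cov f → Unique f → length f ≡ 2 →
    Σ (List (Fin n)) λ xs → Unique xs × t < length xs × All (λ x → x ∉ f × Cov (x ∷ f)) xs)
  (F₀ : Vec (Fin n) 2 → Bool)
  (F₀-cov : ∀ u → F₀ u ≡ true → Cov (Vec.toList u)) (F₀-unique : ∀ u → F₀ u ≡ true → Unique (Vec.toList u))
  (qs : List Component) (qs≥5 : All (λ q → 5 ≤ proj₁ q) qs) (total : sum (map cover-number qs) ≡ suc t)
  (0<k : 0 < length qs) (0<n : 0 < n) where

  open Boxes n
  open Extensions v₀ 2 t Cov mono extensions F₀ F₀-cov F₀-unique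
  open RichSubgraph 0<n using (#pairs)

  private V = Fin n

  Goal : Set
  Goal = Σ (ℕ → V) (Assembly.Embedding 0 Cov (unionPattern 3 qs))

  near far : Bool → Vec V 2 → V
  near b u = nth (Vec.toList u) v₀ (side b 0)
  far  b u = nth (Vec.toList u) v₀ (side b 1)

  side<2 : ∀ b i → side b i < 2
  side<2 b i = s≤s (side≤1 b i)

  entry-∈ : ∀ (u : Vec V 2) h → h < 2 → nth (Vec.toList u) v₀ h ∈ Vec.toList u
  entry-∈ u h lt = nth-∈ (Vec.toList u) v₀ h (subst (h <_) (sym (Vecₚ.length-toList u)) lt)

  pair-list : ℕ → Bool → Vec V 2 → List V
  pair-list p b u = colour p u ∷ near b u ∷ []

  pair-cov : ∀ p b u → F₀ u ≡ true → p ≤ t → Cov (pair-list p b u)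
  pair-cov p b u e p≤ = mono (λ { v (here x) → here x ; v (there (here x)) → there (subst (_∈ Vec.toList u) (sym x) (entry-∈ u _ (side<2 b 0))) })
    (proj₂ (colour-cover u p e p≤))

  pair-unique : ∀ p b u → F₀ u ≡ true → p ≤ t → Unique (pair-list p b u)
  pair-unique p b u e p≤ = ((λ x → proj₁ (colour-cover u p e p≤) (subst (_∈ Vec.toList u) (sym x) (entry-∈ u _ (side<2 b 0)))) ∷ []) ∷ [] ∷ []

  -- The pair has more than `t` extensions. Its companion entry `far` in the tuple may be one of
  -- them and is removed, so that the rest are new to the whole tuple; at least `t` remain.
  further : ∀ p b u → F₀ u ≡ true ⊎ F₀ u ≡ false → Dec (p ≤ t) → List V
  further p b u (inj₁ e) (yes p≤) = filterᵇ (λ v → not (v ∈ᵇ (far b u ∷ [])))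
    (proj₁ (extensions (pair-list p b u) (pair-cov p b u e p≤) (pair-unique p b u e p≤) refl))
  further p b u (inj₁ _) (no _) = []
  further p b u (inj₂ _) _      = []

  Further : ℕ → Bool → Vec V 2 → V → Set
  Further p b u x = (x ∉ pair-list p b u × Cov (x ∷ pair-list p b u)) × x ≢ far b u

  further-ok : ∀ p b u c dc → F₀ u ≡ true → p ≤ t →
    Unique (further p b u c dc) × t ≤ length (further p b u c dc) × All (Further p b u) (further p b u c dc)
  further-ok p b u (inj₂ f) _ e _ = case trans (sym e) f of λ ()
  further-ok p b u (inj₁ _) (no ¬p) _ p≤ = contradiction p≤ ¬p
  further-ok p b u (inj₁ e′) (yes p≤′) e p≤ =
    let ys , uy , len , all = extensions (pair-list p b u) (pair-cov p b u e′ p≤′) (pair-unique p b u e′ p≤′) refl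
    in ⊑-AllPairs (⊑ₚ.filter-⊆ _ ys) uy ,
       ≤-pred (≤-trans len (≤-trans (≤-reflexive (sym (trans (∑-const ys 1) (*-identityʳ _)))) (≤-trans (#-avoid ys (far b u ∷ []) (λ _ → true) uy)
         (≤-reflexive (cong suc (sym (#-filterᵇ (λ v → not (v ∈ᵇ (far b u ∷ []))) ys))))))) ,
       All.zipWith (λ {v} → λ { (h , k) → h , ∉-head (not-∈ᵇ⁻ v (far b u ∷ []) k) }) (⊑ₚ.All-resp-⊆ (⊑ₚ.filter-⊆ _ ys) all , filterᵇ-All _ ys)

  labelFun : Label → Vec V 2 → V
  labelFun (proj h)    u = nth (Vec.toList u) v₀ h
  labelFun (col p)     u = colour p u
  labelFun (ext p b s) u = nth (further p b u (bool-cases (F₀ u)) (p ≤? t)) v₀ s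

  further-at : ∀ p b s u → F₀ u ≡ true → p ≤ t → s < t → Further p b u (labelFun (ext p b s) u)
  further-at p b s u e p≤ s< = let _ , len , all = further-ok p b u (bool-cases (F₀ u)) (p ≤? t) e p≤ in
    All.lookup all (nth-∈ _ v₀ s (≤-trans s< len))

  further-distinct : ∀ p b s s′ u → F₀ u ≡ true → p ≤ t → s < t → s′ < t → labelFun (ext p b s) u ≡ labelFun (ext p b s′) u → s ≡ s′
  further-distinct p b s s′ u e p≤ s< s′< = let un , len , _ = further-ok p b u (bool-cases (F₀ u)) (p ≤? t) e p≤ in
    nth-injective _ v₀ un s s′ (≤-trans s< len) (≤-trans s′< len)

  DependsRow DependsColumn : (V → V → Bool) → ℕ → Set
  DependsRow    F p = ∀ a b b′ → F a b ≡ true → F a b′ ≡ true → colour p (a ∷ b ∷ []) ≡ colour p (a ∷ b′ ∷ [])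
  DependsColumn F p = ∀ b a a′ → F a b ≡ true → F a′ b ≡ true → colour p (a ∷ b ∷ []) ≡ colour p (a′ ∷ b ∷ [])

  onVec : (V → V → Bool) → Vec V 2 → Bool
  onVec F (a ∷ b ∷ []) = F a b

  #-onVec : ∀ F → # (tuples 2) (onVec F) ≡ #pairs F
  #-onVec F = trans (∑-tuples 1 _) (∑-cong (allFin n) λ a → trans (∑-tuples 0 _) (∑-cong (allFin n) λ b → +-identityʳ _))

  module Rigid (F : V → V → Bool) (F⊂F₀ : ∀ a b → F a b ≡ true → F₀ (a ∷ b ∷ []) ≡ true)
    (dep : ∀ p → p ≤ t → DependsRow F p ⊎ DependsColumn F p)
    (As : Vec (List V) 2) (lens : Lengths (gridSize qs) As) (inF : ∀ u → InBox As u → onVec F u ≡ true)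
    (can : CanonicalBox (map labelFun (labels₃ t)) As) where

    m = gridSize qs

    toF₀ : ∀ u → onVec F u ≡ true → F₀ u ≡ true
    toF₀ (a ∷ b ∷ []) = F⊂F₀ a b

    open FromBox v₀ 0 t Cov mono using (cellvec; cellvec-in; nth-cellvec; point)

    D : Embed.BoxData 0 t Cov mono m
    D = FromBox.boxData v₀ 0 t Cov mono (labels₃ t) labelFun (λ _ _ → refl)
          (λ h h< → base⊂labels₃ t (∈-base-proj 2 t h h<)) (λ p p≤ → base⊂labels₃ t (∈-base-col 2 t p p≤))
          (onVec F) (λ u e → F₀-unique u (toF₀ u e)) (λ u p p′ e → colour-distinct u p p′ (toF₀ u e)) (λ u p e → colour-cover u p (toF₀ u e))
          m (s≤s (s≤s z≤n)) As lens inF can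

    open Embed 0 t Cov mono using (Idx)
    open Embed.Box 0 t Cov mono D qs qs≥5 (maxLength qs) (maxLength-bound qs) ≤-refl

    cellF : ∀ ι → Idx m ι → onVec F (cellvec As ι) ≡ true
    cellF ι iι = inF _ (cellvec-in m As ι lens iι)

    depends : ∀ p → p ≤ t → DependsOn 0 (col p) ⊎ DependsOn 1 (col p)
    depends p p≤ = [ (λ r → inj₁ (row r As (cellF zeros idx-zeros) (cellF (keep 0) (idx-keep 0)))) ,
                     (λ c → inj₂ (column c As (cellF zeros idx-zeros) (cellF (keep 1) (idx-keep 1)))) ]′ (dep p p≤)
      where
      row : DependsRow F p → ∀ As → onVec F (cellvec As zeros) ≡ true → onVec F (cellvec As (keep 0)) ≡ true →
        colour p (cellvec As zeros) ≡ colour p (cellvec As (keep 0))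
      row r (_ ∷ _ ∷ []) e e′ = r _ _ _ e e′
      column : DependsColumn F p → ∀ As → onVec F (cellvec As zeros) ≡ true → onVec F (cellvec As (keep 1)) ≡ true →
        colour p (cellvec As zeros) ≡ colour p (cellvec As (keep 1))
      column c (_ ∷ _ ∷ []) e e′ = c _ _ _ e e′

    open Embed.BoxData D using (pt)

    extData : ∀ b e o (e≤ : e ≤ t) (o≤ : o ≤ t) (e≢o : e ≢ o) →
      ThreeUniform.ExtData t Cov mono D qs qs≥5 (maxLength qs) (maxLength-bound qs) ≤-refl b e o e≤ o≤ e≢o
    extData b e o e≤ o≤ e≢o = record
      { ok-ext = λ s s< → ∈-extLabels t o b s o≤ s<
      ; ext-distinct = λ s s′ ι s< s′< iι ne eq → ne (further-distinct o b s s′ _ (toF₀ _ (cellF ι iι)) o≤ s< s′< eq)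
      ; ext-fresh = λ s h ι s< h< iι eq → fresh s h ι s< h< iι (trans eq (sym (nth-cellvec As ι h h<)))
      ; ext≢col = λ s ι s< iι eq → ∉-head (proj₁ (proj₁ (further-at o b s _ (toF₀ _ (cellF ι iι)) o≤ s<))) eq
      ; ext-cover = λ s ι s< iι → subst (λ v → Cov (labelFun (ext o b s) (cellvec As ι) ∷ colour o (cellvec As ι) ∷ v ∷ []))
          (nth-cellvec As ι (side b 0) (side<2 b 0)) (proj₂ (proj₁ (further-at o b s _ (toF₀ _ (cellF ι iι)) o≤ s<))) }
      where
      sides : ∀ b h → h < 2 → h ≡ side b 0 ⊎ h ≡ side b 1
      sides true  0 _ = inj₂ refl
      sides true  1 _ = inj₁ refl
      sides false 0 _ = inj₁ refl
      sides false 1 _ = inj₂ refl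
      sides _ (suc (suc _)) (s≤s (s≤s ()))
      fresh : ∀ s h ι → s < t → h < 2 → Idx m ι → labelFun (ext o b s) (cellvec As ι) ≢ nth (Vec.toList (cellvec As ι)) v₀ h
      fresh s h ι s< h< iι eq = [ (λ { refl → ∉-head (∉-tail (proj₁ (proj₁ fa))) eq }) , (λ { refl → proj₂ fa eq }) ]′ (sides b h h<)
        where fa = further-at o b s _ (toF₀ _ (cellF ι iι)) o≤ s<

    embedding : Goal
    embedding = Dispatch₃.three-uniform t Fin._≟_ Cov mono D qs qs≥5 (maxLength qs) (maxLength-bound qs) ≤-refl total 0<k depends extData

  rigid-embedding : ∀ K F → (∀ a b → F a b ≡ true → F₀ (a ∷ b ∷ []) ≡ true) → (∀ p → p ≤ t → DependsRow F p ⊎ DependsColumn F p) →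
    n * n ≤ K * #pairs F → denseBound 2 K (boxBound 2 (length (labels₃ t)) (gridSize qs)) ≤ n → Goal
  rigid-embedding K F F⊂F₀ dep dense n≥ =
    use (dense-box 2 K (boxBound 2 (length (labels₃ t)) (gridSize qs)) (onVec F) n≥
      (≤-trans (≤-reflexive (cong (n *_) (*-identityʳ n))) (≤-trans dense (≤-reflexive (cong (K *_) (sym (#-onVec F)))))))
    where
    use : (Σ (Vec (List V) 2) λ As → Lengths (boxBound 2 (length (labels₃ t)) (gridSize qs)) As × (∀ u → InBox As u → onVec F u ≡ true)) → Goal
    use (As , lens , inF) = use′ (canonical-box 2 (length (labels₃ t)) (gridSize qs) (map labelFun (labels₃ t))
      (Listₚ.length-map labelFun (labels₃ t)) As (LongEnough-exact Fin._≟_ _ As lens))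
      where
      use′ : (Σ (Vec (List V) 2) λ Bs → SubBox Bs As × Lengths (gridSize qs) Bs × CanonicalBox (map labelFun (labels₃ t)) Bs) → Goal
      use′ (Bs , sub , lensB , can) = Rigid.embedding F F⊂F₀ dep Bs lensB (λ u b → inF u (SubBox-In Bs As sub u b)) can

  Refinement : (V → V → Bool) → ℕ → ℕ → Set
  Refinement F p K′ = Σ (V → V → Bool) λ F′ → (∀ a b → F′ a b ≡ true → F a b ≡ true) ×
    (DependsRow F′ p ⊎ DependsColumn F′ p) × n * n ≤ K′ * #pairs F′

  private
    z = size (unionPattern 3 qs)
    L = suc (maxLength qs)

  module Refine (p K : ℕ) (p≤ : p ≤ t) (0<K : 0 < K) (F : V → V → Bool)
    (F⊂F₀ : ∀ a b → F a b ≡ true → F₀ (a ∷ b ∷ []) ≡ true) (dense : n * n ≤ K * #pairs F)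
    (n≥ : sizeConst (2 * K) z L ≤ n) (K₂ : ℕ) (K₂≡ : K₂ ≡ spreadConst (2 * K) z L) where

    open Starry 0<n K₂

    x xᵀ : V → V → V
    x  a b = colour p (a ∷ b ∷ [])
    xᵀ b a = x a b

    Fᵀ : V → V → Bool
    Fᵀ b a = F a b

    0<K₂ : 0 < K₂
    0<K₂ = subst (0 <_) (sym K₂≡) (s≤s z≤n)

    plain : V → V → Bool
    plain a b = F a b ∧ (light F x a b ∧ light Fᵀ xᵀ b a)

    plain⁻ : ∀ a b → plain a b ≡ true → F a b ≡ true × light F x a b ≡ true × light Fᵀ xᵀ b a ≡ true
    plain⁻ a b e = let i , j = ∧-true⁻ (F a b) e in i , ∧-true⁻ (light F x a b) j

    first-two : ∀ {u v : V} → Unique (u ∷ v ∷ []) → u ≢ v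
    first-two ((ne ∷ []) ∷ _) = ne

    embed-plain : n * n ≤ 2 * K * #pairs plain → Goal
    embed-plain h = nonstarry-embedding v₀ Cov mono qs qs≥5 (2 * K) (*-mono-< {0} {2} (s≤s z≤n) 0<K) K₂ 0<K₂ 0<n
      (≤-reflexive (sym K₂≡)) n≥ plain x
      (λ a b e → proj₂ (colour-cover (a ∷ b ∷ []) p (in₀ a b e) p≤))
      (λ a b e → let x∉ = proj₁ (colour-cover (a ∷ b ∷ []) p (in₀ a b e) p≤) in
        first-two (F₀-unique _ (in₀ a b e)) , ∉-head x∉ , ∉-head (∉-tail x∉))
      (light-spread F x 0<K₂ plain (λ a b e → let f , l , _ = plain⁻ a b e in f , l))
      (light-spread Fᵀ xᵀ 0<K₂ (λ b a → plain a b) (λ b a e → let f , _ , l = plain⁻ a b e in f , l)) h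
      where
      in₀ : ∀ a b → plain a b ≡ true → F₀ (a ∷ b ∷ []) ≡ true
      in₀ a b e = F⊂F₀ a b (proj₁ (plain⁻ a b e))

    split : #pairs F ≤ #pairs plain + (#pairs (starry F x) + #pairs (λ a b → starry Fᵀ xᵀ b a))
    split = ≤-trans (∑-mono (allFin n) λ a → ≤-trans (∑-mono (allFin n) λ b → 𝟙-two (F a b) (light F x a b) (light Fᵀ xᵀ b a))
        (≤-reflexive (trans (∑-+ (allFin n) _ _) (cong (# (allFin n) (plain a) +_) (∑-+ (allFin n) _ _)))))
      (≤-reflexive (trans (∑-+ (allFin n) _ _) (cong (#pairs plain +_) (∑-+ (allFin n) _ _))))

    refine : Goal ⊎ Refinement F p (4 * K * K₂)
    refine = decide (n * n ≤? 2 * K * #pairs plain)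
      where
      decide : Dec (n * n ≤ 2 * K * #pairs plain) → Goal ⊎ Refinement F p (4 * K * K₂)
      decide (yes h) = inj₁ (embed-plain h)
      decide (no few) = inj₂ ([ by-row , by-column ]′ (pair-arith K n (#pairs F) (#pairs plain) _ _ dense split few))
        where
        by-row : n * n ≤ 4 * K * #pairs (starry F x) → Refinement F p (4 * K * K₂)
        by-row h = restrict F x , restrict⊂F F x , inj₁ (restrict-row F x) , restrict-dense F x K h
        by-column : n * n ≤ 4 * K * #pairs (λ a b → starry Fᵀ xᵀ b a) → Refinement F p (4 * K * K₂)
        by-column h = (λ a b → restrict Fᵀ xᵀ b a) , (λ a b → restrict⊂F Fᵀ xᵀ b a) , inj₂ (restrict-row Fᵀ xᵀ) ,
          ≤-trans (restrict-dense Fᵀ xᵀ K (≤-trans h (≤-reflexive (cong (4 * K *_) (∑-swap (allFin n) (allFin n) (λ a b → 𝟙 (starry Fᵀ xᵀ b a)))))))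
            (≤-reflexive (cong (4 * K * K₂ *_) (∑-swap (allFin n) (allFin n) (λ b a → 𝟙 (restrict Fᵀ xᵀ b a)))))

  State : ℕ → ℕ → Set
  State K j = Σ (V → V → Bool) λ F → (∀ a b → F a b ≡ true → F₀ (a ∷ b ∷ []) ≡ true) ×
    (∀ p → p < j → DependsRow F p ⊎ DependsColumn F p) × n * n ≤ refined z L K j * #pairs F

  0<refined : ∀ K j → 0 < K → 0 < refined z L K j
  0<refined K zero    0<K = 0<K
  0<refined K (suc j) 0<K = *-mono-< {0} {4 * refined z L K j} (*-mono-< {0} {4} (s≤s z≤n) (0<refined K j 0<K)) (s≤s z≤n)

  -- Dependence on one coordinate is inherited by subsets, so what has been achieved for earlier
  -- extensions survives the later restrictions. A spread colouring at any stage already yields the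
  -- goal.
  process : ∀ K → 0 < K → n * n ≤ K * # (tuples 2) F₀ → ∀ j → j ≤ suc t → refinedSize z L K j ≤ n → Goal ⊎ State K j
  process K 0<K dense zero _ _ = inj₂ ((λ a b → F₀ (a ∷ b ∷ [])) , (λ _ _ e → e) , (λ _ ()) ,
    ≤-trans dense (≤-reflexive (cong (K *_) (trans (∑-tuples 1 _) (∑-cong (allFin n) λ a → trans (∑-tuples 0 _) (∑-cong (allFin n) λ b → +-identityʳ _))))))
  process K 0<K dense (suc j) j< n≥ =
    [ inj₁ , continue ]′ (process K 0<K dense j (≤-trans (n≤1+n j) j<) (m⊔n≤o⇒n≤o (sizeConst (2 * refined z L K j) z L) (refinedSize z L K j) n≥))
    where
    continue : State K j → Goal ⊎ State K (suc j)
    continue (F , F⊂F₀ , dep , dns) = [ inj₁ , finish ]′ (Refine.refine j (refined z L K j) (≤-pred j<) (0<refined K j 0<K) F F⊂F₀ dns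
        (m⊔n≤o⇒m≤o (sizeConst (2 * refined z L K j) z L) (refinedSize z L K j) n≥) (spreadConst (2 * refined z L K j) z L) refl)
      where
      finish : Refinement F j (starConst z L (refined z L K j)) → Goal ⊎ State K (suc j)
      finish (F′ , sub , dj , dns′) = inj₂ (F′ , (λ a b e → F⊂F₀ a b (sub a b e)) , dep′ , dns′)
        where
        old : ∀ p → DependsRow F p ⊎ DependsColumn F p → DependsRow F′ p ⊎ DependsColumn F′ p
        old p (inj₁ r) = inj₁ λ a b b′ e e′ → r a b b′ (sub a b e) (sub a b′ e′)
        old p (inj₂ c) = inj₂ λ b a a′ e e′ → c b a a′ (sub a b e) (sub a′ b e′)
        dep′ : ∀ p → p < suc j → DependsRow F′ p ⊎ DependsColumn F′ p
        dep′ p (s≤s le) = [ (λ lt → old p (dep p lt)) , (λ { refl → dj }) ]′ (m≤n⇒m<n∨m≡n le)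

  dense-embedding : ∀ K → 0 < K → refinedSize z L K (suc t) ≤ n →
    denseBound 2 (refined z L K (suc t)) (boxBound 2 (length (labels₃ t)) (gridSize qs)) ≤ n →
    n * n ≤ K * # (tuples 2) F₀ → Goal
  dense-embedding K 0<K n≥ n≥′ dense = [ (λ g → g) , finish ]′ (process K 0<K dense (suc t) ≤-refl n≥)
    where
    finish : State K (suc t) → Goal
    finish (F , F⊂F₀ , dep , dns) = rigid-embedding (refined z L K (suc t)) F F⊂F₀ (λ p p≤ → dep p (s≤s p≤)) dns n≥′

-- The upper bound.

_≟ˢ_ : ∀ {n} (p q : Subset n) → Dec (p ≡ q)
_≟ˢ_ = Vecₚ.≡-dec Boolₚ._≟_

allSubsets-unique : ∀ n → Unique (allSubsets n)
allSubsets-unique zero    = [] ∷ []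
allSubsets-unique (suc n) = Uniqueₚ.++⁺ (Uniqueₚ.map⁺ Vecₚ.∷-injectiveʳ (allSubsets-unique n)) (Uniqueₚ.map⁺ Vecₚ.∷-injectiveʳ (allSubsets-unique n))
  λ { (p , q) → case trans (sym (proj₂ (proj₂ (∈ₚ.∈-map⁻ (inside ∷_) p)))) (proj₂ (proj₂ (∈ₚ.∈-map⁻ (outside ∷_) q))) of λ () }

toVec : ∀ {A : Set} {d} (xs : List A) → length xs ≡ d → ∃ λ (u : Vec A d) → Vec.toList u ≡ xs
toVec xs refl = Vec.fromList xs , Vecₚ.toList∘fromList xs

image-select : ∀ {n} (f : Subset n) → image (select (Vec.lookup f)) ≡ f
image-select {n} f = Subₚ.⊆-antisym
  (λ {v} v∈ → lookup⇒∈ f v (T⇒≡true (proj₂ (∈ₚ.∈-filter⁻ _ {xs = allFin n} (∈-image⁻ (select (Vec.lookup f)) v∈)))))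
  (λ {v} v∈ → ∈-image⁺ (select (Vec.lookup f)) (∈ₚ.∈-filter⁺ _ (∈ₚ.∈-allFin v) (≡true⇒T (∈⇒lookup v∈))))

cover-total : ∀ qs → All (λ q → 5 ≤ proj₁ q) qs → 0 < length qs → sum (map cover-number qs) ≡ suc (tOf qs)
cover-total qs qs≥5 0<k = sym (m+[n∸m]≡n (≤-trans (*-mono-≤ {1} {3} (s≤s z≤n) 0<k) (3*length≤cover qs qs≥5)))

final-arith : ∀ K c₀ c₁ Q A N X B → Q + c₀ * A ≤ N + c₀ * B → N ≤ c₁ * A → K * c₁ * A ≤ X → K * Q ≤ K * (c₀ * B) + X
final-arith K c₀ c₁ Q A N X B h₁ h₂ h₃ = begin
  K * Q                        ≤⟨ *-monoʳ-≤ K (≤-trans (m≤m+n Q _) h₁) ⟩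
  K * (N + c₀ * B)             ≤⟨ *-monoʳ-≤ K (+-monoˡ-≤ (c₀ * B) h₂) ⟩
  K * (c₁ * A + c₀ * B)        ≡⟨ lem K c₁ A (c₀ * B) ⟩
  K * (c₀ * B) + K * c₁ * A    ≤⟨ +-monoʳ-≤ (K * (c₀ * B)) h₃ ⟩
  K * (c₀ * B) + X             ∎
  where
  open ≤-Reasoning
  lem : ∀ K c A x → K * (c * A + x) ≡ K * x + K * c * A
  lem = solve-∀

module Upper (r′ s : ℕ) (r≤s : 3 + r′ ≤ s) (qs : List Component) (qs≥5 : All (λ q → 5 ≤ proj₁ q) qs) (0<k : 0 < length qs) where

  private
    r = 3 + r′
    d = 2 + r′
    t = tOf qs
    w = suc r′
    z = size (unionPattern r qs)
    L = suc (maxLength qs)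
    -- Room for the vertices already placed, at most `z`, and for the core and new vertices of one
    -- more cycle. `L` exceeds the largest length by one because paths are cut from longer cycles.
    D = z + (L + L * w)

  total : sum (map cover-number qs) ≡ suc t
  total = cover-total qs qs≥5 0<k

  c₀ c₁ : ℕ
  c₀ = t C (s ∸ d)
  c₁ = D C (s ∸ d)

  module FreeGraph {n : ℕ} (0<n : 0 < n) (G : Graph n) (free : Free r (unionPattern r qs) G) where

    open CliqueFamily r′ s r≤s G
    open Boxes n using (tuples; ∈-tuples)

    private V = Fin n

    v₀ : V
    v₀ = fromℕ< 0<n

    no-embedding : ∀ q → Cliques q → Σ (ℕ → V) (Assembly.Embedding r′ (Cov q) (unionPattern r qs)) → Empty
    no-embedding q cl (φ , inj , all) = free (φ , inj , All.zipWith edge (Assembly.wf-union r′ qs (All.map (≤-trans (s≤s (s≤s z≤n))) qs≥5) , all))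
      where
      edge : ∀ {e} → Assembly.WfEdge r′ z e × Cov q (map φ e) → IsEdge r G (image (map φ e))
      edge {e} ((u , len , bd) , cv) = Family.cov⇒edge q cl (map φ e) cv
        (Assembly.map-unique r′ φ bd (λ {x} {y} lx ly → inj x y lx ly) u) (trans (Listₚ.length-map φ e) len)

    no-full : ∀ q → Cliques q → Cl.Full c₁ q → # (allSubsets n) q ≡ 0
    no-full q cl full = n≤0⇒n≡0 (≮⇒≥ λ pos → no-embedding q cl (embed (#-pos (allSubsets n) q pos)))
      where
      module Gr = Greedy r′ (Cov q) (λ h → Cov-mono q h) D (λ f W → Family.extend q cl c₁ D ≤-refl full f W)
      split : ∀ ℓ → 5 ≤ ℓ → ∃ λ m → ℓ ≡ 2 + m
      split (suc zero)    (s≤s ())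
      split (suc (suc m)) _ = m , refl
      embed : (∃ λ S → S ∈ allSubsets n × q S ≡ true) → Σ (ℕ → V) (Assembly.Embedding r′ (Cov q) (unionPattern r qs))
      embed (S , _ , qS) =
        let φ , emb , _ = Assembly.sequential-embedding r′ (Cov q) qs z (All.map (≤-trans (s≤s (s≤s z≤n))) qs≥5) v₀ cyc [] ≤-refl
        in φ , emb
        where
        cyc : ∀ p Z → p ∈ qs → length Z ≤ z → ∀ ℓ → proj₁ p ≤ ℓ → ℓ ≤ suc (proj₁ p) → Assembly.CycleAvoiding r′ (Cov q) ℓ Z
        cyc p Z p∈ Z≤ ℓ ℓ≥ ℓ≤ = go (split ℓ (≤-trans (All.lookup qs≥5 p∈) ℓ≥)) (≤-trans ℓ≤ (s≤s (maxLength-bound qs p p∈)))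
          where
          go : ∀ {ℓ} → (∃ λ m → ℓ ≡ 2 + m) → ℓ ≤ L → Assembly.CycleAvoiding r′ (Cov q) ℓ Z
          go (m , refl) le = Gr.cycle m Z (S , qS , []) (≤-trans (≤-reflexive (+-assoc (length Z) (2 + m) ((2 + m) * w)))
            (+-mono-≤ Z≤ (+-mono-≤ le (*-monoˡ-≤ w le))))

    covered : (Subset n → Bool) → Vec V d → Bool
    covered q u = ⌊ AllPairs.allPairs? (λ x y → ¬? (x Fin.≟ y)) (Vec.toList u) ⌋ ∧ (1 ≤ᵇ Cl.deg c₀ q (image (Vec.toList u)))

    covered-unique : ∀ q u → covered q u ≡ true → Unique (Vec.toList u)
    covered-unique q u e = ⌊⌋-true⁻ (AllPairs.allPairs? (λ x y → ¬? (x Fin.≟ y)) (Vec.toList u)) (proj₁ (∧-true⁻ _ e))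

    covered-cov : ∀ q u → covered q u ≡ true → Cov q (Vec.toList u)
    covered-cov q u e =
      let S , _ , e′ = #-pos (allSubsets n) _ (≤ᵇ⇒≤ 1 _ (≡true⇒T (proj₂ (∧-true⁻ ⌊ AllPairs.allPairs? (λ x y → ¬? (x Fin.≟ y)) (Vec.toList u) ⌋ e))))
          i , j = ∧-true⁻ (q S) e′
      in S , i , All.tabulate (λ {v} v∈ → ⊆ᵇ⁻ (image (Vec.toList u)) S j (∈-image⁺ (Vec.toList u) v∈))

    covered-tuple : ∀ q f → f ∈ handles → 1 ≤ Cl.deg c₀ q f → ∃ λ u → covered q u ≡ true × image (Vec.toList u) ≡ f
    covered-tuple q f f∈ pos =
      let xs = select (Vec.lookup f)
          card : ∣ f ∣ ≡ d
          card = ≡ᵇ-true⁻ _ _ (T⇒≡true (proj₂ (∈ₚ.∈-filter⁻ _ {xs = allSubsets n} f∈)))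
          u , e = toVec xs (trans (#-filterᵇ (Vec.lookup f) (allFin n)) (trans (sym (card-lookup f)) card))
          im : image (Vec.toList u) ≡ f
          im = trans (cong image e) (image-select f)
      in u , ∧-true⁺ (⌊⌋-true⁺ (AllPairs.allPairs? (λ x y → ¬? (x Fin.≟ y)) (Vec.toList u)) (subst Unique (sym e) (Uniqueₚ.filter⁺ _ (Uniqueₚ.allFin⁺ n))))
               (T⇒≡true (≤⇒≤ᵇ (subst (λ g → 1 ≤ Cl.deg c₀ q g) (sym im) pos))) , im

    -- Listing the elements of an active set in order gives a covered tuple, and a tuple has only
    -- one underlying set.
    active≤tuples : ∀ q → Cl.active c₀ q ≤ # (tuples d) (covered q)
    active≤tuples q = begin
      # handles (λ f → 1 ≤ᵇ Cl.deg c₀ q f)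
        ≤⟨ ∑-mono∈ handles pt ⟩
      ∑ handles (λ f → ∑ (tuples d) (λ u → 𝟙 (covered q u) * 𝟙 ⌊ f ≟ˢ image (Vec.toList u) ⌋))
        ≡⟨ ∑-swap handles (tuples d) (λ f u → 𝟙 (covered q u) * 𝟙 ⌊ f ≟ˢ image (Vec.toList u) ⌋) ⟩
      ∑ (tuples d) (λ u → ∑ handles (λ f → 𝟙 (covered q u) * 𝟙 ⌊ f ≟ˢ image (Vec.toList u) ⌋))
        ≡⟨ ∑-cong (tuples d) (λ u → ∑-*ˡ handles (𝟙 (covered q u)) (λ f → 𝟙 ⌊ f ≟ˢ image (Vec.toList u) ⌋)) ⟩
      ∑ (tuples d) (λ u → 𝟙 (covered q u) * # handles (λ f → ⌊ f ≟ˢ image (Vec.toList u) ⌋))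
        ≤⟨ ∑-mono (tuples d) (λ u → ≤-trans (*-monoʳ-≤ (𝟙 (covered q u)) (#-unique _≟ˢ_ handles (image (Vec.toList u))
             (Uniqueₚ.filter⁺ _ (allSubsets-unique n)))) (≤-reflexive (*-identityʳ _))) ⟩
      # (tuples d) (covered q) ∎
      where
      open ≤-Reasoning
      pt : ∀ f → f ∈ handles → 𝟙 (1 ≤ᵇ Cl.deg c₀ q f) ≤ ∑ (tuples d) (λ u → 𝟙 (covered q u) * 𝟙 ⌊ f ≟ˢ image (Vec.toList u) ⌋)
      pt f f∈ with bool-cases (1 ≤ᵇ Cl.deg c₀ q f)
      ... | inj₂ e = ≤-trans (≤-reflexive (cong 𝟙 e)) z≤n
      ... | inj₁ e = ≤-trans (≤-reflexive (cong 𝟙 e)) (witness (covered-tuple q f f∈ (≤ᵇ⇒≤ 1 _ (≡true⇒T e))))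
        where
        witness : (∃ λ u → covered q u ≡ true × image (Vec.toList u) ≡ f) → 1 ≤ ∑ (tuples d) (λ u → 𝟙 (covered q u) * 𝟙 ⌊ f ≟ˢ image (Vec.toList u) ⌋)
        witness (u , c , im) = ≤-trans (≤-reflexive (sym (cong₂ (λ x y → 𝟙 x * 𝟙 y) c (⌊⌋-true⁺ (f ≟ˢ image (Vec.toList u)) (sym im)))))
          (∑-∈ (λ u → 𝟙 (covered q u) * 𝟙 ⌊ f ≟ˢ image (Vec.toList u) ⌋) (∈-tuples u))

    -- Discarding (r-1)-sets lying in at most c₀ cliques costs c₀ per set; what is left has dense shadow
    -- or few cliques, since by no-full the family is degenerate.
    bound : ∀ K → (∀ q → Cliques q → Cl.Full c₀ q → n ^ d ≤ K * c₁ * # (tuples d) (covered q) → Empty) →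
      K * numK r s G ≤ K * (c₀ * (n C d)) + n ^ d
    bound K sparse = ≤-trans (≤-reflexive (cong (K *_) (#-filterᵇ (isCliqueᵇ r s G) (allSubsets n)))) (run (Cl.clean c₀ (Cl.active c₀ q₀) q₀ ≤-refl))
      where
      q₀ = isCliqueᵇ r s G
      run : (Σ (Subset n → Bool) λ q → (∀ S → q S ≡ true → q₀ S ≡ true) ×
              # (allSubsets n) q₀ + c₀ * Cl.active c₀ q ≤ # (allSubsets n) q + c₀ * Cl.active c₀ q₀ × Cl.Full c₀ q) →
            K * # (allSubsets n) q₀ ≤ K * (c₀ * (n C d)) + n ^ d
      run (q , sub , ineq , full) = run′ (Cl.clean c₁ (Cl.active c₁ q) q ≤-refl)
        where
        run′ : (Σ (Subset n → Bool) λ q′ → (∀ S → q′ S ≡ true → q S ≡ true) ×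
              # (allSubsets n) q + c₁ * Cl.active c₁ q′ ≤ # (allSubsets n) q′ + c₁ * Cl.active c₁ q × Cl.Full c₁ q′) →
            K * # (allSubsets n) q₀ ≤ K * (c₀ * (n C d)) + n ^ d
        run′ (q′ , sub′ , ineq′ , full′) = final-arith K c₀ c₁ (# (allSubsets n) q₀) (Cl.active c₀ q) (# (allSubsets n) q) (n ^ d) (n C d)
          (≤-trans ineq (+-monoʳ-≤ (# (allSubsets n) q) (*-monoʳ-≤ c₀ (≤-trans (#-≤length handles _) (≤-reflexive length-handles)))))
          (≤-trans (m≤m+n _ _) (≤-trans ineq′ (≤-reflexive (cong (_+ c₁ * Cl.active c₁ q) (no-full q′ (λ S e → sub S (sub′ S e)) full′)))))
          (≮⇒≥ λ big → sparse q sub full (≤-trans (<⇒≤ big) (*-monoʳ-≤ (K * c₁) (active≤tuples q))))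

-- With `K` arbitrary, this says that the number of cliques is at most c₀ C(n, d) + o(n^d), in a
-- form without division.
upper-bound : ∀ r′ s (r≤s : 3 + r′ ≤ s) qs → All (λ q → 5 ≤ proj₁ q) qs → 0 < length qs → ∀ K →
  Σ ℕ λ N → ∀ n → N ≤ n → (G : Graph n) → Free (3 + r′) (unionPattern (3 + r′) qs) G →
  K * numK (3 + r′) s G ≤ K * ((tOf qs C (s ∸ (2 + r′))) * (n C (2 + r′))) + n ^ (2 + r′)
upper-bound zero s r≤s qs qs≥5 0<k K = suc N , λ n n≥ G free →
  let open Upper.FreeGraph 0 s r≤s qs qs≥5 0<k (≤-trans (s≤s z≤n) n≥) G free in
  bound K λ q cl full dense → no-embedding q cl (DenseThree.dense-embedding v₀ (tOf qs) (CliqueFamily.Cov 0 s r≤s G q)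
    (λ h → CliqueFamily.Cov-mono 0 s r≤s G q h)
    (λ f → CliqueFamily.Family.extensions 0 s r≤s G q cl _ (tOf qs) ≤-refl full f)
    (covered q) (covered-cov q) (covered-unique q) qs qs≥5 (cover-total qs qs≥5 0<k) 0<k (≤-trans (s≤s z≤n) n≥)
    K′ (s≤s z≤n) (≤-trans (m≤m+n _ _) (≤-trans (n≤1+n N) n≥)) (≤-trans (m≤n+m _ (refinedSize z L K′ (suc (tOf qs)))) (≤-trans (n≤1+n N) n≥))
    (≤-trans (≤-reflexive (cong (n *_) (sym (*-identityʳ n)))) (≤-trans dense (*-monoˡ-≤ _ (n≤1+n (K * Upper.c₁ 0 s r≤s qs qs≥5 0<k))))))
  where
  z = size (unionPattern 3 qs)
  L = suc (maxLength qs)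
  -- The refinement needs a positive density constant, and the product may vanish.
  K′ = suc (K * Upper.c₁ 0 s r≤s qs qs≥5 0<k)
  N = refinedSize z L K′ (suc (tOf qs)) + denseBound 2 (refined z L K′ (suc (tOf qs))) (boxBound 2 (length (labels₃ (tOf qs))) (gridSize qs))
upper-bound (suc r″) s r≤s qs qs≥5 0<k K = suc N , λ n n≥ G free →
  let open Upper.FreeGraph (suc r″) s r≤s qs qs≥5 0<k (≤-trans (s≤s z≤n) n≥) G free in
  bound K λ q cl full dense → no-embedding q cl (DenseFour.dense-embedding v₀ r″ (tOf qs) (CliqueFamily.Cov (suc r″) s r≤s G q)
    (λ h → CliqueFamily.Cov-mono (suc r″) s r≤s G q h)
    (λ f → CliqueFamily.Family.extensions (suc r″) s r≤s G q cl _ (tOf qs) ≤-refl full f)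
    (covered q) (covered-cov q) (covered-unique q) qs qs≥5 (cover-total qs qs≥5 0<k)
    (K * Upper.c₁ (suc r″) s r≤s qs qs≥5 0<k) (≤-trans (n≤1+n N) n≥) dense)
  where
  N = denseBound (3 + r″) (K * Upper.c₁ (suc r″) s r≤s qs qs≥5 0<k) (boxBound (3 + r″) ((3 + r″) + suc (tOf qs)) (gridSize qs))

-- The star

∑< : ℕ → (ℕ → ℕ) → ℕ
∑< zero    f = 0
∑< (suc n) f = ∑< n f + f n

∑<-split : ∀ a b f → ∑< (a + b) f ≡ ∑< a f + ∑< b (λ i → f (a + i))
∑<-split a zero    f = trans (cong (λ k → ∑< k f) (+-identityʳ a)) (sym (+-identityʳ _))
∑<-split a (suc b) f = trans (cong (λ k → ∑< k f) (+-suc a b)) (trans (cong (_+ f (a + b)) (∑<-split a b f)) (+-assoc (∑< a f) _ _))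

∑<-shift : ∀ n f → ∑< (suc n) f ≡ f 0 + ∑< n (f ∘ suc)
∑<-shift n f = ∑<-split 1 n f

∑<-mono : ∀ n {f g} → (∀ i → i < n → f i ≤ g i) → ∑< n f ≤ ∑< n g
∑<-mono zero    h = z≤n
∑<-mono (suc n) h = +-mono-≤ (∑<-mono n (λ i lt → h i (m<n⇒m<1+n lt))) (h n ≤-refl)

∑<-+ : ∀ n f g → ∑< n (λ i → f i + g i) ≡ ∑< n f + ∑< n g
∑<-+ zero    f g = refl
∑<-+ (suc n) f g = trans (cong (_+ (f n + g n)) (∑<-+ n f g)) (lem (∑< n f) (∑< n g) (f n) (g n))
  where lem : ∀ a b c d → a + b + (c + d) ≡ a + c + (b + d)
        lem = solve-∀

∑<-const : ∀ n c → ∑< n (λ _ → c) ≡ n * c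
∑<-const zero    c = refl
∑<-const (suc n) c = trans (cong (_+ c) (∑<-const n c)) (+-comm (n * c) c)

∑<-swap : ∀ m n (f : ℕ → ℕ → ℕ) → ∑< m (λ i → ∑< n (f i)) ≡ ∑< n (λ j → ∑< m (λ i → f i j))
∑<-swap m zero    f = trans (∑<-const m 0) (*-zeroʳ m)
∑<-swap m (suc n) f = trans (∑<-+ m (λ i → ∑< n (f i)) (λ i → f i n)) (cong (_+ ∑< m (λ i → f i n)) (∑<-swap m n f))

∑<-block : ∀ ℓ w f → ∑< (ℓ * w) f ≡ ∑< ℓ (λ i → ∑< w (λ j → f (i * w + j)))
∑<-block zero    w f = refl
∑<-block (suc ℓ) w f = trans (cong (λ k → ∑< k f) (+-comm w (ℓ * w))) (trans (∑<-split (ℓ * w) w f) (cong (_+ ∑< w (λ j → f (ℓ * w + j))) (∑<-block ℓ w f)))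

∑<-∈ : ∀ n f i → i < n → f i ≤ ∑< n f
∑<-∈ (suc n) f i (s≤s le) = [ (λ lt → ≤-trans (∑<-∈ n f i lt) (m≤m+n _ _)) , (λ { refl → m≤n+m _ _ }) ]′ (m≤n⇒m<n∨m≡n le)

∑<-single : ∀ n (p : ℕ → Bool) → (∀ i j → i < n → j < n → p i ≡ true → p j ≡ true → i ≡ j) → ∑< n (λ i → 𝟙 (p i)) ≤ 1
∑<-single zero    p h = z≤n
∑<-single (suc n) p h with bool-cases (p n)
... | inj₂ e = ≤-trans (≤-reflexive (trans (cong (λ b → ∑< n (λ i → 𝟙 (p i)) + 𝟙 b) e) (+-identityʳ _)))
                 (∑<-single n p (λ i j li lj → h i j (m<n⇒m<1+n li) (m<n⇒m<1+n lj)))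
... | inj₁ e = ≤-trans (+-monoˡ-≤ (𝟙 (p n)) (≤-trans (∑<-mono n zero-at) (≤-reflexive (trans (∑<-const n 0) (*-zeroʳ n))))) (𝟙≤1 (p n))
  where
  zero-at : ∀ i → i < n → 𝟙 (p i) ≤ 0
  zero-at i lt with bool-cases (p i)
  ... | inj₂ f = ≤-reflexive (cong 𝟙 f)
  ... | inj₁ e′ = ⊥-elim (<⇒≢ lt (h i n (m<n⇒m<1+n lt) ≤-refl e′ e))

module Covers (r′ : ℕ) where

  open Assembly r′ using (w; size-comp; encodeEdge; edgeVerts; encode; newVerts≡)

  private r = 3 + r′

  Hit : (ℕ → Bool) → List ℕ → Set
  Hit c e = ∃ λ u → u ∈ e × c u ≡ true

  edges-comp⁻ : ∀ q {P : List ℕ → Set} → All P (edges (compPattern r q)) → ∀ i → i < proj₁ q → P (encodeEdge q i)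
  edges-comp⁻ (ℓ , true) {P} all i lt = subst (λ vs → P (i ∷ suc i ∷ vs)) (newVerts≡ (suc ℓ) i) (All.lookup all (∈ₚ.∈-map⁺ _ (∈ₚ.∈-upTo⁺ lt)))
  edges-comp⁻ (suc ℓ , false) {P} all i (s≤s le) with m≤n⇒m<n∨m≡n le
  ... | inj₁ lt = subst P (sym (cong₂ (λ x vs → i ∷ x ∷ vs) (next-inner (suc ℓ) i (s≤s lt)) (sym (newVerts≡ (suc ℓ) i))))
        (All.lookup (Allₚ.++⁻ˡ (map (λ i → i ∷ suc i ∷ newVerts r (suc ℓ) i) (upTo ℓ)) all) (∈ₚ.∈-map⁺ _ (∈ₚ.∈-upTo⁺ lt)))
  ... | inj₂ refl = subst P (sym (cong₂ (λ x vs → i ∷ x ∷ vs) (next-last (suc ℓ) i refl) (sym (newVerts≡ (suc ℓ) i))))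
        (All.head (Allₚ.++⁻ʳ (map (λ i → i ∷ suc i ∷ newVerts r (suc ℓ) i) (upTo ℓ)) all))

  next-sum : ∀ q f → 1 ≤ proj₁ q → ∑< (proj₁ q) (λ i → f (next q i)) ≤ ∑< (ncores q) f
  next-sum (ℓ , true) f _ = ≤-trans (m≤n+m _ (f 0)) (≤-reflexive (sym (∑<-shift ℓ f)))
  next-sum (suc ℓ , false) f _ = ≤-trans (+-mono-≤ (∑<-mono ℓ λ i lt → ≤-reflexive (cong f (next-inner (suc ℓ) i (s≤s lt)))) (≤-reflexive (cong f (next-last (suc ℓ) ℓ refl))))
    (≤-trans (≤-reflexive (+-comm _ (f 0))) (≤-reflexive (sym (∑<-shift ℓ f))))

  core-sum : ∀ q f → ∑< (proj₁ q) f ≤ ∑< (ncores q) f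
  core-sum (ℓ , true)  f = m≤m+n _ _
  core-sum (ℓ , false) f = ≤-refl

  half-bound : ∀ ℓ x → ℓ ≤ 2 * x → ⌊ suc ℓ /2⌋ ≤ x
  half-bound ℓ x le = ≤-trans (⌊n/2⌋-mono (s≤s le)) (≤-reflexive (half x))
    where
    half : ∀ x → ⌊ suc (2 * x) /2⌋ ≡ x
    half zero    = refl
    half (suc x) = trans (cong (λ k → ⌊ suc k /2⌋) (*-suc 2 x)) (cong suc (half x))

  -- Every vertex of an expanded path or cycle lies in at most two edges.
  cover-comp : ∀ q c → 1 ≤ proj₁ q → All (Hit c) (edges (compPattern r q)) →
    cover-number q ≤ ∑< (size (compPattern r q)) (λ u → 𝟙 (c u))
  cover-comp q c 1≤ all = half-bound (proj₁ q) _ (begin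
    proj₁ q                                          ≡⟨ sym (trans (∑<-const (proj₁ q) 1) (*-identityʳ _)) ⟩
    ∑< (proj₁ q) (λ _ → 1)                           ≤⟨ ∑<-mono (proj₁ q) hit ⟩
    ∑< (proj₁ q) (λ i → f i + f (next q i) + g i)    ≡⟨ trans (∑<-+ (proj₁ q) _ g) (cong (_+ ∑< (proj₁ q) g) (∑<-+ (proj₁ q) f (λ i → f (next q i)))) ⟩
    ∑< (proj₁ q) f + ∑< (proj₁ q) (λ i → f (next q i)) + ∑< (proj₁ q) g
      ≤⟨ +-monoˡ-≤ _ (+-mono-≤ (core-sum q f) (next-sum q f 1≤)) ⟩
    -- A new vertex lies in one edge only; counting it twice as well produces the common factor 2.
    Σcore + Σcore + Σnew                                        ≤⟨ m≤m+n _ Σnew ⟩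
    Σcore + Σcore + Σnew + Σnew                                    ≡⟨ lem Σcore Σnew ⟩
    2 * (Σcore + Σnew)                                      ≡⟨ cong (2 *_) (sym total) ⟩
    2 * ∑< (size (compPattern r q)) f                ∎)
    where
    open ≤-Reasoning
    f : ℕ → ℕ
    f u = 𝟙 (c u)
    g : ℕ → ℕ
    g i = ∑< w (λ j → f (ncores q + i * w + j))
    Σcore = ∑< (ncores q) f
    Σnew = ∑< (proj₁ q) g
    lem : ∀ a b → a + a + b + b ≡ 2 * (a + b)
    lem = solve-∀
    total : ∑< (size (compPattern r q)) f ≡ Σcore + Σnew
    total = trans (cong (λ k → ∑< k f) (size-comp q)) (trans (∑<-split (ncores q) (proj₁ q * w) f) (cong (Σcore +_)
      (trans (∑<-block (proj₁ q) w (λ i → f (ncores q + i))) (∑<-cong (proj₁ q) λ i → ∑<-cong w λ j → cong f (sym (+-assoc (ncores q) (i * w) j))))))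
      where
      ∑<-cong : ∀ n {f g} → (∀ i → f i ≡ g i) → ∑< n f ≡ ∑< n g
      ∑<-cong zero    h = refl
      ∑<-cong (suc n) h = cong₂ _+_ (∑<-cong n h) (h n)
    hit : ∀ i → i < proj₁ q → 1 ≤ f i + f (next q i) + g i
    hit i lt with edges-comp⁻ q all i lt
    ... | u , here refl , cu = ≤-trans (≤-reflexive (cong 𝟙 (sym cu))) (≤-trans (m≤m+n _ _) (m≤m+n _ _))
    ... | u , there (here refl) , cu = ≤-trans (≤-reflexive (cong 𝟙 (sym cu))) (≤-trans (m≤n+m _ (f i)) (m≤m+n _ _))
    ... | u , there (there u∈) , cu = ≤-trans (in-new (∈ₚ.∈-map⁻ (λ j → encode (ncores q) (new i j)) (subst (u ∈_) (sym (Listₚ.map-∘ (upTo w))) u∈))) (m≤n+m (g i) (f i + f (next q i)))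
      where
      in-new : (∃ λ j → j ∈ upTo w × u ≡ ncores q + i * w + j) → 1 ≤ g i
      in-new (j , j∈ , refl) = ≤-trans (≤-reflexive (cong 𝟙 (sym cu))) (∑<-∈ w (λ j → f (ncores q + i * w + j)) j (∈ₚ.∈-upTo⁻ j∈))

  cover-union : ∀ qs c → All (λ q → 1 ≤ proj₁ q) qs → All (Hit c) (edges (unionPattern r qs)) →
    sum (map cover-number qs) ≤ ∑< (size (unionPattern r qs)) (λ u → 𝟙 (c u))
  cover-union []       c _        _   = z≤n
  cover-union (q ∷ qs) c (p ∷ ps) all = ≤-trans
    (+-mono-≤ (cover-comp q c p (Allₚ.++⁻ˡ (edges (compPattern r q)) all))
      (cover-union qs (λ u → c (a + u)) ps (All.map (λ {e} → unshift e) (Allₚ.map⁻ (Allₚ.++⁻ʳ (edges (compPattern r q)) all)))))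
    (≤-reflexive (sym (∑<-split a (size (unionPattern r qs)) (λ u → 𝟙 (c u)))))
    where
    a = size (compPattern r q)
    unshift : ∀ e → Hit c (map (a +_) e) → Hit (λ u → c (a + u)) e
    unshift e (u , u∈ , cu) with ∈ₚ.∈-map⁻ (a +_) u∈
    ... | v , v∈ , refl = v , v∈ , cu

meetsFirst⁻ : ∀ {n} t (S : Subset n) → meetsFirst t S ≡ true → ∃ λ v → v ∈ˢ S × toℕ v < t
meetsFirst⁻ (suc t) (true ∷ S)  e = Fin.zero , here , s≤s z≤n
meetsFirst⁻ (suc t) (false ∷ S) e = let v , v∈ , lt = meetsFirst⁻ t S e in Fin.suc v , there v∈ , s≤s lt

star-free : ∀ r′ n qs → All (λ q → 5 ≤ proj₁ q) qs → 0 < length qs → Free (3 + r′) (unionPattern (3 + r′) qs) (starGraph n (tOf qs))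
star-free r′ n qs qs≥5 0<k (φ , inj , all) = <-irrefl refl (begin-strict
  tOf qs                                          <⟨ ≤-refl ⟩
  suc (tOf qs)                                    ≡⟨ sym (cover-total qs qs≥5 0<k) ⟩
  sum (map cover-number qs)                       ≤⟨ Covers.cover-union r′ qs c (All.map (≤-trans (s≤s z≤n)) qs≥5) (All.map (λ {e} → hit e) all) ⟩
  ∑< m (λ u → 𝟙 (c u))                            ≤⟨ ∑<-mono m (λ u _ → spread u) ⟩
  ∑< m (λ u → ∑< (tOf qs) (λ v → 𝟙 ⌊ toℕ (φ u) ℕ.≟ v ⌋)) ≡⟨ ∑<-swap m (tOf qs) (λ u v → 𝟙 ⌊ toℕ (φ u) ℕ.≟ v ⌋) ⟩
  ∑< (tOf qs) (λ v → ∑< m (λ u → 𝟙 ⌊ toℕ (φ u) ℕ.≟ v ⌋)) ≤⟨ ∑<-mono (tOf qs) (λ v _ → ∑<-single m (λ u → ⌊ toℕ (φ u) ℕ.≟ v ⌋) (single v)) ⟩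
  ∑< (tOf qs) (λ _ → 1)                           ≡⟨ trans (∑<-const (tOf qs) 1) (*-identityʳ _) ⟩
  tOf qs                                          ∎)
  where
  open ≤-Reasoning
  m = size (unionPattern (3 + r′) qs)
  c : ℕ → Bool
  c u = ⌊ toℕ (φ u) <? tOf qs ⌋
  hit : ∀ e → IsEdge (3 + r′) (starGraph n (tOf qs)) (image (map φ e)) → Covers.Hit r′ c e
  hit e (_ , g) with meetsFirst⁻ (tOf qs) (image (map φ e)) g
  ... | v , v∈ , lt with ∈ₚ.∈-map⁻ φ (∈-image⁻ (map φ e) v∈)
  ...   | u , u∈ , refl = u , u∈ , ⌊⌋-true⁺ (toℕ (φ u) <? tOf qs) lt
  spread : ∀ u → 𝟙 (c u) ≤ ∑< (tOf qs) (λ v → 𝟙 ⌊ toℕ (φ u) ℕ.≟ v ⌋)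
  spread u with toℕ (φ u) <? tOf qs
  ... | no _   = z≤n
  ... | yes lt = ≤-trans (≤-reflexive (cong 𝟙 (sym (⌊⌋-true⁺ (toℕ (φ u) ℕ.≟ toℕ (φ u)) refl)))) (∑<-∈ (tOf qs) (λ v → 𝟙 ⌊ toℕ (φ u) ℕ.≟ v ⌋) (toℕ (φ u)) lt)
  single : ∀ v i j → i < m → j < m → ⌊ toℕ (φ i) ℕ.≟ v ⌋ ≡ true → ⌊ toℕ (φ j) ℕ.≟ v ⌋ ≡ true → i ≡ j
  single v i j li lj e e′ = inj i j li lj (Finₚ.toℕ-injective (trans (⌊⌋-true⁻ (toℕ (φ i) ℕ.≟ v) e) (sym (⌊⌋-true⁻ (toℕ (φ j) ℕ.≟ v) e′))))

headCard tailCard : ∀ {n} → ℕ → Subset n → ℕ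
headCard zero    _       = 0
headCard (suc t) []      = 0
headCard (suc t) (b ∷ S) = 𝟙 b + headCard t S
tailCard zero    S       = ∣ S ∣
tailCard (suc t) []      = 0
tailCard (suc t) (b ∷ S) = tailCard t S

card-cons : ∀ {n} b (S : Subset n) → ∣ b ∷ S ∣ ≡ 𝟙 b + ∣ S ∣
card-cons true  S = refl
card-cons false S = refl

card-head-tail : ∀ {n} t (S : Subset n) → ∣ S ∣ ≡ headCard t S + tailCard t S
card-head-tail zero    S       = refl
card-head-tail (suc t) []      = refl
card-head-tail (suc t) (b ∷ S) = trans (card-cons b S) (trans (cong (𝟙 b +_) (card-head-tail t S)) (sym (+-assoc (𝟙 b) _ _)))

head-missed : ∀ {n} t (S : Subset n) → meetsFirst t S ≡ false → headCard t S ≡ 0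
head-missed zero    S           e = refl
head-missed (suc t) []          e = refl
head-missed (suc t) (false ∷ S) e = head-missed t S e

tailCard-mono : ∀ {n} t (S T : Subset n) → S ⊆ˢ T → tailCard t S ≤ tailCard t T
tailCard-mono zero    S       T       h = Subₚ.p⊆q⇒∣p∣≤∣q∣ h
tailCard-mono (suc t) []      []      h = z≤n
tailCard-mono (suc t) (x ∷ S) (y ∷ T) h = tailCard-mono t S T (Subₚ.drop-∷-⊆ h)

#-head-tail : ∀ t m k d → # (allSubsets (t + m)) (λ S → (headCard t S ≡ᵇ k) ∧ (tailCard t S ≡ᵇ d)) ≡ (t C k) * (m C d)
#-head-tail zero m zero    d = trans (#-size m d) (sym (+-identityʳ _))
#-head-tail zero m (suc k) d = #-none (allSubsets m) _ λ _ ()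
#-head-tail (suc t) m zero d = trans (∑-allSubsets (t + m) _) (trans (cong₂ _+_ (#-none (allSubsets (t + m)) _ λ _ ()) (#-head-tail t m 0 d)) refl)
#-head-tail (suc t) m (suc k) d = trans (∑-allSubsets (t + m) _) (trans (cong₂ _+_ (#-head-tail t m k d) (#-head-tail t m (suc k) d))
  (trans (sym (*-distribʳ-+ (m C d) (t C k) (t C suc k))) (cong (_* (m C d)) (nCk+nC[k+1]≡[n+1]C[k+1] t k))))

all-true⁺ : ∀ {A : Set} (p : A → Bool) xs → (∀ x → p x ≡ true) → BoolL.all p xs ≡ true
all-true⁺ p []       h = refl
all-true⁺ p (x ∷ xs) h = ∧-true⁺ (h x) (all-true⁺ p xs h)

-- Only `d` vertices of the set lie outside the centre of the star, so every (d + 1)-subset meets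
-- the centre.
star-clique : ∀ {n} t d s (S : Subset n) → headCard t S ≡ s ∸ d → tailCard t S ≡ d → d ≤ s →
  isCliqueᵇ (suc d) s (starGraph n t) S ≡ true
star-clique {n} t d s S hd tl d≤s = ∧-true⁺ (≡ᵇ-true⁺ (trans (card-head-tail t S) (trans (cong₂ _+_ hd tl) (m∸n+n≡m d≤s))))
  (all-true⁺ _ (allSubsets n) λ T → implies (T ⊆ᵇ S) (∣ T ∣ ≡ᵇ suc d) (meetsFirst t T) (hits T))
  where
  implies : ∀ a b c → (a ≡ true → b ≡ true → c ≡ true) → not (a ∧ b) ∨ c ≡ true
  implies true  true  c h = h refl refl
  implies true  false c h = refl
  implies false b     c h = refl
  hits : ∀ T → T ⊆ᵇ S ≡ true → (∣ T ∣ ≡ᵇ suc d) ≡ true → meetsFirst t T ≡ true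
  hits T sub sz with bool-cases (meetsFirst t T)
  ... | inj₁ e = e
  ... | inj₂ e = ⊥-elim (<⇒≱ (≤-reflexive (trans (sym (≡ᵇ-true⁻ _ _ sz)) (trans (card-head-tail t T) (cong (_+ tailCard t T) (head-missed t T e)))))
                   (≤-trans (tailCard-mono t T S (⊆ᵇ⁻ T S sub)) (≤-reflexive tl)))

star-count : ∀ n t d s → d ≤ s → t ≤ n → (t C (s ∸ d)) * ((n ∸ t) C d) ≤ numK (suc d) s (starGraph n t)
star-count n t d s d≤s t≤n = subst (λ n → (t C (s ∸ d)) * ((n ∸ t) C d) ≤ numK (suc d) s (starGraph n t)) (m+[n∸m]≡n t≤n)
  (≤-trans (≤-reflexive (trans (cong (λ x → (t C (s ∸ d)) * (x C d)) (m+n∸m≡n t (n ∸ t))) (sym (#-head-tail t (n ∸ t) (s ∸ d) d))))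
    (≤-trans (#-mono (allSubsets (t + (n ∸ t))) λ S e → let i , j = ∧-true⁻ (headCard t S ≡ᵇ s ∸ d) e in
        star-clique t d s S (≡ᵇ-true⁻ _ _ i) (≡ᵇ-true⁻ _ _ j) d≤s)
      (≤-reflexive (sym (#-filterᵇ (isCliqueᵇ (suc d) s (starGraph (t + (n ∸ t)) t)) (allSubsets (t + (n ∸ t))))))))

-- Binomial estimates and the asymptotic statements.

absorption : ∀ m d → suc d * (suc m C suc d) ≡ suc m * (m C d)
absorption zero    zero    = refl
absorption zero    (suc d) = *-zeroʳ (suc (suc d))
absorption (suc m) zero    = trans (*-identityˡ (suc (suc m) C 1)) (trans (nC1≡n (suc (suc m))) (sym (*-identityʳ (suc (suc m)))))
absorption (suc m) (suc d) = begin
  suc (suc d) * (suc (suc m) C suc (suc d))                       ≡⟨ cong (suc (suc d) *_) (sym (nCk+nC[k+1]≡[n+1]C[k+1] (suc m) (suc d))) ⟩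
  suc (suc d) * (x + (suc m C suc (suc d)))                       ≡⟨ *-distribˡ-+ (suc (suc d)) x _ ⟩
  suc (suc d) * x + suc (suc d) * (suc m C suc (suc d))           ≡⟨ cong₂ _+_ (cong (x +_) (absorption m d)) (absorption m (suc d)) ⟩
  x + suc m * (m C d) + suc m * (m C suc d)                       ≡⟨ lem x (suc m) (m C d) (m C suc d) ⟩
  x + suc m * ((m C d) + (m C suc d))                             ≡⟨ cong (λ y → x + suc m * y) (nCk+nC[k+1]≡[n+1]C[k+1] m d) ⟩
  suc (suc m) * x                                                 ∎
  where
  open ≡-Reasoning
  x = suc m C suc d
  lem : ∀ x m a b → x + m * a + m * b ≡ x + m * (a + b)
  lem = solve-∀

factorial-step : ∀ m d → suc d ! * (suc m C suc d) ≡ suc m * (d ! * (m C d))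
factorial-step m d = begin
  suc d * d ! * (suc m C suc d)       ≡⟨ lem (suc d) (d !) (suc m C suc d) ⟩
  d ! * (suc d * (suc m C suc d))     ≡⟨ cong (d ! *_) (absorption m d) ⟩
  d ! * (suc m * (m C d))             ≡⟨ lem′ (d !) (suc m) (m C d) ⟩
  suc m * (d ! * (m C d))             ∎
  where
  open ≡-Reasoning
  lem : ∀ a b c → a * b * c ≡ b * (a * c)
  lem = solve-∀
  lem′ : ∀ a b c → a * (b * c) ≡ b * (a * c)
  lem′ = solve-∀

binomial-upper : ∀ m d → d ! * (m C d) ≤ m ^ d
binomial-upper m       zero    = ≤-refl
binomial-upper zero    (suc d) = ≤-reflexive (*-zeroʳ (suc d !))
binomial-upper (suc m) (suc d) = ≤-trans (≤-reflexive (factorial-step m d))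
  (*-monoʳ-≤ (suc m) (≤-trans (binomial-upper m d) (^-monoˡ-≤ d (n≤1+n m))))

binomial-lower : ∀ m d → (m ∸ d) ^ d ≤ d ! * (m C d)
binomial-lower m       zero    = ≤-refl
binomial-lower zero    (suc d) = z≤n
binomial-lower (suc m) (suc d) = ≤-trans (*-mono-≤ (≤-trans (m∸n≤m m d) (n≤1+n m)) (binomial-lower m d))
  (≤-reflexive (sym (factorial-step m d)))

-- Bernoulli's inequality in additive form. It bounds the loss when the binomial coefficient of the
-- star is compared with a power of `n`.
power-shift : ∀ n e d → n ^ suc d ≤ (n ∸ e) ^ suc d + suc d * e * n ^ d
power-shift n e zero = ≤-trans (≤-reflexive (*-identityʳ n)) (≤-trans (m≤n+m∸n n e) (≤-reflexive (lem e (n ∸ e))))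
  where lem : ∀ e x → e + x ≡ x * 1 + 1 * e * 1
        lem = solve-∀
power-shift n e (suc d) = begin
  n * n ^ suc d                                                             ≤⟨ *-monoʳ-≤ n (power-shift n e d) ⟩
  n * ((n ∸ e) ^ suc d + suc d * e * n ^ d)                                 ≡⟨ lem₁ n ((n ∸ e) ^ suc d) (suc d * e) (n ^ d) ⟩
  n * (n ∸ e) ^ suc d + suc d * e * n ^ suc d                               ≤⟨ +-monoˡ-≤ (suc d * e * n ^ suc d) (*-monoˡ-≤ ((n ∸ e) ^ suc d) (m≤n+m∸n n e)) ⟩
  (e + (n ∸ e)) * (n ∸ e) ^ suc d + suc d * e * n ^ suc d                   ≡⟨ lem₂ e (n ∸ e) ((n ∸ e) ^ suc d) (suc d * e * n ^ suc d) ⟩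
  (n ∸ e) ^ suc (suc d) + (e * (n ∸ e) ^ suc d + suc d * e * n ^ suc d)     ≤⟨ +-monoʳ-≤ ((n ∸ e) ^ suc (suc d)) (+-monoˡ-≤ _ (*-monoʳ-≤ e (^-monoˡ-≤ (suc d) (m∸n≤m n e)))) ⟩
  (n ∸ e) ^ suc (suc d) + (e * n ^ suc d + suc d * e * n ^ suc d)           ≡⟨ cong ((n ∸ e) ^ suc (suc d) +_) (lem₃ e (suc d) (n ^ suc d)) ⟩
  (n ∸ e) ^ suc (suc d) + suc (suc d) * e * n ^ suc d                       ∎
  where
  open ≤-Reasoning
  lem₁ : ∀ n a b c → n * (a + b * c) ≡ n * a + b * (n * c)
  lem₁ = solve-∀
  lem₂ : ∀ e x p q → (e + x) * p + q ≡ x * p + (e * p + q)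
  lem₂ = solve-∀
  lem₃ : ∀ e d p → e * p + d * e * p ≡ suc d * e * p
  lem₃ = solve-∀

star-lower : ∀ n t d s → suc d ≤ s → t ≤ n →
  (t C (s ∸ suc d)) * n ^ suc d ≤ suc d ! * numK (suc (suc d)) s (starGraph n t) + (t C (s ∸ suc d)) * (suc d * (t + suc d) * n ^ d)
star-lower n t d s d≤s t≤n = begin
  c * n ^ suc d                                                ≤⟨ *-monoʳ-≤ c (power-shift n (t + suc d) d) ⟩
  c * ((n ∸ (t + suc d)) ^ suc d + E)                          ≡⟨ *-distribˡ-+ c _ E ⟩
  c * (n ∸ (t + suc d)) ^ suc d + c * E                        ≡⟨ cong (λ x → c * x ^ suc d + c * E) (sym (∸-+-assoc n t (suc d))) ⟩
  c * (n ∸ t ∸ suc d) ^ suc d + c * E                          ≤⟨ +-monoˡ-≤ (c * E) (*-monoʳ-≤ c (binomial-lower (n ∸ t) (suc d))) ⟩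
  c * (suc d ! * ((n ∸ t) C suc d)) + c * E                    ≡⟨ cong (_+ c * E) (lem c (suc d !) ((n ∸ t) C suc d)) ⟩
  suc d ! * (c * ((n ∸ t) C suc d)) + c * E                    ≤⟨ +-monoˡ-≤ (c * E) (*-monoʳ-≤ (suc d !) (star-count n t (suc d) s d≤s t≤n)) ⟩
  suc d ! * numK (suc (suc d)) s (starGraph n t) + c * E       ∎
  where
  open ≤-Reasoning
  c = t C (s ∸ suc d)
  E = suc d * (t + suc d) * n ^ d
  lem : ∀ a b x → a * (b * x) ≡ b * (a * x)
  lem = solve-∀

-- Passing from m + 1 to m + 2 gains 2c·nP in the doubled inequality, and c ≥ 1 makes this at least
-- 2·nP. One nP pays for the error of the upper bound and the other for the lower-order term of the
-- star.
relative-arith : ∀ m A c X Y P B E n → 0 < A → 1 ≤ c →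
  2 * suc m * A * X ≤ 2 * suc m * A * (c * B) + n * P → A * B ≤ n * P →
  c * (n * P) ≤ A * Y + c * (E * P) → 2 * (suc (suc m) * (c * E)) ≤ n →
  suc m * X ≤ suc (suc m) * Y
relative-arith m A c X Y P B E n 0<A 1≤c up binom low n≥ =
  *-cancelˡ-≤ (2 * A) {{>-nonZero (*-mono-< {0} {2} (s≤s z≤n) 0<A)}} (+-cancelʳ-≤ (n * P) _ _ (begin
  2 * A * (suc m * X) + n * P                                    ≡⟨ cong (_+ n * P) (lem₁ A (suc m) X) ⟩
  2 * suc m * A * X + n * P                                      ≤⟨ +-monoˡ-≤ (n * P) up ⟩
  2 * suc m * A * (c * B) + n * P + n * P                        ≡⟨ lem₂ (suc m) A c B (n * P) ⟩
  2 * suc m * c * (A * B) + 2 * (1 * (n * P))                    ≤⟨ +-mono-≤ (*-monoʳ-≤ (2 * suc m * c) binom) (*-monoʳ-≤ 2 (*-monoˡ-≤ (n * P) 1≤c)) ⟩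
  2 * suc m * c * (n * P) + 2 * (c * (n * P))                    ≡⟨ lem₃ m c (n * P) ⟩
  2 * suc (suc m) * (c * (n * P))                                ≤⟨ *-monoʳ-≤ (2 * suc (suc m)) low ⟩
  2 * suc (suc m) * (A * Y + c * (E * P))                        ≡⟨ lem₄ (suc (suc m)) A Y c E P ⟩
  2 * A * (suc (suc m) * Y) + 2 * (suc (suc m) * (c * E)) * P    ≤⟨ +-monoʳ-≤ (2 * A * (suc (suc m) * Y)) (*-monoˡ-≤ P n≥) ⟩
  2 * A * (suc (suc m) * Y) + n * P                              ∎))
  where
  open ≤-Reasoning
  lem₁ : ∀ a m x → 2 * a * (m * x) ≡ 2 * m * a * x
  lem₁ = solve-∀
  lem₂ : ∀ m a c b p → 2 * m * a * (c * b) + p + p ≡ 2 * m * c * (a * b) + 2 * (1 * p)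
  lem₂ = solve-∀
  lem₃ : ∀ m c p → 2 * suc m * c * p + 2 * (c * p) ≡ 2 * suc (suc m) * (c * p)
  lem₃ = solve-∀
  lem₄ : ∀ m a y c e p → 2 * m * (a * y + c * (e * p)) ≡ 2 * a * (m * y) + 2 * (m * (c * e)) * p
  lem₄ = solve-∀

absolute-upper-arith : ∀ m A c X B P → suc m * X ≤ suc m * (c * B) + P → A * B ≤ P → suc m * (A * X) ≤ suc m * (c * P) + A * P
absolute-upper-arith m A c X B P up binom = begin
  suc m * (A * X)                       ≡⟨ lem₁ (suc m) A X ⟩
  A * (suc m * X)                       ≤⟨ *-monoʳ-≤ A up ⟩
  A * (suc m * (c * B) + P)             ≡⟨ lem₂ (suc m) A c B P ⟩
  suc m * (c * (A * B)) + A * P         ≤⟨ +-monoˡ-≤ (A * P) (*-monoʳ-≤ (suc m) (*-monoʳ-≤ c binom)) ⟩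
  suc m * (c * P) + A * P               ∎
  where
  open ≤-Reasoning
  lem₁ : ∀ m a x → m * (a * x) ≡ a * (m * x)
  lem₁ = solve-∀
  lem₂ : ∀ m a c b p → a * (m * (c * b) + p) ≡ m * (c * (a * b)) + a * p
  lem₂ = solve-∀

absolute-lower-arith : ∀ m A c Y E n P → 0 < A → c * (n * P) ≤ A * Y + c * (E * P) → suc m * (c * E) ≤ n →
  suc m * (c * (n * P)) ≤ suc m * (A * Y) + A * (n * P)
absolute-lower-arith m A c Y E n P 0<A low n≥ = begin
  suc m * (c * (n * P))                        ≤⟨ *-monoʳ-≤ (suc m) low ⟩
  suc m * (A * Y + c * (E * P))                ≡⟨ lem (suc m) A Y c E P ⟩
  suc m * (A * Y) + suc m * (c * E) * P        ≤⟨ +-monoʳ-≤ (suc m * (A * Y)) (*-monoˡ-≤ P n≥) ⟩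
  suc m * (A * Y) + n * P                      ≤⟨ +-monoʳ-≤ (suc m * (A * Y)) (m≤n*m (n * P) A {{>-nonZero 0<A}}) ⟩
  suc m * (A * Y) + A * (n * P)                ∎
  where
  open ≤-Reasoning
  lem : ∀ m a y c e p → m * (a * y + c * (e * p)) ≡ m * (a * y) + m * (c * e) * p
  lem = solve-∀

C-pos : ∀ n k → k ≤ n → 1 ≤ n C k
C-pos n       zero    _        = ≤-refl
C-pos (suc n) (suc k) (s≤s le) = ≤-trans (C-pos n k le) (≤-trans (m≤m+n _ _) (≤-reflexive (nCk+nC[k+1]≡[n+1]C[k+1] n k)))

module Asymptotics (r′ s : ℕ) (r≤s : 3 + r′ ≤ s) (qs : List Component) (qs≥5 : All (λ q → 5 ≤ proj₁ q) qs) (0<k : 0 < length qs) where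

  private
    r = 3 + r′
    d = 2 + r′
    t = tOf qs
    c = t C (s ∸ d)
    F = unionPattern r qs
    fact = d !
    E = d * (t + d)

  star : ∀ n → Graph n
  star n = starGraph n t

  free-star : ∀ n → Free r F (star n)
  free-star n = star-free r′ n qs qs≥5 0<k

  0<fact : 0 < fact
  0<fact = n≢0⇒n>0 (ℕ.≢-nonZero⁻¹ fact {{d !≢0}})

  low : ∀ n → t ≤ n → c * n ^ d ≤ fact * numK r s (star n) + c * (E * n ^ suc r′)
  low n t≤n = star-lower n t (suc r′) s (≤-trans (n≤1+n d) r≤s) t≤n

  relative : s ∸ d ≤ t → ∀ m → Σ ℕ λ N → ∀ n → N ≤ n →
    (∀ (G : Graph n) → Free r F G → suc m * numK r s G ≤ suc (suc m) * numK r s (star n))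
    × Σ (Graph n) (λ G → Free r F G × m * numK r s (star n) ≤ suc m * numK r s G)
  relative k≤t m =
    -- The comparison takes place after multiplication by `fact`, so the precision is scaled by it;
    -- the 2 leaves half of the allowed error to the star.
    let N , up = upper-bound r′ s r≤s qs qs≥5 0<k (2 * suc m * fact)
        N′ = N + (t + 2 * (suc (suc m) * (c * E)))
    in N′ , λ n n≥ →
      (λ G free → relative-arith m fact c (numK r s G) (numK r s (star n)) (n ^ suc r′) (n C d) E n 0<fact (C-pos t (s ∸ d) k≤t)
        (up n (≤-trans (m≤m+n N _) n≥) G free) (binomial-upper n d)
        (low n (≤-trans (m≤m+n t _) (≤-trans (m≤n+m _ N) n≥)))
        (≤-trans (m≤n+m _ t) (≤-trans (m≤n+m _ N) n≥))) ,
      star n , free-star n , *-monoˡ-≤ (numK r s (star n)) (n≤1+n m)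

  absolute : ∀ m → Σ ℕ λ N → ∀ n → N ≤ n →
    (∀ (G : Graph n) → Free r F G → suc m * (fact * numK r s G) ≤ suc m * (c * n ^ d) + fact * n ^ d)
    × Σ (Graph n) (λ G → Free r F G × suc m * (c * n ^ d) ≤ suc m * (fact * numK r s G) + fact * n ^ d)
  absolute m =
    let N , up = upper-bound r′ s r≤s qs qs≥5 0<k (suc m)
        N′ = N + (t + suc m * (c * E))
    in N′ , λ n n≥ →
      (λ G free → absolute-upper-arith m fact c (numK r s G) (n C d) (n ^ d) (up n (≤-trans (m≤m+n N _) n≥) G free) (binomial-upper n d)) ,
      star n , free-star n , absolute-lower-arith m fact c (numK r s (star n)) E n (n ^ suc r′) 0<fact
        (low n (≤-trans (m≤m+n t _) (≤-trans (m≤n+m _ N) n≥))) (≤-trans (m≤n+m _ t) (≤-trans (m≤n+m _ N) n≥))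

  negligible : t < s ∸ d → ∀ m → Σ ℕ λ N → ∀ n → N ≤ n → ∀ (G : Graph n) → Free r F G → suc m * numK r s G ≤ n ^ d
  negligible t<k m =
    let N , up = upper-bound r′ s r≤s qs qs≥5 0<k (suc m)
    in N , λ n n≥ G free → ≤-trans (up n n≥ G free) (≤-reflexive (cong (_+ n ^ d)
         (trans (cong (λ x → suc m * (x * (n C d))) (k>n⇒nCk≡0 t<k)) (*-zeroʳ (suc m)))))

clique-excess : ∀ s r → suc r ≤ s → s ∸ suc r + 1 ≡ s ∸ r
clique-excess s r le = trans (+-comm _ 1) (sym (+-∸-assoc 1 le))

theorem6p1 : (r k s : ℕ) (qs : List Component) →
    3 ≤ r → 1 ≤ k → length qs ≡ k → All (λ q → 5 ≤ proj₁ q) qs → r ≤ s →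
    (s ≤ tOf qs + r ∸ 1 →
    (∀ m → Σ ℕ λ N → ∀ n → N ≤ n →
    (∀ (G : Graph n) → Free r (unionPattern r qs) G →
    suc m * numK r s G ≤ suc (suc m) * numK r s (starGraph n (tOf qs)))
    × Σ (Graph n) (λ G → Free r (unionPattern r qs) G ×
    m * numK r s (starGraph n (tOf qs)) ≤ suc m * numK r s G))
    ×
    (∀ m → Σ ℕ λ N → ∀ n → N ≤ n →
    (∀ (G : Graph n) → Free r (unionPattern r qs) G →
    suc m * ((r ∸ 1) ! * numK r s G)
    ≤ suc m * ((tOf qs C (s ∸ r + 1)) * n ^ (r ∸ 1)) + (r ∸ 1) ! * n ^ (r ∸ 1))
    × Σ (Graph n) (λ G → Free r (unionPattern r qs) G ×
    suc m * ((tOf qs C (s ∸ r + 1)) * n ^ (r ∸ 1))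
    ≤ suc m * ((r ∸ 1) ! * numK r s G) + (r ∸ 1) ! * n ^ (r ∸ 1))))
    ×
    (tOf qs + r ≤ s →
    ∀ m → Σ ℕ λ N → ∀ n → N ≤ n →
    ∀ (G : Graph n) → Free r (unionPattern r qs) G →
    suc m * numK r s G ≤ n ^ (r ∸ 1))
theorem6p1 (suc zero) _ _ _ (s≤s ())
theorem6p1 (suc (suc zero)) _ _ _ (s≤s (s≤s ()))
theorem6p1 (suc (suc (suc r′))) k s qs _ 1≤k refl qs≥5 r≤s
  rewrite clique-excess s (2 + r′) r≤s =
  (λ s≤ → As.relative (small s≤) , As.absolute) , (λ s≥ → As.negligible (large s≥))
  where
  module As = Asymptotics r′ s r≤s qs qs≥5 1≤k
  d = 2 + r′
  small : s ≤ tOf qs + suc d ∸ 1 → s ∸ d ≤ tOf qs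
  small le = m≤n+o⇒m∸n≤o s d (≤-trans le (≤-trans (≤-reflexive (cong (_∸ 1) (+-suc (tOf qs) d))) (≤-reflexive (+-comm (tOf qs) d))))
  large : tOf qs + suc d ≤ s → tOf qs < s ∸ d
  large le = ≤-trans (≤-reflexive (sym (m+n∸n≡m (suc (tOf qs)) d))) (∸-monoˡ-≤ d (≤-trans (≤-reflexive (sym (+-suc (tOf qs) d))) le))
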